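{- Let $p,q,r\ge 0$ be integers, at most one of which is $0$. The graph $\theta(p,q,r)$ is determined by its signless Laplacian permanental polynomial; that is, for every graph $H$, if $\pi(Q(H);x)=\pi(Q(\theta(p,q,r));x)$ then $H$ is isomorphic to $\theta(p,q,r)$.
   Context: All graphs are finite, simple and undirected (not necessarily connected). For a graph $G$ with vertices $v_1,\dots,v_n$, let $A(G)$ be its $(0,1)$-adjacency matrix, $D(G)=\mathrm{diag}(d(v_1),\dots,d(v_n))$ the diagonal matrix of vertex degrees, and $Q(G)=D(G)+A(G)$ the signless Laplacian matrix. The permanent of an $n\times n$ matrix $X=(x_{ij})$ is $\mathrm{per}(X)=\sum_{\sigma}\prod_{i=1}^n x_{i\sigma(i)}$, the sum being over all permutations $\sigma$ of $\{1,\dots,n\}$. The signless Laplacian permanental polynomial of $G$ is $\pi(Q(G);x)=\mathrm{per}(xI-Q(G))$, where $I$ is the $n\times n$ identity matrix. The graph $\theta(p,q,r)$, on $n=p+q+r+2$ vertices, consists of two given distinct vertices $u,v$ joined by three internally disjoint paths having respectively $p$, $q$ and $r$ interior vertices (a path with $0$ interior vertices is the single edge $uv$), where $p,q,r\ge 0$ and at most one of them is $0$. -}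

module Defs where

open import Algebra.Bundles.Raw using (RawSemiring; RawRing)
import Algebra.Definitions.RawMonoid as RawMonoidDefs
open import Data.Bool.Base using (if_then_else_)
open import Data.Fin.Base using (Fin; zero; suc; _↑ˡ_; _↑ʳ_; punchIn)
open import Data.Fin.Patterns using (0F; 1F)
open import Data.Fin.Permutation as Perm
  using (Permutation; Permutation′; _⟨$⟩ʳ_; insert; remove; insert-remove; insert-punchIn)
import Data.Fin.Properties as Fin
open import Data.Integer.Base as ℤ using (ℤ; +_; 0ℤ; 1ℤ)
open import Data.List.Base as List using (List; []; _∷_; [_]; _++_; map)
import Data.List.Membership.DecPropositional as DecMembership
open import Data.List.Membership.Propositional using (_∈_)
open import Data.List.Membership.Propositional.Properties using (∈-allFin)
open import Data.List.Relation.Unary.All as All using (All; []; _∷_)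
import Data.List.Relation.Unary.All.Properties as All
open import Data.List.Relation.Unary.AllPairs using ([]; _∷_)
import Data.List.Relation.Unary.AllPairs.Properties as AllPairs
open import Data.List.Relation.Unary.Any using (Any; here)
import Data.List.Relation.Unary.Any.Properties as Any
open import Data.List.Relation.Unary.Linked using (Linked; []; [-]; _∷_)
open import Data.List.Relation.Unary.Linked.Properties using (AllPairs⇒Linked)
open import Data.List.Relation.Unary.Unique.Propositional using (Unique)
import Data.List.Relation.Unary.Unique.Propositional.Properties as Unique
import Data.List.Relation.Unary.Unique.Setoid as UniqueSetoid
import Data.List.Relation.Unary.Unique.Setoid.Properties as UniqueSetoid
open import Data.Nat.Base using (ℕ; zero; suc; _+_)
open import Data.Product.Base using (Σ-syntax; _×_; _,_; uncurry)
open import Data.Product.Properties using (≡-dec)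
open import Data.Sum.Base using (_⊎_; [_,_]′; swap)
open import Data.Vec.Base as Vec using (count)
open import Data.Vec.Functional using (Vector)
open import Function.Base using (_∘_)
open import Function.Bundles using (_⇔_)
open import Function.Definitions using (Injective)
open import Level using (0ℓ)
open import Relation.Binary.Bundles using (Setoid)
open import Relation.Binary.Core using (Rel)
open import Relation.Binary.Definitions using (Decidable; Symmetric; Irreflexive)
open import Relation.Binary.PropositionalEquality
  using (_≡_; _≢_; refl; sym; trans; cong; setoid)
open import Relation.Nullary.Decidable using (does; _⊎-dec_)

------------------------------------------------------------------------
-- Graphs

-- Adjacency is required to be decidable, as it always is classically for
-- finite graphs; otherwise the adjacency matrix could not be formed.
record Graph (n : ℕ) : Set₁ where
  field
    Adj        : Rel (Fin n) 0ℓ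
    Adj?       : Decidable Adj
    Adj-sym    : Symmetric Adj
    Adj-irrefl : Irreflexive _≡_ Adj

  degree : Fin n → ℕ
  degree v = count (Adj? v) (Vec.allFin n)

infix 4 _≅_

_≅_ : ∀ {m n} → Graph m → Graph n → Set
_≅_ {m} {n} G H =
  Σ[ φ ∈ Permutation m n ] (∀ i j → Graph.Adj G i j ⇔ Graph.Adj H (φ ⟨$⟩ʳ i) (φ ⟨$⟩ʳ j))

------------------------------------------------------------------------
-- Matrices and permanents

Matrix : Set → ℕ → Set
Matrix A n = Vector (Vector A n) n

-- Each permutation of Fin (suc n) is determined by the image j of 0 and
-- the induced bijection on the remaining points.
permutations : ∀ n → List (Permutation′ n)
permutations zero    = [ Perm.id ]
permutations (suc n) = List.cartesianProductWith (insert 0F) (List.allFin (suc n)) (permutations n)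

insert-cong : ∀ {n} {j k : Fin (suc n)} {π ρ : Permutation′ n} →
              j ≡ k → π Perm.≈ ρ → insert 0F j π Perm.≈ insert 0F k ρ
insert-cong refl π≈ρ zero = refl
insert-cong {j = j} {π = π} {ρ} refl π≈ρ (suc i) =
  trans (insert-punchIn 0F j π i)
    (trans (cong (punchIn j) (π≈ρ i)) (sym (insert-punchIn 0F j ρ i)))

insert-injective : ∀ {n} {j k : Fin (suc n)} {π ρ : Permutation′ n} →
                   insert 0F j π Perm.≈ insert 0F k ρ → j ≡ k × π Perm.≈ ρ
insert-injective {j = j} {k} {π} {ρ} eq with refl ← eq 0F = refl , λ i →
  Fin.punchIn-injective j _ _
    (trans (sym (insert-punchIn 0F j π i)) (trans (eq (suc i)) (insert-punchIn 0F j ρ i)))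

permutationSetoid : ℕ → Setoid 0ℓ 0ℓ
permutationSetoid n = record
  { Carrier       = Permutation′ n
  ; _≈_           = Perm._≈_
  ; isEquivalence = record
    { refl  = λ _ → refl
    ; sym   = λ eq i → sym (eq i)
    ; trans = λ eq eq′ i → trans (eq i) (eq′ i)
    }
  }

-- Every permutation occurs in the list, and no permutation occurs twice
-- (permutations being compared pointwise).

permutations-complete : ∀ {n} (σ : Permutation′ n) → Any (σ Perm.≈_) (permutations n)
permutations-complete {zero}  σ = here λ ()
permutations-complete {suc n} σ =
  Any.cartesianProductWith⁺ (insert 0F)
    (λ σ0≡j ρ≈π i → trans (sym (insert-remove 0F σ i)) (insert-cong σ0≡j ρ≈π i))
    (∈-allFin (σ ⟨$⟩ʳ 0F)) (permutations-complete (remove 0F σ))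

permutations-unique : ∀ n → UniqueSetoid.Unique (permutationSetoid n) (permutations n)
permutations-unique zero    = [] ∷ []
permutations-unique (suc n) =
  UniqueSetoid.cartesianProductWith⁺
    (setoid (Fin (suc n))) (permutationSetoid n) (permutationSetoid (suc n))
    (insert 0F) (λ {w} {x} {y} {z} → insert-injective {j = w} {x} {y} {z})
    (Unique.allFin⁺ (suc n)) (permutations-unique n)

module _ (R : RawSemiring 0ℓ 0ℓ) where
  open RawSemiring R using (Carrier; 0#; *-rawMonoid) renaming (_+_ to _+ᴿ_)
  open RawMonoidDefs *-rawMonoid using () renaming (sum to ∏)

  per : ∀ {n} → Matrix Carrier n → Carrier
  per {n} X =
    List.foldr _+ᴿ_ 0# (map (λ σ → ∏ (λ i → X i (σ ⟨$⟩ʳ i))) (permutations n))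

------------------------------------------------------------------------
-- Polynomials over ℤ

-- Coefficient lists, constant term first; trailing zeros are allowed, so
-- equality of polynomials is equality of all coefficients.
Poly : Set
Poly = List ℤ

coeff : Poly → ℕ → ℤ
coeff []      _       = 0ℤ
coeff (a ∷ f) zero    = a
coeff (a ∷ f) (suc k) = coeff f k

infix  4 _≈ᴾ_
infixl 6 _+ᴾ_
infixl 7 _*ᴾ_
infix  8 -ᴾ_

_≈ᴾ_ : Rel Poly 0ℓ
f ≈ᴾ g = ∀ k → coeff f k ≡ coeff g k

_+ᴾ_ : Poly → Poly → Poly
[]      +ᴾ g       = g
(a ∷ f) +ᴾ []      = a ∷ f
(a ∷ f) +ᴾ (b ∷ g) = (a ℤ.+ b) ∷ (f +ᴾ g)

_*ᴾ_ : Poly → Poly → Poly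
[]      *ᴾ g = []
(a ∷ f) *ᴾ g = map (a ℤ.*_) g +ᴾ (0ℤ ∷ (f *ᴾ g))

-ᴾ_ : Poly → Poly
-ᴾ_ = map (λ a → ℤ.- a)

const : ℤ → Poly
const a = [ a ]

X : Poly
X = 0ℤ ∷ 1ℤ ∷ []

polyRawRing : RawRing 0ℓ 0ℓ
polyRawRing = record
  { Carrier = Poly
  ; _≈_     = _≈ᴾ_
  ; _+_     = _+ᴾ_
  ; _*_     = _*ᴾ_
  ; -_      = -ᴾ_
  ; 0#      = []
  ; 1#      = const 1ℤ
  }

------------------------------------------------------------------------
-- The signless Laplacian permanental polynomial

diag : ∀ {A : Set} {n} → A → Vector A n → Matrix A n
diag 0# d i j = if does (i Fin.≟ j) then d i else 0#

module _ {n} (G : Graph n) where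
  open Graph G

  adjacencyMatrix : Matrix ℤ n
  adjacencyMatrix i j = if does (Adj? i j) then 1ℤ else 0ℤ

  degreeMatrix : Matrix ℤ n
  degreeMatrix = diag 0ℤ (λ v → + degree v)

  signlessLaplacian : Matrix ℤ n
  signlessLaplacian i j = degreeMatrix i j ℤ.+ adjacencyMatrix i j

permanentalPolynomial : ∀ {n} → Matrix ℤ n → Poly
permanentalPolynomial M =
  per (RawRing.rawSemiring polyRawRing) (λ i j → diag [] (λ _ → X) i j +ᴾ (-ᴾ (const (M i j))))

------------------------------------------------------------------------
-- Theta graphs

steps : ∀ {A : Set} → List A → List (A × A)
steps []           = []
steps (_ ∷ [])     = []
steps (a ∷ b ∷ as) = (a , b) ∷ steps (b ∷ as)

module _ (p q r : ℕ) where

  -- 0F and 1F are the two given vertices u and v; the other vertices are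
  -- the interior vertices of the three paths, one path after another.
  V : Set
  V = Fin (2 + (p + q + r))

  inP : Fin p → V
  inP i = 2 ↑ʳ ((i ↑ˡ q) ↑ˡ r)

  inQ : Fin q → V
  inQ i = 2 ↑ʳ ((p ↑ʳ i) ↑ˡ r)

  inR : Fin r → V
  inR i = 2 ↑ʳ ((p + q) ↑ʳ i)

  path : ∀ {k} → (Fin k → V) → List V
  path f = 0F ∷ List.tabulate f ++ [ 1F ]

  θ-edges : List (V × V)
  θ-edges = steps (path inP) ++ steps (path inQ) ++ steps (path inR)

  open DecMembership (≡-dec {A = V} Fin._≟_ (Fin._≟_ {2 + (p + q + r)})) using (_∈?_)

  steps-≢ : ∀ {as : List V} → Linked _≢_ as → All (uncurry _≢_) (steps as)
  steps-≢ []         = []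
  steps-≢ [-]        = []
  steps-≢ (a≢b ∷ as) = a≢b ∷ steps-≢ as

  path-unique : ∀ {k} {f : Fin k → V} → Injective _≡_ _≡_ f →
                (∀ i → 0F ≢ f i) → (∀ i → f i ≢ 1F) → Unique (path f)
  path-unique f-inj u≢ ≢v =
    All.++⁺ (All.tabulate⁺ u≢) ((λ ()) ∷ []) ∷
    AllPairs.++⁺ (Unique.tabulate⁺ f-inj) ([] ∷ []) (All.tabulate⁺ (λ i → ≢v i ∷ []))

  path-loopless : ∀ {k} {f : Fin k → V} → Injective _≡_ _≡_ f →
                  (∀ i → 0F ≢ f i) → (∀ i → f i ≢ 1F) → All (uncurry _≢_) (steps (path f))
  path-loopless f-inj u≢ ≢v = steps-≢ (AllPairs⇒Linked (path-unique f-inj u≢ ≢v))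

  θ-loopless : All (uncurry _≢_) θ-edges
  θ-loopless =
    All.++⁺ (path-loopless (λ {i} {j} → Fin.↑ˡ-injective q i j ∘ Fin.↑ˡ-injective r _ _ ∘ Fin.↑ʳ-injective 2 _ _)
                           (λ _ ()) (λ _ ()))
    (All.++⁺ (path-loopless (λ {i} {j} → Fin.↑ʳ-injective p i j ∘ Fin.↑ˡ-injective r _ _ ∘ Fin.↑ʳ-injective 2 _ _)
                            (λ _ ()) (λ _ ()))
             (path-loopless (λ {i} {j} → Fin.↑ʳ-injective (p + q) i j ∘ Fin.↑ʳ-injective 2 _ _)
                            (λ _ ()) (λ _ ())))

  θ : Graph (2 + (p + q + r))
  θ = record
    { Adj        = λ i j → (i , j) ∈ θ-edges ⊎ (j , i) ∈ θ-edges
    ; Adj?       = λ i j → ((i , j) ∈? θ-edges) ⊎-dec ((j , i) ∈? θ-edges)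
    ; Adj-sym    = swap
    ; Adj-irrefl = λ { refl → [ (λ e → All.lookup θ-loopless e refl) , (λ e → All.lookup θ-loopless e refl) ]′ }
    }

{-# OPTIONS --safe #-}

-- The permanent of M is the coefficient of the product of all rᵢ and cⱼ in
-- ∏ᵢⱼ (1 + Mᵢⱼ rᵢ cⱼ), where the rᵢ and cⱼ are commuting variables of square zero.
-- For X I + s Q this is a product with one factor for each vertex and one for
-- each edge.  At X = 1, its expansion to second order in s determines the number
-- of edges and ∑ (d − 2)(d − 3).  For a theta graph this sum is 0, so H has, like
-- θ(p,q,r), two vertices of degree 3 and all others of degree 2: it is a theta
-- graph or a dumbbell together with disjoint cycles.  At x = 2 + s − 1/s a path
-- of ℓ edges contributes a factor that depends only on s and s^ℓ, whence the
-- permanent becomes a product of cycle factors 1 + (−s²)^ℓ + 2 s^ℓ and an explicit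
-- polynomial in s and the powers s^a, s^b, s^c for the three paths of the core.
-- For a ≤ b ≤ c its lowest terms in s, together with parity, yield a + b and a;
-- they also exclude the dumbbell and all disjoint cycles, and the number of edges
-- then gives c.
module Submission where

open import Defs
open import Data.Nat.Base using (ℕ)
open import Data.Product.Base using (_×_)
open import Relation.Binary.PropositionalEquality using (_≡_)
open import Relation.Nullary.Negation using (¬_)

open import Algebra.Bundles using (CommutativeSemiring)
open import Algebra.Bundles.Raw using (RawRing)
import Algebra.Definitions.RawMonoid as RawMonoidDefs
import Algebra.Properties.CommutativeMonoid.Sum as CMSum
import Algebra.Properties.Semiring.Sum as SSum
import Algebra.Solver.Ring.NaturalCoefficients.Default as SemiringSolver
open import Algebra.Structures.Biased using (IsCommutativeSemiringˡ)
open import Data.Bool.Base using (Bool; true; false; if_then_else_)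
open import Data.Empty using (⊥-elim)
open import Data.Fin.Base using (Fin; zero; suc; _↑ˡ_; _↑ʳ_; punchIn; splitAt) renaming (_<_ to _Fin<_)
open import Data.Fin.Patterns using (0F; 1F)
open import Data.Fin.Permutation as FinPerm using (Permutation′; _⟨$⟩ʳ_; insert; insert-punchIn)
import Data.Fin.Properties as Fin
open import Data.Integer.Base as ℤ using (ℤ; +_; -[1+_]; 0ℤ; 1ℤ; -1ℤ; +-*-rawSemiring)
open import Data.Integer.Divisibility.Signed using (_∣_; divides; ∣ᵤ⇒∣; ∣⇒∣ᵤ; ∣-refl; ∣-trans; 0∣⇒≡0;
  ∣m∣n⇒∣m+n; ∣m∣n⇒∣m-n; ∣m⇒∣-m; ∣m⇒∣m*n; ∣n⇒∣m*n; *-monoʳ-∣; *-cancelˡ-∣; *-cancelʳ-∣)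
import Data.Integer.Properties as ℤ
open import Data.Integer.Tactic.RingSolver using (solve-∀)
open import Data.List.Base as List using (List; []; _∷_; _++_; [_]; foldr; allFin; length; reverse; concatMap; map;
  cartesianProduct; cartesianProductWith; filter)
open import Data.List.Membership.Propositional using (_∈_; _∉_)
open import Data.List.Membership.Propositional.Properties using (∈-allFin; ∈-++⁺ˡ; ∈-++⁺ʳ; ∈-++⁻; ∈-map⁺; ∈-map⁻;
  ∈-tabulate⁺; ∈-tabulate⁻; ∈-filter⁺; ∈-filter⁻; ∈-cartesianProduct⁺)
import Data.List.Properties as List
open import Data.List.Relation.Binary.Permutation.Propositional as Perm
  using (_↭_; ↭-refl; ↭-sym; ↭-trans; ↭-reflexive; prep; swap)
import Data.List.Relation.Binary.Permutation.Propositional.Properties as Perm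
open import Data.List.Relation.Unary.All as All using (All; []; _∷_)
import Data.List.Relation.Unary.All.Properties as All
open import Data.List.Relation.Unary.AllPairs using ([]; _∷_)
open import Data.List.Relation.Unary.Any using (Any; here; there)
open import Data.List.Relation.Unary.Unique.Propositional using (Unique)
import Data.List.Relation.Unary.Unique.Propositional.Properties as Unique
open import Data.Nat.Base as ℕ using (zero; suc; _≤_; _<_; z≤n; s≤s)
import Data.Nat.Divisibility as ℕ
import Data.Nat.Properties as ℕ
import Data.Nat.Tactic.RingSolver as ℕR
open import Data.Product.Base as Product using (Σ-syntax; ∃; _,_; proj₁; proj₂)
open import Data.Sum.Base as Sum using (_⊎_; inj₁; inj₂; [_,_]′)
open import Data.Vec.Base as Vec using (Vec; []; _∷_; lookup; _[_]≔_)
import Data.Vec.Properties as Vec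
open import Function.Base using (_∘_; id)
open import Function.Bundles using (_⇔_; mk⇔; Equivalence)
open import Level using (0ℓ)
open import Relation.Binary.Definitions using (tri<; tri≈; tri>)
open import Relation.Binary.PropositionalEquality using (_≢_; refl; sym; trans; cong; cong₂; subst; module ≡-Reasoning)
import Relation.Binary.Reasoning.Setoid as SetoidReasoning
open import Relation.Binary.Structures using (IsEquivalence)
open import Relation.Nullary using (Dec; yes; no; does; _×-dec_)

-- The substitution is chosen to split a recurrence. With diagonal entry `d` at the vertices of
-- degree 2 and off-diagonal entry `s`, permanents along a path obey a recurrence with
-- characteristic polynomial `λ² − d λ − s²`. Asking for the root 1 gives `d = 1 − s²`, that is
-- `x = 2 + s − 1/s`, and the other root is then `−s²`. Hence only `(−s²)^ℓ`, and `s^ℓ` for a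
-- traversal of the path, can occur.
--
-- Parity helps because a cycle has two orientations and so contributes with an even coefficient,
-- while the correction caused by a path of length a between the two cubic vertices begins with
-- `± s^(2a+2)`. Even when their exponents coincide, the two kinds of term cannot cancel or imitate
-- each other.
--
-- No power series are formed. The identities hold for every integer `s`, truncation after `s^h` is
-- divisibility by `s^(h+1)`, and coefficients are compared at a single even `s` that is large
-- against them. Elimination would divide by `1 + s²`; powers of this factor are carried along
-- instead.

-- Permanents as products of linear forms in square-zero variables.

module Permanent where

  perℤ : ∀ {n} → Matrix ℤ n → ℤ
  perℤ = per +-*-rawSemiring

  ∑ℤ ∏ℤ : ∀ {n} → (Fin n → ℤ) → ℤ
  ∑ℤ = SSum.sum ℤ.+-*-semiring
  ∏ℤ = CMSum.sum ℤ.*-1-commutativeMonoid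

  module _ {A : Set} where
    sumOver : (A → ℤ) → List A → ℤ
    sumOver f xs = foldr ℤ._+_ 0ℤ (map f xs)

    sumOver-cong : ∀ {f g : A → ℤ} → (∀ x → f x ≡ g x) → ∀ xs → sumOver f xs ≡ sumOver g xs
    sumOver-cong f≗g xs = cong (foldr ℤ._+_ 0ℤ) (List.map-cong f≗g xs)

    sumOver-++ : ∀ (f : A → ℤ) xs ys → sumOver f (xs ++ ys) ≡ sumOver f xs ℤ.+ sumOver f ys
    sumOver-++ f []       ys = sym (ℤ.+-identityˡ _)
    sumOver-++ f (x ∷ xs) ys = trans (cong (λ z → f x ℤ.+ z) (sumOver-++ f xs ys)) (sym (ℤ.+-assoc (f x) _ _))

    sumOver-* : ∀ k (f : A → ℤ) xs → sumOver (λ x → k ℤ.* f x) xs ≡ k ℤ.* sumOver f xs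
    sumOver-* k f []       = sym (ℤ.*-zeroʳ k)
    sumOver-* k f (x ∷ xs) = trans (cong (λ z → k ℤ.* f x ℤ.+ z) (sumOver-* k f xs)) (sym (ℤ.*-distribˡ-+ k (f x) _))

  sumOver-map : ∀ {A B : Set} (f : B → ℤ) (g : A → B) xs → sumOver f (map g xs) ≡ sumOver (f ∘ g) xs
  sumOver-map f g xs = cong (foldr ℤ._+_ 0ℤ) (sym (List.map-∘ xs))

  sumOver-cartesian : ∀ {A B C : Set} (h : A → B → C) (f : C → ℤ) xs ys →
    sumOver f (cartesianProductWith h xs ys) ≡ sumOver (λ x → sumOver (λ y → f (h x y)) ys) xs
  sumOver-cartesian h f []       ys = refl
  sumOver-cartesian h f (x ∷ xs) ys = trans (sumOver-++ f (map (h x) ys) _)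
    (cong₂ ℤ._+_ (sumOver-map f (h x) ys) (sumOver-cartesian h f xs ys))

  sumOver-tabulate : ∀ {A : Set} {n} (f : A → ℤ) (g : Fin n → A) → sumOver f (List.tabulate g) ≡ ∑ℤ (f ∘ g)
  sumOver-tabulate {n = zero}  f g = refl
  sumOver-tabulate {n = suc n} f g = cong (λ z → f (g zero) ℤ.+ z) (sumOver-tabulate f (g ∘ suc))

  minor : ∀ {n} → Matrix ℤ (suc n) → Fin (suc n) → Matrix ℤ n
  minor m j i k = m (suc i) (punchIn j k)

  -- The enumeration of permutations is itself indexed by the image of `zero`, so the expansion
  -- along the first row is a regrouping of the sum.
  per-laplace : ∀ {n} (m : Matrix ℤ (suc n)) → perℤ m ≡ ∑ℤ (λ j → m zero j ℤ.* perℤ (minor m j))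
  per-laplace {n} m = begin
    perℤ m
      ≡⟨ sumOver-cartesian (insert zero) term (allFin (suc n)) (permutations n) ⟩
    sumOver (λ j → sumOver (λ π → term (insert zero j π)) (permutations n)) (allFin (suc n))
      ≡⟨ sumOver-cong (λ j → trans (sumOver-cong (term-insert j) (permutations n))
                                       (sumOver-* (m zero j) _ (permutations n))) (allFin (suc n)) ⟩
    sumOver (λ j → m zero j ℤ.* perℤ (minor m j)) (allFin (suc n))
      ≡⟨ sumOver-tabulate (λ j → m zero j ℤ.* perℤ (minor m j)) (λ j → j) ⟩
    ∑ℤ (λ j → m zero j ℤ.* perℤ (minor m j)) ∎
    where
    open ≡-Reasoning
    term : Permutation′ (suc n) → ℤ
    term σ = ∏ℤ (λ i → m i (σ ⟨$⟩ʳ i))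
    term-insert : ∀ j (π : Permutation′ n) →
      term (insert zero j π) ≡ m zero j ℤ.* ∏ℤ (λ i → minor m j i (π ⟨$⟩ʳ i))
    term-insert j π = cong (λ z → m zero j ℤ.* z)
      (CMSum.sum-cong-≗ ℤ.*-1-commutativeMonoid (λ i → cong (m (suc i)) (insert-punchIn zero j π i)))

  module Products (R : CommutativeSemiring 0ℓ 0ℓ) where
    open CommutativeSemiring R hiding (zero) renaming (Carrier to C; refl to ≈-refl; sym to ≈-sym; trans to ≈-trans)
    open import Relation.Binary.Reasoning.Setoid setoid
    open import Algebra.Solver.Ring.NaturalCoefficients.Default R
    open CMSum *-commutativeMonoid public using () renaming (sum to ∏; sum-cong-≋ to ∏-cong;
      sum-cong-≗ to ∏-cong-≗; ∑-distrib-+ to ∏-distrib-*; sum-remove to ∏-remove; sum-replicate-zero to ∏-replicate-1)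
    open SSum semiring public using () renaming (sum to ∑; sum-cong-≋ to ∑-cong; sum-remove to ∑-remove;
      *-distribˡ-sum to *-distribˡ-∑; *-distribʳ-sum to *-distribʳ-∑)

    ∏-1 : ∀ {n} {f : Fin n → C} → (∀ j → f j ≈ 1#) → ∏ f ≈ 1#
    ∏-1 {n} eq = ≈-trans (∏-cong eq) (∏-replicate-1 n)

    ∏-point : ∀ {n} (f : Fin n → C) j → (∀ k → k ≢ j → f k ≈ 1#) → ∏ f ≈ f j
    ∏-point {suc n} f j eq = begin
      ∏ f                           ≈⟨ ∏-remove {i = j} f ⟩
      f j * ∏ (λ k → f (punchIn j k)) ≈⟨ *-congˡ (∏-1 (λ k → eq _ (Fin.punchInᵢ≢i j k))) ⟩
      f j * 1#                      ≈⟨ *-identityʳ _ ⟩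
      f j ∎

    -- Every product of two or more of the terms contains `r * r`.
    ∏-nilpotent : ∀ {n} r (t : Fin n → C) → r * r ≈ 0# → ∏ (λ j → 1# + r * t j) ≈ 1# + r * ∑ t
    ∏-nilpotent {zero}  r t r² = ≈-sym (≈-trans (+-congˡ (zeroʳ r)) (+-identityʳ _))
    ∏-nilpotent {suc n} r t r² = begin
      (1# + r * t zero) * ∏ (λ j → 1# + r * t (suc j)) ≈⟨ *-congˡ (∏-nilpotent r (t ∘ suc) r²) ⟩
      (1# + r * t zero) * (1# + r * ∑ (t ∘ suc))
        ≈⟨ solve 3 (λ r x y → (con 1 :+ r :* x) :* (con 1 :+ r :* y) :=
             con 1 :+ r :* (x :+ y) :+ (r :* r) :* (x :* y)) ≈-refl r (t zero) (∑ (t ∘ suc)) ⟩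
      1# + r * (t zero + ∑ (t ∘ suc)) + (r * r) * (t zero * ∑ (t ∘ suc)) ≈⟨ +-congˡ (≈-trans (*-congʳ r²) (zeroˡ _)) ⟩
      1# + r * ∑ t + 0# ≈⟨ +-identityʳ _ ⟩
      1# + r * ∑ t ∎

    ∏-↑ : ∀ m {n} (f : Fin (m ℕ.+ n) → C) → ∏ f ≈ ∏ (λ i → f (i ↑ˡ n)) * ∏ (λ i → f (m ↑ʳ i))
    ∏-↑ zero    f = ≈-sym (*-identityˡ _)
    ∏-↑ (suc m) f = ≈-trans (*-congˡ (∏-↑ m (f ∘ suc))) (≈-sym (*-assoc _ _ _))

    -- Congruence modulo the annihilator of `a`: one copy of `a` serves all factors, because it is
    -- moved on to the next factor after each replacement.
    *-∏-cong : ∀ {n} a {f g : Fin n → C} → (∀ i → a * f i ≈ a * g i) → a * ∏ f ≈ a * ∏ g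
    *-∏-cong {zero}  a eq = ≈-refl
    *-∏-cong {suc n} a {f} {g} eq = begin
      a * (f zero * ∏ (f ∘ suc)) ≈⟨ *-assoc a _ _ ⟨
      a * f zero * ∏ (f ∘ suc)   ≈⟨ *-congʳ (eq zero) ⟩
      a * g zero * ∏ (f ∘ suc)   ≈⟨ solve 3 (λ a x y → a :* x :* y := x :* (a :* y)) ≈-refl a (g zero) (∏ (f ∘ suc)) ⟩
      g zero * (a * ∏ (f ∘ suc)) ≈⟨ *-congˡ (*-∏-cong a (eq ∘ suc)) ⟩
      g zero * (a * ∏ (g ∘ suc)) ≈⟨ solve 3 (λ a x y → x :* (a :* y) := a :* (x :* y)) ≈-refl a (g zero) (∏ (g ∘ suc)) ⟩
      a * ∏ g ∎

    module Constants (κ : ℤ → C) (κ-+ : ∀ k l → κ (k ℤ.+ l) ≈ κ k + κ l)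
                     (κ-* : ∀ k l → κ (k ℤ.* l) ≈ κ k * κ l) (κ-0 : κ 0ℤ ≈ 0#) (κ-1 : κ 1ℤ ≈ 1#) where

      κ-∑ : ∀ {n} (f : Fin n → ℤ) → κ (∑ℤ f) ≈ ∑ (κ ∘ f)
      κ-∑ {zero}  f = κ-0
      κ-∑ {suc n} f = ≈-trans (κ-+ _ _) (+-congˡ (κ-∑ (f ∘ suc)))

      -- In the expanded product of the rows a column chosen twice gives a square. What survives are
      -- the choices of distinct columns, that is the permutations.
      per-rows : ∀ {n} (m : Matrix ℤ n) (c : Fin n → C) → (∀ j → c j * c j ≈ 0#) →
                 κ (perℤ m) * ∏ c ≈ ∏ (λ i → ∑ (λ j → κ (m i j) * c j))
      per-rows {zero}  m c c² = ≈-trans (*-congʳ κ-1) (*-identityˡ _)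
      per-rows {suc n} m c c² = begin
        κ (perℤ m) * ∏ c
          ≡⟨ cong (λ z → κ z * ∏ c) (per-laplace m) ⟩
        κ (∑ℤ (λ j → m zero j ℤ.* perℤ (minor m j))) * ∏ c
          ≈⟨ *-congʳ (κ-∑ {suc n} (λ j → m zero j ℤ.* perℤ (minor m j))) ⟩
        ∑ (λ j → κ (m zero j ℤ.* perℤ (minor m j))) * ∏ c
          ≈⟨ *-distribʳ-∑ (∏ c) (λ j → κ (m zero j ℤ.* perℤ (minor m j))) ⟩
        ∑ (λ j → κ (m zero j ℤ.* perℤ (minor m j)) * ∏ c)
          ≈⟨ ∑-cong column ⟩
        ∑ (λ j → κ (m zero j) * c j * rest)
          ≈⟨ *-distribʳ-∑ rest (λ j → κ (m zero j) * c j) ⟨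
        ∑ (λ j → κ (m zero j) * c j) * rest ∎
        where
        row : Fin n → C
        row i = ∑ (λ k → κ (m (suc i) k) * c k)
        rest : C
        rest = ∏ row
        -- Once `c j` stands in front, column `j` may be restored to the remaining rows, as its term
        -- there carries `c j * c j`.
        row-remove : ∀ j i → c j * ∑ (λ k → κ (minor m j i k) * c (punchIn j k)) ≈ c j * row i
        row-remove j i = ≈-sym (begin
          c j * row i ≈⟨ *-congˡ (∑-remove {i = j} (λ k → κ (m (suc i) k) * c k)) ⟩
          c j * (κ (m (suc i) j) * c j + ∑ (λ k → κ (minor m j i k) * c (punchIn j k)))
            ≈⟨ solve 3 (λ c k t → c :* (k :* c :+ t) := (c :* c) :* k :+ c :* t) ≈-refl (c j) _ _ ⟩
          (c j * c j) * κ (m (suc i) j) + c j * ∑ (λ k → κ (minor m j i k) * c (punchIn j k))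
            ≈⟨ +-congʳ (≈-trans (*-congʳ (c² j)) (zeroˡ _)) ⟩
          0# + c j * ∑ (λ k → κ (minor m j i k) * c (punchIn j k))
            ≈⟨ +-identityˡ _ ⟩
          c j * ∑ (λ k → κ (minor m j i k) * c (punchIn j k)) ∎)
        column : ∀ j → κ (m zero j ℤ.* perℤ (minor m j)) * ∏ c ≈ κ (m zero j) * c j * rest
        column j = begin
          κ (m zero j ℤ.* perℤ (minor m j)) * ∏ c ≈⟨ *-cong (κ-* _ _) (∏-remove {i = j} c) ⟩
          κ (m zero j) * κ (perℤ (minor m j)) * (c j * ∏ (c ∘ punchIn j))
            ≈⟨ solve 4 (λ a b c d → a :* b :* (c :* d) := a :* (c :* (b :* d))) ≈-refl _ _ _ _ ⟩
          κ (m zero j) * (c j * (κ (perℤ (minor m j)) * ∏ (c ∘ punchIn j)))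
            ≈⟨ *-congˡ (*-congˡ (per-rows (minor m j) (c ∘ punchIn j) (c² ∘ punchIn j))) ⟩
          κ (m zero j) * (c j * ∏ (λ i → ∑ (λ k → κ (minor m j i k) * c (punchIn j k))))
            ≈⟨ *-congˡ (*-∏-cong (c j) (row-remove j)) ⟩
          κ (m zero j) * (c j * rest) ≈⟨ *-assoc _ _ _ ⟨
          κ (m zero j) * c j * rest ∎

-- An algebra over ℤ with commuting generators of square zero.

module NilpotentAlgebra where

  open Permanent

  private variable N : ℕ

  infix  4 _≈ᴱ_
  infixl 6 _⊕_
  infixl 7 _⊗_

  -- Terms are the carrier rather than operators: arbitrary operators do not commute, whereas for
  -- the denotations of terms linearity, extensionality and commutativity follow by induction on the
  -- term.
  data Expr (N : ℕ) : Set where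
    con     : ℤ → Expr N
    gen     : Fin N → Expr N
    _⊕_ _⊗_ : Expr N → Expr N → Expr N

  -- The generators act as annihilation operators on functions of the subsets of
  -- Fin N; they commute and have square zero.
  ⟦_⟧ : Expr N → (Vec Bool N → ℤ) → Vec Bool N → ℤ
  ⟦ con k ⟧ f S = k ℤ.* f S
  ⟦ gen i ⟧ f S = if lookup S i then f (S [ i ]≔ false) else 0ℤ
  ⟦ a ⊕ b ⟧ f S = ⟦ a ⟧ f S ℤ.+ ⟦ b ⟧ f S
  ⟦ a ⊗ b ⟧ f S = ⟦ a ⟧ (⟦ b ⟧ f) S

  -- A record rather than the bare statement, so that `a` and `b` can be inferred from the type of a
  -- proof.
  record _≈ᴱ_ {N} (a b : Expr N) : Set where
    constructor mk≈
    field app : ∀ f S → ⟦ a ⟧ f S ≡ ⟦ b ⟧ f S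
  open _≈ᴱ_ public

  ⟦⟧-cong : ∀ (e : Expr N) {f g} → (∀ S → f S ≡ g S) → ∀ S → ⟦ e ⟧ f S ≡ ⟦ e ⟧ g S
  ⟦⟧-cong (con k) f≗g S = cong (k ℤ.*_) (f≗g S)
  ⟦⟧-cong (gen i) f≗g S with lookup S i
  ... | true  = f≗g _
  ... | false = refl
  ⟦⟧-cong (a ⊕ b) f≗g S = cong₂ ℤ._+_ (⟦⟧-cong a f≗g S) (⟦⟧-cong b f≗g S)
  ⟦⟧-cong (a ⊗ b) f≗g   = ⟦⟧-cong a (⟦⟧-cong b f≗g)

  private
    +-swap : ∀ a b c d → (a ℤ.+ b) ℤ.+ (c ℤ.+ d) ≡ (a ℤ.+ c) ℤ.+ (b ℤ.+ d)
    +-swap a b c d = begin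
      (a ℤ.+ b) ℤ.+ (c ℤ.+ d) ≡⟨ ℤ.+-assoc a b _ ⟩
      a ℤ.+ (b ℤ.+ (c ℤ.+ d)) ≡⟨ cong (λ x → a ℤ.+ x) (ℤ.+-assoc b c d) ⟨
      a ℤ.+ (b ℤ.+ c ℤ.+ d)   ≡⟨ cong (λ x → a ℤ.+ (x ℤ.+ d)) (ℤ.+-comm b c) ⟩
      a ℤ.+ (c ℤ.+ b ℤ.+ d)   ≡⟨ cong (λ x → a ℤ.+ x) (ℤ.+-assoc c b d) ⟩
      a ℤ.+ (c ℤ.+ (b ℤ.+ d)) ≡⟨ ℤ.+-assoc a c _ ⟨
      (a ℤ.+ c) ℤ.+ (b ℤ.+ d) ∎
      where open ≡-Reasoning

    *-swap : ∀ a b c → a ℤ.* (b ℤ.* c) ≡ b ℤ.* (a ℤ.* c)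
    *-swap a b c = trans (sym (ℤ.*-assoc a b c)) (trans (cong (ℤ._* c) (ℤ.*-comm a b)) (ℤ.*-assoc b a c))

  ⟦⟧-+ : ∀ (e : Expr N) f g S → ⟦ e ⟧ (λ S → f S ℤ.+ g S) S ≡ ⟦ e ⟧ f S ℤ.+ ⟦ e ⟧ g S
  ⟦⟧-+ (con k) f g S = ℤ.*-distribˡ-+ k (f S) (g S)
  ⟦⟧-+ (gen i) f g S with lookup S i
  ... | true  = refl
  ... | false = refl
  ⟦⟧-+ (a ⊕ b) f g S = trans (cong₂ ℤ._+_ (⟦⟧-+ a f g S) (⟦⟧-+ b f g S)) (+-swap (⟦ a ⟧ f S) _ _ _)
  ⟦⟧-+ (a ⊗ b) f g S = trans (⟦⟧-cong a (⟦⟧-+ b f g) S) (⟦⟧-+ a _ _ S)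

  ⟦⟧-* : ∀ (e : Expr N) k f S → ⟦ e ⟧ (λ S → k ℤ.* f S) S ≡ k ℤ.* ⟦ e ⟧ f S
  ⟦⟧-* (con l) k f S = *-swap l k (f S)
  ⟦⟧-* (gen i) k f S with lookup S i
  ... | true  = refl
  ... | false = sym (ℤ.*-zeroʳ k)
  ⟦⟧-* (a ⊕ b) k f S = trans (cong₂ ℤ._+_ (⟦⟧-* a k f S) (⟦⟧-* b k f S)) (sym (ℤ.*-distribˡ-+ k (⟦ a ⟧ f S) _))
  ⟦⟧-* (a ⊗ b) k f S = trans (⟦⟧-cong a (⟦⟧-* b k f) S) (⟦⟧-* a k _ S)

  gen-comm : ∀ (i j : Fin N) f S → ⟦ gen i ⟧ (⟦ gen j ⟧ f) S ≡ ⟦ gen j ⟧ (⟦ gen i ⟧ f) S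
  gen-comm i j f S with i Fin.≟ j
  ... | yes refl = refl
  ... | no  i≢j
    rewrite Vec.lookup∘update′ i≢j S false | Vec.lookup∘update′ (λ eq → i≢j (sym eq)) S false
          | Vec.[]≔-commutes {x = false} {y = false} S i j i≢j
    with lookup S i | lookup S j
  ... | true  | true  = refl
  ... | true  | false = refl
  ... | false | true  = refl
  ... | false | false = refl

  gen-⟦⟧-comm : ∀ (i : Fin N) e f S → ⟦ gen i ⟧ (⟦ e ⟧ f) S ≡ ⟦ e ⟧ (⟦ gen i ⟧ f) S
  gen-⟦⟧-comm i (con k) f S = ⟦⟧-* (gen i) k f S
  gen-⟦⟧-comm i (gen j) f S = gen-comm i j f S
  gen-⟦⟧-comm i (a ⊕ b) f S = trans (⟦⟧-+ (gen i) (⟦ a ⟧ f) (⟦ b ⟧ f) S)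
    (cong₂ ℤ._+_ (gen-⟦⟧-comm i a f S) (gen-⟦⟧-comm i b f S))
  gen-⟦⟧-comm i (a ⊗ b) f S = trans (gen-⟦⟧-comm i a (⟦ b ⟧ f) S) (⟦⟧-cong a (gen-⟦⟧-comm i b f) S)

  ⟦⟧-comm : ∀ (d e : Expr N) f S → ⟦ d ⟧ (⟦ e ⟧ f) S ≡ ⟦ e ⟧ (⟦ d ⟧ f) S
  ⟦⟧-comm (con k) e f S = sym (⟦⟧-* e k f S)
  ⟦⟧-comm (gen i) e f S = gen-⟦⟧-comm i e f S
  ⟦⟧-comm (a ⊕ b) e f S = trans (cong₂ ℤ._+_ (⟦⟧-comm a e f S) (⟦⟧-comm b e f S)) (sym (⟦⟧-+ e (⟦ a ⟧ f) (⟦ b ⟧ f) S))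
  ⟦⟧-comm (a ⊗ b) e f S = trans (⟦⟧-cong a (⟦⟧-comm b e f) S) (⟦⟧-comm a e (⟦ b ⟧ f) S)

  exprSemiring : ℕ → CommutativeSemiring 0ℓ 0ℓ
  exprSemiring N = record
    { Carrier = Expr N ; _≈_ = _≈ᴱ_ ; _+_ = _⊕_ ; _*_ = _⊗_ ; 0# = con 0ℤ ; 1# = con 1ℤ
    ; isCommutativeSemiring = IsCommutativeSemiringˡ.isCommutativeSemiring record
      { +-isCommutativeMonoid = record
        { isMonoid = record
          { isSemigroup = record
            { isMagma = record
              { isEquivalence = equiv
              ; ∙-cong = λ (mk≈ p) (mk≈ q) → mk≈ λ f S → cong₂ ℤ._+_ (p f S) (q f S) }
            ; assoc = λ a b c → mk≈ λ f S → ℤ.+-assoc (⟦ a ⟧ f S) _ _ }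
          ; identity = (λ a → mk≈ λ f S → ℤ.+-identityˡ _) , (λ a → mk≈ λ f S → ℤ.+-identityʳ _) }
        ; comm = λ a b → mk≈ λ f S → ℤ.+-comm (⟦ a ⟧ f S) _ }
      ; *-isCommutativeMonoid = record
        { isMonoid = record
          { isSemigroup = record
            { isMagma = record
              { isEquivalence = equiv
              ; ∙-cong = λ {a} {b} {c} {d} (mk≈ p) (mk≈ q) → mk≈ λ f S → trans (p _ S) (⟦⟧-cong b (q f) S) }
            ; assoc = λ a b c → mk≈ λ f S → refl }
          ; identity = (λ a → mk≈ λ f S → ℤ.*-identityˡ _)
                     , (λ a → mk≈ λ f S → ⟦⟧-cong a (λ S → ℤ.*-identityˡ (f S)) S) }
        ; comm = λ a b → mk≈ (⟦⟧-comm a b) }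
      ; distribʳ = λ a b c → mk≈ λ f S → refl
      ; zeroˡ = λ a → mk≈ λ f S → refl } }
    where
    equiv : IsEquivalence (_≈ᴱ_ {N})
    equiv = record
      { refl = mk≈ λ f S → refl
      ; sym = λ (mk≈ p) → mk≈ λ f S → sym (p f S)
      ; trans = λ (mk≈ p) (mk≈ q) → mk≈ λ f S → trans (p f S) (q f S) }

  con-+ : ∀ k l → con {N} (k ℤ.+ l) ≈ᴱ con k ⊕ con l
  con-+ k l = mk≈ λ f S → ℤ.*-distribʳ-+ (f S) k l

  con-* : ∀ k l → con {N} (k ℤ.* l) ≈ᴱ con k ⊗ con l
  con-* k l = mk≈ λ f S → ℤ.*-assoc k l (f S)

  gen² : ∀ (i : Fin N) → gen i ⊗ gen i ≈ᴱ con 0ℤ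
  gen² i = mk≈ λ f S → lem f S
    where
    lem : ∀ f S → ⟦ gen i ⊗ gen i ⟧ f S ≡ 0ℤ
    lem f S rewrite Vec.lookup∘update i S false with lookup S i
    ... | true  = refl
    ... | false = refl

  -- ⟦ e ⟧ δ at the full subset is the coefficient of the product of all generators.
  δ : Vec Bool N → ℤ
  δ []          = 1ℤ
  δ (true ∷ S)  = 0ℤ
  δ (false ∷ S) = δ S

  data Free (i : Fin N) : Expr N → Set where
    con  : ∀ k → Free i (con k)
    gen  : ∀ {j} → i ≢ j → Free i (gen j)
    _⊕_  : ∀ {a b} → Free i a → Free i b → Free i (a ⊕ b)
    _⊗_  : ∀ {a b} → Free i a → Free i b → Free i (a ⊗ b)

  δ-vanish : ∀ (i : Fin N) S → lookup S i ≡ true → δ S ≡ 0ℤ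
  δ-vanish zero    (true ∷ S)  eq = refl
  δ-vanish (suc i) (true ∷ S)  eq = refl
  δ-vanish (suc i) (false ∷ S) eq = δ-vanish i S eq

  -- Without `gen i` an expression never removes `i` from the subset, so `f` is only evaluated at
  -- subsets that still contain `i`.
  Free-vanish : ∀ {i : Fin N} {e f} → Free i e → (∀ S → lookup S i ≡ true → f S ≡ 0ℤ) →
                ∀ S → lookup S i ≡ true → ⟦ e ⟧ f S ≡ 0ℤ
  Free-vanish (con k) van S on = trans (cong (k ℤ.*_) (van S on)) (ℤ.*-zeroʳ k)
  Free-vanish (gen {j} i≢j) van S on with lookup S j
  ... | true  = van _ (trans (Vec.lookup∘update′ i≢j S false) on)
  ... | false = refl
  Free-vanish (p ⊕ q) van S on = cong₂ ℤ._+_ (Free-vanish p van S on) (Free-vanish q van S on)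
  Free-vanish (p ⊗ q) van S on = Free-vanish p (Free-vanish q van) S on

  module _ {N : ℕ} where
    open Products (exprSemiring N) public

  shift : Expr N → Expr (suc N)
  shift (con k) = con k
  shift (gen i) = gen (suc i)
  shift (a ⊕ b) = shift a ⊕ shift b
  shift (a ⊗ b) = shift a ⊗ shift b

  ⟦shift⟧ : ∀ (e : Expr N) f b S → ⟦ shift e ⟧ f (b ∷ S) ≡ ⟦ e ⟧ (λ S → f (b ∷ S)) S
  ⟦shift⟧ (con k) f b S = refl
  ⟦shift⟧ (gen i) f b S = refl
  ⟦shift⟧ (a ⊕ c) f b S = cong₂ ℤ._+_ (⟦shift⟧ a f b S) (⟦shift⟧ c f b S)
  ⟦shift⟧ (a ⊗ c) f b S = trans (⟦shift⟧ a _ b S) (⟦⟧-cong a (⟦shift⟧ c f b) S)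

  shift-∏ : ∀ {k} (t : Fin k → Expr N) → shift (∏ t) ≡ ∏ (λ i → shift (t i))
  shift-∏ {k = zero}  t = refl
  shift-∏ {k = suc k} t = cong (shift (t zero) ⊗_) (shift-∏ (λ i → t (suc i)))

  abstract
    -- The coefficient of the full monomial. It is abstract so that later computations go through
    -- the laws below instead of unfolding operators.
    top : Expr N → ℤ
    top {N} e = ⟦ e ⟧ δ (Vec.replicate N true)

    top-cong : {a b : Expr N} → a ≈ᴱ b → top a ≡ top b
    top-cong eq = app eq δ _

    top-⊕ : ∀ (a b : Expr N) → top (a ⊕ b) ≡ top a ℤ.+ top b
    top-⊕ a b = refl

    top-con : ∀ k (e : Expr N) → top (con k ⊗ e) ≡ k ℤ.* top e
    top-con k e = refl

    top-free : ∀ {i : Fin N} {e} → Free i e → top e ≡ 0ℤ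
    top-free {i = i} p = Free-vanish p (δ-vanish i) _ (Vec.lookup-replicate i true)

    top-∏gen : ∀ N → top (∏ {N} gen) ≡ 1ℤ
    top-∏gen zero    = refl
    top-∏gen (suc N) = begin
      ⟦ ∏ {suc N} {N} (λ i → gen (suc i)) ⟧ δ (false ∷ Vec.replicate N true) ≡⟨ cong (λ e → ⟦ e ⟧ δ (false ∷ Vec.replicate N true)) (shift-∏ {N} gen) ⟨
      ⟦ shift (∏ {N} gen) ⟧ δ (false ∷ Vec.replicate N true)   ≡⟨ ⟦shift⟧ (∏ {N} gen) δ false _ ⟩
      ⟦ ∏ {N} gen ⟧ δ (Vec.replicate N true)                    ≡⟨ top-∏gen N ⟩
      1ℤ ∎
      where open ≡-Reasoning

-- The permanent as a product over vertices and edges.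

module ArcProducts where

  open Permanent
  open NilpotentAlgebra

  private variable N : ℕ

  module ES {N : ℕ} = CommutativeSemiring (exprSemiring N)
  module ER {N : ℕ} = SetoidReasoning (ES.setoid {N})
  module Sol {N : ℕ} = SemiringSolver (exprSemiring N)

  1ᴱ : Expr N
  1ᴱ = con 1ℤ

  Free-∏ : ∀ {k} {i : Fin N} {t : Fin k → Expr N} → (∀ j → Free i (t j)) → Free i (∏ t)
  Free-∏ {k = zero}  fr = con 1ℤ
  Free-∏ {k = suc k} fr = fr zero ⊗ Free-∏ (fr ∘ suc)

  Free-∑ : ∀ {k} {i : Fin N} {t : Fin k → Expr N} → (∀ j → Free i (t j)) → Free i (∑ t)
  Free-∑ {k = zero}  fr = con 0ℤ
  Free-∑ {k = suc k} fr = fr zero ⊕ Free-∑ (fr ∘ suc)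

  top-⊕-free : ∀ {i} {a b e : Expr N} → e ≈ᴱ a ⊕ b → Free i a → top e ≡ top b
  top-⊕-free {b = b} eq fr = trans (trans (top-cong eq) (top-⊕ _ _)) (trans (cong (ℤ._+ top b) (top-free fr)) (ℤ.+-identityˡ _))

  -- The generator `g i` must occur in the full monomial, and its own factor is the only place that
  -- can supply it. The summand `1ᴱ` of that factor therefore never counts.
  top-∏-peel : ∀ k {g : Fin k → Fin N} → (∀ i j → g i ≡ g j → i ≡ j) → {v : Fin k → Expr N} {G : Expr N} →
    (∀ i j → Free (g i) (v j)) → (∀ i → Free (g i) G) →
    top (G ⊗ ∏ (λ i → 1ᴱ ⊕ gen (g i) ⊗ v i)) ≡ top (G ⊗ ∏ (λ i → gen (g i) ⊗ v i))
  top-∏-peel zero    inj fv fG = refl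
  top-∏-peel (suc k) {g} inj {v} {G} fv fG = begin
    top (G ⊗ ((1ᴱ ⊕ gen (g zero) ⊗ v zero) ⊗ R))
      ≡⟨ top-⊕-free (Sol.solve 3 (λ G x R → G :* ((con′ 1 :+ x) :* R) := G :* R :+ G :* x :* R) (ES.refl {x = _}) G (gen (g zero) ⊗ v zero) R)
           (fG zero ⊗ Free-∏ λ i → con 1ℤ ⊕ gen (λ eq → case-0 i (inj zero (suc i) eq)) ⊗ fv zero (suc i)) ⟩
    top (G ⊗ (gen (g zero) ⊗ v zero) ⊗ R)
      ≡⟨ top-∏-peel k (λ i j eq → Fin.suc-injective (inj _ _ eq)) (λ i j → fv (suc i) (suc j))
           (λ i → fG (suc i) ⊗ (gen (λ eq → case-0 i (sym (inj (suc i) zero eq))) ⊗ fv (suc i) zero)) ⟩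
    top (G ⊗ (gen (g zero) ⊗ v zero) ⊗ ∏ (λ i → gen (g (suc i)) ⊗ v (suc i)))
      ≡⟨ top-cong (ES.*-assoc G (gen (g zero) ⊗ v zero) _) ⟩
    top (G ⊗ ∏ (λ i → gen (g i) ⊗ v i)) ∎
    where
    open ≡-Reasoning
    open Sol using (_:*_; _:+_; _:=_) renaming (con to con′)
    R = ∏ (λ i → 1ᴱ ⊕ gen (g (suc i)) ⊗ v (suc i))
    case-0 : ∀ (i : Fin k) → zero ≡ suc i → _
    case-0 i ()

  module _ {N : ℕ} where
    open Products.Constants (exprSemiring N) con con-+ con-* ES.refl ES.refl public

  Π : ∀ {A : Set} → (A → Expr N) → List A → Expr N
  Π f = foldr (λ x t → f x ⊗ t) 1ᴱ

  Π-tabulate : ∀ {A : Set} {k} (f : A → Expr N) (g : Fin k → A) → Π f (List.tabulate g) ≈ᴱ ∏ (f ∘ g)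
  Π-tabulate {k = zero}  f g = ES.refl
  Π-tabulate {k = suc k} f g = ES.*-congˡ (Π-tabulate f (g ∘ suc))

  module _ {n : ℕ} where

    r c p : Fin n → Expr (n ℕ.+ n)
    r w = gen (w ↑ˡ n)
    c w = gen (n ↑ʳ w)
    p w = r w ⊗ c w

    r≢c : ∀ {i j : Fin n} → i ↑ˡ n ≢ n ↑ʳ j
    r≢c {i} {j} eq with trans (sym (Fin.splitAt-↑ˡ n i n)) (trans (cong (splitAt n) eq) (Fin.splitAt-↑ʳ n n j))
    ... | ()

    r≢r : ∀ {i j : Fin n} → i ≢ j → i ↑ˡ n ≢ j ↑ˡ n
    r≢r i≢j eq = i≢j (Fin.↑ˡ-injective n _ _ eq)

    c≢c : ∀ {i j : Fin n} → i ≢ j → n ↑ʳ i ≢ n ↑ʳ j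
    c≢c i≢j eq = i≢j (Fin.↑ʳ-injective n _ _ eq)

    arcFactor : (Fin n → Fin n → ℤ) → Fin n → Fin n → Expr (n ℕ.+ n)
    arcFactor m i j = 1ᴱ ⊕ r i ⊗ (con (m i j) ⊗ c j)

    arcs : (Fin n → Fin n → ℤ) → Expr (n ℕ.+ n)
    arcs m = ∏ (λ i → ∏ (arcFactor m i))

    top-∏r∏c : top (∏ r ⊗ ∏ c) ≡ 1ℤ
    top-∏r∏c = trans (top-cong (ES.sym (∏-↑ n gen))) (top-∏gen (n ℕ.+ n))

    -- For a fixed row the factors collapse to `1 + r i` times a linear form in the column
    -- variables; the full monomial demands every `r i`, and `per-rows` evaluates the product of the
    -- forms.
    per-top : ∀ (m : Matrix ℤ n) → perℤ m ≡ top (arcs m)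
    per-top m = sym (begin
      top (arcs m)
        ≡⟨ top-cong (∏-cong {k} (λ i → ∏-nilpotent (r i) (λ j → con (m i j) ⊗ c j) (gen² (i ↑ˡ n)))) ⟩
      top (∏ (λ i → 1ᴱ ⊕ r i ⊗ v i))
        ≡⟨ top-cong (ES.*-identityˡ _) ⟨
      top (1ᴱ ⊗ ∏ (λ i → 1ᴱ ⊕ r i ⊗ v i))
        ≡⟨ top-∏-peel n (Fin.↑ˡ-injective n) {v} (λ i j → Free-∑ λ k → con (m j k) ⊗ gen r≢c) (λ i → con 1ℤ) ⟩
      top (1ᴱ ⊗ ∏ (λ i → r i ⊗ v i))
        ≡⟨ top-cong (ES.trans (ES.*-identityˡ _) (∏-distrib-* r v)) ⟩
      top (∏ r ⊗ ∏ v)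
        ≡⟨ top-cong (ES.*-congˡ (ES.sym (per-rows m c (λ j → gen² (n ↑ʳ j))))) ⟩
      top (∏ r ⊗ (con (perℤ m) ⊗ ∏ c))
        ≡⟨ top-cong (Sol.solve 3 (λ a b c → a :* (b :* c) := b :* (a :* c)) ES.refl (∏ r) (con (perℤ m)) (∏ c)) ⟩
      top (con (perℤ m) ⊗ (∏ r ⊗ ∏ c))
        ≡⟨ top-con (perℤ m) (∏ r ⊗ ∏ c) ⟩
      perℤ m ℤ.* top (∏ r ⊗ ∏ c)
        ≡⟨ cong (λ z → perℤ m ℤ.* z) top-∏r∏c ⟩
      perℤ m ℤ.* 1ℤ ≡⟨ ℤ.*-identityʳ _ ⟩
      perℤ m ∎)
      where
      open ≡-Reasoning
      open Sol using (_:*_; _:+_; _:=_)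
      k = n ℕ.+ n
      v : Fin n → Expr (n ℕ.+ n)
      v i = ∑ (λ j → con (m i j) ⊗ c j)

    -- Since `r i` has square zero, `arcs` behaves like an exponential: sums of matrices become
    -- products. This is what allows the permanent to be factored along a decomposition of the
    -- graph.
    arcs-+ : ∀ m m′ → arcs (λ i j → m i j ℤ.+ m′ i j) ≈ᴱ arcs m ⊗ arcs m′
    arcs-+ m m′ = ES.trans (∏-cong λ i → ES.trans (∏-cong λ j → entry i j) (∏-distrib-* (arcFactor m i) (arcFactor m′ i)))
                           (∏-distrib-* (λ i → ∏ (arcFactor m i)) (λ i → ∏ (arcFactor m′ i)))
      where
      entry : ∀ i j → arcFactor (λ i j → m i j ℤ.+ m′ i j) i j ≈ᴱ arcFactor m i j ⊗ arcFactor m′ i j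
      entry i j = begin
        1ᴱ ⊕ r i ⊗ (con (m i j ℤ.+ m′ i j) ⊗ c j)
          ≈⟨ ES.+-congˡ (ES.*-congˡ (ES.*-congʳ (con-+ (m i j) (m′ i j)))) ⟩
        1ᴱ ⊕ r i ⊗ ((con (m i j) ⊕ con (m′ i j)) ⊗ c j)
          -- The quadratic term of the desired product is introduced as zero, disguised by `gen²`.
          ≈⟨ ES.+-identityʳ _ ⟨
        1ᴱ ⊕ r i ⊗ ((con (m i j) ⊕ con (m′ i j)) ⊗ c j) ⊕ con 0ℤ
          ≈⟨ ES.+-congˡ (ES.zeroˡ _) ⟨
        1ᴱ ⊕ r i ⊗ ((con (m i j) ⊕ con (m′ i j)) ⊗ c j) ⊕ con 0ℤ ⊗ (con (m i j) ⊗ c j ⊗ (con (m′ i j) ⊗ c j))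
          ≈⟨ ES.+-congˡ (ES.*-congʳ (gen² (i ↑ˡ n))) ⟨
        1ᴱ ⊕ r i ⊗ ((con (m i j) ⊕ con (m′ i j)) ⊗ c j) ⊕ r i ⊗ r i ⊗ (con (m i j) ⊗ c j ⊗ (con (m′ i j) ⊗ c j))
          ≈⟨ Sol.solve 4 (λ r a b c → con′ 1 :+ r :* ((a :+ b) :* c) :+ r :* r :* (a :* c :* (b :* c))
               := (con′ 1 :+ r :* (a :* c)) :* (con′ 1 :+ r :* (b :* c))) ES.refl (r i) (con (m i j)) (con (m′ i j)) (c j) ⟩
        arcFactor m i j ⊗ arcFactor m′ i j ∎
        where
        open ER
        open Sol using (_:*_; _:+_; _:=_) renaming (con to con′)

    arcFactor-0 : ∀ m {i j} → m i j ≡ 0ℤ → arcFactor m i j ≈ᴱ 1ᴱ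
    arcFactor-0 m {i} {j} eq rewrite eq =
      ES.trans (ES.+-congˡ (ES.trans (ES.*-congˡ (ES.zeroˡ _)) (ES.zeroʳ _))) (ES.+-identityʳ _)

    arcs-diagonal : ∀ m → (∀ i j → j ≢ i → m i j ≡ 0ℤ) → arcs m ≈ᴱ ∏ (λ i → arcFactor m i i)
    arcs-diagonal m eq = ∏-cong λ i → ∏-point (arcFactor m i) i (λ j j≢i → arcFactor-0 m (eq i j j≢i))

    arcs-point : ∀ m x y → (∀ i j → i ≢ x → m i j ≡ 0ℤ) → (∀ i j → j ≢ y → m i j ≡ 0ℤ) → arcs m ≈ᴱ arcFactor m x y
    arcs-point m x y x-only y-only = ES.trans
      (∏-point (λ i → ∏ (arcFactor m i)) x (λ i i≢x → ∏-1 (λ j → arcFactor-0 m (x-only i j i≢x))))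
      (∏-point (arcFactor m x) y (λ j j≢y → arcFactor-0 m (y-only x j j≢y)))

    arcs-cong : ∀ {m m′} → (∀ i j → m i j ≡ m′ i j) → arcs m ≈ᴱ arcs m′
    arcs-cong {m} {m′} eq = ∏-cong λ i → ∏-cong λ j → ES.reflexive (cong (λ z → 1ᴱ ⊕ r i ⊗ (con z ⊗ c j)) (eq i j))

    arc : Fin n → Fin n → Fin n → Fin n → ℤ
    arc x y i j = if does (x Fin.≟ i) then (if does (y Fin.≟ j) then 1ℤ else 0ℤ) else 0ℤ

    arc-self : ∀ x y → arc x y x y ≡ 1ℤ
    arc-self x y with x Fin.≟ x | y Fin.≟ y
    ... | yes _  | yes _  = refl
    ... | no x≢x | _      = ⊥-elim (x≢x refl)
    ... | _      | no y≢y = ⊥-elim (y≢y refl)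

    arc-≢ˡ : ∀ x y i j → i ≢ x → arc x y i j ≡ 0ℤ
    arc-≢ˡ x y i j i≢x with x Fin.≟ i
    ... | yes eq = ⊥-elim (i≢x (sym eq))
    ... | no  _  = refl

    arc-≢ʳ : ∀ x y i j → j ≢ y → arc x y i j ≡ 0ℤ
    arc-≢ʳ x y i j j≢y with x Fin.≟ i | y Fin.≟ j
    ... | yes _ | yes eq = ⊥-elim (j≢y (sym eq))
    ... | yes _ | no _   = refl
    ... | no  _ | _      = refl

    arcCount : List (Fin n × Fin n) → Fin n → Fin n → ℤ
    arcCount []             i j = 0ℤ
    arcCount ((x , y) ∷ es) i j = (arc x y i j ℤ.+ arc y x i j) ℤ.+ arcCount es i j

    -- The summands are the choices at an edge: no arc, one arc in either direction, or both arcs,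
    -- which form a transposition.
    edgeFactor : ℤ → Fin n × Fin n → Expr (n ℕ.+ n)
    edgeFactor s (x , y) = 1ᴱ ⊕ con s ⊗ (r x ⊗ c y ⊕ r y ⊗ c x) ⊕ con s ⊗ con s ⊗ (p x ⊗ p y)

    arcs-arcCount : ∀ s es → arcs (λ i j → s ℤ.* arcCount es i j) ≈ᴱ Π (edgeFactor s) es
    arcs-arcCount s [] = ES.trans (arcs-cong (λ i j → ℤ.*-zeroʳ s))
      (∏-1 (λ i → ∏-1 (λ j → arcFactor-0 (λ _ _ → 0ℤ) {i} {j} refl)))
    arcs-arcCount s ((x , y) ∷ es) = begin
      arcs (λ i j → s ℤ.* ((arc x y i j ℤ.+ arc y x i j) ℤ.+ arcCount es i j))
        ≈⟨ arcs-cong (λ i j → trans (ℤ.*-distribˡ-+ s _ (arcCount es i j)) (cong (ℤ._+ _) (ℤ.*-distribˡ-+ s (arc x y i j) _))) ⟩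
      arcs (λ i j → (s ℤ.* arc x y i j ℤ.+ s ℤ.* arc y x i j) ℤ.+ s ℤ.* arcCount es i j)
        ≈⟨ arcs-+ _ _ ⟩
      arcs (λ i j → s ℤ.* arc x y i j ℤ.+ s ℤ.* arc y x i j) ⊗ arcs (λ i j → s ℤ.* arcCount es i j)
        ≈⟨ ES.*-cong (arcs-+ _ _) (arcs-arcCount s es) ⟩
      arcs (λ i j → s ℤ.* arc x y i j) ⊗ arcs (λ i j → s ℤ.* arc y x i j) ⊗ Π (edgeFactor s) es
        ≈⟨ ES.*-congʳ (ES.*-cong (single x y) (single y x)) ⟩
      (1ᴱ ⊕ r x ⊗ (con s ⊗ c y)) ⊗ (1ᴱ ⊕ r y ⊗ (con s ⊗ c x)) ⊗ Π (edgeFactor s) es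
        ≈⟨ ES.*-congʳ (Sol.solve 5 (λ s rx cx ry cy → (con′ 1 :+ rx :* (s :* cy)) :* (con′ 1 :+ ry :* (s :* cx)) :=
             con′ 1 :+ s :* (rx :* cy :+ ry :* cx) :+ s :* s :* ((rx :* cx) :* (ry :* cy)))
             ES.refl (con s) (r x) (c x) (r y) (c y)) ⟩
      edgeFactor s (x , y) ⊗ Π (edgeFactor s) es ∎
      where
      open ER
      open Sol using (_:*_; _:+_; _:=_) renaming (con to con′)
      single : ∀ x y → arcs (λ i j → s ℤ.* arc x y i j) ≈ᴱ 1ᴱ ⊕ r x ⊗ (con s ⊗ c y)
      single x y = ES.trans (arcs-point (λ i j → s ℤ.* arc x y i j) x y
          (λ i j i≢x → trans (cong (λ z → s ℤ.* z) (arc-≢ˡ x y i j i≢x)) (ℤ.*-zeroʳ s))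
          (λ i j j≢y → trans (cong (λ z → s ℤ.* z) (arc-≢ʳ x y i j j≢y)) (ℤ.*-zeroʳ s)))
        (ES.reflexive (cong (λ z → 1ᴱ ⊕ r x ⊗ (con z ⊗ c y)) (trans (cong (λ z → s ℤ.* z) (arc-self x y)) (ℤ.*-identityʳ s))))

    vertexFactor : (Fin n → ℤ) → Fin n → Expr (n ℕ.+ n)
    vertexFactor D w = 1ᴱ ⊕ con (D w) ⊗ p w

    diag-≢ : ∀ (d : Fin n → ℤ) {i j} → j ≢ i → diag 0ℤ d i j ≡ 0ℤ
    diag-≢ d {i} {j} j≢i with i Fin.≟ j
    ... | yes eq = ⊥-elim (j≢i (sym eq))
    ... | no  _  = refl

    diag-self : ∀ (d : Fin n → ℤ) i → diag 0ℤ d i i ≡ d i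
    diag-self d i with i Fin.≟ i
    ... | yes _  = refl
    ... | no i≢i = ⊥-elim (i≢i refl)

    -- This is `− s` times `x I − Q` at `x = − X / s`. Keeping `X` and `s` separate avoids
    -- denominators and lets the weight of a vertex be prescribed.
    shiftedLaplacian : Graph n → ℤ → ℤ → Matrix ℤ n
    shiftedLaplacian G X s i j = diag 0ℤ (λ _ → X) i j ℤ.+ s ℤ.* signlessLaplacian G i j

    vertexWeight : Graph n → ℤ → ℤ → Fin n → ℤ
    vertexWeight G X s w = X ℤ.+ s ℤ.* (+ Graph.degree G w)

    per-shiftedLaplacian : ∀ (G : Graph n) es → (∀ i j → adjacencyMatrix G i j ≡ arcCount es i j) → ∀ X s →
      perℤ (shiftedLaplacian G X s) ≡ top (Π (vertexFactor (vertexWeight G X s)) (allFin n) ⊗ Π (edgeFactor s) es)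
    per-shiftedLaplacian G es pres X s = trans (per-top (shiftedLaplacian G X s)) (top-cong (begin
      arcs (shiftedLaplacian G X s)
        ≈⟨ arcs-cong (λ i j → trans (cong (λ z → diag 0ℤ (λ _ → X) i j ℤ.+ z) (ℤ.*-distribˡ-+ s (degreeMatrix G i j) (adjacencyMatrix G i j)))
                                (sym (ℤ.+-assoc (diag 0ℤ (λ _ → X) i j) _ _))) ⟩
      arcs (λ i j → m i j ℤ.+ s ℤ.* adjacencyMatrix G i j)
        ≈⟨ arcs-+ _ _ ⟩
      arcs m ⊗ arcs (λ i j → s ℤ.* adjacencyMatrix G i j)
        ≈⟨ ES.*-cong diagonal (ES.trans (arcs-cong (λ i j → cong (λ z → s ℤ.* z) (pres i j))) (arcs-arcCount s es)) ⟩
      Π (vertexFactor (vertexWeight G X s)) (allFin n) ⊗ Π (edgeFactor s) es ∎))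
      where
      open ER
      open Sol using (_:*_; _:+_; _:=_) renaming (con to con′)
      m : Matrix ℤ n
      m i j = diag 0ℤ (λ _ → X) i j ℤ.+ s ℤ.* degreeMatrix G i j
      m-self : ∀ i → m i i ≡ vertexWeight G X s i
      m-self i = cong₂ (λ a b → a ℤ.+ s ℤ.* b) (diag-self (λ _ → X) i) (diag-self (λ v → + Graph.degree G v) i)
      m-≢ : ∀ i j → j ≢ i → m i j ≡ 0ℤ
      m-≢ i j j≢i = trans (cong₂ (λ a b → a ℤ.+ s ℤ.* b) (diag-≢ (λ _ → X) j≢i) (diag-≢ (λ v → + Graph.degree G v) j≢i))
        (trans (ℤ.+-identityˡ _) (ℤ.*-zeroʳ s))
      diagonal : arcs m ≈ᴱ Π (vertexFactor (vertexWeight G X s)) (allFin n)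
      diagonal = begin
        arcs m ≈⟨ arcs-diagonal m m-≢ ⟩
        ∏ (λ i → arcFactor m i i) ≈⟨ ∏-cong (λ i → ES.trans (ES.reflexive (cong (λ z → 1ᴱ ⊕ r i ⊗ (con z ⊗ c i)) (m-self i)))
          (Sol.solve 3 (λ r d c → con′ 1 :+ r :* (d :* c) := con′ 1 :+ d :* (r :* c)) ES.refl (r i) (con (vertexWeight G X s i)) (c i))) ⟩
        ∏ (vertexFactor (vertexWeight G X s)) ≈⟨ Π-tabulate (vertexFactor (vertexWeight G X s)) (λ i → i) ⟨
        Π (vertexFactor (vertexWeight G X s)) (allFin n) ∎

-- Elimination of a vertex of degree 2 between two paths.

module Merging where

  open Permanent
  open NilpotentAlgebra
  open ArcProducts

  module Dual (R : CommutativeSemiring 0ℓ 0ℓ) where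
    open CommutativeSemiring R renaming (Carrier to C; refl to ≈-refl; trans to ≈-trans)
    open import Relation.Binary.Reasoning.Setoid setoid
    open SemiringSolver R using (solve; _:+_; _:*_; _:=_)

    -- Dual numbers in two variables; everything discarded is collected as a multiple of `ρ * ρ` or
    -- of `γ * γ`.
    dual-* : ∀ {ρ γ} → ρ * ρ ≈ 0# → γ * γ ≈ 0# → ∀ a₁ b₁ c₁ d₁ a₂ b₂ c₂ d₂ →
      (a₁ + ρ * b₁ + γ * c₁ + (ρ * γ) * d₁) * (a₂ + ρ * b₂ + γ * c₂ + (ρ * γ) * d₂) ≈
      a₁ * a₂ + ρ * (a₁ * b₂ + b₁ * a₂) + γ * (a₁ * c₂ + c₁ * a₂) + (ρ * γ) * (a₁ * d₂ + d₁ * a₂ + b₁ * c₂ + c₁ * b₂)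
    dual-* {ρ} {γ} ρ² γ² a₁ b₁ c₁ d₁ a₂ b₂ c₂ d₂ = begin
      _ ≈⟨ solve 10 (λ ρ γ a₁ b₁ c₁ d₁ a₂ b₂ c₂ d₂ →
            (a₁ :+ ρ :* b₁ :+ γ :* c₁ :+ (ρ :* γ) :* d₁) :* (a₂ :+ ρ :* b₂ :+ γ :* c₂ :+ (ρ :* γ) :* d₂) :=
            (a₁ :* a₂ :+ ρ :* (a₁ :* b₂ :+ b₁ :* a₂) :+ γ :* (a₁ :* c₂ :+ c₁ :* a₂) :+ (ρ :* γ) :* (a₁ :* d₂ :+ d₁ :* a₂ :+ b₁ :* c₂ :+ c₁ :* b₂))
            :+ ((ρ :* ρ) :* (b₁ :* b₂ :+ γ :* (b₁ :* d₂ :+ d₁ :* b₂) :+ γ :* γ :* (d₁ :* d₂))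
            :+ (γ :* γ) :* (c₁ :* c₂ :+ ρ :* (c₁ :* d₂ :+ d₁ :* c₂))))
            ≈-refl ρ γ a₁ b₁ c₁ d₁ a₂ b₂ c₂ d₂ ⟩
      _ ≈⟨ +-congˡ (+-cong (≈-trans (*-congʳ ρ²) (zeroˡ _)) (≈-trans (*-congʳ γ²) (zeroˡ _))) ⟩
      _ + (0# + 0#) ≈⟨ +-congˡ (+-identityˡ 0#) ⟩
      _ + 0# ≈⟨ +-identityʳ _ ⟩
      _ ∎

  module _ {N : ℕ} where
    open Dual (exprSemiring N) public

  module _ {n : ℕ} where

    Avoids : Fin n → Expr (n ℕ.+ n) → Set
    Avoids w e = Free (w ↑ˡ n) e × Free (n ↑ʳ w) e

    avoids-p : ∀ {w x} → w ≢ x → Avoids w (p x)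
    avoids-p w≢x = gen (r≢r w≢x) ⊗ gen r≢c , gen (r≢c ∘ sym) ⊗ gen (c≢c w≢x)

    avoids-rc : ∀ {w x y} → w ≢ x → w ≢ y → Avoids w (r x ⊗ c y)
    avoids-rc w≢x w≢y = gen (r≢r w≢x) ⊗ gen r≢c , gen (r≢c ∘ sym) ⊗ gen (c≢c w≢y)

    infixl 6 _⊕ᵃ_
    infixl 7 _⊗ᵃ_

    _⊕ᵃ_ : ∀ {w a b} → Avoids w a → Avoids w b → Avoids w (a ⊕ b)
    (f , g) ⊕ᵃ (f′ , g′) = f ⊕ f′ , g ⊕ g′

    _⊗ᵃ_ : ∀ {w a b} → Avoids w a → Avoids w b → Avoids w (a ⊗ b)
    (f , g) ⊗ᵃ (f′ , g′) = f ⊗ f′ , g ⊗ g′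

    conᵃ : ∀ {w} k → Avoids w (con k)
    conᵃ k = con k , con k

    avoids-Π : ∀ {A : Set} {f : A → Expr (n ℕ.+ n)} {w xs} → All (λ x → Avoids w (f x)) xs → Avoids w (Π f xs)
    avoids-Π []       = conᵃ 1ℤ
    avoids-Π (q ∷ qs) = q ⊗ᵃ avoids-Π qs

    -- The full monomial contains both `r w` and `c w`, while `G` and the coefficients of the three
    -- other components contain neither.
    top-dual : ∀ w {a b b′ d G} → Avoids w a → Avoids w b → Avoids w b′ → Avoids w G →
      top ((a ⊕ r w ⊗ b ⊕ c w ⊗ b′ ⊕ p w ⊗ d) ⊗ G) ≡ top (p w ⊗ d ⊗ G)
    top-dual w {a} {b} {b′} {d} {G} fa fb fb′ fG = begin
      top ((a ⊕ r w ⊗ b ⊕ c w ⊗ b′ ⊕ p w ⊗ d) ⊗ G)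
        ≡⟨ top-⊕-free (ES.trans (ES.distribʳ G _ _) (ES.trans (ES.+-congʳ (ES.trans (ES.distribʳ G _ _) (ES.+-comm _ _))) (ES.+-assoc _ _ _)))
             ((gen (r≢c {i = w} {w}) ⊗ proj₁ fb′) ⊗ proj₁ fG) ⟩
      top ((a ⊕ r w ⊗ b) ⊗ G ⊕ p w ⊗ d ⊗ G)
        ≡⟨ top-⊕-free (ES.trans (ES.+-congʳ (ES.distribʳ G _ _)) (ES.+-assoc _ _ _)) (proj₁ fa ⊗ proj₁ fG) ⟩
      top (r w ⊗ b ⊗ G ⊕ p w ⊗ d ⊗ G)
        ≡⟨ top-⊕-free ES.refl (gen (r≢c {i = w} {w} ∘ sym) ⊗ proj₂ fb ⊗ proj₂ fG) ⟩
      top (p w ⊗ d ⊗ G) ∎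
      where open ≡-Reasoning

    -- The shape of the factor of a path between `x` and `y` whose interior is gone: `A`, `B` and
    -- `C` weigh the configurations that cover none, one or both of its ends within the path, `E`
    -- those that run through the whole path in one direction.
    link : (A B C E : ℤ) → Fin n → Fin n → Expr (n ℕ.+ n)
    link A B C E x y =
      con A ⊕ con B ⊗ (p x ⊕ p y) ⊕ con C ⊗ (p x ⊗ p y) ⊕ con E ⊗ (r x ⊗ c y ⊕ r y ⊗ c x)

    link-sym : ∀ A B C E x y → link A B C E x y ≈ᴱ link A B C E y x
    link-sym A B C E x y = ES.+-cong (ES.+-cong (ES.+-congˡ (ES.*-congˡ (ES.+-comm _ _))) (ES.*-congˡ (ES.*-comm _ _)))
                                     (ES.*-congˡ (ES.+-comm _ _))

    avoids-link : ∀ {w A B C E x y} → w ≢ x → w ≢ y → Avoids w (link A B C E x y)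
    avoids-link w≢x w≢y = conᵃ _ ⊕ᵃ conᵃ _ ⊗ᵃ (avoids-p w≢x ⊕ᵃ avoids-p w≢y)
      ⊕ᵃ conᵃ _ ⊗ᵃ (avoids-p w≢x ⊗ᵃ avoids-p w≢y) ⊕ᵃ conᵃ _ ⊗ᵃ (avoids-rc w≢x w≢y ⊕ᵃ avoids-rc w≢y w≢x)

    -- The factor of a path with ℓ edges after elimination of its interior vertices,
    -- normalised so that ℓ = 1 gives (1 + s²) times the factor of an edge.
    segment : ℤ → ℕ → Fin n → Fin n → Expr (n ℕ.+ n)
    segment s ℓ = link (1ℤ ℤ.- α) (s ℤ.* s ℤ.+ α) (s ℤ.* s ℤ.* (s ℤ.* s) ℤ.- α) ((1ℤ ℤ.+ s ℤ.* s) ℤ.* s ℤ.^ ℓ)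
      where α = (ℤ.- (s ℤ.* s)) ℤ.^ ℓ

    private
      dualFactor : Fin n → (a b b′ d : Expr (n ℕ.+ n)) → Expr (n ℕ.+ n)
      dualFactor w a b b′ d = a ⊕ r w ⊗ b ⊕ c w ⊗ b′ ⊕ p w ⊗ d

      link-dual : ∀ A B C E x w → link A B C E x w ≈ᴱ
        dualFactor w (con A ⊕ con B ⊗ p x) (con E ⊗ c x) (con E ⊗ r x) (con B ⊕ con C ⊗ p x)
      link-dual A B C E x w = Sol.solve 8
        (λ A B C E rx cx rw cw → A :+ B :* (rx :* cx :+ rw :* cw) :+ C :* ((rx :* cx) :* (rw :* cw)) :+ E :* (rx :* cw :+ rw :* cx)
           := (A :+ B :* (rx :* cx)) :+ rw :* (E :* cx) :+ cw :* (E :* rx) :+ (rw :* cw) :* (B :+ C :* (rx :* cx)))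
        ES.refl (con A) (con B) (con C) (con E) (r x) (c x) (r w) (c w)
        where open Sol using (_:*_; _:+_; _:=_)

      vertex-dual : ∀ D w → vertexFactor D w ≈ᴱ dualFactor w 1ᴱ (con 0ℤ) (con 0ℤ) (con (D w))
      vertex-dual D w = Sol.solve 3 (λ d rw cw → con′ 1 :+ d :* (rw :* cw)
          := con′ 1 :+ rw :* con′ 0 :+ cw :* con′ 0 :+ (rw :* cw) :* d) ES.refl (con (D w)) (r w) (c w)
        where open Sol using (_:*_; _:+_; _:=_) renaming (con to con′)

    con-mul-add : ∀ a b c′ d → con {n ℕ.+ n} (a ℤ.* b ℤ.+ c′ ℤ.* d) ≈ᴱ con a ⊗ con b ⊕ con c′ ⊗ con d
    con-mul-add a b c′ d = ES.trans (con-+ _ _) (ES.+-cong (con-* a b) (con-* c′ d))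

    con-mul-add₃ : ∀ a b c′ d D e f → con {n ℕ.+ n} ((a ℤ.* b ℤ.+ c′ ℤ.* d) ℤ.+ D ℤ.* (e ℤ.* f)) ≈ᴱ
      con a ⊗ con b ⊕ con c′ ⊗ con d ⊕ con D ⊗ (con e ⊗ con f)
    con-mul-add₃ a b c′ d D e f = ES.trans (con-+ _ _) (ES.+-cong (con-mul-add a b c′ d)
      (ES.trans (con-* _ _) (ES.*-congˡ (con-* e f))))

    -- The left-hand side lists what can happen at the vertex between two links: it is covered
    -- within the second link, within the first, it is a fixed point of weight `D`, or the
    -- permutation passes through it in one of two directions.
    link-merge : ∀ {k A₁ B₁ C₁ E₁ A₂ B₂ C₂ E₂ A B C E D x y} →
      (A₁ ℤ.* B₂ ℤ.+ B₁ ℤ.* A₂) ℤ.+ D ℤ.* (A₁ ℤ.* A₂) ≡ k ℤ.* A →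
      (B₁ ℤ.* B₂ ℤ.+ C₁ ℤ.* A₂) ℤ.+ D ℤ.* (B₁ ℤ.* A₂) ≡ k ℤ.* B →
      (A₁ ℤ.* C₂ ℤ.+ B₁ ℤ.* B₂) ℤ.+ D ℤ.* (A₁ ℤ.* B₂) ≡ k ℤ.* B →
      (B₁ ℤ.* C₂ ℤ.+ C₁ ℤ.* B₂) ℤ.+ D ℤ.* (B₁ ℤ.* B₂) ≡ k ℤ.* C →
      E₁ ℤ.* E₂ ≡ k ℤ.* E →
      let a₁ = con A₁ ⊕ con B₁ ⊗ p x ; d₁ = con B₁ ⊕ con C₁ ⊗ p x
          a₂ = con A₂ ⊕ con B₂ ⊗ p y ; d₂ = con B₂ ⊕ con C₂ ⊗ p y in
      a₁ ⊗ d₂ ⊕ (d₁ ⊕ con D ⊗ a₁) ⊗ a₂ ⊕ (con E₁ ⊗ c x) ⊗ (con E₂ ⊗ r y) ⊕ (con E₁ ⊗ r x) ⊗ (con E₂ ⊗ c y)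
        ≈ᴱ con k ⊗ link A B C E x y
    link-merge {k} {A₁} {B₁} {C₁} {E₁} {A₂} {B₂} {C₂} {E₂} {A} {B} {C} {E} {D} {x} {y} eqA eqB eqB′ eqC eqE = begin
      _ ≈⟨ ES.+-cong (ES.+-congʳ (Sol.solve 9 (λ A₁ B₁ C₁ A₂ B₂ C₂ D px py →
             (A₁ :+ B₁ :* px) :* (B₂ :+ C₂ :* py) :+ (B₁ :+ C₁ :* px :+ D :* (A₁ :+ B₁ :* px)) :* (A₂ :+ B₂ :* py)
             := (A₁ :* B₂ :+ B₁ :* A₂ :+ D :* (A₁ :* A₂)) :+ (B₁ :* B₂ :+ C₁ :* A₂ :+ D :* (B₁ :* A₂)) :* px
                :+ (A₁ :* C₂ :+ B₁ :* B₂ :+ D :* (A₁ :* B₂)) :* py :+ (B₁ :* C₂ :+ C₁ :* B₂ :+ D :* (B₁ :* B₂)) :* (px :* py))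
             ES.refl (con A₁) (con B₁) (con C₁) (con A₂) (con B₂) (con C₂) (con D) (p x) (p y)))
             ES.refl ⟩
      _ ≈⟨ ES.+-cong (ES.+-congʳ (ES.+-cong (ES.+-cong (ES.+-cong (coef eqA) (ES.*-congʳ (coef eqB))) (ES.*-congʳ (coef eqB′))) (ES.*-congʳ (coef
        eqC)))) ES.refl ⟩
      con k ⊗ con A ⊕ con k ⊗ con B ⊗ p x ⊕ con k ⊗ con B ⊗ p y ⊕ con k ⊗ con C ⊗ (p x ⊗ p y)
        ⊕ (con E₁ ⊗ c x) ⊗ (con E₂ ⊗ r y) ⊕ (con E₁ ⊗ r x) ⊗ (con E₂ ⊗ c y)
        ≈⟨ Sol.solve 12 (λ k A B C E₁ E₂ px py rx cx ry cy →
             k :* A :+ k :* B :* px :+ k :* B :* py :+ k :* C :* (px :* py) :+ (E₁ :* cx) :* (E₂ :* ry) :+ (E₁ :* rx) :* (E₂ :* cy)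
             := k :* (A :+ B :* (px :+ py) :+ C :* (px :* py)) :+ E₁ :* E₂ :* (rx :* cy :+ ry :* cx))
             ES.refl (con k) (con A) (con B) (con C) (con E₁) (con E₂) (p x) (p y) (r x) (c x) (r y) (c y) ⟩
      con k ⊗ (con A ⊕ con B ⊗ (p x ⊕ p y) ⊕ con C ⊗ (p x ⊗ p y)) ⊕ con E₁ ⊗ con E₂ ⊗ (r x ⊗ c y ⊕ r y ⊗ c x)
        ≈⟨ ES.+-congˡ (ES.trans (ES.*-congʳ (ES.trans (ES.sym (con-* E₁ E₂)) (ES.trans (ES.reflexive (cong con eqE)) (con-* k E)))) (ES.*-assoc _ _ _)) ⟩
      con k ⊗ (con A ⊕ con B ⊗ (p x ⊕ p y) ⊕ con C ⊗ (p x ⊗ p y)) ⊕ con k ⊗ (con E ⊗ (r x ⊗ c y ⊕ r y ⊗ c x))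
        ≈⟨ ES.distribˡ (con k) _ _ ⟨
      con k ⊗ link A B C E x y ∎
      where
      open ER
      open Sol using (_:*_; _:+_; _:=_)
      coef : ∀ {a b c′ d e f z} → (a ℤ.* b ℤ.+ c′ ℤ.* d) ℤ.+ D ℤ.* (e ℤ.* f) ≡ k ℤ.* z →
        con a ⊗ con b ⊕ con c′ ⊗ con d ⊕ con D ⊗ (con e ⊗ con f) ≈ᴱ con {n ℕ.+ n} k ⊗ con z
      coef {a} {b} {c′} {d} {e} {f} {z} eq =
        ES.trans (ES.sym (con-mul-add₃ a b c′ d D e f)) (ES.trans (ES.reflexive (cong con eq)) (con-* k z))

    -- For the weight `1ℤ - s * s` the recurrence along a path has the roots 1 and `- (s * s)`.
    -- Segments are therefore closed under composition: the signed powers and the powers of `s`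
    -- multiply, and one factor `1ℤ + s * s` splits off.
    top-merge : ∀ s ℓ₁ ℓ₂ {D : Fin n → ℤ} {x w y G} → D w ≡ 1ℤ ℤ.- s ℤ.* s → w ≢ x → w ≢ y → Avoids w G →
      top (vertexFactor D w ⊗ segment s ℓ₁ x w ⊗ segment s ℓ₂ w y ⊗ G) ≡
      (1ℤ ℤ.+ s ℤ.* s) ℤ.* top (p w ⊗ segment s (ℓ₁ ℕ.+ ℓ₂) x y ⊗ G)
    top-merge s ℓ₁ ℓ₂ {D} {x} {w} {y} {G} Dw w≢x w≢y fG = begin
      top (vertexFactor D w ⊗ segment s ℓ₁ x w ⊗ segment s ℓ₂ w y ⊗ G)
        ≡⟨ top-cong (ES.*-congʳ (ES.trans (ES.*-cong
             (ES.trans (ES.*-cong (vertex-dual D w) (link-dual A₁ B₁ C₁ E₁ x w)) (dual-* (gen² (w ↑ˡ n)) (gen² (n ↑ʳ w)) 1ᴱ (con 0ℤ) (con 0ℤ) (con (D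
               w)) a₁ b₁ b₁′ d₁))
             (ES.trans (link-sym A₂ B₂ C₂ E₂ w y) (link-dual A₂ B₂ C₂ E₂ y w)))
           (dual-* (gen² (w ↑ˡ n)) (gen² (n ↑ʳ w)) _ _ _ _ a₂ b₂ b₂′ d₂))) ⟩
      top (dualFactor w (a ⊗ a₂) (a ⊗ b₂ ⊕ b ⊗ a₂) (a ⊗ b₂′ ⊕ b′ ⊗ a₂) (a ⊗ d₂ ⊕ d ⊗ a₂ ⊕ b ⊗ b₂′ ⊕ b′ ⊗ b₂) ⊗ G)
        ≡⟨ top-dual w (fa ⊗ᵃ fa₂) (fa ⊗ᵃ (conᵃ _ ⊗ᵃ cᵃ w≢y) ⊕ᵃ fb ⊗ᵃ fa₂) (fa ⊗ᵃ (conᵃ _ ⊗ᵃ rᵃ w≢y) ⊕ᵃ fb′ ⊗ᵃ fa₂) fG ⟩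
      top (p w ⊗ (a ⊗ d₂ ⊕ d ⊗ a₂ ⊕ b ⊗ b₂′ ⊕ b′ ⊗ b₂) ⊗ G)
        ≡⟨ top-cong (ES.*-congʳ (ES.*-congˡ (ES.+-cong (ES.+-cong (ES.+-cong (ES.*-congʳ (ES.*-identityˡ a₁))
              (ES.*-congʳ (ES.trans (drop0 (1ᴱ ⊗ d₁ ⊕ con (D w) ⊗ a₁) b₁′ b₁) (ES.+-congʳ (ES.*-identityˡ d₁)))))
              (ES.*-congʳ (unit b₁ a₁))) (ES.*-congʳ (unit b₁′ a₁))))) ⟩
      top (p w ⊗ (a₁ ⊗ d₂ ⊕ (d₁ ⊕ con (D w) ⊗ a₁) ⊗ a₂ ⊕ b₁ ⊗ b₂′ ⊕ b₁′ ⊗ b₂) ⊗ G)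
        ≡⟨ top-cong (ES.*-congʳ (ES.*-congˡ (link-merge {1ℤ ℤ.+ s ℤ.* s} {A₁} {B₁} {C₁} {E₁} {A₂} {B₂} {C₂} {E₂}
             {1ℤ ℤ.- α} {s ℤ.* s ℤ.+ α} {s ℤ.* s ℤ.* (s ℤ.* s) ℤ.- α} {(1ℤ ℤ.+ s ℤ.* s) ℤ.* s ℤ.^ (ℓ₁ ℕ.+ ℓ₂)} {D w} {x} {y} eqA eqB eqB′ eqC eqE))) ⟩
      top (p w ⊗ (con (1ℤ ℤ.+ s ℤ.* s) ⊗ segment s (ℓ₁ ℕ.+ ℓ₂) x y) ⊗ G)
        ≡⟨ top-cong (Sol.solve 4 (λ p k t g → p :* (k :* t) :* g := k :* (p :* t :* g)) ES.refl (p w) (con (1ℤ ℤ.+ s ℤ.* s)) (segment s (ℓ₁ ℕ.+ ℓ₂) x y) G) ⟩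
      top (con (1ℤ ℤ.+ s ℤ.* s) ⊗ (p w ⊗ segment s (ℓ₁ ℕ.+ ℓ₂) x y ⊗ G))
        ≡⟨ top-con _ _ ⟩
      (1ℤ ℤ.+ s ℤ.* s) ℤ.* top (p w ⊗ segment s (ℓ₁ ℕ.+ ℓ₂) x y ⊗ G) ∎
      where
      open ≡-Reasoning
      open Sol using (_:*_; _:+_; _:=_)
      α₁ = (ℤ.- (s ℤ.* s)) ℤ.^ ℓ₁
      α₂ = (ℤ.- (s ℤ.* s)) ℤ.^ ℓ₂
      α  = (ℤ.- (s ℤ.* s)) ℤ.^ (ℓ₁ ℕ.+ ℓ₂)
      A₁ = 1ℤ ℤ.- α₁
      A₂ = 1ℤ ℤ.- α₂
      B₁ = s ℤ.* s ℤ.+ α₁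
      B₂ = s ℤ.* s ℤ.+ α₂
      C₁ = s ℤ.* s ℤ.* (s ℤ.* s) ℤ.- α₁
      C₂ = s ℤ.* s ℤ.* (s ℤ.* s) ℤ.- α₂
      E₁ = (1ℤ ℤ.+ s ℤ.* s) ℤ.* s ℤ.^ ℓ₁
      E₂ = (1ℤ ℤ.+ s ℤ.* s) ℤ.* s ℤ.^ ℓ₂
      a₁ = con A₁ ⊕ con B₁ ⊗ p x
      b₁ = con E₁ ⊗ c x
      b₁′ = con E₁ ⊗ r x
      d₁ = con B₁ ⊕ con C₁ ⊗ p x
      a₂ = con A₂ ⊕ con B₂ ⊗ p y
      b₂ = con E₂ ⊗ c y
      b₂′ = con E₂ ⊗ r y
      d₂ = con B₂ ⊕ con C₂ ⊗ p y
      a = 1ᴱ ⊗ a₁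
      b = 1ᴱ ⊗ b₁ ⊕ con 0ℤ ⊗ a₁
      b′ = 1ᴱ ⊗ b₁′ ⊕ con 0ℤ ⊗ a₁
      d = 1ᴱ ⊗ d₁ ⊕ con (D w) ⊗ a₁ ⊕ con 0ℤ ⊗ b₁′ ⊕ con 0ℤ ⊗ b₁
      cᵃ : ∀ {x} → w ≢ x → Avoids w (c x)
      cᵃ w≢x = gen r≢c , gen (c≢c w≢x)
      rᵃ : ∀ {x} → w ≢ x → Avoids w (r x)
      rᵃ w≢x = gen (r≢r w≢x) , gen (r≢c ∘ sym)
      fa₁ = conᵃ A₁ ⊕ᵃ conᵃ B₁ ⊗ᵃ avoids-p w≢x
      fa = conᵃ 1ℤ ⊗ᵃ fa₁
      fb = conᵃ 1ℤ ⊗ᵃ (conᵃ E₁ ⊗ᵃ cᵃ w≢x) ⊕ᵃ conᵃ 0ℤ ⊗ᵃ fa₁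
      fb′ = conᵃ 1ℤ ⊗ᵃ (conᵃ E₁ ⊗ᵃ rᵃ w≢x) ⊕ᵃ conᵃ 0ℤ ⊗ᵃ fa₁
      fa₂ = conᵃ A₂ ⊕ᵃ conᵃ B₂ ⊗ᵃ avoids-p w≢y
      unit : ∀ e f → 1ᴱ ⊗ e ⊕ con 0ℤ ⊗ f ≈ᴱ e
      unit e f = ES.trans (ES.+-cong (ES.*-identityˡ e) (ES.zeroˡ f)) (ES.+-identityʳ e)
      drop0 : ∀ e f g → e ⊕ con 0ℤ ⊗ f ⊕ con 0ℤ ⊗ g ≈ᴱ e
      drop0 e f g = ES.trans (ES.+-cong (ES.trans (ES.+-congˡ (ES.zeroˡ f)) (ES.+-identityʳ e)) (ES.zeroˡ g)) (ES.+-identityʳ e)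
      α-+ : α ≡ α₁ ℤ.* α₂
      α-+ = ℤ.^-distribˡ-+-* (ℤ.- (s ℤ.* s)) ℓ₁ ℓ₂
      idA : ∀ s a b → ((1ℤ ℤ.- a) ℤ.* (s ℤ.* s ℤ.+ b) ℤ.+ (s ℤ.* s ℤ.+ a) ℤ.* (1ℤ ℤ.- b)) ℤ.+ (1ℤ ℤ.- s ℤ.* s) ℤ.* ((1ℤ ℤ.- a) ℤ.* (1ℤ ℤ.- b))
        ≡ (1ℤ ℤ.+ s ℤ.* s) ℤ.* (1ℤ ℤ.- a ℤ.* b)
      idA = solve-∀
      idB : ∀ s a b → ((s ℤ.* s ℤ.+ a) ℤ.* (s ℤ.* s ℤ.+ b) ℤ.+ (s ℤ.* s ℤ.* (s ℤ.* s) ℤ.- a) ℤ.* (1ℤ ℤ.- b)) ℤ.+ (1ℤ ℤ.- s ℤ.* s) ℤ.* ((s ℤ.* s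
        ℤ.+ a) ℤ.* (1ℤ ℤ.- b)) ≡ (1ℤ ℤ.+ s ℤ.* s) ℤ.* (s ℤ.* s ℤ.+ a ℤ.* b)
      idB = solve-∀
      idB′ : ∀ s a b → ((1ℤ ℤ.- a) ℤ.* (s ℤ.* s ℤ.* (s ℤ.* s) ℤ.- b) ℤ.+ (s ℤ.* s ℤ.+ a) ℤ.* (s ℤ.* s ℤ.+ b)) ℤ.+ (1ℤ ℤ.- s ℤ.* s) ℤ.* ((1ℤ
        ℤ.- a) ℤ.* (s ℤ.* s ℤ.+ b)) ≡ (1ℤ ℤ.+ s ℤ.* s) ℤ.* (s ℤ.* s ℤ.+ a ℤ.* b)
      idB′ = solve-∀
      idC : ∀ s a b → ((s ℤ.* s ℤ.+ a) ℤ.* (s ℤ.* s ℤ.* (s ℤ.* s) ℤ.- b) ℤ.+ (s ℤ.* s ℤ.* (s ℤ.* s) ℤ.- a) ℤ.* (s ℤ.* s ℤ.+ b)) ℤ.+ (1ℤ ℤ.- s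
        ℤ.* s) ℤ.* ((s ℤ.* s ℤ.+ a) ℤ.* (s ℤ.* s ℤ.+ b)) ≡ (1ℤ ℤ.+ s ℤ.* s) ℤ.* (s ℤ.* s ℤ.* (s ℤ.* s) ℤ.- a ℤ.* b)
      idC = solve-∀
      idE : ∀ k a b → (k ℤ.* a) ℤ.* (k ℤ.* b) ≡ k ℤ.* (k ℤ.* (a ℤ.* b))
      idE = solve-∀
      eqA : (A₁ ℤ.* B₂ ℤ.+ B₁ ℤ.* A₂) ℤ.+ D w ℤ.* (A₁ ℤ.* A₂) ≡ (1ℤ ℤ.+ s ℤ.* s) ℤ.* (1ℤ ℤ.- α)
      eqA rewrite Dw | α-+ = idA s α₁ α₂
      eqB : (B₁ ℤ.* B₂ ℤ.+ C₁ ℤ.* A₂) ℤ.+ D w ℤ.* (B₁ ℤ.* A₂) ≡ (1ℤ ℤ.+ s ℤ.* s) ℤ.* (s ℤ.* s ℤ.+ α)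
      eqB rewrite Dw | α-+ = idB s α₁ α₂
      eqB′ : (A₁ ℤ.* C₂ ℤ.+ B₁ ℤ.* B₂) ℤ.+ D w ℤ.* (A₁ ℤ.* B₂) ≡ (1ℤ ℤ.+ s ℤ.* s) ℤ.* (s ℤ.* s ℤ.+ α)
      eqB′ rewrite Dw | α-+ = idB′ s α₁ α₂
      eqC : (B₁ ℤ.* C₂ ℤ.+ C₁ ℤ.* B₂) ℤ.+ D w ℤ.* (B₁ ℤ.* B₂) ≡ (1ℤ ℤ.+ s ℤ.* s) ℤ.* (s ℤ.* s ℤ.* (s ℤ.* s) ℤ.- α)
      eqC rewrite Dw | α-+ = idC s α₁ α₂
      eqE : E₁ ℤ.* E₂ ≡ (1ℤ ℤ.+ s ℤ.* s) ℤ.* ((1ℤ ℤ.+ s ℤ.* s) ℤ.* s ℤ.^ (ℓ₁ ℕ.+ ℓ₂))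
      eqE rewrite ℤ.^-distribˡ-+-* s ℓ₁ ℓ₂ = idE (1ℤ ℤ.+ s ℤ.* s) (s ℤ.^ ℓ₁) (s ℤ.^ ℓ₂)

-- Closed cycles, and the algebra at the two vertices of degree 3.

module LoopsAndTerminals where

  open Permanent
  open NilpotentAlgebra
  open ArcProducts
  open Merging

  -- The first two terms are the trace of the ℓ-th power of a transfer matrix with eigenvalues 1 and
  -- `- (s * s)`; the last counts the two rotations around the cycle.
  cycleValue : ℤ → ℕ → ℤ
  cycleValue s ℓ = 1ℤ ℤ.+ (ℤ.- (s ℤ.* s)) ℤ.^ ℓ ℤ.+ + 2 ℤ.* s ℤ.^ ℓ

  opaque
    cyclesValue : ℤ → List ℕ → ℤ
    cyclesValue s = foldr (λ k t → cycleValue s k ℤ.* t) 1ℤ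

    cyclesValue-[] : ∀ s → cyclesValue s [] ≡ 1ℤ
    cyclesValue-[] s = refl

    cyclesValue-∷ : ∀ s k ks → cyclesValue s (k ∷ ks) ≡ cycleValue s k ℤ.* cyclesValue s ks
    cyclesValue-∷ s k ks = refl

  module Forms (R : CommutativeSemiring 0ℓ 0ℓ) where
    open CommutativeSemiring R renaming (Carrier to C; refl to ≈-refl; trans to ≈-trans)
    open import Relation.Binary.Reasoning.Setoid setoid
    open SemiringSolver R using (solve; _:+_; _:*_; _:=_)

    -- The five elements span a subring: the square of `ρ * γ′ + ρ′ * γ` is twice the product of all
    -- four variables, and its products with `ρ * γ` and `ρ′ * γ′` contain squares.
    form-expand : ∀ {ρ γ ρ′ γ′} → ρ * ρ ≈ 0# → γ * γ ≈ 0# → ρ′ * ρ′ ≈ 0# → γ′ * γ′ ≈ 0# →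
      ∀ A₁ P₁ Q₁ C₁ E₁ A₂ P₂ Q₂ C₂ E₂ →
      (A₁ + P₁ * (ρ * γ) + Q₁ * (ρ′ * γ′) + C₁ * ((ρ * γ) * (ρ′ * γ′)) + E₁ * (ρ * γ′ + ρ′ * γ)) *
      (A₂ + P₂ * (ρ * γ) + Q₂ * (ρ′ * γ′) + C₂ * ((ρ * γ) * (ρ′ * γ′)) + E₂ * (ρ * γ′ + ρ′ * γ)) ≈
      A₁ * A₂ + (A₁ * P₂ + P₁ * A₂) * (ρ * γ) + (A₁ * Q₂ + Q₁ * A₂) * (ρ′ * γ′)
        + (A₁ * C₂ + C₁ * A₂ + (P₁ * Q₂ + Q₁ * P₂) + (E₁ * E₂ + E₁ * E₂)) * ((ρ * γ) * (ρ′ * γ′))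
        + (A₁ * E₂ + E₁ * A₂) * (ρ * γ′ + ρ′ * γ)
    form-expand {ρ} {γ} {ρ′} {γ′} ρ² γ² ρ′² γ′² A₁ P₁ Q₁ C₁ E₁ A₂ P₂ Q₂ C₂ E₂ = begin
      _ ≈⟨ solve 14 (λ ρ γ ρ′ γ′ A₁ P₁ Q₁ C₁ E₁ A₂ P₂ Q₂ C₂ E₂ →
        (A₁ :+ P₁ :* (ρ :* γ) :+ Q₁ :* (ρ′ :* γ′) :+ C₁ :* ((ρ :* γ) :* (ρ′ :* γ′)) :+ E₁ :* (ρ :* γ′ :+ ρ′ :* γ)) :*
        (A₂ :+ P₂ :* (ρ :* γ) :+ Q₂ :* (ρ′ :* γ′) :+ C₂ :* ((ρ :* γ) :* (ρ′ :* γ′)) :+ E₂ :* (ρ :* γ′ :+ ρ′ :* γ)) :=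
        (A₁ :* A₂ :+ (A₁ :* P₂ :+ P₁ :* A₂) :* (ρ :* γ) :+ (A₁ :* Q₂ :+ Q₁ :* A₂) :* (ρ′ :* γ′)
        :+ (A₁ :* C₂ :+ C₁ :* A₂ :+ (P₁ :* Q₂ :+ Q₁ :* P₂) :+ (E₁ :* E₂ :+ E₁ :* E₂)) :* ((ρ :* γ) :* (ρ′ :* γ′))
        :+ (A₁ :* E₂ :+ E₁ :* A₂) :* (ρ :* γ′ :+ ρ′ :* γ))
        :+ ((ρ :* ρ) :* (P₁ :* P₂ :* (γ :* γ) :+ (P₁ :* C₂ :+ C₁ :* P₂) :* (γ :* γ :* (ρ′ :* γ′))
                :+ C₁ :* C₂ :* (γ :* γ :* ((ρ′ :* γ′) :* (ρ′ :* γ′)))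
                :+ (P₁ :* E₂ :+ E₁ :* P₂) :* (γ :* γ′) :+ (C₁ :* E₂ :+ E₁ :* C₂) :* (γ :* (ρ′ :* γ′) :* γ′)
                :+ E₁ :* E₂ :* (γ′ :* γ′))
          :+ (γ :* γ) :* ((P₁ :* E₂ :+ E₁ :* P₂) :* (ρ :* ρ′)))
        :+ ((ρ′ :* ρ′) :* (Q₁ :* Q₂ :* (γ′ :* γ′) :+ (Q₁ :* C₂ :+ C₁ :* Q₂) :* (γ′ :* γ′ :* (ρ :* γ))
                :+ (Q₁ :* E₂ :+ E₁ :* Q₂) :* (γ′ :* γ) :+ (C₁ :* E₂ :+ E₁ :* C₂) :* (γ′ :* (ρ :* γ) :* γ)
                :+ E₁ :* E₂ :* (γ :* γ))
          :+ (γ′ :* γ′) :* ((Q₁ :* E₂ :+ E₁ :* Q₂) :* (ρ′ :* ρ))))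
        ≈-refl ρ γ ρ′ γ′ A₁ P₁ Q₁ C₁ E₁ A₂ P₂ Q₂ C₂ E₂ ⟩
      _ ≈⟨ +-cong (+-congˡ (nil ρ² γ²)) (nil ρ′² γ′²) ⟩
      _ + 0# + 0# ≈⟨ ≈-trans (+-identityʳ _) (+-identityʳ _) ⟩
      _ ∎
      where
      nil : ∀ {x y} → x ≈ 0# → y ≈ 0# → ∀ {a b} → x * a + y * b ≈ 0#
      nil x≈0 y≈0 = ≈-trans (+-cong (≈-trans (*-congʳ x≈0) (zeroˡ _)) (≈-trans (*-congʳ y≈0) (zeroˡ _))) (+-identityˡ 0#)

  module _ {N : ℕ} where
    open Forms (exprSemiring N) public

  -- Coordinates in the subring of `form-expand`; products of core factors thereby become integer
  -- arithmetic.
  record Form : Set where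
    constructor form
    field A P Q C E : ℤ

  _·_ : Form → Form → Form
  form A₁ P₁ Q₁ C₁ E₁ · form A₂ P₂ Q₂ C₂ E₂ = form
    (A₁ ℤ.* A₂) (A₁ ℤ.* P₂ ℤ.+ P₁ ℤ.* A₂) (A₁ ℤ.* Q₂ ℤ.+ Q₁ ℤ.* A₂)
    (A₁ ℤ.* C₂ ℤ.+ C₁ ℤ.* A₂ ℤ.+ (P₁ ℤ.* Q₂ ℤ.+ Q₁ ℤ.* P₂) ℤ.+ (E₁ ℤ.* E₂ ℤ.+ E₁ ℤ.* E₂))
    (A₁ ℤ.* E₂ ℤ.+ E₁ ℤ.* A₂)

  module _ {n : ℕ} where

    private
      K = n ℕ.+ n
      open module Sl = Sol {K} using (_:*_; _:+_; _:=_) renaming (con to con′)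

    -- When the ends coincide, the term covering both ends contains a square, and the remaining
    -- terms merge in pairs, whence the doubling.
    link-loop : ∀ A B C E w → link A B C E w w ≈ᴱ con {K} A ⊕ con (B ℤ.+ B ℤ.+ (E ℤ.+ E)) ⊗ p w
    link-loop A B C E w = begin
      link A B C E w w
        ≈⟨ Sol.solve 6 (λ A B C E r c → A :+ B :* (r :* c :+ r :* c) :+ C :* ((r :* c) :* (r :* c)) :+ E :* (r :* c :+ r :* c)
            := A :+ (B :+ B :+ (E :+ E)) :* (r :* c) :+ (r :* r) :* (C :* (c :* c))) ES.refl (con A) (con B) (con C) (con E) (r w) (c w) ⟩
      con A ⊕ (con B ⊕ con B ⊕ (con E ⊕ con E)) ⊗ p w ⊕ (r w ⊗ r w) ⊗ (con C ⊗ (c w ⊗ c w))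
        ≈⟨ ES.+-cong (ES.+-congˡ (ES.*-congʳ (ES.sym (ES.trans (con-+ _ _) (ES.+-cong (con-+ B B) (con-+ E E))))))
             (ES.trans (ES.*-congʳ (gen² (w ↑ˡ n))) (ES.zeroˡ _)) ⟩
      con A ⊕ con (B ℤ.+ B ℤ.+ (E ℤ.+ E)) ⊗ p w ⊕ con 0ℤ
        ≈⟨ ES.+-identityʳ _ ⟩
      con A ⊕ con (B ℤ.+ B ℤ.+ (E ℤ.+ E)) ⊗ p w ∎
      where open ER

    top-loop : ∀ s ℓ {D : Fin n → ℤ} {w G} → D w ≡ 1ℤ ℤ.- s ℤ.* s → Avoids w G →
      top (vertexFactor D w ⊗ segment s ℓ w w ⊗ G) ≡ ((1ℤ ℤ.+ s ℤ.* s) ℤ.* cycleValue s ℓ) ℤ.* top (p w ⊗ G)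
    top-loop s ℓ {D} {w} {G} Dw fG = begin
      top (vertexFactor D w ⊗ segment s ℓ w w ⊗ G)
        ≡⟨ top-cong (ES.*-congʳ (ES.*-congˡ (link-loop A B C E w))) ⟩
      top (vertexFactor D w ⊗ (con A ⊕ con M ⊗ p w) ⊗ G)
        ≡⟨ top-cong (Sol.solve 6 (λ d a m r c g → (con′ 1 :+ d :* (r :* c)) :* (a :+ m :* (r :* c)) :* g
             := a :* g :+ ((m :+ d :* a) :* ((r :* c) :* g) :+ (r :* r) :* (d :* m :* (c :* c) :* g)))
             ES.refl (con (D w)) (con A) (con M) (r w) (c w) G) ⟩
      top (con A ⊗ G ⊕ ((con M ⊕ con (D w) ⊗ con A) ⊗ (p w ⊗ G) ⊕ (r w ⊗ r w) ⊗ (con (D w) ⊗ con M ⊗ (c w ⊗ c w) ⊗ G)))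
        ≡⟨ top-⊕-free ES.refl (con A ⊗ proj₁ fG) ⟩
      top ((con M ⊕ con (D w) ⊗ con A) ⊗ (p w ⊗ G) ⊕ (r w ⊗ r w) ⊗ (con (D w) ⊗ con M ⊗ (c w ⊗ c w) ⊗ G))
        ≡⟨ top-cong (ES.trans (ES.+-congˡ (ES.trans (ES.*-congʳ (gen² (w ↑ˡ n))) (ES.zeroˡ _))) (ES.+-identityʳ _)) ⟩
      top ((con M ⊕ con (D w) ⊗ con A) ⊗ (p w ⊗ G))
        ≡⟨ top-cong (ES.*-congʳ (ES.sym (ES.trans (con-+ M (D w ℤ.* A)) (ES.+-congˡ (con-* (D w) A))))) ⟩
      top (con (M ℤ.+ D w ℤ.* A) ⊗ (p w ⊗ G))
        ≡⟨ top-con _ _ ⟩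
      (M ℤ.+ D w ℤ.* A) ℤ.* top (p w ⊗ G)
        ≡⟨ cong (ℤ._* top (p w ⊗ G)) (trans (cong (λ d → M ℤ.+ d ℤ.* A) Dw) (ident s α (s ℤ.^ ℓ))) ⟩
      ((1ℤ ℤ.+ s ℤ.* s) ℤ.* cycleValue s ℓ) ℤ.* top (p w ⊗ G) ∎
      where
      open ≡-Reasoning
      α = (ℤ.- (s ℤ.* s)) ℤ.^ ℓ
      A = 1ℤ ℤ.- α
      B = s ℤ.* s ℤ.+ α
      C = s ℤ.* s ℤ.* (s ℤ.* s) ℤ.- α
      E = (1ℤ ℤ.+ s ℤ.* s) ℤ.* s ℤ.^ ℓ
      M = B ℤ.+ B ℤ.+ (E ℤ.+ E)
      ident : ∀ s α ξ → ((s ℤ.* s ℤ.+ α) ℤ.+ (s ℤ.* s ℤ.+ α) ℤ.+ ((1ℤ ℤ.+ s ℤ.* s) ℤ.* ξ ℤ.+ (1ℤ ℤ.+ s ℤ.* s) ℤ.* ξ)) ℤ.+ (1ℤ ℤ.- s ℤ.* s) ℤ.* (1ℤ ℤ.- α)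
        ≡ (1ℤ ℤ.+ s ℤ.* s) ℤ.* (1ℤ ℤ.+ α ℤ.+ + 2 ℤ.* ξ)
      ident = solve-∀

    module Terminals (u v : Fin n) where

      ⟪_⟫ : Form → Expr K
      ⟪ form A P Q C E ⟫ = con A ⊕ con P ⊗ p u ⊕ con Q ⊗ p v ⊕ con C ⊗ (p u ⊗ p v) ⊕ con E ⊗ (r u ⊗ c v ⊕ r v ⊗ c u)

      ⟪·⟫ : ∀ F G → ⟪ F · G ⟫ ≈ᴱ ⟪ F ⟫ ⊗ ⟪ G ⟫
      ⟪·⟫ (form A₁ P₁ Q₁ C₁ E₁) (form A₂ P₂ Q₂ C₂ E₂) = ES.sym (ES.trans
        (form-expand (gen² (u ↑ˡ n)) (gen² (n ↑ʳ u)) (gen² (v ↑ˡ n)) (gen² (n ↑ʳ v))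
          (con A₁) (con P₁) (con Q₁) (con C₁) (con E₁) (con A₂) (con P₂) (con Q₂) (con C₂) (con E₂))
        (ES.+-cong (ES.+-cong (ES.+-cong (ES.+-cong (ES.sym (con-* A₁ A₂)) (ES.*-congʳ (ES.sym (con-mul-add {n} A₁ P₂ P₁ A₂))))
          (ES.*-congʳ (ES.sym (con-mul-add {n} A₁ Q₂ Q₁ A₂))))
          (ES.*-congʳ (ES.sym (ES.trans (con-+ _ _) (ES.+-cong (ES.trans (con-+ _ _)
            (ES.+-cong (con-mul-add {n} A₁ C₂ C₁ A₂) (con-mul-add {n} P₁ Q₂ Q₁ P₂))) (con-mul-add {n} E₁ E₂ E₁ E₂))))))
          (ES.*-congʳ (ES.sym (con-mul-add {n} A₁ E₂ E₁ A₂)))))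

      vertexᵘ vertexᵛ : ℤ → Form
      vertexᵘ d = form 1ℤ d 0ℤ 0ℤ 0ℤ
      vertexᵛ d = form 1ℤ 0ℤ d 0ℤ 0ℤ

      ⟪vertexᵘ⟫ : ∀ D → vertexFactor D u ≈ᴱ ⟪ vertexᵘ (D u) ⟫
      ⟪vertexᵘ⟫ D = Sol.solve 5 (λ d pu pv q e → con′ 1 :+ d :* pu := con′ 1 :+ d :* pu :+ con′ 0 :* pv :+ con′ 0 :* q :+ con′ 0 :* e)
        ES.refl (con (D u)) (p u) (p v) (p u ⊗ p v) (r u ⊗ c v ⊕ r v ⊗ c u)

      ⟪vertexᵛ⟫ : ∀ D → vertexFactor D v ≈ᴱ ⟪ vertexᵛ (D v) ⟫
      ⟪vertexᵛ⟫ D = Sol.solve 5 (λ d pu pv q e → con′ 1 :+ d :* pv := con′ 1 :+ con′ 0 :* pu :+ d :* pv :+ con′ 0 :* q :+ con′ 0 :* e)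
        ES.refl (con (D v)) (p u) (p v) (p u ⊗ p v) (r u ⊗ c v ⊕ r v ⊗ c u)

      linkForm : (A B C E : ℤ) → Form
      linkForm A B C E = form A B B C E

      ⟪linkForm⟫ : ∀ A B C E → link A B C E u v ≈ᴱ ⟪ linkForm A B C E ⟫
      ⟪linkForm⟫ A B C E = ES.+-congʳ (ES.+-congʳ (ES.trans (ES.+-congˡ (ES.distribˡ _ _ _)) (ES.sym (ES.+-assoc _ _ _))))

      loopᵘ loopᵛ : (A B C E : ℤ) → Form
      loopᵘ A B C E = form A (B ℤ.+ B ℤ.+ (E ℤ.+ E)) 0ℤ 0ℤ 0ℤ
      loopᵛ A B C E = form A 0ℤ (B ℤ.+ B ℤ.+ (E ℤ.+ E)) 0ℤ 0ℤ

      ⟪loopᵘ⟫ : ∀ A B C E → link A B C E u u ≈ᴱ ⟪ loopᵘ A B C E ⟫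
      ⟪loopᵘ⟫ A B C E = ES.trans (link-loop A B C E u)
        (Sol.solve 6 (λ a d pu pv q e → a :+ d :* pu := a :+ d :* pu :+ con′ 0 :* pv :+ con′ 0 :* q :+ con′ 0 :* e)
        ES.refl (con A) (con (B ℤ.+ B ℤ.+ (E ℤ.+ E))) (p u) (p v) (p u ⊗ p v) (r u ⊗ c v ⊕ r v ⊗ c u))

      ⟪loopᵛ⟫ : ∀ A B C E → link A B C E v v ≈ᴱ ⟪ loopᵛ A B C E ⟫
      ⟪loopᵛ⟫ A B C E = ES.trans (link-loop A B C E v)
        (Sol.solve 6 (λ a d pu pv q e → a :+ d :* pv := a :+ con′ 0 :* pu :+ d :* pv :+ con′ 0 :* q :+ con′ 0 :* e)
        ES.refl (con A) (con (B ℤ.+ B ℤ.+ (E ℤ.+ E))) (p u) (p v) (p u ⊗ p v) (r u ⊗ c v ⊕ r v ⊗ c u))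

      -- Each term outside the `C` component lacks the row variable of `u` or that of `v`.
      top-form : u ≢ v → ∀ F {G} → Avoids u G → Avoids v G → top (⟪ F ⟫ ⊗ G) ≡ Form.C F ℤ.* top (p u ⊗ p v ⊗ G)
      top-form u≢v (form A P Q C E) {G} fu fv = begin
        top (⟪ form A P Q C E ⟫ ⊗ G)
          ≡⟨ top-cong (Sol.solve 10 (λ A P Q C E ru cu rv cv g →
               (A :+ P :* (ru :* cu) :+ Q :* (rv :* cv) :+ C :* ((ru :* cu) :* (rv :* cv)) :+ E :* (ru :* cv :+ rv :* cu)) :* g :=
               (A :+ P :* (ru :* cu)) :* g :+ (Q :* (rv :* cv) :* g :+ (E :* (rv :* cu) :* g :+ (E :* (ru :* cv) :* g :+ C :* ((ru :* cu) :* (rv :*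
                 cv) :* g)))))
               ES.refl (con A) (con P) (con Q) (con C) (con E) (r u) (c u) (r v) (c v) G) ⟩
        top ((con A ⊕ con P ⊗ p u) ⊗ G ⊕ (con Q ⊗ p v ⊗ G ⊕ (con E ⊗ (r v ⊗ c u) ⊗ G ⊕ (con E ⊗ (r u ⊗ c v) ⊗ G ⊕ con C ⊗ (p u ⊗ p v ⊗ G)))))
          ≡⟨ top-⊕-free ES.refl ((con A ⊕ con P ⊗ proj₁ (avoids-p {n} (u≢v ∘ sym))) ⊗ proj₁ fv) ⟩
        top (con Q ⊗ p v ⊗ G ⊕ (con E ⊗ (r v ⊗ c u) ⊗ G ⊕ (con E ⊗ (r u ⊗ c v) ⊗ G ⊕ con C ⊗ (p u ⊗ p v ⊗ G))))
          ≡⟨ top-⊕-free ES.refl (con Q ⊗ proj₁ (avoids-p {n} u≢v) ⊗ proj₁ fu) ⟩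
        top (con E ⊗ (r v ⊗ c u) ⊗ G ⊕ (con E ⊗ (r u ⊗ c v) ⊗ G ⊕ con C ⊗ (p u ⊗ p v ⊗ G)))
          ≡⟨ top-⊕-free ES.refl (con E ⊗ (gen (r≢r {n} u≢v) ⊗ gen (r≢c {n})) ⊗ proj₁ fu) ⟩
        top (con E ⊗ (r u ⊗ c v) ⊗ G ⊕ con C ⊗ (p u ⊗ p v ⊗ G))
          ≡⟨ top-⊕-free ES.refl (con E ⊗ (gen (r≢r {n} (u≢v ∘ sym)) ⊗ gen (r≢c {n})) ⊗ proj₁ fv) ⟩
        top (con C ⊗ (p u ⊗ p v ⊗ G)) ≡⟨ top-con C _ ⟩
        C ℤ.* top (p u ⊗ p v ⊗ G) ∎
        where open ≡-Reasoning

-- The polynomials of the theta graph and of the dumbbell.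

module CorePolynomials where

  open import Data.Integer.Base using (_+_; _*_; _-_; -_; _^_)

  -- The Greek variables stand for the signed powers `(−s²)^ℓ` of the three path lengths, the Latin
  -- ones for `s^ℓ`. Leaving them independent makes the evaluation a polynomial identity.
  thetaPolynomial : (s α β γ x y z : ℤ) → ℤ
  thetaPolynomial s α β γ x y z =
    k * k + + 2 * (q * q) * (x * y + x * z + y * z)
    - (s + s * s) * (s + s * s) * (α + β + γ)
    + (1ℤ - s) * (1ℤ - s) * (α * β + α * γ + β * γ)
    - (+ 2 - s + s * s) * (+ 2 - s + s * s) * (α * β * γ)
    - + 2 * (q * q) * (x * y * γ + x * z * β + y * z * α)
    where
    q = 1ℤ + s * s
    k = 1ℤ + s + + 2 * (s * s)

  -- The connecting path lies on no cycle, so its power of `s` is absent. Its two characteristic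
  -- roots 1 and `α` each contribute a product of one factor per lobe.
  dumbbellPolynomial : (s α β γ y z : ℤ) → ℤ
  dumbbellPolynomial s α β γ y z = outer β y * outer γ z - α * (inside β y * inside γ z)
    where
    outer inside : ℤ → ℤ → ℤ
    outer  β y = 1ℤ + s + + 2 * (s * s) + (1ℤ - s) * β + + 2 * (1ℤ + s * s) * y
    inside β y = s + s * s + (+ 2 - s + s * s) * β + + 2 * (1ℤ + s * s) * y

  -- The left-hand side is the C-coefficient of the product of the forms of the two
  -- terminals and the three paths, multiplied out.
  theta-identity : ∀ s α β γ x y z → ((((((1ℤ) * (1ℤ))) * (1ℤ - α))) * (((1ℤ - β) * (s * s * (s * s) - γ) + (s * s * (s * s) - β) * (1ℤ - γ) + ((s
    * s + β) * (s * s + γ) + (s * s + β) * (s * s + γ)) + (((1ℤ + s * s) * y) * ((1ℤ + s * s) * z) + ((1ℤ + s * s) * y) * ((1ℤ + s * s) * z))))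
    + (((((1ℤ) * (1ℤ))) * (s * s * (s * s) - α) + (((1ℤ) * (0ℤ) + (0ℤ) * (1ℤ) + ((1ℤ + s - s * s) * (1ℤ + s - s * s) + (0ℤ) * (0ℤ)) + ((0ℤ) * (0ℤ)
    + (0ℤ) * (0ℤ)))) * (1ℤ - α) + ((((1ℤ) * (0ℤ) + (1ℤ + s - s * s) * (1ℤ))) * (s * s + α) + (((1ℤ) * (1ℤ + s - s * s) + (0ℤ) * (1ℤ))) * (s * s
    + α)) + ((((1ℤ) * (0ℤ) + (0ℤ) * (1ℤ))) * ((1ℤ + s * s) * x) + (((1ℤ) * (0ℤ) + (0ℤ) * (1ℤ))) * ((1ℤ + s * s) * x)))) * (((1ℤ - β) * (1ℤ - γ)))
    + ((((((1ℤ) * (1ℤ))) * (s * s + α) + (((1ℤ) * (0ℤ) + (1ℤ + s - s * s) * (1ℤ))) * (1ℤ - α))) * (((1ℤ - β) * (s * s + γ) + (s * s + β) * (1ℤ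
    - γ))) + (((((1ℤ) * (1ℤ))) * (s * s + α) + (((1ℤ) * (1ℤ + s - s * s) + (0ℤ) * (1ℤ))) * (1ℤ - α))) * (((1ℤ - β) * (s * s + γ) + (s * s + β)
    * (1ℤ - γ)))) + ((((((1ℤ) * (1ℤ))) * ((1ℤ + s * s) * x) + (((1ℤ) * (0ℤ) + (0ℤ) * (1ℤ))) * (1ℤ - α))) * (((1ℤ - β) * ((1ℤ + s * s) * z) + ((1ℤ
    + s * s) * y) * (1ℤ - γ))) + (((((1ℤ) * (1ℤ))) * ((1ℤ + s * s) * x) + (((1ℤ) * (0ℤ) + (0ℤ) * (1ℤ))) * (1ℤ - α))) * (((1ℤ - β) * ((1ℤ + s * s)
    * z) + ((1ℤ + s * s) * y) * (1ℤ - γ))))) ≡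
    (1ℤ + s + + 2 * (s * s)) * (1ℤ + s + + 2 * (s * s)) + + 2 * ((1ℤ + s * s) * (1ℤ + s * s)) * (x * y + x * z + y * z)
    - (s + s * s) * (s + s * s) * (α + β + γ)
    + (1ℤ - s) * (1ℤ - s) * (α * β + α * γ + β * γ)
    - (+ 2 - s + s * s) * (+ 2 - s + s * s) * (α * β * γ)
    - + 2 * ((1ℤ + s * s) * (1ℤ + s * s)) * (x * y * γ + x * z * β + y * z * α)
  theta-identity = solve-∀

  -- Again a product of forms multiplied out, now with one path and a loop at each terminal.
  dumbbell-identity : ∀ s α β γ x y z → ((((((1ℤ) * (1ℤ))) * (1ℤ - α))) * (((1ℤ - β) * (0ℤ) + (0ℤ) * (1ℤ - γ) + (((s * s + β) + (s * s + β) + (((1ℤ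
    + s * s) * y) + ((1ℤ + s * s) * y))) * ((s * s + γ) + (s * s + γ) + (((1ℤ + s * s) * z) + ((1ℤ + s * s) * z))) + (0ℤ) * (0ℤ)) + ((0ℤ) * (0ℤ)
    + (0ℤ) * (0ℤ)))) + (((((1ℤ) * (1ℤ))) * (s * s * (s * s) - α) + (((1ℤ) * (0ℤ) + (0ℤ) * (1ℤ) + ((1ℤ + s - s * s) * (1ℤ + s - s * s) + (0ℤ)
    * (0ℤ)) + ((0ℤ) * (0ℤ) + (0ℤ) * (0ℤ)))) * (1ℤ - α) + ((((1ℤ) * (0ℤ) + (1ℤ + s - s * s) * (1ℤ))) * (s * s + α) + (((1ℤ) * (1ℤ + s - s * s)
    + (0ℤ) * (1ℤ))) * (s * s + α)) + ((((1ℤ) * (0ℤ) + (0ℤ) * (1ℤ))) * ((1ℤ + s * s) * x) + (((1ℤ) * (0ℤ) + (0ℤ) * (1ℤ))) * ((1ℤ + s * s) * x))))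
    * (((1ℤ - β) * (1ℤ - γ))) + ((((((1ℤ) * (1ℤ))) * (s * s + α) + (((1ℤ) * (0ℤ) + (1ℤ + s - s * s) * (1ℤ))) * (1ℤ - α))) * (((1ℤ - β) * ((s * s
    + γ) + (s * s + γ) + (((1ℤ + s * s) * z) + ((1ℤ + s * s) * z))) + (0ℤ) * (1ℤ - γ))) + (((((1ℤ) * (1ℤ))) * (s * s + α) + (((1ℤ) * (1ℤ + s - s
    * s) + (0ℤ) * (1ℤ))) * (1ℤ - α))) * (((1ℤ - β) * (0ℤ) + ((s * s + β) + (s * s + β) + (((1ℤ + s * s) * y) + ((1ℤ + s * s) * y))) * (1ℤ - γ))))
    + ((((((1ℤ) * (1ℤ))) * ((1ℤ + s * s) * x) + (((1ℤ) * (0ℤ) + (0ℤ) * (1ℤ))) * (1ℤ - α))) * (((1ℤ - β) * (0ℤ) + (0ℤ) * (1ℤ - γ))) + (((((1ℤ)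
    * (1ℤ))) * ((1ℤ + s * s) * x) + (((1ℤ) * (0ℤ) + (0ℤ) * (1ℤ))) * (1ℤ - α))) * (((1ℤ - β) * (0ℤ) + (0ℤ) * (1ℤ - γ))))) ≡
    (1ℤ + s + + 2 * (s * s) + (1ℤ - s) * β + + 2 * (1ℤ + s * s) * y) * (1ℤ + s + + 2 * (s * s) + (1ℤ - s) * γ + + 2 * (1ℤ + s * s) * z) - α * ((s
      + s * s + (+ 2 - s + s * s) * β + + 2 * (1ℤ + s * s) * y) * (s + s * s + (+ 2 - s + s * s) * γ + + 2 * (1ℤ + s * s) * z))
  dumbbell-identity = solve-∀

module CoreValues where

  open Permanent
  open NilpotentAlgebra
  open ArcProducts
  open Merging
  open LoopsAndTerminals
  open CorePolynomials
  open import Data.Integer.Base using (_+_; _*_; _-_; -_; _^_)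

  opaque
    thetaValue : ℤ → ℕ → ℕ → ℕ → ℤ
    thetaValue s a b c = thetaPolynomial s ((- (s * s)) ^ a) ((- (s * s)) ^ b) ((- (s * s)) ^ c) (s ^ a) (s ^ b) (s ^ c)

    dumbbellValue : ℤ → ℕ → ℕ → ℕ → ℤ
    dumbbellValue s a b c = dumbbellPolynomial s ((- (s * s)) ^ a) ((- (s * s)) ^ b) ((- (s * s)) ^ c) (s ^ b) (s ^ c)

    thetaValue-def : ∀ s a b c → thetaValue s a b c ≡
      thetaPolynomial s ((- (s * s)) ^ a) ((- (s * s)) ^ b) ((- (s * s)) ^ c) (s ^ a) (s ^ b) (s ^ c)
    thetaValue-def s a b c = refl

    dumbbellValue-def : ∀ s a b c → dumbbellValue s a b c ≡
      dumbbellPolynomial s ((- (s * s)) ^ a) ((- (s * s)) ^ b) ((- (s * s)) ^ c) (s ^ b) (s ^ c)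
    dumbbellValue-def s a b c = refl

  Π-↭ : ∀ {N} {A : Set} (f : A → Expr N) {xs ys} → xs ↭ ys → Π f xs ≈ᴱ Π f ys
  Π-↭ f Perm.refl         = ES.refl
  Π-↭ f (Perm.prep x q)   = ES.*-congˡ (Π-↭ f q)
  Π-↭ f (Perm.swap x y q) = ES.trans (ES.sym (ES.*-assoc _ _ _))
    (ES.trans (ES.*-cong (ES.*-comm _ _) (Π-↭ f q)) (ES.*-assoc _ _ _))
  Π-↭ f (Perm.trans q q′) = ES.trans (Π-↭ f q) (Π-↭ f q′)

  top-Πp : ∀ {n} {ws : List (Fin n)} → ws ↭ allFin n → top (Π p ws) ≡ 1ℤ
  top-Πp {n} all = trans (top-cong (ES.trans (Π-↭ (p {n}) all) (ES.trans (Π-tabulate (p {n}) id) (∏-distrib-* (r {n}) (c {n}))))) (top-∏r∏c {n})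

-- Multigraphs with subdivided edges and their reduction to a core.

module EdgeLists where

  open Permanent
  open NilpotentAlgebra
  open ArcProducts
  open Merging
  open LoopsAndTerminals
  open CorePolynomials
  open CoreValues
  open import Data.Integer.Base using (_+_; _*_; _-_; -_; _^_)

  -- An edge stands for a whole path; its interior vertices are remembered so that the original
  -- graph can be recovered from the core.
  record Edge (n : ℕ) : Set where
    constructor edge
    field
      src   : Fin n
      inner : List (Fin n)
      tgt   : Fin n

    vertices : List (Fin n)
    vertices = src ∷ inner ++ [ tgt ]

    len : ℕ
    len = suc (length inner)

  open Edge public

  private variable n : ℕ

  toEdge : Fin n × Fin n → Edge n
  toEdge (x , y) = edge x [] y

  flipEdge : Edge n → Edge n
  flipEdge (edge x L y) = edge y (reverse L) x

  infix 4 _≃_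

  -- Lists are meant as multisets of undirected edges. Generating the equivalence by elementary
  -- moves lets every invariant be transported by a short induction.
  data _≃_ {n} : List (Edge n) → List (Edge n) → Set where
    ≃-refl  : ∀ {es} → es ≃ es
    ≃-flip  : ∀ {e es} → e ∷ es ≃ flipEdge e ∷ es
    ≃-swap  : ∀ {e f es} → e ∷ f ∷ es ≃ f ∷ e ∷ es
    ≃-prep  : ∀ {e es fs} → es ≃ fs → e ∷ es ≃ e ∷ fs
    ≃-trans : ∀ {es fs gs} → es ≃ fs → fs ≃ gs → es ≃ gs

  ↭⇒≃ : {es fs : List (Edge n)} → es ↭ fs → es ≃ fs
  ↭⇒≃ Perm.refl          = ≃-refl
  ↭⇒≃ (Perm.prep e p)    = ≃-prep (↭⇒≃ p)
  ↭⇒≃ (Perm.swap e f p)  = ≃-trans ≃-swap (≃-prep (≃-prep (↭⇒≃ p)))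
  ↭⇒≃ (Perm.trans p q)   = ≃-trans (↭⇒≃ p) (↭⇒≃ q)

  hit : Fin n → Fin n → ℕ
  hit w x = if does (w Fin.≟ x) then 1 else 0

  hit-self : ∀ (w : Fin n) → hit w w ≡ 1
  hit-self w with w Fin.≟ w
  ... | yes _  = refl
  ... | no w≢w = ⊥-elim (w≢w refl)

  hit-≢ : ∀ {w x : Fin n} → w ≢ x → hit w x ≡ 0
  hit-≢ {w = w} {x} w≢x with w Fin.≟ x
  ... | yes w≡x = ⊥-elim (w≢x w≡x)
  ... | no _    = refl

  hit-0 : ∀ {w x : Fin n} → hit w x ≡ 0 → w ≢ x
  hit-0 {w = w} eq refl with trans (sym eq) (hit-self w)
  ... | ()

  -- A loop counts twice at its vertex, as it does for the degree.
  ends : Fin n → Edge n → ℕ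
  ends w e = hit w (src e) ℕ.+ hit w (tgt e)

  occ : Fin n → List (Edge n) → ℕ
  occ w []       = 0
  occ w (e ∷ es) = ends w e ℕ.+ occ w es

  occ-≃ : ∀ (w : Fin n) {es fs} → es ≃ fs → occ w es ≡ occ w fs
  occ-≃ w ≃-refl              = refl
  occ-≃ w (≃-flip {e} {es})   = cong (ℕ._+ occ w es) (ℕ.+-comm (hit w (src e)) _)
  occ-≃ w (≃-swap {e} {f} {es}) = trans (sym (ℕ.+-assoc (ends w e) _ _))
    (trans (cong (ℕ._+ occ w es) (ℕ.+-comm (ends w e) _)) (ℕ.+-assoc (ends w f) _ _))
  occ-≃ w (≃-prep {e} eq)     = cong (ends w e ℕ.+_) (occ-≃ w eq)
  occ-≃ w (≃-trans p q)       = trans (occ-≃ w p) (occ-≃ w q)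

  totalLen : List (Edge n) → ℕ
  totalLen []       = 0
  totalLen (e ∷ es) = len e ℕ.+ totalLen es

  totalLen-≃ : ∀ {es fs : List (Edge n)} → es ≃ fs → totalLen es ≡ totalLen fs
  totalLen-≃ ≃-refl              = refl
  totalLen-≃ (≃-flip {e} {es})   = cong (λ k → suc k ℕ.+ totalLen es) (sym (List.length-reverse (inner e)))
  totalLen-≃ (≃-swap {e} {f} {es}) = trans (sym (ℕ.+-assoc (len e) _ _))
    (trans (cong (ℕ._+ totalLen es) (ℕ.+-comm (len e) _)) (ℕ.+-assoc (len f) _ _))
  totalLen-≃ (≃-prep {e} eq)     = cong (len e ℕ.+_) (totalLen-≃ eq)
  totalLen-≃ (≃-trans p q)       = trans (totalLen-≃ p) (totalLen-≃ q)

  inners : List (Edge n) → List (Fin n)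
  inners = concatMap inner

  inners-≃ : ∀ {es fs : List (Edge n)} → es ≃ fs → inners es ↭ inners fs
  inners-≃ ≃-refl                = ↭-refl
  inners-≃ (≃-flip {e} {es})     = Perm.++⁺ʳ (inners es) (↭-sym (Perm.↭-reverse (inner e)))
  inners-≃ (≃-swap {e} {f} {es}) = Perm.shifts (inner e) (inner f)
  inners-≃ (≃-prep {e} eq)       = Perm.++⁺ˡ (inner e) (inners-≃ eq)
  inners-≃ (≃-trans p q)         = ↭-trans (inners-≃ p) (inners-≃ q)

  module _ {A : Set} where

    steps-++ : ∀ (as : List A) b bs → steps (as ++ b ∷ bs) ≡ steps (as ++ [ b ]) ++ steps (b ∷ bs)
    steps-++ []            b bs = refl
    steps-++ (a ∷ [])      b bs = refl
    steps-++ (a ∷ a′ ∷ as) b bs = cong ((a , a′) ∷_) (steps-++ (a′ ∷ as) b bs)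

    steps-reverse : ∀ {i j} (l : List A) → (i , j) ∈ steps l → (j , i) ∈ steps (reverse l)
    steps-reverse {i} {j} (x ∷ y ∷ l) st = subst ((j , i) ∈_) (sym eq) (split st)
      where
      eq : steps (reverse (x ∷ y ∷ l)) ≡ steps (reverse (y ∷ l)) ++ [ (y , x) ]
      eq = begin
        steps (reverse (x ∷ y ∷ l))             ≡⟨ cong steps (List.unfold-reverse x (y ∷ l)) ⟩
        steps (reverse (y ∷ l) ++ [ x ])        ≡⟨ cong (λ t → steps (t ++ [ x ])) (List.unfold-reverse y l) ⟩
        steps ((reverse l ++ [ y ]) ++ [ x ])   ≡⟨ cong steps (List.++-assoc (reverse l) [ y ] [ x ]) ⟩
        steps (reverse l ++ y ∷ [ x ])          ≡⟨ steps-++ (reverse l) y [ x ] ⟩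
        steps (reverse l ++ [ y ]) ++ [ (y , x) ] ≡⟨ cong (λ t → steps t ++ [ (y , x) ]) (List.unfold-reverse y l) ⟨
        steps (reverse (y ∷ l)) ++ [ (y , x) ]  ∎
        where open ≡-Reasoning
      split : (i , j) ∈ (x , y) ∷ steps (y ∷ l) → (j , i) ∈ steps (reverse (y ∷ l)) ++ [ (y , x) ]
      split (here refl) = ∈-++⁺ʳ (steps (reverse (y ∷ l))) (here refl)
      split (there st)  = ∈-++⁺ˡ (steps-reverse (y ∷ l) st)

  StepIn : Edge n → Fin n → Fin n → Set
  StepIn e i j = (i , j) ∈ steps (vertices e) ⊎ (j , i) ∈ steps (vertices e)

  -- Adjacency in the graph obtained by inserting all remembered vertices again. Merging two edges
  -- leaves it unchanged.
  Step : List (Edge n) → Fin n → Fin n → Set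
  Step es i j = Any (λ e → StepIn e i j) es

  vertices-flip : ∀ (e : Edge n) → vertices (flipEdge e) ≡ reverse (vertices e)
  vertices-flip (edge x L y) = sym (trans (List.unfold-reverse x (L ++ [ y ])) (cong (_++ [ x ]) (List.reverse-++ L [ y ])))

  StepIn-flip : ∀ (e : Edge n) {i j} → StepIn e i j → StepIn (flipEdge e) i j
  StepIn-flip e {i} {j} = Sum.swap ∘ Sum.map (back {i} {j}) (back {j} {i})
    where
    back : ∀ {i j} → (i , j) ∈ steps (vertices e) → (j , i) ∈ steps (vertices (flipEdge e))
    back {i} {j} st = subst (λ l → (j , i) ∈ steps l) (sym (vertices-flip e)) (steps-reverse (vertices e) st)

  flip-flip : ∀ (e : Edge n) → flipEdge (flipEdge e) ≡ e
  flip-flip (edge x L y) = cong (λ t → edge x t y) (List.reverse-involutive L)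

  infix 4 _⇔ˢ_

  _⇔ˢ_ : List (Edge n) → List (Edge n) → Set
  es ⇔ˢ fs = ∀ i j → Step es i j ⇔ Step fs i j

  ⇔ˢ-refl : ∀ {es : List (Edge n)} → es ⇔ˢ es
  ⇔ˢ-refl i j = mk⇔ id id

  ⇔ˢ-trans : ∀ {es fs gs : List (Edge n)} → es ⇔ˢ fs → fs ⇔ˢ gs → es ⇔ˢ gs
  ⇔ˢ-trans p q i j = mk⇔ (Equivalence.to (q i j) ∘ Equivalence.to (p i j)) (Equivalence.from (p i j) ∘ Equivalence.from (q i j))

  Step-≃ : ∀ {es fs : List (Edge n)} → es ≃ fs → es ⇔ˢ fs
  Step-≃ ≃-refl i j = mk⇔ id id
  Step-≃ (≃-flip {e} {es}) i j = mk⇔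
    (λ { (here s) → here (StepIn-flip e s) ; (there a) → there a })
    (λ { (here s) → here (subst (λ f → StepIn f i j) (flip-flip e) (StepIn-flip (flipEdge e) s)) ; (there a) → there a })
  Step-≃ ≃-swap i j = mk⇔ sw sw
    where
    sw : ∀ {e f es} → Step (e ∷ f ∷ es) i j → Step (f ∷ e ∷ es) i j
    sw (here s)          = there (here s)
    sw (there (here s))  = here s
    sw (there (there a)) = there (there a)
  Step-≃ (≃-prep eq) i j = mk⇔ (pr (Equivalence.to (Step-≃ eq i j))) (pr (Equivalence.from (Step-≃ eq i j)))
    where
    pr : ∀ {e es fs} → (Step es i j → Step fs i j) → Step (e ∷ es) i j → Step (e ∷ fs) i j
    pr f (here s)  = here s
    pr f (there a) = there (f a)
  Step-≃ (≃-trans p q) = ⇔ˢ-trans (Step-≃ p) (Step-≃ q)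

  -- A simple graph has no loop of length 1, and merging creates only edges of length at least 2.
  -- This yields the lower bound 2 for all cycle lengths.
  Proper : Edge n → Set
  Proper e = src e ≡ tgt e → 2 ≤ len e

  Proper-≃ : ∀ {es fs : List (Edge n)} → es ≃ fs → All Proper es → All Proper fs
  Proper-≃ ≃-refl ps = ps
  Proper-≃ (≃-flip {e}) (q ∷ ps) = (λ eq → subst (λ k → 2 ≤ suc k) (sym (List.length-reverse (inner e))) (q (sym eq))) ∷ ps
  Proper-≃ ≃-swap (q ∷ q′ ∷ ps) = q′ ∷ q ∷ ps
  Proper-≃ (≃-prep eq) (q ∷ ps) = q ∷ Proper-≃ eq ps
  Proper-≃ (≃-trans p q) = Proper-≃ q ∘ Proper-≃ p

  mergeEdge : Edge n → Edge n → Edge n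
  mergeEdge (edge x L w) (edge w′ L′ y) = edge x (L ++ w ∷ L′) y

  len-merge : ∀ x L (w : Fin n) L′ y → len (mergeEdge (edge x L w) (edge w L′ y)) ≡ len (edge x L w) ℕ.+ len (edge w L′ y)
  len-merge x L w L′ y = cong suc (List.length-++ L)

  steps-merge : ∀ x L (w : Fin n) L′ y → steps (vertices (mergeEdge (edge x L w) (edge w L′ y))) ≡
                steps (vertices (edge x L w)) ++ steps (vertices (edge w L′ y))
  steps-merge x L w L′ y = trans (cong (λ t → steps (x ∷ t)) (List.++-assoc L (w ∷ L′) [ y ])) (steps-++ (x ∷ L) w (L′ ++ [ y ]))

  Step-merge : ∀ x L (w : Fin n) L′ y es → edge x L w ∷ edge w L′ y ∷ es ⇔ˢ mergeEdge (edge x L w) (edge w L′ y) ∷ es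
  Step-merge x L w L′ y es i j = mk⇔ to from
    where
    e = edge x L w
    f = edge w L′ y
    eq = steps-merge x L w L′ y
    into : ∀ {q} → q ∈ steps (vertices e) ++ steps (vertices f) → q ∈ steps (vertices (mergeEdge e f))
    into {q} = subst (q ∈_) (sym eq)
    to : Step (e ∷ f ∷ es) i j → Step (mergeEdge e f ∷ es) i j
    to (here (inj₁ s))         = here (inj₁ (into (∈-++⁺ˡ s)))
    to (here (inj₂ s))         = here (inj₂ (into (∈-++⁺ˡ s)))
    to (there (here (inj₁ s))) = here (inj₁ (into (∈-++⁺ʳ (steps (vertices e)) s)))
    to (there (here (inj₂ s))) = here (inj₂ (into (∈-++⁺ʳ (steps (vertices e)) s)))
    to (there (there a))       = there a
    from : Step (mergeEdge e f ∷ es) i j → Step (e ∷ f ∷ es) i j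
    from (here (inj₁ s)) with ∈-++⁻ (steps (vertices e)) (subst ((i , j) ∈_) eq s)
    ... | inj₁ t = here (inj₁ t)
    ... | inj₂ t = there (here (inj₁ t))
    from (here (inj₂ s)) with ∈-++⁻ (steps (vertices e)) (subst ((j , i) ∈_) eq s)
    ... | inj₁ t = here (inj₂ t)
    ... | inj₂ t = there (here (inj₂ t))
    from (there a) = there (there a)

  extract : ∀ (w : Fin n) es → occ w es ≢ 0 → Σ[ x ∈ Fin n ] Σ[ L ∈ List (Fin n) ] Σ[ fs ∈ List (Edge n) ] es ≃ edge x L w ∷ fs
  extract w [] w∈ = ⊥-elim (w∈ refl)
  extract w (e@(edge x L y) ∷ es) w∈ with w Fin.≟ y
  ... | yes refl = x , L , es , ≃-refl
  ... | no w≢y with w Fin.≟ x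
  ...   | yes refl = y , reverse L , es , ≃-flip
  ...   | no w≢x with extract w es w∈
  ...     | x′ , L′ , fs , eq = x′ , L′ , e ∷ fs , ≃-trans (≃-prep eq) ≃-swap

  occ-0 : ∀ {w : Fin n} es → occ w es ≡ 0 → All (λ e → w ≢ src e × w ≢ tgt e) es
  occ-0 [] eq = []
  occ-0 {w = w} (e ∷ es) eq =
    (hit-0 (ℕ.m+n≡0⇒m≡0 _ ends≡0) , hit-0 (ℕ.m+n≡0⇒n≡0 (hit w (src e)) ends≡0)) ∷ occ-0 es (ℕ.m+n≡0⇒n≡0 (ends w e) eq)
    where ends≡0 = ℕ.m+n≡0⇒m≡0 (ends w e) eq

  -- The vertices in done are eliminated, those in ws are still to be.
  module Elimination {n : ℕ} (D : ℤ → Fin n → ℤ) (u v : Fin n) where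

    segmentOf : ℤ → Edge n → Expr (n ℕ.+ n)
    segmentOf s e = segment s (len e) (src e) (tgt e)

    -- An eliminated vertex leaves behind the factor `p`, by which its row and column are spent.
    val : ℤ → List (Fin n) → List (Fin n) → List (Edge n) → ℤ
    val s done ws es = top (Π p done ⊗ Π (vertexFactor (D s)) (u ∷ v ∷ []) ⊗ Π (vertexFactor (D s)) ws ⊗ Π (segmentOf s) es)

    Π-≃ : ∀ s {es fs} → es ≃ fs → Π (segmentOf s) es ≈ᴱ Π (segmentOf s) fs
    Π-≃ s ≃-refl = ES.refl
    Π-≃ s (≃-flip {e} {es}) = ES.*-congʳ (ES.trans (link-sym _ _ _ _ (src e) (tgt e))
      (ES.reflexive (cong (λ k → segment s (suc k) (tgt e) (src e)) (sym (List.length-reverse (inner e))))))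
    Π-≃ s ≃-swap = ES.trans (ES.sym (ES.*-assoc _ _ _)) (ES.trans (ES.*-congʳ (ES.*-comm _ _)) (ES.*-assoc _ _ _))
    Π-≃ s (≃-prep eq) = ES.*-congˡ (Π-≃ s eq)
    Π-≃ s (≃-trans q r) = ES.trans (Π-≃ s q) (Π-≃ s r)

    val-≃ : ∀ s done ws {es fs} → es ≃ fs → val s done ws es ≡ val s done ws fs
    val-≃ s done ws eq = top-cong (ES.*-congˡ (Π-≃ s eq))

    record Invariant (done ws : List (Fin n)) (es : List (Edge n)) : Set where
      field
        occ-u    : occ u es ≡ 3
        occ-v    : occ v es ≡ 3
        occ-ws   : ∀ {w} → w ∈ ws → occ w es ≡ 2
        occ-else : ∀ {z} → z ≢ u → z ≢ v → z ∉ ws → occ z es ≡ 0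
        unique   : Unique ws
        fresh    : ∀ {w} → w ∈ ws → w ≢ u × w ≢ v × w ∉ done
        weight   : ∀ {w} → w ∈ ws → ∀ s → D s w ≡ 1ℤ - s * s
        proper   : All Proper es
    open Invariant

    Invariant-≃ : ∀ {done ws es fs} → es ≃ fs → Invariant done ws es → Invariant done ws fs
    Invariant-≃ eq I = record
      { occ-u    = trans (sym (occ-≃ u eq)) (occ-u I)
      ; occ-v    = trans (sym (occ-≃ v eq)) (occ-v I)
      ; occ-ws   = λ w∈ → trans (sym (occ-≃ _ eq)) (occ-ws I w∈)
      ; occ-else = λ z≢u z≢v z∉ → trans (sym (occ-≃ _ eq)) (occ-else I z≢u z≢v z∉)
      ; unique   = unique I ; fresh = fresh I ; weight = weight I
      ; proper   = Proper-≃ eq (proper I) }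

    -- The reconstruction `same` is conditional on `ks ≡ []`, because a cycle that is split off
    -- takes its vertices and adjacencies out of the remaining list.
    record Reduces (done ws : List (Fin n)) (es : List (Edge n)) (done′ : List (Fin n)) (es′ : List (Edge n)) (ks : List ℕ) : Set where
      field
        value    : ∀ s → val s done ws es ≡ (1ℤ + s * s) ^ length ws * cyclesValue s ks * val s done′ [] es′
        eliminated : done′ ↭ ws ++ done
        total    : totalLen es ≡ foldr ℕ._+_ 0 ks ℕ.+ totalLen es′
        long     : All (2 ≤_) ks
        same     : ks ≡ [] → es ⇔ˢ es′ × inners es′ ↭ ws ++ inners es
    open Reduces

    done : ∀ {dn es} → Reduces dn [] es dn es []
    done {dn} {es} = record
      { value = λ s → sym (trans (cong (λ z → 1ℤ * z * val s dn [] es) (cyclesValue-[] s)) (ℤ.*-identityˡ _)) ; eliminated = ↭-refl ; total = refl ;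
        long = [] ; same = λ _ → ⇔ˢ-refl , ↭-refl }

    reduces-≃ : ∀ {dn ws es fs dn′ es′ ks} → es ≃ fs → Reduces dn ws fs dn′ es′ ks → Reduces dn ws es dn′ es′ ks
    reduces-≃ {dn} {ws} eq R = record
      { value = λ s → trans (val-≃ s dn ws eq) (value R s) ; eliminated = eliminated R
      ; total = trans (totalLen-≃ eq) (total R) ; long = long R
      ; same = λ k → let (st , inn) = same R k in
          ⇔ˢ-trans (Step-≃ eq) st , ↭-trans inn (Perm.++⁺ˡ ws (↭-sym (inners-≃ eq))) }

    ≢-of : ∀ {w : Fin n} {ws : List (Fin n)} {z} → All (w ≢_) ws → z ∈ ws → z ≢ w
    ≢-of w∉ z∈ refl = All.lookup w∉ z∈ refl

    rest-avoids : ∀ {w dn ws es} s → w ≢ u → w ≢ v → w ∉ dn → All (w ≢_) ws → occ w es ≡ 0 →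
      Avoids w (Π p dn ⊗ Π (vertexFactor (D s)) (u ∷ v ∷ []) ⊗ Π (vertexFactor (D s)) ws ⊗ Π (segmentOf s) es)
    rest-avoids {w} {dn} {ws} {es} s w≢u w≢v w∉ w∉ws occ≡0 =
      avoids-Π {n} {f = p} {xs = dn} (All.tabulate λ {x} x∈ → avoids-p λ { refl → w∉ x∈ })
      ⊗ᵃ avoids-Π {n} {f = vertexFactor (D s)} (av w≢u ∷ av w≢v ∷ [])
      ⊗ᵃ avoids-Π {n} {f = vertexFactor (D s)} {xs = ws} (All.map av w∉ws)
      ⊗ᵃ avoids-Π {n} {f = segmentOf s} {xs = es} (All.map (λ (a , b) → avoids-link a b) (occ-0 es occ≡0))
      where
      av : ∀ {x} → w ≢ x → Avoids w (vertexFactor (D s) x)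
      av w≢x = conᵃ 1ℤ ⊕ᵃ conᵃ _ ⊗ᵃ avoids-p w≢x

    module MergeStep {dn w ws x L L′ y es} (I : Invariant dn (w ∷ ws) (edge x L w ∷ edge w L′ y ∷ es)) where
      private
        e = edge x L w
        f = edge w L′ y
        w∉ws : All (w ≢_) ws
        w∉ws with unique I
        ... | q ∷ _ = q
        -- The end of the first edge and the start of the second exhaust the two occurrences of `w`,
        -- so the far ends and all other edges avoid it.
        count : hit w x ℕ.+ 1 ℕ.+ (1 ℕ.+ hit w y ℕ.+ occ w es) ≡ 2
        count = trans (sym (cong (λ h → hit w x ℕ.+ h ℕ.+ (h ℕ.+ hit w y ℕ.+ occ w es)) (hit-self w))) (occ-ws I (here refl))
        zeros : hit w x ≡ 0 × hit w y ≡ 0 × occ w es ≡ 0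
        zeros = ℕ.m+n≡0⇒m≡0 (hit w x) sum≡0 , ℕ.m+n≡0⇒m≡0 (hit w y) rest≡0 , ℕ.m+n≡0⇒n≡0 (hit w y) rest≡0
          where
          regroup : ∀ a b c → suc (suc (a ℕ.+ (b ℕ.+ c))) ≡ a ℕ.+ 1 ℕ.+ (1 ℕ.+ b ℕ.+ c)
          regroup = ℕR.solve-∀
          sum≡0 : hit w x ℕ.+ (hit w y ℕ.+ occ w es) ≡ 0
          sum≡0 = ℕ.suc-injective (ℕ.suc-injective (trans (regroup (hit w x) (hit w y) (occ w es)) count))
          rest≡0 = ℕ.m+n≡0⇒n≡0 (hit w x) sum≡0
        occ-merge : ∀ {z} → z ≢ w → occ z (e ∷ f ∷ es) ≡ occ z (mergeEdge e f ∷ es)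
        occ-merge {z} z≢w rewrite hit-≢ z≢w | ℕ.+-identityʳ (hit z x) = sym (ℕ.+-assoc (hit z x) (hit z y) _)
        w≢u = proj₁ (fresh I (here refl))
        w≢v = proj₁ (proj₂ (fresh I (here refl)))
        w∉dn = proj₂ (proj₂ (fresh I (here refl)))

      invariant : Invariant (w ∷ dn) ws (mergeEdge e f ∷ es)
      invariant = record
        { occ-u = trans (sym (occ-merge (w≢u ∘ sym))) (occ-u I)
        ; occ-v = trans (sym (occ-merge (w≢v ∘ sym))) (occ-v I)
        ; occ-ws = λ z∈ → trans (sym (occ-merge (≢-of w∉ws z∈))) (occ-ws I (there z∈))
        ; occ-else = else
        ; unique = uniq (unique I)
        ; fresh = λ z∈ → let (a , b , c) = fresh I (there z∈) in
            a , b , λ { (here refl) → All.lookup w∉ws z∈ refl ; (there z∈dn) → c z∈dn }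
        ; weight = λ z∈ → weight I (there z∈)
        ; proper = proper-merge (proper I) }
        where
        uniq : Unique (w ∷ ws) → Unique ws
        uniq (_ ∷ q) = q
        proper-merge : All Proper (e ∷ f ∷ es) → All Proper (mergeEdge e f ∷ es)
        proper-merge (_ ∷ _ ∷ ps) = (λ _ → subst (2 ≤_) (sym (len-merge x L w L′ y))
          (s≤s (ℕ.≤-trans (s≤s z≤n) (ℕ.m≤n+m (suc (length L′)) (length L))))) ∷ ps
        else : ∀ {z} → z ≢ u → z ≢ v → z ∉ ws → occ z (mergeEdge e f ∷ es) ≡ 0
        else {z} z≢u z≢v z∉ with z Fin.≟ w
        ... | yes refl = cong₂ ℕ._+_ (cong₂ ℕ._+_ (proj₁ zeros) (proj₁ (proj₂ zeros))) (proj₂ (proj₂ zeros))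
        ... | no z≢w = trans (sym (occ-merge z≢w)) (occ-else I z≢u z≢v λ { (here eq) → z≢w eq ; (there z∈) → z∉ z∈ })

      val-merge : ∀ s → val s dn (w ∷ ws) (e ∷ f ∷ es) ≡ (1ℤ + s * s) * val s (w ∷ dn) ws (mergeEdge e f ∷ es)
      val-merge s = begin
        val s dn (w ∷ ws) (e ∷ f ∷ es)
          ≡⟨ top-cong (Sol.solve 7 (λ d t v w a b g → d :* t :* (v :* w) :* (a :* (b :* g)) := v :* a :* b :* (d :* t :* w :* g))
               ES.refl (Π p dn) UV (vertexFactor (D s) w) W (segmentOf s e) (segmentOf s f) R) ⟩
        top (vertexFactor (D s) w ⊗ segmentOf s e ⊗ segmentOf s f ⊗ (Π p dn ⊗ UV ⊗ W ⊗ R))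
          ≡⟨ top-merge s (len e) (len f) {D s} (weight I (here refl) s) (hit-0 (proj₁ zeros)) (hit-0 (proj₁ (proj₂ zeros)))
               (rest-avoids {w} {dn} {ws} {es} s w≢u w≢v w∉dn w∉ws (proj₂ (proj₂ zeros))) ⟩
        (1ℤ + s * s) * top (p w ⊗ segment s (len e ℕ.+ len f) x y ⊗ (Π p dn ⊗ UV ⊗ W ⊗ R))
          ≡⟨ cong (λ k → (1ℤ + s * s) * top (p w ⊗ segment s k x y ⊗ (Π p dn ⊗ UV ⊗ W ⊗ R))) (len-merge x L w L′ y) ⟨
        (1ℤ + s * s) * top (p w ⊗ segmentOf s (mergeEdge e f) ⊗ (Π p dn ⊗ UV ⊗ W ⊗ R))
          ≡⟨ cong ((1ℤ + s * s) *_) (top-cong (Sol.solve 6 (λ d t w a b g → a :* b :* (d :* t :* w :* g) := a :* d :* t :* w :* (b :* g))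
               ES.refl (Π p dn) UV W (p w) (segmentOf s (mergeEdge e f)) R)) ⟩
        (1ℤ + s * s) * val s (w ∷ dn) ws (mergeEdge e f ∷ es) ∎
        where
        open ≡-Reasoning
        open Sol using (_:*_; _:=_)
        UV = Π (vertexFactor (D s)) (u ∷ v ∷ [])
        W = Π (vertexFactor (D s)) ws
        R = Π (segmentOf s) es

      reduces : ∀ {dn′ es′ ks} → Reduces (w ∷ dn) ws (mergeEdge e f ∷ es) dn′ es′ ks → Reduces dn (w ∷ ws) (e ∷ f ∷ es) dn′ es′ ks
      reduces {dn′} {es′} {ks} R = record
        { value = λ s → trans (val-merge s) (trans (cong ((1ℤ + s * s) *_) (value R s)) (assoc (1ℤ + s * s) _ _ _))
        ; eliminated = ↭-trans (eliminated R) (Perm.shift w ws dn)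
        ; total = trans (trans (sym (ℕ.+-assoc (len e) (len f) _)) (cong (ℕ._+ totalLen es) (sym (len-merge x L w L′ y)))) (total R)
        ; long = long R
        ; same = λ k → let (st , inn) = same R k in
            ⇔ˢ-trans (Step-merge x L w L′ y es) st ,
            ↭-trans inn (↭-trans (Perm.++⁺ˡ ws inn-w) (Perm.shift w ws (L ++ L′ ++ inners es))) }
        where
        assoc : ∀ q a b c → q * (a * b * c) ≡ q * a * b * c
        assoc = solve-∀
        inn-w : (L ++ w ∷ L′) ++ inners es ↭ w ∷ L ++ L′ ++ inners es
        inn-w = ↭-trans (↭-reflexive (List.++-assoc L (w ∷ L′) (inners es))) (Perm.shift w L (L′ ++ inners es))

    module LoopStep {dn w ws L es} (I : Invariant dn (w ∷ ws) (edge w L w ∷ es)) where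
      private
        e = edge w L w
        w∉ws : All (w ≢_) ws
        w∉ws with unique I
        ... | q ∷ _ = q
        occ≡0 : occ w es ≡ 0
        occ≡0 = ℕ.suc-injective (ℕ.suc-injective (trans (sym (cong (λ h → h ℕ.+ h ℕ.+ occ w es) (hit-self w))) (occ-ws I (here refl))))
        occ-loop : ∀ {z} → z ≢ w → occ z (e ∷ es) ≡ occ z es
        occ-loop {z} z≢w rewrite hit-≢ z≢w = refl
        w≢u = proj₁ (fresh I (here refl))
        w≢v = proj₁ (proj₂ (fresh I (here refl)))
        w∉dn = proj₂ (proj₂ (fresh I (here refl)))

      invariant : Invariant (w ∷ dn) ws es
      invariant = record
        { occ-u = trans (sym (occ-loop (w≢u ∘ sym))) (occ-u I)
        ; occ-v = trans (sym (occ-loop (w≢v ∘ sym))) (occ-v I)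
        ; occ-ws = λ z∈ → trans (sym (occ-loop (≢-of w∉ws z∈))) (occ-ws I (there z∈))
        ; occ-else = else
        ; unique = uniq (unique I)
        ; fresh = λ z∈ → let (a , b , c) = fresh I (there z∈) in
            a , b , λ { (here refl) → All.lookup w∉ws z∈ refl ; (there z∈dn) → c z∈dn }
        ; weight = λ z∈ → weight I (there z∈)
        ; proper = All.tail (proper I) }
        where
        uniq : Unique (w ∷ ws) → Unique ws
        uniq (_ ∷ q) = q
        else : ∀ {z} → z ≢ u → z ≢ v → z ∉ ws → occ z es ≡ 0
        else {z} z≢u z≢v z∉ with z Fin.≟ w
        ... | yes refl = occ≡0
        ... | no z≢w = trans (sym (occ-loop z≢w)) (occ-else I z≢u z≢v λ { (here eq) → z≢w eq ; (there z∈) → z∉ z∈ })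

      val-loop : ∀ s → val s dn (w ∷ ws) (e ∷ es) ≡ (1ℤ + s * s) * cycleValue s (len e) * val s (w ∷ dn) ws es
      val-loop s = begin
        val s dn (w ∷ ws) (e ∷ es)
          ≡⟨ top-cong (Sol.solve 6 (λ d t v w a g → d :* t :* (v :* w) :* (a :* g) := v :* a :* (d :* t :* w :* g))
               ES.refl (Π p dn) UV (vertexFactor (D s) w) W (segmentOf s e) R) ⟩
        top (vertexFactor (D s) w ⊗ segmentOf s e ⊗ (Π p dn ⊗ UV ⊗ W ⊗ R))
          ≡⟨ top-loop s (len e) {D s} (weight I (here refl) s) (rest-avoids {w} {dn} {ws} {es} s w≢u w≢v w∉dn w∉ws occ≡0) ⟩
        (1ℤ + s * s) * cycleValue s (len e) * top (p w ⊗ (Π p dn ⊗ UV ⊗ W ⊗ R))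
          ≡⟨ cong ((1ℤ + s * s) * cycleValue s (len e) *_) (top-cong (Sol.solve 5 (λ d t w a g → a :* (d :* t :* w :* g) := a :* d :* t :* w :* g)
               ES.refl (Π p dn) UV W (p w) R)) ⟩
        (1ℤ + s * s) * cycleValue s (len e) * val s (w ∷ dn) ws es ∎
        where
        open ≡-Reasoning
        open Sol using (_:*_; _:=_)
        UV = Π (vertexFactor (D s)) (u ∷ v ∷ [])
        W = Π (vertexFactor (D s)) ws
        R = Π (segmentOf s) es

      reduces : ∀ {dn′ es′ ks} → Reduces (w ∷ dn) ws es dn′ es′ ks → Reduces dn (w ∷ ws) (e ∷ es) dn′ es′ (len e ∷ ks)
      reduces {dn′} {es′} {ks} R = record
        { value = λ s → trans (val-loop s) (trans (cong ((1ℤ + s * s) * cycleValue s (len e) *_) (value R s)) (trans (assoc (1ℤ + s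
          * s) (cycleValue s (len e)) ((1ℤ + s * s) ^ length ws) (cyclesValue s ks) (val s dn′ [] es′))
            (cong (λ z → (1ℤ + s * s) ^ suc (length ws) * z * val s dn′ [] es′) (sym (cyclesValue-∷ s (len e) ks)))))
        ; eliminated = ↭-trans (eliminated R) (Perm.shift w ws dn)
        ; total = trans (cong (len e ℕ.+_) (total R)) (sym (ℕ.+-assoc (len e) _ _))
        ; long = All.head (proper I) refl ∷ long R
        ; same = λ () }
        where
        assoc : ∀ q k a b c → q * k * (a * b * c) ≡ q * a * (k * b) * c
        assoc = solve-∀

    -- A pending vertex has two edge ends. They belong to one loop, which is split off as a cycle,
    -- or to two edges, which are merged.
    reduce : ∀ ws {dn es} → Invariant dn ws es →
      Σ[ dn′ ∈ List (Fin n) ] Σ[ es′ ∈ List (Edge n) ] Σ[ ks ∈ List ℕ ] Invariant dn′ [] es′ × Reduces dn ws es dn′ es′ ks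
    reduce [] {dn} {es} I = dn , es , [] , I , done
    reduce (w ∷ ws) {dn} {es} I with extract w es (λ eq → 2≢0 (trans (sym (occ-ws I (here refl))) eq))
      where 2≢0 : 2 ≢ 0
            2≢0 ()
    ... | x , L , fs , es≃ with w Fin.≟ x
    ...   | yes refl =
      let I′ = Invariant-≃ es≃ I
          (dn′ , es′ , ks , J , R) = reduce ws (LoopStep.invariant I′)
      in dn′ , es′ , _ , J , reduces-≃ es≃ (LoopStep.reduces I′ R)
    ...   | no w≢x with extract w fs (λ eq → 1≢0 (trans (sym occ≡1) eq))
      where
      1≢0 : 1 ≢ 0
      1≢0 ()
      occ≡1 : occ w fs ≡ 1
      occ≡1 = ℕ.suc-injective (trans (sym (trans (cong (ℕ._+ occ w fs) (cong₂ ℕ._+_ (hit-≢ w≢x) (hit-self w))) refl))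
        (trans (sym (occ-≃ w es≃)) (occ-ws I (here refl))))
    ...     | y , L′ , gs , fs≃ =
      -- Both extracted edges end at `w`; the second is reversed so that it continues the first.
      let eq = ≃-trans es≃ (≃-trans (≃-prep fs≃) (≃-prep ≃-flip))
          I′ = Invariant-≃ eq I
          (dn′ , es′ , ks , J , R) = reduce ws (MergeStep.invariant I′)
      in dn′ , es′ , ks , J , reduces-≃ eq (MergeStep.reduces I′ R)

    -- Stated for every completion of the reduction, so that partial eliminations compose as
    -- functions.
    Continues : List (Fin n) → List (Fin n) → List (Edge n) → List (Fin n) → List (Fin n) → List (Edge n) → Set
    Continues dn ws es dn′ ws′ es′ = Invariant dn′ ws′ es′ × (∀ {dn″ es″ ks} → Reduces dn′ ws′ es′ dn″ es″ ks → Reduces dn ws es dn″ es″ ks)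

    collapse : ∀ z zs {dn ws x L y es} → Invariant dn (z ∷ zs ++ ws) (edge x L z ∷ map toEdge (steps (z ∷ zs ++ [ y ])) ++ es) →
      Σ[ dn′ ∈ _ ] Continues dn (z ∷ zs ++ ws) (edge x L z ∷ map toEdge (steps (z ∷ zs ++ [ y ])) ++ es) dn′ ws (edge x (L ++ z ∷ zs) y ∷ es)
    collapse z [] I = _ , MergeStep.invariant I , MergeStep.reduces I
    collapse z (z′ ∷ zs) {dn} {ws} {x} {L} {y} {es} I with collapse z′ zs {L = L ++ [ z ]} (MergeStep.invariant I)
    ... | dn′ , I′ , step = dn′ , subst (λ M → Continues dn (z ∷ z′ ∷ zs ++ ws) (edge x L z ∷ map toEdge (steps (z ∷ z′ ∷ zs ++ [ y ])) ++ es) dn′ ws (edge x M y ∷ es))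
      (List.++-assoc L [ z ] (z′ ∷ zs)) (I′ , MergeStep.reduces I ∘ step)

    collapsePath : ∀ P {dn ws es} → Invariant dn (P ++ ws) (map toEdge (steps (u ∷ P ++ [ v ])) ++ es) →
      Σ[ dn′ ∈ _ ] Continues dn (P ++ ws) (map toEdge (steps (u ∷ P ++ [ v ])) ++ es) dn′ ws (edge u P v ∷ es)
    collapsePath []       I = _ , I , id
    collapsePath (z ∷ zs) I = collapse z zs I

    rearrange : ∀ {dn ws es fs dn′ ws′ es′} → es ↭ fs → Continues dn ws fs dn′ ws′ es′ → Continues dn ws es dn′ ws′ es′
    rearrange perm (I , step) = I , reduces-≃ (↭⇒≃ perm) ∘ step

    -- Applied to the theta graph, `reduce` would yield a core whose lengths still had to be
    -- identified. Eliminating along the three given paths makes them explicit.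
    collapseTheta : ∀ P Q R {dn} → let stepsOf = λ L → map toEdge (steps (u ∷ L ++ [ v ])) in
      Invariant dn (P ++ Q ++ R ++ []) (stepsOf P ++ stepsOf Q ++ stepsOf R ++ []) →
      Σ[ dn′ ∈ _ ] Reduces dn (P ++ Q ++ R ++ []) (stepsOf P ++ stepsOf Q ++ stepsOf R ++ []) dn′ (edge u R v ∷ edge u Q v ∷ edge u P v ∷ []) []
    collapseTheta P Q R I =
      let stepsOf = λ L → map toEdge (steps (u ∷ L ++ [ v ]))
          (_ , I₁ , s₁) = collapsePath P I
          p₁ = ↭-trans (↭-sym (Perm.shift (edge u P v) (stepsOf Q) (stepsOf R ++ []))) ↭-refl
          (_ , I₂ , s₂) = collapsePath Q (Invariant-≃ (↭⇒≃ p₁) I₁)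
          p₂ = ↭-trans (prep (edge u Q v) (↭-trans (prep (edge u P v) (↭-reflexive (List.++-identityʳ (stepsOf R)))) (↭-sym (Perm.++-comm (stepsOf R)
            [ edge u P v ]))))
                 (↭-sym (Perm.shift (edge u Q v) (stepsOf R) [ edge u P v ]))
          (_ , I₃ , s₃) = collapsePath R (Invariant-≃ (↭⇒≃ p₂) I₂)
      in _ , (s₁ ∘ reduces-≃ (↭⇒≃ p₁) ∘ s₂ ∘ reduces-≃ (↭⇒≃ p₂) ∘ s₃) done

    -- Evaluation and classification of the core on two cubic vertices.

    module Core (u≢v : u ≢ v) (Du : ∀ s → D s u ≡ 1ℤ + s - s * s) (Dv : ∀ s → D s v ≡ 1ℤ + s - s * s) where
      open Terminals {n} u v

      private
        module _ (s : ℤ) {dn : List (Fin n)} (all : u ∷ v ∷ dn ↭ allFin n) (u∉ : u ∉ dn) (v∉ : v ∉ dn) where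

          avoids : ∀ {w} → w ∉ dn → Avoids w (Π p dn)
          avoids w∉ = avoids-Π {n} {f = p} {xs = dn} (All.tabulate λ x∈ → avoids-p λ { refl → w∉ x∈ })

          val-forms : ∀ e f g {F G H} → segmentOf s e ≈ᴱ ⟪ F ⟫ → segmentOf s f ≈ᴱ ⟪ G ⟫ → segmentOf s g ≈ᴱ ⟪ H ⟫ →
            val s dn [] (e ∷ f ∷ g ∷ []) ≡
            Form.C (((vertexᵘ (1ℤ + s - s * s) · vertexᵛ (1ℤ + s - s * s)) · F) · (G · H))
          val-forms e f g {F} {G} {H} eqF eqG eqH = begin
            val s dn [] (e ∷ f ∷ g ∷ [])
              ≡⟨ top-cong (Sol.solve 6 (λ d u v e f g → d :* (u :* (v :* con′ 1)) :* con′ 1 :* (e :* (f :* (g :* con′ 1))) :=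
                   (u :* v :* e) :* (f :* g) :* d) ES.refl (Π p dn) (vertexFactor (D s) u) (vertexFactor (D s) v)
                   (segmentOf s e) (segmentOf s f) (segmentOf s g)) ⟩
            top (vertexFactor (D s) u ⊗ vertexFactor (D s) v ⊗ segmentOf s e ⊗ (segmentOf s f ⊗ segmentOf s g) ⊗ Π p dn)
              ≡⟨ top-cong (ES.*-congʳ (ES.*-cong (ES.*-cong (ES.*-cong (⟪vertexᵘ⟫ (D s)) (⟪vertexᵛ⟫ (D s))) eqF) (ES.*-cong eqG eqH))) ⟩
            top (⟪ vertexᵘ (D s u) ⟫ ⊗ ⟪ vertexᵛ (D s v) ⟫ ⊗ ⟪ F ⟫ ⊗ (⟪ G ⟫ ⊗ ⟪ H ⟫) ⊗ Π p dn)
              ≡⟨ top-cong (ES.*-congʳ (ES.sym (ES.trans (⟪·⟫ (VV · F) (G · H))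
                   (ES.*-cong (ES.trans (⟪·⟫ VV F) (ES.*-congʳ (⟪·⟫ (vertexᵘ (D s u)) (vertexᵛ (D s v))))) (⟪·⟫ G H))))) ⟩
            top (⟪ (VV · F) · (G · H) ⟫ ⊗ Π p dn)
              ≡⟨ top-form u≢v ((VV · F) · (G · H)) (avoids u∉) (avoids v∉) ⟩
            Form.C ((VV · F) · (G · H)) * top (p u ⊗ p v ⊗ Π p dn)
              ≡⟨ cong (Form.C ((VV · F) · (G · H)) *_) (trans (top-cong (ES.*-assoc _ _ _)) (top-Πp {n} {u ∷ v ∷ dn} all)) ⟩
            Form.C ((VV · F) · (G · H)) * 1ℤ
              ≡⟨ ℤ.*-identityʳ _ ⟩
            Form.C ((VV · F) · (G · H))
              ≡⟨ cong₂ (λ d d′ → Form.C (((vertexᵘ d · vertexᵛ d′) · F) · (G · H))) (Du s) (Dv s) ⟩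
            Form.C (((vertexᵘ (1ℤ + s - s * s) · vertexᵛ (1ℤ + s - s * s)) · F) · (G · H)) ∎
            where
            open ≡-Reasoning
            open Sol using (_:*_; _:=_) renaming (con to con′)
            VV = vertexᵘ (D s u) · vertexᵛ (D s v)

      val-theta : ∀ s {dn} P Q R → u ∷ v ∷ dn ↭ allFin n → u ∉ dn → v ∉ dn →
        val s dn [] (edge u P v ∷ edge u Q v ∷ edge u R v ∷ []) ≡
        thetaValue s (suc (length P)) (suc (length Q)) (suc (length R))
      val-theta s P Q R all u∉ v∉ = trans
        (val-forms s all u∉ v∉ (edge u P v) (edge u Q v) (edge u R v)
          (⟪linkForm⟫ (1ℤ - pw a) (s * s + pw a) (s * s * (s * s) - pw a) ((1ℤ + s * s) * s ^ a))
          (⟪linkForm⟫ (1ℤ - pw b) (s * s + pw b) (s * s * (s * s) - pw b) ((1ℤ + s * s) * s ^ b))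
          (⟪linkForm⟫ (1ℤ - pw c′) (s * s + pw c′) (s * s * (s * s) - pw c′) ((1ℤ + s * s) * s ^ c′)))
        (trans (theta-identity s (pw a) (pw b) (pw c′) (s ^ a) (s ^ b) (s ^ c′)) (sym (thetaValue-def s a b c′)))
        where
        a = suc (length P)
        b = suc (length Q)
        c′ = suc (length R)
        pw : ℕ → ℤ
        pw k = (- (s * s)) ^ k

      val-dumbbell : ∀ s {dn} P Q R → u ∷ v ∷ dn ↭ allFin n → u ∉ dn → v ∉ dn →
        val s dn [] (edge u P v ∷ edge u Q u ∷ edge v R v ∷ []) ≡
        dumbbellValue s (suc (length P)) (suc (length Q)) (suc (length R))
      val-dumbbell s P Q R all u∉ v∉ = trans
        (val-forms s all u∉ v∉ (edge u P v) (edge u Q u) (edge v R v)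
          (⟪linkForm⟫ (1ℤ - pw a) (s * s + pw a) (s * s * (s * s) - pw a) ((1ℤ + s * s) * s ^ a))
          (⟪loopᵘ⟫ (1ℤ - pw b) (s * s + pw b) (s * s * (s * s) - pw b) ((1ℤ + s * s) * s ^ b))
          (⟪loopᵛ⟫ (1ℤ - pw c′) (s * s + pw c′) (s * s * (s * s) - pw c′) ((1ℤ + s * s) * s ^ c′)))
        (trans (dumbbell-identity s (pw a) (pw b) (pw c′) (s ^ a) (s ^ b) (s ^ c′)) (sym (dumbbellValue-def s a b c′)))
        where
        a = suc (length P)
        b = suc (length Q)
        c′ = suc (length R)
        pw : ℕ → ℤ
        pw k = (- (s * s)) ^ k

      -- Up to order and orientation of the edges, these are the only multigraphs on two vertices
      -- that are both of degree 3.
      data CoreShape (es : List (Edge n)) : Set where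
        theta    : ∀ P Q R → es ≃ edge u P v ∷ edge u Q v ∷ edge u R v ∷ [] → CoreShape es
        dumbbell : ∀ P Q R → es ≃ edge u P v ∷ edge u Q u ∷ edge v R v ∷ [] → CoreShape es

      private
        record Terminal (es : List (Edge n)) : Set where
          constructor terminal
          field occ-else : ∀ {z} → z ≢ u → z ≢ v → occ z es ≡ 0

        hit-uv = hit-≢ u≢v
        hit-vu = hit-≢ (u≢v ∘ sym)

        terminal-≃ : ∀ {es fs} → es ≃ fs → Terminal es → Terminal fs
        terminal-≃ eq (terminal T) = terminal λ z≢u z≢v → trans (sym (occ-≃ _ eq)) (T z≢u z≢v)

        terminal-tail : ∀ {e es} → Terminal (e ∷ es) → Terminal es
        terminal-tail {e} (terminal T) = terminal λ {z} z≢u z≢v → ℕ.m+n≡0⇒n≡0 (ends z e) (T z≢u z≢v)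

        src-terminal : ∀ {e es} → Terminal (e ∷ es) → src e ≡ u ⊎ src e ≡ v
        src-terminal {e} (terminal T) with src e Fin.≟ u | src e Fin.≟ v
        ... | yes eq | _      = inj₁ eq
        ... | no _   | yes eq = inj₂ eq
        ... | no ≢u  | no ≢v  = ⊥-elim (hit-0 {w = src e} {src e} (ℕ.m+n≡0⇒m≡0 (hit (src e) (src e)) (ℕ.m+n≡0⇒m≡0 (ends (src e) e) (T ≢u ≢v))) refl)

        pull : ∀ w es → Terminal es → occ w es ≢ 0 →
          Σ[ L ∈ List (Fin n) ] Σ[ fs ∈ List (Edge n) ] (es ≃ edge u L w ∷ fs ⊎ es ≃ edge v L w ∷ fs) × Terminal fs
        pull w es T w∈ with extract w es w∈
        ... | x , L , fs , eq with src-terminal (terminal-≃ eq T)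
        ...   | inj₁ refl = L , fs , inj₁ eq , terminal-tail {edge u L w} (terminal-≃ eq T)
        ...   | inj₂ refl = L , fs , inj₂ eq , terminal-tail {edge v L w} (terminal-≃ eq T)

        empty : ∀ es → Terminal es → occ u es ≡ 0 → occ v es ≡ 0 → es ≡ []
        empty [] T _ _ = refl
        empty (e ∷ es) T u≡0 v≡0 with src-terminal T
        ... | inj₁ eq = ⊥-elim (hit-0 {w = u} {src e} (ℕ.m+n≡0⇒m≡0 (hit u (src e)) (ℕ.m+n≡0⇒m≡0 (ends u e) u≡0)) (sym eq))
        ... | inj₂ eq = ⊥-elim (hit-0 {w = v} {src e} (ℕ.m+n≡0⇒m≡0 (hit v (src e)) (ℕ.m+n≡0⇒m≡0 (ends v e) v≡0)) (sym eq))

        suc≢0 : ∀ {k m} → k ≡ suc m → k ≢ 0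
        suc≢0 refl ()

        occ-uv-u : ∀ L es → occ u (edge u L v ∷ es) ≡ suc (occ u es)
        occ-uv-u L es = cong (ℕ._+ occ u es) (cong₂ ℕ._+_ (hit-self u) hit-uv)
        occ-uv-v : ∀ L es → occ v (edge u L v ∷ es) ≡ suc (occ v es)
        occ-uv-v L es = cong (ℕ._+ occ v es) (cong₂ ℕ._+_ hit-vu (hit-self v))
        occ-uu-u : ∀ L es → occ u (edge u L u ∷ es) ≡ suc (suc (occ u es))
        occ-uu-u L es = cong (ℕ._+ occ u es) (cong₂ ℕ._+_ (hit-self u) (hit-self u))
        occ-uu-v : ∀ L es → occ v (edge u L u ∷ es) ≡ occ v es
        occ-uu-v L es = cong (ℕ._+ occ v es) (cong₂ ℕ._+_ hit-vu hit-vu)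
        occ-vv-u : ∀ L es → occ u (edge v L v ∷ es) ≡ occ u es
        occ-vv-u L es = cong (ℕ._+ occ u es) (cong₂ ℕ._+_ hit-uv hit-uv)
        occ-vv-v : ∀ L es → occ v (edge v L v ∷ es) ≡ suc (suc (occ v es))
        occ-vv-v L es = cong (ℕ._+ occ v es) (cong₂ ℕ._+_ (hit-self v) (hit-self v))

        peel : ∀ {k m} → suc k ≡ suc m → k ≡ m
        peel = ℕ.suc-injective

        Both : ℕ → ℕ → List (Edge n) → Set
        Both a b es = occ u es ≡ a × occ v es ≡ b

        both-≃ : ∀ {a b es fs} → es ≃ fs → Both a b es → Both a b fs
        both-≃ eq (a , b) = trans (sym (occ-≃ u eq)) a , trans (sym (occ-≃ v eq)) b

        drop-uv : ∀ {a b L es fs} → es ≃ edge u L v ∷ fs → Both (suc a) (suc b) es → Both a b fs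
        drop-uv {L = L} {fs = fs} eq B = let (a , b) = both-≃ eq B in
          peel (trans (sym (occ-uv-u L fs)) a) , peel (trans (sym (occ-uv-v L fs)) b)

        drop-uu : ∀ {a b L es fs} → es ≃ edge u L u ∷ fs → Both (suc (suc a)) b es → Both a b fs
        drop-uu {L = L} {fs = fs} eq B = let (a , b) = both-≃ eq B in
          peel (peel (trans (sym (occ-uu-u L fs)) a)) , trans (sym (occ-uu-v L fs)) b

        drop-vv : ∀ {a b L es fs} → es ≃ edge v L v ∷ fs → Both a (suc (suc b)) es → Both a b fs
        drop-vv {L = L} {fs = fs} eq B = let (a , b) = both-≃ eq B in
          trans (sym (occ-vv-u L fs)) a , peel (peel (trans (sym (occ-vv-v L fs)) b))

        vu⇒uv : ∀ {es L fs} → es ≃ edge v L u ∷ fs → es ≃ edge u (reverse L) v ∷ fs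
        vu⇒uv eq = ≃-trans eq ≃-flip

        -- In this family the subscripts are the numbers of edge ends still to be found at `u` and
        -- at `v`.
        shape₀₀ : ∀ es → Terminal es → Both 0 0 es → es ≃ []
        shape₀₀ es T (a , b) rewrite empty es T a b = ≃-refl

        shape₁₁ : ∀ es → Terminal es → Both 1 1 es → Σ[ R ∈ _ ] es ≃ edge u R v ∷ []
        shape₁₁ es T B with pull u es T (suc≢0 (proj₁ B))
        ... | R , fs , inj₂ eq , T′ = reverse R , ≃-trans (vu⇒uv eq) (≃-prep (shape₀₀ fs T′ (drop-uv (vu⇒uv eq) B)))
        -- A loop at `u` would need two of its ends, and only one is left.
        ... | R , fs , inj₁ eq , T′ with trans (sym (occ-uu-u R fs)) (proj₁ (both-≃ eq B))
        ...   | ()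

        shape₀₂ : ∀ es → Terminal es → Both 0 2 es → Σ[ R ∈ _ ] es ≃ edge v R v ∷ []
        shape₀₂ es T B with pull v es T (suc≢0 (proj₂ B))
        ... | R , fs , inj₂ eq , T′ = R , ≃-trans eq (≃-prep (shape₀₀ fs T′ (drop-vv eq B)))
        ... | R , fs , inj₁ eq , T′ with trans (sym (occ-uv-u R fs)) (proj₁ (both-≃ eq B))
        ...   | ()

        shape₁₃ : ∀ es → Terminal es → Both 1 3 es → Σ[ P ∈ _ ] Σ[ R ∈ _ ] es ≃ edge u P v ∷ edge v R v ∷ []
        shape₁₃ es T B with pull u es T (suc≢0 (proj₁ B))
        ... | P , fs , inj₂ eq , T′ = let (R , eq′) = shape₀₂ fs T′ (drop-uv (vu⇒uv eq) B) in
          reverse P , R , ≃-trans (vu⇒uv eq) (≃-prep eq′)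
        ... | P , fs , inj₁ eq , T′ with trans (sym (occ-uu-u P fs)) (proj₁ (both-≃ eq B))
        ...   | ()

        shape₂₂ : ∀ es → Terminal es → Both 2 2 es →
          (Σ[ Q ∈ _ ] Σ[ R ∈ _ ] es ≃ edge u Q v ∷ edge u R v ∷ []) ⊎ (Σ[ Q ∈ _ ] Σ[ R ∈ _ ] es ≃ edge u Q u ∷ edge v R v ∷ [])
        shape₂₂ es T B with pull u es T (suc≢0 (proj₁ B))
        ... | Q , fs , inj₂ eq , T′ = let (R , eq′) = shape₁₁ fs T′ (drop-uv (vu⇒uv eq) B) in
          inj₁ (reverse Q , R , ≃-trans (vu⇒uv eq) (≃-prep eq′))
        ... | Q , fs , inj₁ eq , T′ = let (R , eq′) = shape₀₂ fs T′ (drop-uu eq B) in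
          inj₂ (Q , R , ≃-trans eq (≃-prep eq′))

      coreShape : ∀ {dn es} → Invariant dn [] es → CoreShape es
      coreShape {es = es} I with pull u es T (suc≢0 (proj₁ B))
        where
        T : Terminal es
        T = terminal λ z≢u z≢v → Invariant.occ-else I z≢u z≢v λ ()
        B : Both 3 3 es
        B = Invariant.occ-u I , Invariant.occ-v I
      ... | P , fs , inj₁ eq , T′ = let (P′ , R , eq′) = shape₁₃ fs T′ (drop-uu eq (Invariant.occ-u I , Invariant.occ-v I)) in
        dumbbell P′ P R (≃-trans eq (≃-trans (≃-prep eq′) ≃-swap))
      ... | P , fs , inj₂ eq , T′ with shape₂₂ fs T′ (drop-uv (vu⇒uv eq) (Invariant.occ-u I , Invariant.occ-v I))
      ...   | inj₁ (Q , R , eq′) = theta (reverse P) Q R (≃-trans (vu⇒uv eq) (≃-prep eq′))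
      ...   | inj₂ (Q , R , eq′) = dumbbell (reverse P) Q R (≃-trans (vu⇒uv eq) (≃-prep eq′))

-- Comparison of coefficients by divisibility and parity.

module Parities where

  open import Data.Integer.Base using (_+_; _*_; _-_; -_; _^_)

  signedPower : ℤ → ℕ → ℤ
  signedPower s a = (- (s * s)) ^ a

  ∣-resp : ∀ {d x y} → x ≡ y → d ∣ x → d ∣ y
  ∣-resp {d} = subst (d ∣_)

  ^-split : ∀ s {m n} → m ≤ n → s ^ n ≡ s ^ m * s ^ (n ℕ.∸ m)
  ^-split s {m} {n} m≤n = trans (cong (s ^_) (sym (ℕ.m+[n∸m]≡n m≤n))) (ℤ.^-distribˡ-+-* s m (n ℕ.∸ m))

  ^-mono-∣ : ∀ s {m n} → m ≤ n → s ^ m ∣ s ^ n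
  ^-mono-∣ s {m} {n} m≤n = ∣-resp (sym (^-split s m≤n)) (∣m⇒∣m*n (s ^ (n ℕ.∸ m)) ∣-refl)

  signedPower-± : ∀ s a → signedPower s a ≡ -1ℤ ^ a * s ^ (a ℕ.+ a)
  signedPower-± s zero    = refl
  signedPower-± s (suc a) = begin
    - (s * s) * signedPower s a                            ≡⟨ cong (- (s * s) *_) (signedPower-± s a) ⟩
    - (s * s) * (-1ℤ ^ a * s ^ (a ℕ.+ a))            ≡⟨ rearrange s (-1ℤ ^ a) (s ^ (a ℕ.+ a)) ⟩
    -1ℤ * -1ℤ ^ a * (s * (s * s ^ (a ℕ.+ a)))        ≡⟨ cong (λ k → -1ℤ * -1ℤ ^ a * (s * s ^ k)) (ℕ.+-suc a a) ⟨
    -1ℤ ^ suc a * s ^ (suc a ℕ.+ suc a)                    ∎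
    where
    open ≡-Reasoning
    rearrange : ∀ s g x → - (s * s) * (g * x) ≡ -1ℤ * g * (s * (s * x))
    rearrange = solve-∀

  ∣-signedPower : ∀ s {m} a → m ≤ a ℕ.+ a → s ^ m ∣ signedPower s a
  ∣-signedPower s a m≤ = ∣-resp (sym (signedPower-± s a)) (∣n⇒∣m*n (-1ℤ ^ a) (^-mono-∣ s m≤))

  s²-signedPower : ∀ s a → s * (s * signedPower s a) ≡ -1ℤ ^ a * s ^ (2 ℕ.+ (a ℕ.+ a))
  s²-signedPower s a = trans (cong (λ z → s * (s * z)) (signedPower-± s a)) (rearrange s (-1ℤ ^ a) (s ^ (a ℕ.+ a)))
    where
    rearrange : ∀ s g x → s * (s * (g * x)) ≡ g * (s * (s * x))
    rearrange = solve-∀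

  ∣-s²-signedPower : ∀ s {m} a → m ≤ 2 ℕ.+ (a ℕ.+ a) → s ^ m ∣ s * (s * signedPower s a)
  ∣-s²-signedPower s a m≤ = ∣-resp (sym (s²-signedPower s a)) (∣n⇒∣m*n (-1ℤ ^ a) (^-mono-∣ s m≤))

  base : ℤ → ℤ
  base s = 1ℤ + s + + 2 * (s * s)

  -- The beginning of the power series of a core polynomial: the contribution of
  -- the matchings near the two vertices of degree 3, followed by the correction
  -- that comes from a path of length a joining them.
  lead : ℕ → ℤ → ℤ
  lead a s = base s * base s - (s + s * s) * (s + s * s) * signedPower s a

  module Parity (N N′ : ℕ) where

    -- s is even and exceeds 2 N + 2 N′, so that comparing values at this single s
    -- amounts to comparing coefficients.
    t : ℕ
    t = 2 ℕ.* suc (N ℕ.+ N′)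

    s : ℤ
    s = + t

    s-nonZero : ℤ.NonZero s
    s-nonZero = _

    s^-nonZero : ∀ h → ℤ.NonZero (s ^ h)
    s^-nonZero h = ℤ.≢-nonZero (λ eq → s≢0 (ℤ.i^n≡0⇒i≡0 s h eq))
      where s≢0 : s ≢ 0ℤ
            s≢0 ()

    cancel : ∀ h z → s ^ suc h ∣ z * s ^ h → s ∣ z
    cancel h z = *-cancelʳ-∣ (s ^ h) {{s^-nonZero h}}

    2∣s : + 2 ∣ s
    2∣s = ∣ᵤ⇒∣ (ℕ.m∣m*n (suc (N ℕ.+ N′)))

    -- The difference is smaller than `s` in absolute value, so a multiple of `s` must vanish. The
    -- factors 2 are those with which cycles enter.
    bounded : s ∣ + 2 * + N - + 2 * + N′ → N ≡ N′
    bounded s∣ with ℤ.∣ + 2 * + N - + 2 * + N′ ∣ ℕ.≟ 0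
    ... | yes ≡0 = ℤ.+-injective (ℤ.*-cancelˡ-≡ (+ 2) (+ N) (+ N′) (ℤ.i-j≡0⇒i≡j _ _ (ℤ.∣i∣≡0⇒i≡0 ≡0)))
    ... | no ≢0 = ⊥-elim (ℕ.>⇒∤ {{ℕ.≢-nonZero ≢0}} small (∣⇒∣ᵤ s∣))
      where
      open ℕ.≤-Reasoning
      small : ℤ.∣ + 2 * + N - + 2 * + N′ ∣ < t
      small = begin-strict
        ℤ.∣ + 2 * + N - + 2 * + N′ ∣         ≤⟨ ℤ.∣i-j∣≤∣i∣+∣j∣ (+ 2 * + N) (+ 2 * + N′) ⟩
        ℤ.∣ + 2 * + N ∣ ℕ.+ ℤ.∣ + 2 * + N′ ∣   ≡⟨ cong₂ ℕ._+_ (ℤ.abs-* (+ 2) (+ N)) (ℤ.abs-* (+ 2) (+ N′)) ⟩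
        2 ℕ.* N ℕ.+ 2 ℕ.* N′                       ≡⟨ ℕ.*-distribˡ-+ 2 N N′ ⟨
        2 ℕ.* (N ℕ.+ N′)                           <⟨ ℕ.*-monoʳ-< 2 (ℕ.n<1+n (N ℕ.+ N′)) ⟩
        t ∎

    units : ∀ h → s ^ suc h ∣ + 2 * + N * s ^ h - + 2 * + N′ * s ^ h → N ≡ N′
    units h d = bounded (cancel h _ (∣-resp (factor (+ N) (+ N′) (s ^ h)) d))
      where
      factor : ∀ a b x → + 2 * a * x - + 2 * b * x ≡ (+ 2 * a - + 2 * b) * x
      factor = solve-∀

    ±1-odd : ∀ a → ¬ + 2 ∣ -1ℤ ^ a
    ±1-odd a 2∣ = 2∤1 (subst (2 ℕ.∣_) (abs a) (∣⇒∣ᵤ 2∣))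
      where
      abs : ∀ a → ℤ.∣ -1ℤ ^ a ∣ ≡ 1
      abs zero    = refl
      abs (suc a) = trans (ℤ.abs-* -1ℤ (-1ℤ ^ a)) (trans (ℕ.*-identityˡ _) (abs a))
      2∤1 : ¬ 2 ℕ.∣ 1
      2∤1 = ℕ.>⇒∤ (s≤s (s≤s z≤n))

    module _ (a a′ h : ℕ) (a<a′ : a < a′)
             (d : s ^ suc h ∣ (lead a s + + 2 * + N * s ^ h) - (lead a′ s + + 2 * + N′ * s ^ h)) where

      private
        x  = s * (s * signedPower s a)
        x′ = s * (s * signedPower s a′)
        q  = (1ℤ + s) * (1ℤ + s)

      -- Below order 2a + 2 neither correction is visible: both are multiples of `s^(h+1)`, and the
      -- terms in `base s` cancel.
      early : suc h ≤ 2 ℕ.+ (a ℕ.+ a) → N ≡ N′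
      early h< = units h (∣-resp (expand s (signedPower s a) (signedPower s a′) (base s) (+ 2 * + N * s ^ h) (+ 2 * + N′ * s ^ h))
        (∣m∣n⇒∣m+n d (∣n⇒∣m*n q (∣m∣n⇒∣m-n (∣-s²-signedPower s a h<)
          (∣-s²-signedPower s a′ (ℕ.≤-trans h< (ℕ.+-monoʳ-≤ 2 (ℕ.+-mono-≤ (ℕ.<⇒≤ a<a′) (ℕ.<⇒≤ a<a′)))))))))
        where
        expand : ∀ s α β b m m′ →
          ((b * b - (s + s * s) * (s + s * s) * α + m) - (b * b - (s + s * s) * (s + s * s) * β + m′))
          + (1ℤ + s) * (1ℤ + s) * (s * (s * α) - s * (s * β)) ≡ m - m′
        expand = solve-∀

      -- Otherwise the coefficient of s^(2a+2) would be odd on one side only.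
      late : ¬ 2 ℕ.+ (a ℕ.+ a) ≤ h
      late e≤h = ±1-odd a (∣-resp (remaining s (-1ℤ ^ a) (+ N * y) (+ N′ * y))
        (∣m∣n⇒∣m-n (∣m∣n⇒∣m-n (∣m⇒∣m*n (+ N * y - + N′ * y) ∣-refl) (∣-trans 2∣s s∣)) (∣m⇒∣m*n ((+ 2 + s) * -1ℤ ^ a) 2∣s)))
        where
        e = 2 ℕ.+ (a ℕ.+ a)
        y = s ^ (h ℕ.∸ e)
        quotient′ : ℤ
        quotient′ = + 2 * (+ N * y - + N′ * y) - q * -1ℤ ^ a
        expand : ∀ s α β b n n′ →
          ((b * b - (s + s * s) * (s + s * s) * α + + 2 * n) - (b * b - (s + s * s) * (s + s * s) * β + + 2 * n′))
          - (1ℤ + s) * (1ℤ + s) * (s * (s * β)) ≡ + 2 * (n - n′) - (1ℤ + s) * (1ℤ + s) * (s * (s * α))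
        expand = solve-∀
        regroup : ∀ n n′ y z q g → + 2 * (n * (z * y) - n′ * (z * y)) - q * (g * z) ≡
          (+ 2 * (n * y - n′ * y) - q * g) * z
        regroup = solve-∀
        -- All that is left is a multiple of `s^e`; the correction of `a′` goes beyond it by
        -- `a < a′` and is removed beforehand.
        s∣ : s ∣ quotient′
        s∣ = cancel e quotient′ (∣-resp
          (begin
            _ ≡⟨ cong₂ (λ m m′ → ((lead a s + m) - (lead a′ s + m′)) - q * x′) (ℤ.*-assoc (+ 2) (+ N) (s ^ h)) (ℤ.*-assoc (+ 2) (+ N′) (s ^ h)) ⟩
            _ ≡⟨ expand s (signedPower s a) (signedPower s a′) (base s) (+ N * s ^ h) (+ N′ * s ^ h) ⟩
            + 2 * (+ N * s ^ h - + N′ * s ^ h) - q * x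
              ≡⟨ cong₂ (λ m z → + 2 * (+ N * m - + N′ * m) - q * z) (^-split s e≤h) (s²-signedPower s a) ⟩
            + 2 * (+ N * (s ^ e * y) - + N′ * (s ^ e * y)) - q * (-1ℤ ^ a * s ^ e)
              ≡⟨ regroup (+ N) (+ N′) y (s ^ e) q (-1ℤ ^ a) ⟩
            quotient′ * s ^ e ∎)
          (∣m∣n⇒∣m-n (∣-trans (^-mono-∣ s (s≤s e≤h)) d)
            (∣n⇒∣m*n q (∣-s²-signedPower s a′ (s≤s (s≤s (subst (_≤ a′ ℕ.+ a′) (ℕ.+-suc a a) (ℕ.+-mono-≤ (ℕ.<⇒≤ a<a′) a<a′))))))))
          where open ≡-Reasoning
        remaining : ∀ s g m m′ → + 2 * (m - m′) - (+ 2 * (m - m′) - (1ℤ + s) * (1ℤ + s) * g) - s * ((+ 2 + s) * g) ≡ g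
        remaining = solve-∀

  -- If `a` and `a′` differ, the smaller correction exceeds order h, since it would have odd leading
  -- coefficient against only even ones. Hence no correction interferes with the count of cycles,
  -- and a correction that could be seen at order h determines `a`.
  parity : ∀ a a′ h N N′ →
    (∀ s → s ^ suc h ∣ (lead a s + + 2 * + N * s ^ h) - (lead a′ s + + 2 * + N′ * s ^ h)) →
    N ≡ N′ × (2 ℕ.+ (a ℕ.+ a) ≤ h ⊎ 2 ℕ.+ (a′ ℕ.+ a′) ≤ h → a ≡ a′)
  parity a a′ h N N′ d with ℕ.<-cmp a a′
  ... | tri≈ _ refl _ = units h (∣-resp (same (lead a s) _ _) (d s)) , λ _ → refl
    where
    open Parity N N′
    same : ∀ l m m′ → (l + m) - (l + m′) ≡ m - m′
    same = solve-∀
  ... | tri< a<a′ _ _ = early a a′ h a<a′ (d s) (ℕ.≰⇒> ¬late) , λ where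
      (inj₁ e≤h) → ⊥-elim (¬late e≤h)
      (inj₂ e≤h) → ⊥-elim (¬late (ℕ.≤-trans (ℕ.+-monoʳ-≤ 2 (ℕ.+-mono-≤ (ℕ.<⇒≤ a<a′) (ℕ.<⇒≤ a<a′))) e≤h))
    where
    open Parity N N′
    ¬late = late a a′ h a<a′ (d s)
  ... | tri> _ _ a′<a = sym (early a′ a h a′<a d′ (ℕ.≰⇒> ¬late)) , λ where
      (inj₂ e≤h) → ⊥-elim (¬late e≤h)
      (inj₁ e≤h) → ⊥-elim (¬late (ℕ.≤-trans (ℕ.+-monoʳ-≤ 2 (ℕ.+-mono-≤ (ℕ.<⇒≤ a′<a) (ℕ.<⇒≤ a′<a))) e≤h))
    where
    open Parity N′ N
    negate : ∀ x y → - (x - y) ≡ y - x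
    negate = solve-∀
    d′ = ∣-resp (negate (lead a s + + 2 * + N * s ^ h) (lead a′ s + + 2 * + N′ * s ^ h)) (∣m⇒∣-m (d s))
    ¬late = late a′ a h a′<a d′

-- Lowest terms of the core polynomials and of the cycle factors.

module Expansions where

  open LoopsAndTerminals using (cycleValue; cyclesValue; cyclesValue-[]; cyclesValue-∷)
  open CorePolynomials
  open CoreValues using (thetaValue; dumbbellValue; thetaValue-def; dumbbellValue-def)
  open Parities

  powerSum : ℤ → List ℕ → ℤ
  powerSum s = foldr (λ k t → s ℤ.^ k ℤ.+ t) 0ℤ

  powerSum-++ : ∀ s ks ls → powerSum s (ks ++ ls) ≡ powerSum s ks ℤ.+ powerSum s ls
  powerSum-++ s []       ls = sym (ℤ.+-identityˡ _)
  powerSum-++ s (k ∷ ks) ls = trans (cong (λ z → s ℤ.^ k ℤ.+ z) (powerSum-++ s ks ls)) (sym (ℤ.+-assoc (s ℤ.^ k) _ _))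

  ∣-powerSum : ∀ s {h ks} → All (h ≤_) ks → s ℤ.^ h ∣ powerSum s ks
  ∣-powerSum s []       = divides 0ℤ refl
  ∣-powerSum s (q ∷ qs) = ∣m∣n⇒∣m+n (^-mono-∣ s q) (∣-powerSum s qs)

  private
    infixr 7 _∙_
    _∙_ : ∀ {d y} x → d ∣ y → d ∣ x ℤ.* y
    x ∙ q = ∣n⇒∣m*n x q

    infixl 6 _∔_
    _∔_ : ∀ {d x y} → d ∣ x → d ∣ y → d ∣ x ℤ.+ y
    _∔_ = ∣m∣n⇒∣m+n

    two+ : ∀ s h {x} → s ℤ.^ h ∣ x → s ℤ.^ (2 ℕ.+ h) ∣ s ℤ.* (s ℤ.* x)
    two+ s h q = *-monoʳ-∣ s (*-monoʳ-∣ s q)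

    ∣-^-* : ∀ s k h {x y} → s ℤ.^ k ∣ x → s ℤ.^ h ∣ y → s ℤ.^ (k ℕ.+ h) ∣ x ℤ.* y
    ∣-^-* s k h {x} {y} (divides q refl) (divides q′ refl) =
      divides (q ℤ.* q′) (trans (rearrange q q′ (s ℤ.^ k) (s ℤ.^ h)) (cong (q ℤ.* q′ ℤ.*_) (sym (ℤ.^-distribˡ-+-* s k h))))
      where
      rearrange : ∀ q q′ a b → q ℤ.* a ℤ.* (q′ ℤ.* b) ≡ q ℤ.* q′ ℤ.* (a ℤ.* b)
      rearrange = solve-∀

    2≤2a : ∀ {a} → 1 ≤ a → 2 ≤ a ℕ.+ a
    2≤2a 1≤a = ℕ.+-mono-≤ 1≤a 1≤a

  -- A cycle of length k contributes 2 s^k (1 + j s + ⋯), where j is the number of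
  -- vertices of degree 3 off the cycle: Γ lists the lengths k, and Δ lists each k
  -- with multiplicity j.
  Expands : (ℤ → ℤ) → (ℤ → ℤ) → List ℕ → List ℕ → Set
  Expands F L Γ Δ = ∀ h s → 2 ≤ h → All (h ≤_) Γ →
    s ℤ.^ (2 ℕ.+ h) ∣ F s ℤ.- (L s ℤ.+ + 2 ℤ.* powerSum s Γ ℤ.+ + 2 ℤ.* s ℤ.* powerSum s Δ)

  -- The expansion of a theta graph when a and b are known already: only c remains.
  leadPair : ℕ → ℕ → ℤ → ℤ
  leadPair a b s = base s ℤ.* base s ℤ.- (s ℤ.+ s ℤ.* s) ℤ.* (s ℤ.+ s ℤ.* s) ℤ.* (signedPower s a ℤ.+ signedPower s b)
    ℤ.+ (1ℤ ℤ.- s) ℤ.* (1ℤ ℤ.- s) ℤ.* (signedPower s a ℤ.* signedPower s b)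
    ℤ.+ + 2 ℤ.* ((1ℤ ℤ.+ s ℤ.* s) ℤ.* (1ℤ ℤ.+ s ℤ.* s)) ℤ.* (s ℤ.^ a ℤ.* s ℤ.^ b)

  module _ {a b c : ℕ} (1≤a : 1 ≤ a) (a≤b : a ≤ b) (b≤c : b ≤ c) where

    private
      1≤b = ℕ.≤-trans 1≤a a≤b
      a+b≤b+b = ℕ.+-monoˡ-≤ b a≤b
      a+b≤b+c = ℕ.+-mono-≤ a≤b b≤c
      a+b≤c+c = ℕ.≤-trans a+b≤b+c (ℕ.+-monoˡ-≤ c b≤c)
      a+c≤c+c = ℕ.+-monoˡ-≤ c (ℕ.≤-trans a≤b b≤c)
      a+c≤b+c = ℕ.+-monoˡ-≤ c a≤b

    -- As 2b and 2c are at least a + b, every omitted term has order h from a cycle or a signed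
    -- power, and two further orders from `s²`, from another signed power or from a product of two
    -- path powers. There are no defects: each cycle of a theta graph passes through both cubic
    -- vertices.
    theta-expands : Expands (λ s → thetaValue s a b c) (lead a) (a ℕ.+ b ∷ a ℕ.+ c ∷ b ℕ.+ c ∷ []) []
    theta-expands h s 2≤h (h≤ab ∷ h≤ac ∷ h≤bc ∷ []) =
      ∣-resp (trans (sym (expand s α β γ x y z)) (cong₂ ℤ._-_ (sym (thetaValue-def s a b c))
        (trans (leads s α (x ℤ.* y) (x ℤ.* z) (y ℤ.* z))
          (sym (cong₂ (λ m w → lead a s ℤ.+ + 2 ℤ.* m ℤ.+ w) (cong₂ ℤ._+_ (ℤ.^-distribˡ-+-* s a b) (cong₂ ℤ._+_ (ℤ.^-distribˡ-+-* s a c) (cong (ℤ._+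
            0ℤ) (ℤ.^-distribˡ-+-* s b c)))) (ℤ.*-zeroʳ (+ 2 ℤ.* s)))))))
        ( (+ 2 ℤ.* (+ 2 ℤ.+ s ℤ.* s)) ∙ two+ s h (xy ∔ xz ∔ yz)
        ∔ (ℤ.- ((1ℤ ℤ.+ s) ℤ.* (1ℤ ℤ.+ s))) ∙ two+ s h (β∣ ∔ γ∣)
        ∔ ((1ℤ ℤ.- s) ℤ.* (1ℤ ℤ.- s)) ∙ (∣-^-* s 2 h α² β∣ ∔ ∣-^-* s 2 h α² γ∣ ∔ ∣-^-* s 2 h β² γ∣)
        ∔ (ℤ.- ((+ 2 ℤ.- s ℤ.+ s ℤ.* s) ℤ.* (+ 2 ℤ.- s ℤ.+ s ℤ.* s))) ∙ ∣m⇒∣m*n γ (∣-^-* s 2 h α² β∣)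
        ∔ (ℤ.- (+ 2 ℤ.* ((1ℤ ℤ.+ s ℤ.* s) ℤ.* (1ℤ ℤ.+ s ℤ.* s)))) ∙ (∣-^-* s 2 h xy² γ∣ ∔ ∣-^-* s 2 h xz² β∣ ∔ ∣-^-* s 2 h α² yz))
      where
      α = signedPower s a
      β = signedPower s b
      γ = signedPower s c
      x = s ℤ.^ a
      y = s ℤ.^ b
      z = s ℤ.^ c
      α² : s ℤ.^ 2 ∣ α
      α² = ∣-signedPower s a (2≤2a 1≤a)
      β² : s ℤ.^ 2 ∣ β
      β² = ∣-signedPower s b (2≤2a 1≤b)
      β∣ : s ℤ.^ h ∣ β
      β∣ = ∣-signedPower s b (ℕ.≤-trans h≤ab a+b≤b+b)
      γ∣ : s ℤ.^ h ∣ γ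
      γ∣ = ∣-signedPower s c (ℕ.≤-trans h≤ab a+b≤c+c)
      product : ∀ {m} i j → m ≤ i ℕ.+ j → s ℤ.^ m ∣ s ℤ.^ i ℤ.* s ℤ.^ j
      product i j m≤ = ∣-resp (ℤ.^-distribˡ-+-* s i j) (^-mono-∣ s m≤)
      xy : s ℤ.^ h ∣ x ℤ.* y
      xy = product a b h≤ab
      xz : s ℤ.^ h ∣ x ℤ.* z
      xz = product a c h≤ac
      yz : s ℤ.^ h ∣ y ℤ.* z
      yz = product b c h≤bc
      xy² : s ℤ.^ 2 ∣ x ℤ.* y
      xy² = product a b (ℕ.+-mono-≤ 1≤a 1≤b)
      xz² : s ℤ.^ 2 ∣ x ℤ.* z
      xz² = product a c (ℕ.+-mono-≤ 1≤a (ℕ.≤-trans 1≤b b≤c))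
      leads : ∀ s α xy xz yz → ((1ℤ ℤ.+ s ℤ.+ + 2 ℤ.* (s ℤ.* s)) ℤ.* (1ℤ ℤ.+ s ℤ.+ + 2 ℤ.* (s ℤ.* s)) ℤ.- (s ℤ.+ s ℤ.* s) ℤ.* (s ℤ.+ s ℤ.* s)
        ℤ.* α ℤ.+ + 2 ℤ.* (xy ℤ.+ xz ℤ.+ yz)) ≡
        ((1ℤ ℤ.+ s ℤ.+ + 2 ℤ.* (s ℤ.* s)) ℤ.* (1ℤ ℤ.+ s ℤ.+ + 2 ℤ.* (s ℤ.* s)) ℤ.- (s ℤ.+ s ℤ.* s) ℤ.* (s ℤ.+ s ℤ.* s) ℤ.* α ℤ.+ + 2 ℤ.* (xy
          ℤ.+ (xz ℤ.+ (yz ℤ.+ 0ℤ))) ℤ.+ 0ℤ)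
      leads = solve-∀
      expand : ∀ s α β γ x y z →
        ((1ℤ ℤ.+ s ℤ.+ + 2 ℤ.* (s ℤ.* s)) ℤ.* (1ℤ ℤ.+ s ℤ.+ + 2 ℤ.* (s ℤ.* s)) ℤ.+ + 2 ℤ.* ((1ℤ ℤ.+ s ℤ.* s) ℤ.* (1ℤ ℤ.+ s ℤ.* s)) ℤ.* (x ℤ.* y
          ℤ.+ x ℤ.* z ℤ.+ y ℤ.* z)   ℤ.- (s ℤ.+ s ℤ.* s) ℤ.* (s ℤ.+ s ℤ.* s) ℤ.* (α ℤ.+ β ℤ.+ γ)   ℤ.+ (1ℤ ℤ.- s) ℤ.* (1ℤ ℤ.- s) ℤ.* (α ℤ.* β
          ℤ.+ α ℤ.* γ ℤ.+ β ℤ.* γ)   ℤ.- (+ 2 ℤ.- s ℤ.+ s ℤ.* s) ℤ.* (+ 2 ℤ.- s ℤ.+ s ℤ.* s) ℤ.* (α ℤ.* β ℤ.* γ)   ℤ.- + 2 ℤ.* ((1ℤ ℤ.+ s ℤ.* s)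
          ℤ.* (1ℤ ℤ.+ s ℤ.* s)) ℤ.* (x ℤ.* y ℤ.* γ ℤ.+ x ℤ.* z ℤ.* β ℤ.+ y ℤ.* z ℤ.* α)) ℤ.- ((1ℤ ℤ.+ s ℤ.+ + 2 ℤ.* (s ℤ.* s)) ℤ.* (1ℤ ℤ.+ s ℤ.+
          + 2 ℤ.* (s ℤ.* s)) ℤ.- (s ℤ.+ s ℤ.* s) ℤ.* (s ℤ.+ s ℤ.* s) ℤ.* α ℤ.+ + 2 ℤ.* (x ℤ.* y ℤ.+ x ℤ.* z ℤ.+ y ℤ.* z)) ≡
        + 2 ℤ.* (+ 2 ℤ.+ s ℤ.* s) ℤ.* (s ℤ.* (s ℤ.* (x ℤ.* y ℤ.+ x ℤ.* z ℤ.+ y ℤ.* z)))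
        ℤ.+ (ℤ.- ((1ℤ ℤ.+ s) ℤ.* (1ℤ ℤ.+ s))) ℤ.* (s ℤ.* (s ℤ.* (β ℤ.+ γ)))
        ℤ.+ (1ℤ ℤ.- s) ℤ.* (1ℤ ℤ.- s) ℤ.* (α ℤ.* β ℤ.+ α ℤ.* γ ℤ.+ β ℤ.* γ)
        ℤ.+ (ℤ.- ((+ 2 ℤ.- s ℤ.+ s ℤ.* s) ℤ.* (+ 2 ℤ.- s ℤ.+ s ℤ.* s))) ℤ.* (α ℤ.* β ℤ.* γ)
        ℤ.+ (ℤ.- (+ 2 ℤ.* ((1ℤ ℤ.+ s ℤ.* s) ℤ.* (1ℤ ℤ.+ s ℤ.* s)))) ℤ.* (x ℤ.* y ℤ.* γ ℤ.+ x ℤ.* z ℤ.* β ℤ.+ α ℤ.* (y ℤ.* z))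
      expand = solve-∀

    -- All terms in `a` and `b` alone are kept exactly in `leadPair`, so the estimate may start at a
    -- + c instead of a + b; here 2c is at least a + c.
    theta-expands-pair : Expands (λ s → thetaValue s a b c) (leadPair a b) (a ℕ.+ c ∷ b ℕ.+ c ∷ []) []
    theta-expands-pair h s 2≤h (h≤ac ∷ h≤bc ∷ []) =
      ∣-resp (trans (sym (expand s α β γ x y z)) (cong₂ ℤ._-_ (sym (thetaValue-def s a b c))
        (trans (leads (leadPair a b s) (x ℤ.* z) (y ℤ.* z))
          (sym (cong₂ (λ m w → leadPair a b s ℤ.+ + 2 ℤ.* m ℤ.+ w) (cong₂ ℤ._+_ (ℤ.^-distribˡ-+-* s a c) (cong (ℤ._+ 0ℤ) (ℤ.^-distribˡ-+-* s b c)))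
            (ℤ.*-zeroʳ (+ 2 ℤ.* s)))))))
        ( (+ 2 ℤ.* (+ 2 ℤ.+ s ℤ.* s)) ∙ two+ s h (xz ∔ yz)
        ∔ (ℤ.- ((1ℤ ℤ.+ s) ℤ.* (1ℤ ℤ.+ s))) ∙ two+ s h γ∣
        ∔ ((1ℤ ℤ.- s) ℤ.* (1ℤ ℤ.- s)) ∙ (∣-^-* s 2 h α² γ∣ ∔ ∣-^-* s 2 h β² γ∣)
        ∔ (ℤ.- ((+ 2 ℤ.- s ℤ.+ s ℤ.* s) ℤ.* (+ 2 ℤ.- s ℤ.+ s ℤ.* s))) ∙ ∣-^-* s 2 h (∣m⇒∣m*n β α²) γ∣
        ∔ (ℤ.- (+ 2 ℤ.* ((1ℤ ℤ.+ s ℤ.* s) ℤ.* (1ℤ ℤ.+ s ℤ.* s)))) ∙ (∣-^-* s 2 h xy² γ∣ ∔ ∣-^-* s 2 h β² xz ∔ ∣-^-* s 2 h α² yz))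
      where
      α = signedPower s a
      β = signedPower s b
      γ = signedPower s c
      x = s ℤ.^ a
      y = s ℤ.^ b
      z = s ℤ.^ c
      α² : s ℤ.^ 2 ∣ α
      α² = ∣-signedPower s a (2≤2a 1≤a)
      β² : s ℤ.^ 2 ∣ β
      β² = ∣-signedPower s b (2≤2a 1≤b)
      γ∣ : s ℤ.^ h ∣ γ
      γ∣ = ∣-signedPower s c (ℕ.≤-trans h≤ac a+c≤c+c)
      product : ∀ {m} i j → m ≤ i ℕ.+ j → s ℤ.^ m ∣ s ℤ.^ i ℤ.* s ℤ.^ j
      product i j m≤ = ∣-resp (ℤ.^-distribˡ-+-* s i j) (^-mono-∣ s m≤)
      xz : s ℤ.^ h ∣ x ℤ.* z
      xz = product a c h≤ac
      yz : s ℤ.^ h ∣ y ℤ.* z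
      yz = product b c h≤bc
      xy² : s ℤ.^ 2 ∣ x ℤ.* y
      xy² = product a b (ℕ.+-mono-≤ 1≤a 1≤b)
      leads : ∀ l xz yz → l ℤ.+ + 2 ℤ.* (xz ℤ.+ yz) ≡ l ℤ.+ + 2 ℤ.* (xz ℤ.+ (yz ℤ.+ 0ℤ)) ℤ.+ 0ℤ
      leads = solve-∀
      expand : ∀ s α β γ x y z →
        ((1ℤ ℤ.+ s ℤ.+ + 2 ℤ.* (s ℤ.* s)) ℤ.* (1ℤ ℤ.+ s ℤ.+ + 2 ℤ.* (s ℤ.* s)) ℤ.+ + 2 ℤ.* ((1ℤ ℤ.+ s ℤ.* s) ℤ.* (1ℤ ℤ.+ s ℤ.* s)) ℤ.* (x ℤ.* y
          ℤ.+ x ℤ.* z ℤ.+ y ℤ.* z)   ℤ.- (s ℤ.+ s ℤ.* s) ℤ.* (s ℤ.+ s ℤ.* s) ℤ.* (α ℤ.+ β ℤ.+ γ)   ℤ.+ (1ℤ ℤ.- s) ℤ.* (1ℤ ℤ.- s) ℤ.* (α ℤ.* β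
          ℤ.+ α ℤ.* γ ℤ.+ β ℤ.* γ)   ℤ.- (+ 2 ℤ.- s ℤ.+ s ℤ.* s) ℤ.* (+ 2 ℤ.- s ℤ.+ s ℤ.* s) ℤ.* (α ℤ.* β ℤ.* γ)   ℤ.- + 2 ℤ.* ((1ℤ ℤ.+ s ℤ.* s)
          ℤ.* (1ℤ ℤ.+ s ℤ.* s)) ℤ.* (x ℤ.* y ℤ.* γ ℤ.+ x ℤ.* z ℤ.* β ℤ.+ y ℤ.* z ℤ.* α)) ℤ.- ((1ℤ ℤ.+ s ℤ.+ + 2 ℤ.* (s ℤ.* s)) ℤ.* (1ℤ ℤ.+ s ℤ.+
          + 2 ℤ.* (s ℤ.* s)) ℤ.- (s ℤ.+ s ℤ.* s) ℤ.* (s ℤ.+ s ℤ.* s) ℤ.* (α ℤ.+ β)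
          ℤ.+ (1ℤ ℤ.- s) ℤ.* (1ℤ ℤ.- s) ℤ.* (α ℤ.* β) ℤ.+ + 2 ℤ.* ((1ℤ ℤ.+ s ℤ.* s) ℤ.* (1ℤ ℤ.+ s ℤ.* s)) ℤ.* (x ℤ.* y)
          ℤ.+ + 2 ℤ.* (x ℤ.* z ℤ.+ y ℤ.* z)) ≡
        + 2 ℤ.* (+ 2 ℤ.+ s ℤ.* s) ℤ.* (s ℤ.* (s ℤ.* (x ℤ.* z ℤ.+ y ℤ.* z)))
        ℤ.+ (ℤ.- ((1ℤ ℤ.+ s) ℤ.* (1ℤ ℤ.+ s))) ℤ.* (s ℤ.* (s ℤ.* γ))
        ℤ.+ (1ℤ ℤ.- s) ℤ.* (1ℤ ℤ.- s) ℤ.* (α ℤ.* γ ℤ.+ β ℤ.* γ)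
        ℤ.+ (ℤ.- ((+ 2 ℤ.- s ℤ.+ s ℤ.* s) ℤ.* (+ 2 ℤ.- s ℤ.+ s ℤ.* s))) ℤ.* (α ℤ.* β ℤ.* γ)
        ℤ.+ (ℤ.- (+ 2 ℤ.* ((1ℤ ℤ.+ s ℤ.* s) ℤ.* (1ℤ ℤ.+ s ℤ.* s)))) ℤ.* (x ℤ.* y ℤ.* γ ℤ.+ β ℤ.* (x ℤ.* z) ℤ.+ α ℤ.* (y ℤ.* z))
      expand = solve-∀

  -- Each of the two cycles misses exactly one cubic vertex, so both are listed once among the
  -- defects. From h at least 2 the signed powers of `b` and `c` already have order h + 2.
  dumbbell-expands : ∀ {a b c} → 1 ≤ a → Expands (λ s → dumbbellValue s a b c) (lead a) (b ∷ c ∷ []) (b ∷ c ∷ [])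
  dumbbell-expands {a} {b} {c} 1≤a h s 2≤h (h≤b ∷ h≤c ∷ []) =
    ∣-resp (trans (sym (expand s α β γ y z)) (cong (ℤ._- (lead a s ℤ.+ + 2 ℤ.* powerSum s (b ∷ c ∷ []) ℤ.+ + 2 ℤ.* s
      ℤ.* powerSum s (b ∷ c ∷ []))) (sym (dumbbellValue-def s a b c))))
      ( K₁ ∙ two+ s h (y∣ ∔ z∣) ∔ K₂ ∙ (β∣ ∔ γ∣) ∔ (O₁ ∙ γ∣ ∔ K₃ ∙ β∣ ∔ (+ 4 ℤ.* Q) ∙ yz)
      ∔ (ℤ.- 1ℤ) ∙ (K₄ ∙ (β∣ ∔ γ∣) ∔ K₅ ∙ ∣-^-* s 2 h α² (y∣ ∔ z∣) ∔ α ∙ (O₂ ∙ γ∣ ∔ K₆ ∙ β∣ ∔ (+ 4 ℤ.* Q) ∙ yz)))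
    where
    α = signedPower s a
    β = signedPower s b
    γ = signedPower s c
    y = s ℤ.^ b
    z = s ℤ.^ c
    Q = (1ℤ ℤ.+ s ℤ.* s) ℤ.* (1ℤ ℤ.+ s ℤ.* s)
    k = base s
    w = + 2 ℤ.- s ℤ.+ s ℤ.* s
    K₁ = + 2 ℤ.* (+ 3 ℤ.+ s ℤ.+ + 2 ℤ.* (s ℤ.* s))
    K₂ = k ℤ.* (1ℤ ℤ.- s)
    O₁ = ((1ℤ ℤ.- s) ℤ.* β ℤ.+ + 2 ℤ.* (1ℤ ℤ.+ s ℤ.* s) ℤ.* y) ℤ.* (1ℤ ℤ.- s)
    K₃ = + 2 ℤ.* (1ℤ ℤ.+ s ℤ.* s) ℤ.* z ℤ.* (1ℤ ℤ.- s)
    K₄ = α ℤ.* (s ℤ.+ s ℤ.* s) ℤ.* w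
    K₅ = + 2 ℤ.* (1ℤ ℤ.+ s ℤ.* s) ℤ.* (s ℤ.+ s ℤ.* s)
    O₂ = (w ℤ.* β ℤ.+ + 2 ℤ.* (1ℤ ℤ.+ s ℤ.* s) ℤ.* y) ℤ.* w
    K₆ = + 2 ℤ.* (1ℤ ℤ.+ s ℤ.* s) ℤ.* z ℤ.* w
    α² : s ℤ.^ 2 ∣ α
    α² = ∣-signedPower s a (2≤2a 1≤a)
    β∣ : s ℤ.^ (2 ℕ.+ h) ∣ β
    β∣ = ∣-signedPower s b (ℕ.+-mono-≤ (ℕ.≤-trans 2≤h h≤b) h≤b)
    γ∣ : s ℤ.^ (2 ℕ.+ h) ∣ γ
    γ∣ = ∣-signedPower s c (ℕ.+-mono-≤ (ℕ.≤-trans 2≤h h≤c) h≤c)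
    y∣ : s ℤ.^ h ∣ y
    y∣ = ^-mono-∣ s h≤b
    z∣ : s ℤ.^ h ∣ z
    z∣ = ^-mono-∣ s h≤c
    yz : s ℤ.^ (2 ℕ.+ h) ∣ y ℤ.* z
    yz = ∣-^-* s 2 h (^-mono-∣ s (ℕ.≤-trans 2≤h h≤b)) z∣
    expand : ∀ s α β γ y z →
      ((1ℤ ℤ.+ s ℤ.+ + 2 ℤ.* (s ℤ.* s) ℤ.+ (1ℤ ℤ.- s) ℤ.* β ℤ.+ + 2 ℤ.* (1ℤ ℤ.+ s ℤ.* s) ℤ.* y) ℤ.* (1ℤ ℤ.+ s ℤ.+ + 2 ℤ.* (s ℤ.* s) ℤ.+ (1ℤ
        ℤ.- s) ℤ.* γ ℤ.+ + 2 ℤ.* (1ℤ ℤ.+ s ℤ.* s) ℤ.* z) ℤ.- α ℤ.* ((s ℤ.+ s ℤ.* s ℤ.+ (+ 2 ℤ.- s ℤ.+ s ℤ.* s) ℤ.* β ℤ.+ + 2 ℤ.* (1ℤ ℤ.+ s ℤ.* s)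
        ℤ.* y) ℤ.* (s ℤ.+ s ℤ.* s ℤ.+ (+ 2 ℤ.- s ℤ.+ s ℤ.* s) ℤ.* γ ℤ.+ + 2 ℤ.* (1ℤ ℤ.+ s ℤ.* s) ℤ.* z))) ℤ.- ((1ℤ ℤ.+ s ℤ.+ + 2 ℤ.* (s ℤ.* s))
        ℤ.* (1ℤ ℤ.+ s ℤ.+ + 2 ℤ.* (s ℤ.* s)) ℤ.- (s ℤ.+ s ℤ.* s) ℤ.* (s ℤ.+ s ℤ.* s) ℤ.* α
        ℤ.+ + 2 ℤ.* (y ℤ.+ (z ℤ.+ 0ℤ)) ℤ.+ + 2 ℤ.* s ℤ.* (y ℤ.+ (z ℤ.+ 0ℤ))) ≡
      + 2 ℤ.* (+ 3 ℤ.+ s ℤ.+ + 2 ℤ.* (s ℤ.* s)) ℤ.* (s ℤ.* (s ℤ.* (y ℤ.+ z)))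
      ℤ.+ (1ℤ ℤ.+ s ℤ.+ + 2 ℤ.* (s ℤ.* s)) ℤ.* (1ℤ ℤ.- s) ℤ.* (β ℤ.+ γ)
      ℤ.+ (((1ℤ ℤ.- s) ℤ.* β ℤ.+ + 2 ℤ.* (1ℤ ℤ.+ s ℤ.* s) ℤ.* y) ℤ.* (1ℤ ℤ.- s) ℤ.* γ ℤ.+ + 2 ℤ.* (1ℤ ℤ.+ s ℤ.* s) ℤ.* z ℤ.* (1ℤ ℤ.- s) ℤ.* β ℤ.+
        + 4 ℤ.* ((1ℤ ℤ.+ s ℤ.* s) ℤ.* (1ℤ ℤ.+ s ℤ.* s)) ℤ.* (y ℤ.* z))
      ℤ.+ (ℤ.- 1ℤ) ℤ.* (α ℤ.* (s ℤ.+ s ℤ.* s) ℤ.* (+ 2 ℤ.- s ℤ.+ s ℤ.* s) ℤ.* (β ℤ.+ γ)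
        ℤ.+ + 2 ℤ.* (1ℤ ℤ.+ s ℤ.* s) ℤ.* (s ℤ.+ s ℤ.* s) ℤ.* (α ℤ.* (y ℤ.+ z))
        ℤ.+ α ℤ.* (((+ 2 ℤ.- s ℤ.+ s ℤ.* s) ℤ.* β ℤ.+ + 2 ℤ.* (1ℤ ℤ.+ s ℤ.* s) ℤ.* y) ℤ.* (+ 2 ℤ.- s ℤ.+ s ℤ.* s) ℤ.* γ ℤ.+ + 2 ℤ.* (1ℤ ℤ.+ s
          ℤ.* s) ℤ.* z ℤ.* (+ 2 ℤ.- s ℤ.+ s ℤ.* s) ℤ.* β ℤ.+ + 4 ℤ.* ((1ℤ ℤ.+ s ℤ.* s) ℤ.* (1ℤ ℤ.+ s ℤ.* s)) ℤ.* (y ℤ.* z)))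
    expand = solve-∀

  -- Multiplying `1 + 2 s^k` by a series that starts with `1 + 2 s` adds `2 s^k + 4 s^(k+1)`: a
  -- detached cycle misses both cubic vertices, so `k` is listed twice among the defects.
  cycles-expand : ∀ {F L : ℤ → ℤ} {Γ Δ : List ℕ} ks → (∀ s → s ℤ.^ 2 ∣ L s ℤ.- (1ℤ ℤ.+ + 2 ℤ.* s)) →
    (∀ {h} → All (h ≤_) Γ → All (h ≤_) Δ) →
    Expands F L Γ Δ → Expands (λ s → cyclesValue s ks ℤ.* F s) L (ks ++ Γ) (ks ++ ks ++ Δ)
  cycles-expand {F} {L} {Γ} {Δ} [] start sub ex h s 2≤h lower =
    ∣-resp (cong (ℤ._- (L s ℤ.+ + 2 ℤ.* powerSum s Γ ℤ.+ + 2 ℤ.* s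
      ℤ.* powerSum s Δ)) (sym (trans (cong (ℤ._* F s) (cyclesValue-[] s)) (ℤ.*-identityˡ (F s))))) (ex h s 2≤h lower)
  cycles-expand {F} {L} {Γ} {Δ} (k ∷ ks) start sub ex h s 2≤h (h≤k ∷ lower) =
    ∣-resp (trans (sym (expand α x (cyclesValue s ks) (F s) (L s) s G P)) (cong₂ (λ v w → v ℤ.* F s ℤ.- (L s ℤ.+ + 2 ℤ.* (x ℤ.+ G) ℤ.+ + 2 ℤ.* s
      ℤ.* w)) (sym (cyclesValue-∷ s k ks)) (sym moved)))
      (IH ∔ ∣m⇒∣m*n T α∣ ∔ + 2 ∙ ∣-^-* s 2 h T≈ (^-mono-∣ s h≤k))
    where
    α = signedPower s k
    x = s ℤ.^ k
    T = cyclesValue s ks ℤ.* F s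
    G = powerSum s (ks ++ Γ)
    P = powerSum s (ks ++ ks ++ Δ)
    lower-Δ : All (h ≤_) (ks ++ ks ++ Δ)
    lower-Δ = All.++⁺ (All.++⁻ˡ ks lower) (All.++⁺ (All.++⁻ˡ ks lower) (sub (All.++⁻ʳ ks lower)))
    IH : s ℤ.^ (2 ℕ.+ h) ∣ T ℤ.- (L s ℤ.+ + 2 ℤ.* G ℤ.+ + 2 ℤ.* s ℤ.* P)
    IH = cycles-expand {F} {L} {Γ} {Δ} ks start sub ex h s 2≤h lower
    α∣ : s ℤ.^ (2 ℕ.+ h) ∣ α
    α∣ = ∣-signedPower s k (ℕ.+-mono-≤ (ℕ.≤-trans 2≤h h≤k) h≤k)
    split : ∀ T L G P s → T ℤ.- (L ℤ.+ + 2 ℤ.* G ℤ.+ + 2 ℤ.* s ℤ.* P) ℤ.+ (L ℤ.- (1ℤ ℤ.+ + 2 ℤ.* s)) ℤ.+ + 2 ℤ.* G ℤ.+ + 2 ℤ.* s ℤ.* P ≡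
      T ℤ.- (1ℤ ℤ.+ + 2 ℤ.* s)
    split = solve-∀
    T≈ : s ℤ.^ 2 ∣ T ℤ.- (1ℤ ℤ.+ + 2 ℤ.* s)
    T≈ = ∣-resp (split T (L s) G P s)
      (∣-trans (^-mono-∣ s (ℕ.m≤m+n 2 h)) IH ∔ start s
        ∔ + 2 ∙ ∣-trans (^-mono-∣ s 2≤h) (∣-powerSum s lower) ∔ (+ 2 ℤ.* s) ∙ ∣-trans (^-mono-∣ s 2≤h) (∣-powerSum s lower-Δ))
    collect : ∀ x a b → x ℤ.+ (a ℤ.+ (x ℤ.+ b)) ≡ + 2 ℤ.* x ℤ.+ (a ℤ.+ b)
    collect = solve-∀
    moved : powerSum s (k ∷ ks ++ k ∷ ks ++ Δ) ≡ + 2 ℤ.* x ℤ.+ P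
    moved = trans (cong (λ w → x ℤ.+ w) (powerSum-++ s ks (k ∷ ks ++ Δ)))
      (trans (collect x (powerSum s ks) (powerSum s (ks ++ Δ))) (cong (λ w → + 2 ℤ.* x ℤ.+ w) (sym (powerSum-++ s ks (ks ++ Δ)))))
    expand : ∀ α x C F L s G P → (1ℤ ℤ.+ α ℤ.+ + 2 ℤ.* x) ℤ.* C ℤ.* F ℤ.- (L ℤ.+ + 2 ℤ.* (x ℤ.+ G) ℤ.+ + 2 ℤ.* s ℤ.* (+ 2 ℤ.* x ℤ.+ P)) ≡
      C ℤ.* F ℤ.- (L ℤ.+ + 2 ℤ.* G ℤ.+ + 2 ℤ.* s ℤ.* P) ℤ.+ α ℤ.* (C ℤ.* F) ℤ.+ + 2 ℤ.* ((C ℤ.* F ℤ.- (1ℤ ℤ.+ + 2 ℤ.* s)) ℤ.* x)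
    expand = solve-∀

  lead-start : ∀ a s → s ℤ.^ 2 ∣ lead a s ℤ.- (1ℤ ℤ.+ + 2 ℤ.* s)
  lead-start a s = divides (+ 5 ℤ.+ + 4 ℤ.* s ℤ.+ + 4 ℤ.* (s ℤ.* s) ℤ.- (1ℤ ℤ.+ s) ℤ.* (1ℤ ℤ.+ s) ℤ.* signedPower s a) (expand s (signedPower s a))
    where
    expand : ∀ s α → (1ℤ ℤ.+ s ℤ.+ + 2 ℤ.* (s ℤ.* s)) ℤ.* (1ℤ ℤ.+ s ℤ.+ + 2 ℤ.* (s ℤ.* s)) ℤ.- (s ℤ.+ s ℤ.* s) ℤ.* (s ℤ.+ s ℤ.* s) ℤ.* α ℤ.- (1ℤ
      ℤ.+ + 2 ℤ.* s) ≡
      (+ 5 ℤ.+ + 4 ℤ.* s ℤ.+ + 4 ℤ.* (s ℤ.* s) ℤ.- (1ℤ ℤ.+ s) ℤ.* (1ℤ ℤ.+ s) ℤ.* α) ℤ.* (s ℤ.* (s ℤ.* 1ℤ))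
    expand = solve-∀

  leadPair-start : ∀ {a b} → 1 ≤ a → 1 ≤ b → ∀ s → s ℤ.^ 2 ∣ leadPair a b s ℤ.- (1ℤ ℤ.+ + 2 ℤ.* s)
  leadPair-start {a} {b} 1≤a 1≤b s = ∣-resp (sym (expand s (signedPower s a) (signedPower s b) (s ℤ.^ a ℤ.* s ℤ.^ b)))
    ( (+ 5 ℤ.+ + 4 ℤ.* s ℤ.+ + 4 ℤ.* (s ℤ.* s) ℤ.- (1ℤ ℤ.+ s) ℤ.* (1ℤ ℤ.+ s) ℤ.* (signedPower s a ℤ.+ signedPower s b)) ∙ ∣-refl
    ∔ ((1ℤ ℤ.- s) ℤ.* (1ℤ ℤ.- s)) ∙ ∣m⇒∣m*n (signedPower s b) (∣-signedPower s a (2≤2a 1≤a))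
    ∔ (+ 2 ℤ.* ((1ℤ ℤ.+ s ℤ.* s) ℤ.* (1ℤ ℤ.+ s ℤ.* s))) ∙ ∣-resp (ℤ.^-distribˡ-+-* s a b) (^-mono-∣ s (ℕ.+-mono-≤ 1≤a 1≤b)))
    where
    expand : ∀ s α β m → (1ℤ ℤ.+ s ℤ.+ + 2 ℤ.* (s ℤ.* s)) ℤ.* (1ℤ ℤ.+ s ℤ.+ + 2 ℤ.* (s ℤ.* s)) ℤ.- (s ℤ.+ s ℤ.* s) ℤ.* (s ℤ.+ s ℤ.* s) ℤ.* (α ℤ.+ β)
      ℤ.+ (1ℤ ℤ.- s) ℤ.* (1ℤ ℤ.- s) ℤ.* (α ℤ.* β) ℤ.+ + 2 ℤ.* ((1ℤ ℤ.+ s ℤ.* s) ℤ.* (1ℤ ℤ.+ s ℤ.* s)) ℤ.* m ℤ.- (1ℤ ℤ.+ + 2 ℤ.* s) ≡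
      (+ 5 ℤ.+ + 4 ℤ.* s ℤ.+ + 4 ℤ.* (s ℤ.* s) ℤ.- (1ℤ ℤ.+ s) ℤ.* (1ℤ ℤ.+ s) ℤ.* (α ℤ.+ β)) ℤ.* (s ℤ.* (s ℤ.* 1ℤ))
      ℤ.+ (1ℤ ℤ.- s) ℤ.* (1ℤ ℤ.- s) ℤ.* (α ℤ.* β)
      ℤ.+ + 2 ℤ.* ((1ℤ ℤ.+ s ℤ.* s) ℤ.* (1ℤ ℤ.+ s ℤ.* s)) ℤ.* m
    expand = solve-∀

-- Recovering the path lengths from the expansion.

module Comparison where

  open LoopsAndTerminals using (cyclesValue)
  open CoreValues using (thetaValue; dumbbellValue)
  open Parities
  open Expansions
  open import Data.Integer.Base using (_+_; _*_; _-_; -_; _^_)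

  multiplicity : ℕ → List ℕ → ℕ
  multiplicity h [] = 0
  multiplicity h (k ∷ ks) with h ℕ.≟ k
  ... | yes _ = suc (multiplicity h ks)
  ... | no _  = multiplicity h ks

  multiplicity-0 : ∀ {h ks} → h ∉ ks → multiplicity h ks ≡ 0
  multiplicity-0 {ks = []} h∉ = refl
  multiplicity-0 {h} {k ∷ ks} h∉ with h ℕ.≟ k
  ... | yes h≡k = ⊥-elim (h∉ (here h≡k))
  ... | no _    = multiplicity-0 (h∉ ∘ there)

  multiplicity-∈ : ∀ {h ks} → h ∈ ks → multiplicity h ks ≢ 0
  multiplicity-∈ {h} {k ∷ ks} h∈ eq with h ℕ.≟ k | h∈
  ... | yes _   | _         with () ← eq
  ... | no h≢k  | here h≡k  = h≢k h≡k
  ... | no _    | there h∈′ = multiplicity-∈ h∈′ eq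

  multiplicity-≢0 : ∀ {h} ks → multiplicity h ks ≢ 0 → h ∈ ks
  multiplicity-≢0 [] ≢0 = ⊥-elim (≢0 refl)
  multiplicity-≢0 {h} (k ∷ ks) ≢0 with h ℕ.≟ k
  ... | yes h≡k = here h≡k
  ... | no _    = there (multiplicity-≢0 ks ≢0)

  above-∉ : ∀ {h ks} → All (suc h ≤_) ks → h ∉ ks
  above-∉ lower h∈ = ℕ.1+n≰n (All.lookup lower h∈)

  raise : ∀ {h} ks → All (h ≤_) ks → h ∉ ks → All (suc h ≤_) ks
  raise ks lower h∉ = All.tabulate λ k∈ → ℕ.≤∧≢⇒< (All.lookup lower k∈) λ { refl → h∉ k∈ }

  powerSum-leading : ∀ s {h} ks → All (h ≤_) ks → s ^ suc h ∣ powerSum s ks - + multiplicity h ks * s ^ h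
  powerSum-leading s [] _ = divides 0ℤ refl
  powerSum-leading s {h} (k ∷ ks) (h≤k ∷ lower) with h ℕ.≟ k
  ... | yes refl = ∣-resp (expand (s ^ h) (powerSum s ks) (+ multiplicity h ks)) (powerSum-leading s ks lower)
    where
    expand : ∀ x P m → P - m * x ≡ (x + P) - (1ℤ + m) * x
    expand = solve-∀
  ... | no h≢k = ∣-resp (sym (ℤ.+-assoc (s ^ k) (powerSum s ks) _)) (∣m∣n⇒∣m+n (^-mono-∣ s (ℕ.≤∧≢⇒< h≤k h≢k)) (powerSum-leading s ks lower))

  powerSum-leading₂ : ∀ s {h} ks → All (h ≤_) ks →
    s ^ (2 ℕ.+ h) ∣ powerSum s ks - (+ multiplicity h ks * s ^ h + + multiplicity (suc h) ks * s ^ suc h)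
  powerSum-leading₂ s [] _ = divides 0ℤ refl
  powerSum-leading₂ s {h} (k ∷ ks) (h≤k ∷ lower) with h ℕ.≟ k | suc h ℕ.≟ k
  ... | yes refl | yes ()
  ... | yes refl | no _ = ∣-resp (expand (s ^ h) (powerSum s ks) (+ multiplicity h ks) (+ multiplicity (suc h) ks * s ^ suc h)) (powerSum-leading₂ s ks lower)
    where
    expand : ∀ x P m r → P - (m * x + r) ≡ (x + P) - ((1ℤ + m) * x + r)
    expand = solve-∀
  ... | no _ | yes refl = ∣-resp (expand (s ^ suc h) (powerSum s ks) (+ multiplicity (suc h) ks) (+ multiplicity h ks * s ^ h)) (powerSum-leading₂ s ks lower)
    where
    expand : ∀ x P m r → P - (r + m * x) ≡ (x + P) - (r + (1ℤ + m) * x)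
    expand = solve-∀
  ... | no h≢k | no 1+h≢k = ∣-resp (sym (ℤ.+-assoc (s ^ k) (powerSum s ks) _))
    (∣m∣n⇒∣m+n (^-mono-∣ s (ℕ.≤∧≢⇒< (ℕ.≤∧≢⇒< h≤k h≢k) 1+h≢k)) (powerSum-leading₂ s ks lower))

  -- `lengths` and `defects` are the lists Γ and Δ of `Expands`, bundled so that theta graphs and
  -- dumbbells can be treated alike.
  record Series : Set where
    field
      value  : ℤ → ℤ
      start  : ℤ → ℤ
      lengths defects : List ℕ
      expands : Expands value start lengths defects
      defects-above : ∀ {h} → All (h ≤_) lengths → All (h ≤_) defects
  open Series

  module Compare (A B : Series) (A≗B : ∀ s → value A s ≡ value B s) where

    private
      m : ℕ → List ℕ → ℤ
      m h ks = + multiplicity h ks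

    -- Defects carry an additional factor `s` and do not reach order h.
    level : ∀ h → 2 ≤ h → All (h ≤_) (lengths A) → All (h ≤_) (lengths B) → ∀ s →
      s ^ suc h ∣ (start A s + + 2 * m h (lengths A) * s ^ h) - (start B s + + 2 * m h (lengths B) * s ^ h)
    level h 2≤h lowerA lowerB s = ∣-resp
      (combine (value A s) (value B s) (start A s) (start B s) s (s ^ h) (powerSum s (lengths A)) (powerSum s (lengths B)) (powerSum s (defects A))
        (powerSum s (defects B)) (m h (lengths A)) (m h (lengths B)) (A≗B s))
      (∣m∣n⇒∣m+n (∣m∣n⇒∣m-n (∣-trans up (expands B h s 2≤h lowerB)) (∣-trans up (expands A h s 2≤h lowerA)))
        (∣n⇒∣m*n (+ 2) (∣m∣n⇒∣m+n (∣m∣n⇒∣m-n (powerSum-leading s (lengths B) lowerB) (powerSum-leading s (lengths A) lowerA))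
          (∣m∣n⇒∣m-n (defect B lowerB) (defect A lowerA)))))
      where
      up : s ^ suc h ∣ s ^ (2 ℕ.+ h)
      up = ^-mono-∣ s (ℕ.n≤1+n (suc h))
      defect : ∀ C → All (h ≤_) (lengths C) → s ^ suc h ∣ s * powerSum s (defects C)
      defect C lower = *-monoʳ-∣ s (∣-powerSum s (defects-above C lower))
      combine′ : ∀ F L L′ s x G G′ P P′ n n′ →
        F - (L′ + + 2 * G′ + + 2 * s * P′) - (F - (L + + 2 * G + + 2 * s * P))
          + + 2 * (G′ - n′ * x - (G - n * x) + (s * P′ - s * P)) ≡
        (L + + 2 * n * x) - (L′ + + 2 * n′ * x)
      combine′ = solve-∀
      combine : ∀ F F′ L L′ s x G G′ P P′ n n′ → F ≡ F′ →
        F′ - (L′ + + 2 * G′ + + 2 * s * P′) - (F - (L + + 2 * G + + 2 * s * P))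
          + + 2 * (G′ - n′ * x - (G - n * x) + (s * P′ - s * P)) ≡
        (L + + 2 * n * x) - (L′ + + 2 * n′ * x)
      combine F _ L L′ s x G G′ P P′ n n′ refl = combine′ F L L′ s x G G′ P P′ n n′

    -- One order higher the cycles of length h + 1 and the defects of length h add up; equality at
    -- order h is needed to cancel the terms in `s^h`.
    next-level : ∀ h → 2 ≤ h → All (h ≤_) (lengths A) → All (h ≤_) (lengths B) → multiplicity h (lengths A) ≡ multiplicity h (lengths B) → ∀ s →
      s ^ suc (suc h) ∣ (start A s + + 2 * + (multiplicity (suc h) (lengths A) ℕ.+ multiplicity h (defects A)) * s ^ suc h)
                      - (start B s + + 2 * + (multiplicity (suc h) (lengths B) ℕ.+ multiplicity h (defects B)) * s ^ suc h)
    next-level h 2≤h lowerA lowerB same s = ∣-resp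
      (combine (value A s) (value B s) (start A s) (start B s) s (s ^ h) (powerSum s (lengths A)) (powerSum s (lengths B)) (powerSum s (defects A))
        (powerSum s (defects B))
          (m h (lengths A)) (m h (lengths B)) (m (suc h) (lengths A)) (m (suc h) (lengths B)) (m h (defects A)) (m h (defects B)) (A≗B s) (cong +_ same))
      (∣m∣n⇒∣m+n (∣m∣n⇒∣m-n (expands B h s 2≤h lowerB) (expands A h s 2≤h lowerA))
        (∣n⇒∣m*n (+ 2) (∣m∣n⇒∣m+n (∣m∣n⇒∣m-n (powerSum-leading₂ s (lengths B) lowerB) (powerSum-leading₂ s (lengths A) lowerA))
          (∣m∣n⇒∣m-n (defect B lowerB) (defect A lowerA)))))
      where
      defect : ∀ C → All (h ≤_) (lengths C) → s ^ (2 ℕ.+ h) ∣ s * (powerSum s (defects C) - m h (defects C) * s ^ h)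
      defect C lower = *-monoʳ-∣ s (powerSum-leading s (defects C) (defects-above C lower))
      combine′ : ∀ F L L′ s x G G′ P P′ n k k′ d d′ →
        F - (L′ + + 2 * G′ + + 2 * s * P′) - (F - (L + + 2 * G + + 2 * s * P))
          + + 2 * (G′ - (n * x + k′ * (s * x)) - (G - (n * x + k * (s * x)))
            + (s * (P′ - d′ * x) - s * (P - d * x))) ≡
        (L + + 2 * (k + d) * (s * x)) - (L′ + + 2 * (k′ + d′) * (s * x))
      combine′ = solve-∀
      combine : ∀ F F′ L L′ s x G G′ P P′ n n′ k k′ d d′ → F ≡ F′ → n ≡ n′ →
        F′ - (L′ + + 2 * G′ + + 2 * s * P′) - (F - (L + + 2 * G + + 2 * s * P))
          + + 2 * (G′ - (n′ * x + k′ * (s * x)) - (G - (n * x + k * (s * x)))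
            + (s * (P′ - d′ * x) - s * (P - d * x))) ≡
        (L + + 2 * (k + d) * (s * x)) - (L′ + + 2 * (k′ + d′) * (s * x))
      combine F _ L L′ s x G G′ P P′ n _ k k′ d d′ refl refl = combine′ F L L′ s x G G′ P P′ n k k′ d d′

    -- The bound for `B` is raised one step at a time: while it is below g, `A` has no cycle of that
    -- length, hence neither has `B`.
    ascend : ∀ g → (∀ h → 2 ≤ h → All (h ≤_) (lengths A) → All (h ≤_) (lengths B) → multiplicity h (lengths A) ≡ multiplicity h (lengths B)) →
      All (g ≤_) (lengths A) → All (2 ≤_) (lengths B) → 2 ≤ g → All (g ≤_) (lengths B)
    ascend g agree lowerA base≥2 2≤g = subst (λ k → All (k ≤_) (lengths B)) (ℕ.m+[n∸m]≡n 2≤g) (climb (g ℕ.∸ 2) (ℕ.≤-reflexive (ℕ.m+[n∸m]≡n 2≤g)))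
      where
      climb : ∀ d → 2 ℕ.+ d ≤ g → All (2 ℕ.+ d ≤_) (lengths B)
      climb zero    _   = base≥2
      climb (suc d) d<g = raise (lengths B) lower λ d∈ → multiplicity-∈ d∈
        (trans (sym (agree (2 ℕ.+ d) (s≤s (s≤s z≤n)) lowerA′ lower)) (multiplicity-0 (above-∉ (All.map (ℕ.≤-trans d<g) lowerA))))
        where
        lower = climb d (ℕ.<⇒≤ d<g)
        lowerA′ = All.map (ℕ.≤-trans (ℕ.<⇒≤ d<g)) lowerA

  thetaSeries : ∀ {a b c} → 1 ≤ a → a ≤ b → b ≤ c → Series
  thetaSeries {a} {b} {c} 1≤a a≤b b≤c = record
    { value = λ s → thetaValue s a b c ; start = lead a ; lengths = a ℕ.+ b ∷ a ℕ.+ c ∷ b ℕ.+ c ∷ [] ; defects = []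
    ; expands = theta-expands 1≤a a≤b b≤c ; defects-above = λ _ → [] }

  withCycles : (A : Series) (ks : List ℕ) → (∀ s → s ^ 2 ∣ start A s - (1ℤ + + 2 * s)) → Series
  withCycles A ks st = record
    { value = λ s → cyclesValue s ks * value A s ; start = start A
    ; lengths = ks ++ lengths A ; defects = ks ++ ks ++ defects A
    ; expands = cycles-expand {value A} {start A} {lengths A} {defects A} ks st (defects-above A) (expands A)
    ; defects-above = λ lower → All.++⁺ (All.++⁻ˡ ks lower) (All.++⁺ (All.++⁻ˡ ks lower) (defects-above A (All.++⁻ʳ ks lower))) }

  total : List ℕ → ℕ
  total = foldr ℕ._+_ 0

  module Uniqueness {a b c : ℕ} (1≤a : 1 ≤ a) (a≤b : a ≤ b) (b≤c : b ≤ c) (2≤b : 2 ≤ b) where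

    private
      g = a ℕ.+ b
      Θ = thetaSeries 1≤a a≤b b≤c
      2≤g : 2 ≤ g
      2≤g = ℕ.≤-trans 2≤b (ℕ.m≤n+m b a)
      above : All (g ≤_) (lengths Θ)
      above = ℕ.≤-refl ∷ ℕ.+-monoʳ-≤ a b≤c ∷ ℕ.+-mono-≤ a≤b b≤c ∷ []

    -- Conclusions valid for either kind of core, with any detached cycles: only the start `lead a′`
    -- and the bound 2 for cycle lengths are used.
    module Against (B : Series) {a′ : ℕ} (startB : ∀ s → start B s ≡ lead a′ s) (B≥2 : All (2 ≤_) (lengths B))
                   (Θ≗B : ∀ s → thetaValue s a b c ≡ value B s) where
      open Compare Θ B Θ≗B

      private
        parityAt : ∀ h N N′ → (∀ s → s ^ suc h ∣ (lead a s + + 2 * + N * s ^ h) - (start B s + + 2 * + N′ * s ^ h)) →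
          N ≡ N′ × (2 ℕ.+ (a ℕ.+ a) ≤ h ⊎ 2 ℕ.+ (a′ ℕ.+ a′) ≤ h → a ≡ a′)
        parityAt h N N′ d = parity a a′ h N N′ λ s →
          ∣-resp (cong (λ l → (lead a s + + 2 * + N * s ^ h) - (l + + 2 * + N′ * s ^ h)) (startB s)) (d s)

      girth : All (g ≤_) (lengths B)
      girth = ascend g (λ h 2≤h lΘ lB → proj₁ (parityAt h (multiplicity h (lengths Θ)) (multiplicity h (lengths B)) (level h 2≤h lΘ lB))) above B≥2 2≤g

      private
        atGirth = parityAt g (multiplicity g (lengths Θ)) (multiplicity g (lengths B)) (level g 2≤g above girth)

      girth-attained : g ∈ lengths B
      girth-attained = multiplicity-≢0 (lengths B) λ eq → multiplicity-∈ {g} {lengths Θ} (here refl) (trans (proj₁ atGirth) eq)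

      chord : 2 ℕ.+ (a ℕ.+ a) ≤ g ⊎ 2 ℕ.+ (a′ ℕ.+ a′) ≤ g → a ≡ a′
      chord = proj₂ atGirth

      half : ∀ {x y} → x ℕ.+ x ≤ suc (y ℕ.+ y) → x ≤ y
      half {x} {y} x+x≤ with x ℕ.≤? y
      ... | yes x≤y = x≤y
      ... | no x≰y = ⊥-elim (ℕ.1+n≰n (ℕ.≤-trans (ℕ.+-mono-≤ (ℕ.≰⇒> x≰y) (ℕ.≰⇒> x≰y)) (ℕ.≤-trans x+x≤ (ℕ.≤-reflexive (sym (ℕ.+-suc y y))))))

      -- Either the correction of `a′` is visible at order g, and then `chord` gives equality, or a
      -- + b is at most 2a′ + 1, while 2a is at most a + b.
      a≤a′ : a ≤ a′
      a≤a′ with 2 ℕ.+ (a′ ℕ.+ a′) ℕ.≤? g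
      ... | yes e≤g = ℕ.≤-reflexive (chord (inj₂ e≤g))
      ... | no e≰g = half (ℕ.≤-trans (ℕ.+-monoʳ-≤ a a≤b) (ℕ.s≤s⁻¹ (ℕ.≰⇒> e≰g)))

      -- For such `c` the other two cycles are longer than g + 1, so at order g + 1 the theta graph
      -- contributes nothing to the count. A defect of length g would contribute.
      no-defect : suc g ≤ c → g ∉ defects B
      no-defect g<c g∈ = multiplicity-∈ g∈ (ℕ.m+n≡0⇒n≡0 (multiplicity (suc g) (lengths B)) (trans (sym N₁≡N₁′) N₁≡0))
        where
        N₁≡N₁′ = proj₁ (parityAt (suc g) (multiplicity (suc g) (lengths Θ) ℕ.+ multiplicity g (defects Θ)) (multiplicity (suc g) (lengths B) ℕ.+
          multiplicity g (defects B)) (next-level g 2≤g above girth (proj₁ atGirth)))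
        N₁≡0 : multiplicity (suc g) (lengths Θ) ℕ.+ 0 ≡ 0
        N₁≡0 = trans (ℕ.+-identityʳ _) (multiplicity-0 {suc g} {lengths Θ} λ
          { (here eq) → ℕ.1+n≢n eq
          ; (there (here eq)) → ℕ.<⇒≢ (ℕ.+-mono-≤ 1≤a g<c) eq
          ; (there (there (here eq))) → ℕ.<⇒≢ (ℕ.+-mono-≤ (ℕ.≤-trans 1≤a a≤b) g<c) eq })

      -- If the correction of `a` is not visible at the girth, then g is at most 2a + 1; now 2a′ is
      -- at most g as well, which supplies the inequality opposite to `a≤a′`.
      same-path : ∀ {b′} → a′ ≤ b′ → a′ ℕ.+ b′ ≡ g → a ≡ a′
      same-path {b′} a′≤b′ eq with 2 ℕ.+ (a ℕ.+ a) ℕ.≤? g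
      ... | yes e≤g = chord (inj₁ e≤g)
      ... | no e≰g = ℕ.≤-antisym a≤a′ (half (ℕ.≤-trans (ℕ.≤-trans (ℕ.+-monoʳ-≤ a′ a′≤b′) (ℕ.≤-reflexive eq)) (ℕ.s≤s⁻¹ (ℕ.≰⇒> e≰g))))

    private
      regroup : ∀ a b c → a ℕ.+ b ℕ.+ c ≡ c ℕ.+ (a ℕ.+ b)
      regroup = ℕR.solve-∀

    -- Every cycle of a dumbbell with detached cycles misses a cubic vertex, so a shortest one is a
    -- defect of length g. But its two lobes have g edges or more each and the connecting path at
    -- least one, so the number of edges gives c > g, and `no-defect` applies.
    not-dumbbell : ∀ {a′ b′ c′ ks} → 1 ≤ a′ → 2 ≤ b′ → 2 ≤ c′ → All (2 ≤_) ks → a ℕ.+ b ℕ.+ c ≡ total ks ℕ.+ (a′ ℕ.+ b′ ℕ.+ c′) →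
      ¬ (∀ s → thetaValue s a b c ≡ cyclesValue s ks * dumbbellValue s a′ b′ c′)
    not-dumbbell {a′} {b′} {c′} {ks} 1≤a′ 2≤b′ 2≤c′ ks≥2 sum≡ eq = no-defect g<c (defect girth-attained)
      where
      core : Series
      core = record { value = λ s → dumbbellValue s a′ b′ c′ ; start = lead a′ ; lengths = b′ ∷ c′ ∷ [] ; defects = b′ ∷ c′ ∷ []
                    ; expands = dumbbell-expands 1≤a′ ; defects-above = id }
      open Against (withCycles core ks (lead-start a′)) {a′} (λ _ → refl) (All.++⁺ ks≥2 (2≤b′ ∷ 2≤c′ ∷ [])) eq
      defect : g ∈ ks ++ b′ ∷ c′ ∷ [] → g ∈ ks ++ ks ++ b′ ∷ c′ ∷ []
      defect = ∈-++⁺ʳ ks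
      bound : All (g ≤_) (b′ ∷ c′ ∷ []) → suc g ≤ c
      bound (g≤b′ ∷ g≤c′ ∷ []) = ℕ.+-cancelʳ-≤ g (suc g) c (begin
        1 ℕ.+ g ℕ.+ g                     ≤⟨ ℕ.+-mono-≤ (ℕ.+-mono-≤ 1≤a′ g≤b′) g≤c′ ⟩
        a′ ℕ.+ b′ ℕ.+ c′                  ≤⟨ ℕ.m≤n+m _ (total ks) ⟩
        total ks ℕ.+ (a′ ℕ.+ b′ ℕ.+ c′)   ≡⟨ sum≡ ⟨
        a ℕ.+ b ℕ.+ c                     ≡⟨ regroup a b c ⟩
        c ℕ.+ g                           ∎)
        where open ℕ.≤-Reasoning
      g<c : suc g ≤ c
      g<c = bound (All.++⁻ʳ ks girth)

    module _ {a′ b′ c′ : ℕ} (1≤a′ : 1 ≤ a′) (a′≤b′ : a′ ≤ b′) (b′≤c′ : b′ ≤ c′) where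

      private
        Θ′ = thetaSeries 1≤a′ a′≤b′ b′≤c′
        1≤b′ = ℕ.≤-trans 1≤a′ a′≤b′
        Θ′≥2 : All (2 ≤_) (lengths Θ′)
        Θ′≥2 = ℕ.+-mono-≤ 1≤a′ 1≤b′ ∷ ℕ.+-mono-≤ 1≤a′ (ℕ.≤-trans 1≤b′ b′≤c′) ∷ ℕ.+-mono-≤ 1≤b′ (ℕ.≤-trans 1≤b′ b′≤c′) ∷ []
        shortest : ∀ {k} → k ∈ lengths Θ′ → a′ ℕ.+ b′ ≤ k
        shortest (here refl)                 = ℕ.≤-refl
        shortest (there (here refl))         = ℕ.+-monoʳ-≤ a′ b′≤c′
        shortest (there (there (here refl))) = ℕ.+-mono-≤ a′≤b′ b′≤c′

      -- The two longest cycles of the theta graph would have to be accounted for by shorter ones.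
      no-cycles : ∀ {k ks} → a ≡ a′ → b ≡ b′ → All (2 ≤_) (k ∷ ks) → c ≡ total (k ∷ ks) ℕ.+ c′ →
        ¬ (∀ s → thetaValue s a b c ≡ cyclesValue s (k ∷ ks) * thetaValue s a′ b′ c′)
      no-cycles {k} {ks} refl refl ks≥2@(2≤k ∷ _) sum≡ eq = ℕ.1+n≰n (ℕ.≤-trans c′<c (ℕ.+-cancelˡ-≤ a c c′ (All.head (All.++⁻ʳ (k ∷ ks) longest))))
        where
        pair : ∀ {c} → b ≤ c → Series
        pair {c} b≤c = record { value = λ s → thetaValue s a b c ; start = leadPair a b ; lengths = a ℕ.+ c ∷ b ℕ.+ c ∷ [] ; defects = []
          ; expands = theta-expands-pair 1≤a a≤b b≤c ; defects-above = λ _ → [] }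
        before = pair b≤c
        after  = withCycles (pair b′≤c′) (k ∷ ks) (leadPair-start 1≤a (ℕ.≤-trans 1≤a a≤b))
        open Compare before after eq
        same-start : ∀ L m m′ → (L + m) - (L + m′) ≡ m - m′
        same-start = solve-∀
        agree : ∀ h → 2 ≤ h → All (h ≤_) (lengths before) → All (h ≤_) (lengths after) → multiplicity h (lengths before) ≡ multiplicity h (lengths after)
        agree h 2≤h l l′ = units h (∣-resp (same-start (leadPair a b s) (+ 2 * + multiplicity h (lengths before) * s ^ h) (+ 2 *
          + multiplicity h (lengths after) * s ^ h))
          (level h 2≤h l l′ s))
          where open Parity (multiplicity h (lengths before)) (multiplicity h (lengths after))
        -- The leads agree, and below a + c the left side has no further cycle. The bound thus
        -- extends to a + c′, although the detached cycles make `c′` smaller than `c`.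
        longest : All (a ℕ.+ c ≤_) (lengths after)
        longest = ascend (a ℕ.+ c) agree (ℕ.≤-refl ∷ ℕ.+-monoˡ-≤ c a≤b ∷ [])
          (All.++⁺ ks≥2 (All.tail Θ′≥2)) (ℕ.+-mono-≤ 1≤a (ℕ.≤-trans 1≤b′ b≤c))
        c′<c : suc c′ ≤ c
        c′<c = ℕ.≤-trans (ℕ.+-monoˡ-≤ c′ (ℕ.≤-trans (ℕ.≤-trans (s≤s z≤n) 2≤k) (ℕ.m≤m+n k (total ks)))) (ℕ.≤-reflexive (sym sum≡))

      -- The girth is attained by a detached cycle or within the core. A detached one is a defect,
      -- and again the number of edges gives c > g. Within the core it must be a′ + b′, whereupon
      -- `same-path` and `no-cycles` finish.
      unique-theta : ∀ {ks} → All (2 ≤_) ks → a ℕ.+ b ℕ.+ c ≡ total ks ℕ.+ (a′ ℕ.+ b′ ℕ.+ c′) →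
        (∀ s → thetaValue s a b c ≡ cyclesValue s ks * thetaValue s a′ b′ c′) → ks ≡ [] × a ≡ a′ × b ≡ b′ × c ≡ c′
      unique-theta {ks} ks≥2 sum≡ eq = conclude ks refl (∈-++⁻ ks girth-attained)
        where
        open Against (withCycles Θ′ ks (lead-start a′)) {a′} (λ _ → refl) (All.++⁺ ks≥2 Θ′≥2) eq
        a′+b′≥g : g ≤ a′ ℕ.+ b′
        a′+b′≥g = All.head (All.++⁻ʳ ks girth)
        girth-in-core : g ∈ lengths Θ′ → a′ ℕ.+ b′ ≡ g
        girth-in-core g∈ = ℕ.≤-antisym (shortest g∈) a′+b′≥g
        matched : a′ ℕ.+ b′ ≡ g → a ≡ a′ × b ≡ b′ × c ≡ total ks ℕ.+ c′
        matched a′+b′≡g = a≡a′ , ℕ.+-cancelˡ-≡ a b b′ (trans (sym a′+b′≡g) (cong (ℕ._+ b′) (sym a≡a′))) ,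
          ℕ.+-cancelʳ-≡ g c _ (trans (sym (regroup a b c)) (trans sum≡ (trans (move a′ b′ c′ (total ks)) (cong (total ks ℕ.+ c′ ℕ.+_) a′+b′≡g))))
          where
          a≡a′ = same-path a′≤b′ a′+b′≡g
          move : ∀ a b c t → t ℕ.+ (a ℕ.+ b ℕ.+ c) ≡ t ℕ.+ c ℕ.+ (a ℕ.+ b)
          move = ℕR.solve-∀
        longer : ∀ {k ls} → ks ≡ k ∷ ls → g ≤ k → suc g ≤ c
        longer {k} {ls} refl g≤k = ℕ.+-cancelʳ-≤ g (suc g) c (begin
          1 ℕ.+ g ℕ.+ g                           ≤⟨ ℕ.+-mono-≤ (ℕ.+-mono-≤ (ℕ.≤-trans 1≤b′ b′≤c′) g≤k) a′+b′≥g ⟩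
          c′ ℕ.+ k ℕ.+ (a′ ℕ.+ b′)                ≤⟨ ℕ.m≤n+m _ (total ls) ⟩
          total ls ℕ.+ (c′ ℕ.+ k ℕ.+ (a′ ℕ.+ b′)) ≡⟨ move a′ b′ c′ k (total ls) ⟩
          total ks ℕ.+ (a′ ℕ.+ b′ ℕ.+ c′)         ≡⟨ sum≡ ⟨
          a ℕ.+ b ℕ.+ c                           ≡⟨ regroup a b c ⟩
          c ℕ.+ g                                 ∎)
          where
          open ℕ.≤-Reasoning
          move : ∀ a b c k t → t ℕ.+ (c ℕ.+ k ℕ.+ (a ℕ.+ b)) ≡ k ℕ.+ t ℕ.+ (a ℕ.+ b ℕ.+ c)
          move = ℕR.solve-∀
        conclude : ∀ ls → ks ≡ ls → g ∈ ks ⊎ g ∈ lengths Θ′ → ks ≡ [] × a ≡ a′ × b ≡ b′ × c ≡ c′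
        conclude []       refl (inj₂ g∈) = refl , matched (girth-in-core g∈)
        conclude (k ∷ ls) refl (inj₂ g∈) = let (p , q , r) = matched (girth-in-core g∈) in ⊥-elim (no-cycles p q ks≥2 r eq)
        conclude (k ∷ ls) refl (inj₁ g∈) = ⊥-elim (no-defect (longer refl (All.head girth)) (∈-++⁺ˡ g∈))

-- From coefficient lists to values of the homogenised polynomial.

module Homogenisation where

  open Permanent
  open ArcProducts using (shiftedLaplacian)
  open import Data.Integer.Base using (_+_; _*_; _-_; -_; _^_)

  coeff-+ : ∀ f g k → coeff (f +ᴾ g) k ≡ coeff f k + coeff g k
  coeff-+ []      g       k       = sym (ℤ.+-identityˡ _)
  coeff-+ (a ∷ f) []      k       = sym (ℤ.+-identityʳ _)
  coeff-+ (a ∷ f) (b ∷ g) zero    = refl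
  coeff-+ (a ∷ f) (b ∷ g) (suc k) = coeff-+ f g k

  coeff-scale : ∀ a f k → coeff (map (a *_) f) k ≡ a * coeff f k
  coeff-scale a []      k       = sym (ℤ.*-zeroʳ a)
  coeff-scale a (b ∷ f) zero    = refl
  coeff-scale a (b ∷ f) (suc k) = coeff-scale a f k

  delay : (ℕ → ℤ) → ℕ → ℤ
  delay φ zero    = 0ℤ
  delay φ (suc k) = φ k

  -- hom n φ is Yⁿ times the value at X / Y of the polynomial with coefficients φ.
  module _ (X Y : ℤ) where

    hom : ℕ → (ℕ → ℤ) → ℤ
    hom zero    φ = φ 0
    hom (suc n) φ = φ 0 * Y ^ suc n + X * hom n (φ ∘ suc)

    hom-cong : ∀ n {φ ψ} → (∀ k → φ k ≡ ψ k) → hom n φ ≡ hom n ψ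
    hom-cong zero    eq = eq 0
    hom-cong (suc n) eq = cong₂ (λ a b → a * Y ^ suc n + X * b) (eq 0) (hom-cong n (eq ∘ suc))

    hom-0 : ∀ n → hom n (λ _ → 0ℤ) ≡ 0ℤ
    hom-0 zero    = refl
    hom-0 (suc n) = trans (cong (λ z → 0ℤ + X * z) (hom-0 n)) (trans (ℤ.+-identityˡ _) (ℤ.*-zeroʳ X))

    hom-combination : ∀ n a b φ ψ → hom n (λ k → a * φ k + b * ψ k) ≡ a * hom n φ + b * hom n ψ
    hom-combination zero    a b φ ψ = refl
    hom-combination (suc n) a b φ ψ = trans (cong (λ z → (a * φ 0 + b * ψ 0) * Y ^ suc n + X * z) (hom-combination n a b (φ ∘ suc) (ψ ∘ suc)))
      (rearrange a b (φ 0) (ψ 0) (Y ^ suc n) X (hom n (φ ∘ suc)) (hom n (ψ ∘ suc)))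
      where
      rearrange : ∀ a b φ ψ y X h h′ → (a * φ + b * ψ) * y + X * (a * h + b * h′) ≡ a * (φ * y + X * h) + b * (ψ * y + X * h′)
      rearrange = solve-∀

    hom-raise : ∀ n {φ} → φ (suc n) ≡ 0ℤ → hom (suc n) φ ≡ Y * hom n φ
    hom-raise zero    {φ} eq rewrite eq = simplify (φ 0) X Y
      where
      simplify : ∀ f X Y → f * (Y * 1ℤ) + X * 0ℤ ≡ Y * f
      simplify = solve-∀
    hom-raise (suc n) {φ} eq = trans (cong (λ z → φ 0 * Y ^ suc (suc n) + X * z) (hom-raise n eq)) (rearrange (φ 0) X Y (Y ^ n) (hom n (φ ∘ suc)))
      where
      rearrange : ∀ f X Y y h → f * (Y * (Y * y)) + X * (Y * h) ≡ Y * (f * (Y * y) + X * h)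
      rearrange = solve-∀

    hom-delay : ∀ n φ → hom (suc n) (delay φ) ≡ X * hom n φ
    hom-delay n φ = trans (cong (_+ X * hom n φ) (ℤ.*-zeroˡ (Y ^ suc n))) (ℤ.+-identityˡ _)

  hom-1-0 : ∀ n φ → hom 1ℤ 0ℤ n φ ≡ φ n
  hom-1-0 zero    φ = refl
  hom-1-0 (suc n) φ = trans (cong₂ _+_ (ℤ.*-zeroʳ (φ 0)) (trans (ℤ.*-identityˡ _) (hom-1-0 n (φ ∘ suc)))) (ℤ.+-identityˡ _)

  -- Records how multiplication by `b + ε x` acts on coefficients, independently of the list
  -- representing that polynomial.
  record Linear (e : Poly) (b ε : ℤ) : Set where
    field coeff-* : ∀ g k → coeff (e *ᴾ g) k ≡ b * coeff g k + ε * delay (coeff g) k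
  open Linear

  constant-linear : ∀ b → Linear (b ∷ []) b 0ℤ
  constant-linear b .coeff-* g k = trans (coeff-+ (map (b *_) g) (0ℤ ∷ []) k) (cong₂ _+_ (coeff-scale b g k) (trans (zeros k) (sym (ℤ.*-zeroˡ (delay
    (coeff g) k)))))
    where
    zeros : ∀ k → coeff (0ℤ ∷ []) k ≡ 0ℤ
    zeros zero    = refl
    zeros (suc k) = refl

  monic-linear : ∀ b → Linear (b ∷ 1ℤ ∷ []) b 1ℤ
  monic-linear b .coeff-* g k = trans (coeff-+ (map (b *_) g) (0ℤ ∷ (map (1ℤ *_) g +ᴾ (0ℤ ∷ []))) k)
    (cong₂ _+_ (coeff-scale b g k) (trans (shifted k) (sym (ℤ.*-identityˡ (delay (coeff g) k)))))
    where
    zeros : ∀ k → coeff (0ℤ ∷ []) k ≡ 0ℤ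
    zeros zero    = refl
    zeros (suc k) = refl
    shifted : ∀ k → coeff (0ℤ ∷ (map (1ℤ *_) g +ᴾ (0ℤ ∷ []))) k ≡ delay (coeff g) k
    shifted zero    = refl
    shifted (suc k) = trans (coeff-+ (map (1ℤ *_) g) (0ℤ ∷ []) k)
      (trans (cong₂ _+_ (trans (coeff-scale 1ℤ g k) (ℤ.*-identityˡ _)) (zeros k)) (ℤ.+-identityʳ _))

  Bounded : ℕ → (ℕ → ℤ) → Set
  Bounded n φ = ∀ k → n < k → φ k ≡ 0ℤ

  open RawMonoidDefs (RawRing.*-rawMonoid polyRawRing) using () renaming (sum to ∏ᴾ)

  -- Bound and evaluation are proved together, because passing from degree n to n + 1 in `hom`
  -- requires the coefficient n + 1 to vanish.
  ∏ᴾ-linear : ∀ {n} (e : Fin n → Poly) (b ε : Fin n → ℤ) → (∀ i → Linear (e i) (b i) (ε i)) →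
    Bounded n (coeff (∏ᴾ e)) × (∀ X Y → hom X Y n (coeff (∏ᴾ e)) ≡ ∏ℤ (λ i → b i * Y + ε i * X))
  ∏ᴾ-linear {zero}  e b ε lin = (λ { (suc k) _ → refl }) , λ X Y → refl
  ∏ᴾ-linear {suc n} e b ε lin with ∏ᴾ-linear (e ∘ suc) (b ∘ suc) (ε ∘ suc) (lin ∘ suc)
  ... | bounded , homs = bounded′ , λ X Y → begin
    hom X Y (suc n) (coeff (e zero *ᴾ rest))
      ≡⟨ hom-cong X Y (suc n) (coeff-* (lin zero) rest) ⟩
    hom X Y (suc n) (λ k → b zero * coeff rest k + ε zero * delay (coeff rest) k)
      ≡⟨ hom-combination X Y (suc n) (b zero) (ε zero) (coeff rest) (delay (coeff rest)) ⟩
    b zero * hom X Y (suc n) (coeff rest) + ε zero * hom X Y (suc n) (delay (coeff rest))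
      ≡⟨ cong₂ (λ u v → b zero * u + ε zero * v) (hom-raise X Y n (bounded (suc n) (ℕ.n<1+n n))) (hom-delay X Y n (coeff rest)) ⟩
    b zero * (Y * hom X Y n (coeff rest)) + ε zero * (X * hom X Y n (coeff rest))
      ≡⟨ factor (b zero) (ε zero) X Y (hom X Y n (coeff rest)) ⟩
    (b zero * Y + ε zero * X) * hom X Y n (coeff rest)
      ≡⟨ cong ((b zero * Y + ε zero * X) *_) (homs X Y) ⟩
    ∏ℤ (λ i → b i * Y + ε i * X) ∎
    where
    open ≡-Reasoning
    rest = ∏ᴾ (e ∘ suc)
    factor : ∀ b ε X Y h → b * (Y * h) + ε * (X * h) ≡ (b * Y + ε * X) * h
    factor = solve-∀
    zeros : ∀ {a c} → a ≡ 0ℤ → c ≡ 0ℤ → b zero * a + ε zero * c ≡ 0ℤ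
    zeros refl refl = cong₂ _+_ (ℤ.*-zeroʳ (b zero)) (ℤ.*-zeroʳ (ε zero))
    bounded′ : Bounded (suc n) (coeff (e zero *ᴾ rest))
    bounded′ (suc k) (s≤s n<k) = trans (coeff-* (lin zero) rest (suc k)) (zeros (bounded (suc k) (ℕ.<-trans n<k (ℕ.n<1+n k))) (bounded k n<k))

  sumᴾ : List Poly → Poly
  sumᴾ = foldr _+ᴾ_ []

  sumᴾ-bounded : ∀ {A : Set} n (f : A → Poly) xs → (∀ x → Bounded n (coeff (f x))) → Bounded n (coeff (sumᴾ (map f xs)))
  sumᴾ-bounded n f []       bounded k n<k = refl
  sumᴾ-bounded n f (x ∷ xs) bounded k n<k = trans (coeff-+ (f x) _ k) (cong₂ _+_ (bounded x k n<k) (sumᴾ-bounded n f xs bounded k n<k))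

  hom-sumᴾ : ∀ {A : Set} X Y n (f : A → Poly) xs → hom X Y n (coeff (sumᴾ (map f xs))) ≡ sumOver (λ x → hom X Y n (coeff (f x))) xs
  hom-sumᴾ X Y n f []       = hom-0 X Y n
  hom-sumᴾ X Y n f (x ∷ xs) = begin
    hom X Y n (coeff (f x +ᴾ sumᴾ (map f xs)))
      ≡⟨ hom-cong X Y n (λ k → trans (coeff-+ (f x) _ k) (sym (units (coeff (f x) k) _))) ⟩
    hom X Y n (λ k → 1ℤ * coeff (f x) k + 1ℤ * coeff (sumᴾ (map f xs)) k)
      ≡⟨ hom-combination X Y n 1ℤ 1ℤ (coeff (f x)) _ ⟩
    1ℤ * hom X Y n (coeff (f x)) + 1ℤ * hom X Y n (coeff (sumᴾ (map f xs)))
      ≡⟨ trans (units (hom X Y n (coeff (f x))) _) (cong (λ z → hom X Y n (coeff (f x)) + z) (hom-sumᴾ X Y n f xs)) ⟩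
    sumOver (λ x → hom X Y n (coeff (f x))) (x ∷ xs) ∎
    where
    open ≡-Reasoning
    units : ∀ a b → 1ℤ * a + 1ℤ * b ≡ a + b
    units = solve-∀

  module _ {n : ℕ} (M : Matrix ℤ n) where

    private
      entry : Fin n → Fin n → Poly
      entry i j = diag [] (λ _ → X) i j +ᴾ (-ᴾ (const (M i j)))

      ε : Fin n → Fin n → ℤ
      ε = diag 0ℤ (λ _ → 1ℤ)

      entry-linear : ∀ i j → Linear (entry i j) (- M i j) (ε i j)
      entry-linear i j with i Fin.≟ j
      ... | yes _ = subst (λ b → Linear (b ∷ 1ℤ ∷ []) (- M i j) 1ℤ) (sym (ℤ.+-identityˡ (- M i j))) (monic-linear (- M i j))
      ... | no _  = constant-linear (- M i j)

      term : Permutation′ n → Poly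
      term σ = ∏ᴾ (λ i → entry i (σ ⟨$⟩ʳ i))

      term-linear : ∀ σ → _
      term-linear σ = ∏ᴾ-linear (λ i → entry i (σ ⟨$⟩ʳ i)) (λ i → - M i (σ ⟨$⟩ʳ i)) (λ i → ε i (σ ⟨$⟩ʳ i)) (λ i → entry-linear i (σ ⟨$⟩ʳ i))

    permanentalPolynomial-bounded : Bounded n (coeff (permanentalPolynomial M))
    permanentalPolynomial-bounded = sumᴾ-bounded n term (permutations n) (λ σ → proj₁ (term-linear σ))

    -- The choice `- s` for the second variable absorbs the sign of the matrix in `x I − M`.
    hom-permanentalPolynomial : ∀ X s → hom X (- s) n (coeff (permanentalPolynomial M)) ≡
      perℤ (λ i j → diag 0ℤ (λ _ → X) i j + s * M i j)
    hom-permanentalPolynomial X s = begin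
      hom X (- s) n (coeff (permanentalPolynomial M))
        ≡⟨ hom-sumᴾ X (- s) n term (permutations n) ⟩
      sumOver (λ σ → hom X (- s) n (coeff (term σ))) (permutations n)
        ≡⟨ sumOver-cong (λ σ → trans (proj₂ (term-linear σ) X (- s)) (CMSum.sum-cong-≗ ℤ.*-1-commutativeMonoid (λ i
          → entry-value i (σ ⟨$⟩ʳ i)))) (permutations n) ⟩
      perℤ (λ i j → diag 0ℤ (λ _ → X) i j + s * M i j) ∎
      where
      open ≡-Reasoning
      on-diagonal : ∀ m s X → - m * - s + 1ℤ * X ≡ X + s * m
      on-diagonal = solve-∀
      off-diagonal : ∀ m s X → - m * - s + 0ℤ * X ≡ 0ℤ + s * m
      off-diagonal = solve-∀
      entry-value : ∀ i j → - M i j * - s + ε i j * X ≡ diag 0ℤ (λ _ → X) i j + s * M i j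
      entry-value i j with i Fin.≟ j
      ... | yes _ = on-diagonal (M i j) s X
      ... | no _  = off-diagonal (M i j) s X

-- Graphs presented by lists of edges.

module Presentations where

  open Permanent
  open ArcProducts using (arc; arc-self; arc-≢ˡ; arc-≢ʳ; arcCount)
  open EdgeLists

  private variable n : ℕ

  -- Each edge is listed once and in a single orientation, which confines `arcCount` to the values 0
  -- and 1.
  data Simple {n} : List (Fin n × Fin n) → Set where
    []   : Simple []
    cons : ∀ {x y es} → x ≢ y → (x , y) ∉ es → (y , x) ∉ es → Simple es → Simple ((x , y) ∷ es)

  simple : ∀ {es : List (Fin n × Fin n)} → Unique es → (∀ {x y} → (x , y) ∈ es → (y , x) ∉ es) → Simple es
  simple [] asym = []
  simple {es = (x , y) ∷ es} (e∉ ∷ u) asym = cons (λ { refl → asym (here refl) (here refl) })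
    (λ e∈ → All.lookup e∉ e∈ refl) (λ e∈ → asym (here refl) (there e∈)) (simple u λ p q → asym (there p) (there q))

  arc-0 : ∀ (x y i j : Fin n) → (x , y) ≢ (i , j) → arc x y i j ≡ 0ℤ
  arc-0 x y i j ≢ with i Fin.≟ x | j Fin.≟ y
  ... | no i≢x   | _        = arc-≢ˡ x y i j i≢x
  ... | yes _    | no j≢y   = arc-≢ʳ x y i j j≢y
  ... | yes refl | yes refl = ⊥-elim (≢ refl)

  arcCount-∉ : ∀ es {i j : Fin n} → (i , j) ∉ es → (j , i) ∉ es → arcCount es i j ≡ 0ℤ
  arcCount-∉ [] p q = refl
  arcCount-∉ ((x , y) ∷ es) p q = cong₂ ℤ._+_
    (cong₂ ℤ._+_ (arc-0 x y _ _ λ { refl → p (here refl) }) (arc-0 y x _ _ λ { refl → q (here refl) })) (arcCount-∉ es (p ∘ there) (q ∘ there))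

  arcCount-sym : ∀ es (i j : Fin n) → arcCount es i j ≡ arcCount es j i
  arcCount-sym [] i j = refl
  arcCount-sym ((x , y) ∷ es) i j = cong₂ ℤ._+_ (trans (ℤ.+-comm (arc x y i j) _) (cong₂ ℤ._+_ (transpose y x i j) (transpose x y i j))) (arcCount-sym es i j)
    where
    transpose : ∀ a b i j → arc a b i j ≡ arc b a j i
    transpose a b i j with a Fin.≟ i | b Fin.≟ j
    ... | yes _ | yes _ = refl
    ... | yes _ | no _  = refl
    ... | no _  | yes _ = refl
    ... | no _  | no _  = refl

  arcCount-∈ : ∀ {es} {i j : Fin n} → Simple es → (i , j) ∈ es → arcCount es i j ≡ 1ℤ
  arcCount-∈ {es = (x , y) ∷ es} (cons x≢y p q _) (here refl) = cong₂ ℤ._+_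
    (cong₂ ℤ._+_ (arc-self x y) (arc-0 y x x y λ { refl → x≢y refl })) (arcCount-∉ es p q)
  arcCount-∈ {es = (x , y) ∷ es} (cons x≢y p q s) (there e∈) = cong₂ ℤ._+_
    (cong₂ ℤ._+_ (arc-0 x y _ _ λ { refl → p e∈ }) (arc-0 y x _ _ λ { refl → q e∈ })) (arcCount-∈ s e∈)

  record Presents (G : Graph n) (es : List (Fin n × Fin n)) : Set where
    field
      isSimple : Simple es
      adjacent : ∀ i j → Graph.Adj G i j ⇔ ((i , j) ∈ es ⊎ (j , i) ∈ es)

    adjacency : ∀ i j → adjacencyMatrix G i j ≡ arcCount es i j
    adjacency i j with Graph.Adj? G i j
    ... | no ¬adj = sym (arcCount-∉ es (¬adj ∘ Equivalence.from (adjacent i j) ∘ inj₁) (¬adj ∘ Equivalence.from (adjacent i j) ∘ inj₂))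
    ... | yes adj with Equivalence.to (adjacent i j) adj
    ...   | inj₁ e∈ = sym (arcCount-∈ isSimple e∈)
    ...   | inj₂ e∈ = sym (trans (arcCount-sym es i j) (arcCount-∈ isSimple e∈))

  module ∑ℤ-Properties = SSum ℤ.+-*-semiring

  ∑ℤ-point : ∀ (f : Fin n → ℤ) j → (∀ k → k ≢ j → f k ≡ 0ℤ) → ∑ℤ f ≡ f j
  ∑ℤ-point {suc n} f j eq = trans (∑ℤ-Properties.sum-remove {i = j} f)
    (trans (cong (λ z → f j ℤ.+ z) (trans (∑ℤ-Properties.sum-cong-≗ (λ k
      → eq _ (Fin.punchInᵢ≢i j k))) (∑ℤ-Properties.sum-replicate-zero n))) (ℤ.+-identityʳ (f j)))

  ∑-arc : ∀ (x y w : Fin n) → ∑ℤ (arc x y w) ≡ + hit w x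
  ∑-arc {n} x y w with w Fin.≟ x
  ... | yes refl = trans (∑ℤ-point (arc w y w) y (λ k → arc-≢ʳ w y w k)) (arc-self w y)
  ... | no w≢x   = trans (∑ℤ-Properties.sum-cong-≗ (λ j → arc-≢ˡ x y w j w≢x)) (∑ℤ-Properties.sum-replicate-zero n)

  ∑-arcCount : ∀ (w : Fin n) es → ∑ℤ (arcCount es w) ≡ + occ w (map toEdge es)
  ∑-arcCount {n} w [] = ∑ℤ-Properties.sum-replicate-zero n
  ∑-arcCount w ((x , y) ∷ es) = begin
    ∑ℤ (λ j → (arc x y w j ℤ.+ arc y x w j) ℤ.+ arcCount es w j)
      ≡⟨ ∑ℤ-Properties.∑-distrib-+ (λ j → arc x y w j ℤ.+ arc y x w j) (arcCount es w) ⟩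
    ∑ℤ (λ j → arc x y w j ℤ.+ arc y x w j) ℤ.+ ∑ℤ (arcCount es w)
      ≡⟨ cong₂ ℤ._+_ (trans (∑ℤ-Properties.∑-distrib-+ (arc x y w) (arc y x w)) (cong₂ ℤ._+_ (∑-arc x y w) (∑-arc y x w))) (∑-arcCount w es) ⟩
    + occ w (map toEdge ((x , y) ∷ es)) ∎
    where open ≡-Reasoning

  count-tabulate : ∀ {A : Set} {P : A → Set} (P? : ∀ x → Dec (P x)) (f : Fin n → A) →
    + Vec.count P? (Vec.tabulate f) ≡ ∑ℤ (λ i → if does (P? (f i)) then 1ℤ else 0ℤ)
  count-tabulate {zero}  P? f = refl
  count-tabulate {suc n} P? f with does (P? (f zero)) | count-tabulate P? (f ∘ suc)
  ... | true  | eq = cong (λ z → 1ℤ ℤ.+ z) eq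
  ... | false | eq = trans eq (sym (ℤ.+-identityˡ _))

  -- Both sides are the sum of one row of the adjacency matrix.
  degree-occ : ∀ {G : Graph n} {es} → Presents G es → ∀ w → Graph.degree G w ≡ occ w (map toEdge es)
  degree-occ {G = G} {es} P w = ℤ.+-injective (trans (count-tabulate (Graph.Adj? G w) id)
    (trans (∑ℤ-Properties.sum-cong-≗ (λ j → Presents.adjacency P w j)) (∑-arcCount w es)))

  module _ {n} (G : Graph n) where
    open Graph G

    private
      Chosen : Fin n × Fin n → Set
      Chosen (i , j) = (i Fin< j) × Adj i j

      chosen? : ∀ e → Dec (Chosen e)
      chosen? (i , j) = (i Fin.<? j) ×-dec Adj? i j

    edgeList : List (Fin n × Fin n)
    edgeList = filter chosen? (cartesianProduct (allFin n) (allFin n))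

    edgeList-presents : Presents G edgeList
    edgeList-presents = record
      { isSimple = simple (Unique.filter⁺ chosen? (Unique.cartesianProduct⁺ (Unique.allFin⁺ n) (Unique.allFin⁺ n)))
          (λ p q → Fin.<-asym (proj₁ (proj₂ (∈-filter⁻ chosen? {xs = all} p))) (proj₁ (proj₂ (∈-filter⁻ chosen? {xs = all} q))))
      ; adjacent = λ i j → mk⇔ (to i j)
          Sum.[ (λ p → proj₂ (proj₂ (∈-filter⁻ chosen? {xs = all} p))) , (λ p → Adj-sym (proj₂ (proj₂ (∈-filter⁻ chosen? {xs = all} p)))) ] }
      where
      all = cartesianProduct (allFin n) (allFin n)
      to : ∀ i j → Adj i j → (i , j) ∈ edgeList ⊎ (j , i) ∈ edgeList
      to i j adj with Fin.<-cmp i j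
      ... | tri< i<j _ _  = inj₁ (∈-filter⁺ chosen? (∈-cartesianProduct⁺ (∈-allFin i) (∈-allFin j)) (i<j , adj))
      ... | tri≈ _ i≡j _  = ⊥-elim (Adj-irrefl i≡j adj)
      ... | tri> _ _ j<i  = inj₂ (∈-filter⁺ chosen? (∈-cartesianProduct⁺ (∈-allFin j) (∈-allFin i)) (j<i , Adj-sym adj))

-- The permanent up to second order in `s`.

module SecondOrderTerms where

  open Permanent
  open NilpotentAlgebra
  open ArcProducts
  open Merging
  open CoreValues using (top-Πp; Π-↭)
  open Presentations
  open Parities using (∣-resp)
  open import Data.Integer.Base using (_+_; _*_; _-_; -_; _^_)

  pick : ∀ {A : Set} {x : A} {xs} → x ∈ xs → Unique xs → Σ[ ys ∈ List A ] xs ↭ x ∷ ys × x ∉ ys × Unique ys × (∀ {z} → z ∈ xs → z ≢ x → z ∈ ys)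
  pick {xs = x ∷ xs} (here refl) (x∉ ∷ u) = xs , ↭-refl , (λ x∈ → All.lookup x∉ x∈ refl) , u , λ
    { (here refl) z≢x → ⊥-elim (z≢x refl) ; (there z∈) _ → z∈ }
  pick {x = x} {xs = y ∷ xs} (there x∈) (y∉ ∷ u) with pick x∈ u
  ... | ys , perm , x∉ys , uys , rest = y ∷ ys , ↭-trans (prep y perm) (swap y x ↭-refl) ,
    (λ { (here refl) → All.lookup y∉ x∈ refl ; (there x∈ys) → x∉ys x∈ys }) ,
    All.tabulate (λ {z} z∈ → λ { refl → All.lookup y∉ (Perm.∈-resp-↭ (↭-sym perm) (there z∈)) refl }) ∷ uys , λ
    { (here refl) _ → here refl ; (there z∈) z≢x → there (rest z∈ z≢x) }

  module SecondOrder {n : ℕ} (D : Fin n → ℤ) (s : ℤ) where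

    vf : Fin n → Expr (n ℕ.+ n)
    vf = vertexFactor D

    weightProduct : List (Fin n) → ℤ
    weightProduct = foldr (λ w t → D w * t) 1ℤ

    avoids-vf : ∀ {w x} → w ≢ x → Avoids w (vf x)
    avoids-vf w≢x = conᵃ 1ℤ ⊕ᵃ conᵃ _ ⊗ᵃ avoids-p w≢x

    avoids-Πvf : ∀ {w ws} → w ∉ ws → Avoids w (Π vf ws)
    avoids-Πvf {ws = ws} w∉ = avoids-Π {n} {f = vf} {xs = ws} (All.tabulate λ x∈ → avoids-vf λ { refl → w∉ x∈ })

    -- In the absence of edge factors every vertex outside `ds` has to be a fixed point.
    top-vertices : ∀ ws ds → Unique ws → (∀ {w} → w ∈ ws → w ∉ ds) → ws ++ ds ↭ allFin n → top (Π vf ws ⊗ Π p ds) ≡ weightProduct ws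
    top-vertices []       ds u disj all = trans (top-cong (ES.*-identityˡ _)) (top-Πp all)
    top-vertices (w ∷ ws) ds (w∉ ∷ u) disj all = begin
      top ((1ᴱ ⊕ con (D w) ⊗ p w) ⊗ Π vf ws ⊗ Π p ds)
        ≡⟨ top-⊕-free (Sol.solve 4 (λ d q a b → (con′ 1 :+ d :* q) :* a :* b := a :* b :+ d :* (a :* (q :* b))) ES.refl (con (D w)) (p w) (Π vf ws) (Π p ds))
             (proj₁ (avoids-Πvf (λ w∈ → All.lookup w∉ w∈ refl)) ⊗ proj₁ (avoids-Π {n} {f = p} {xs = ds} (All.tabulate λ x∈ → avoids-p λ { refl
               → disj (here refl) x∈ }))) ⟩
      top (con (D w) ⊗ (Π vf ws ⊗ Π p (w ∷ ds)))
        ≡⟨ top-con (D w) _ ⟩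
      D w * top (Π vf ws ⊗ Π p (w ∷ ds))
        ≡⟨ cong (D w *_) (top-vertices ws (w ∷ ds) u (λ { w∈ (here refl) → All.lookup w∉ w∈ refl ; w∈ (there w∈ds) → disj (there w∈) w∈ds })
             (↭-trans (Perm.shift w ws ds) all)) ⟩
      D w * weightProduct ws ∎
      where
      open ≡-Reasoning
      open Sol using (_:*_; _:+_; _:=_) renaming (con to con′)

    ef : Fin n × Fin n → Expr (n ℕ.+ n)
    ef = edgeFactor s

    top-ef : ∀ A x y G → top (A ⊗ (ef (x , y) ⊗ G)) ≡
      top (A ⊗ G) + s * (top (A ⊗ (r x ⊗ c y) ⊗ G) + top (A ⊗ (r y ⊗ c x) ⊗ G)) + s * (s * top (A ⊗ (p x ⊗ p y) ⊗ G))
    top-ef A x y G = begin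
      top (A ⊗ (ef (x , y) ⊗ G))
        ≡⟨ top-cong (Sol.solve 6 (λ A s e f q G → A :* ((con′ 1 :+ s :* (e :+ f) :+ s :* s :* q) :* G) :=
             A :* G :+ s :* (A :* e :* G :+ A :* f :* G) :+ s :* (s :* (A :* q :* G))) ES.refl A (con s) (r x ⊗ c y) (r y ⊗ c x) (p x ⊗ p y) G) ⟩
      top (A ⊗ G ⊕ con s ⊗ (A ⊗ (r x ⊗ c y) ⊗ G ⊕ A ⊗ (r y ⊗ c x) ⊗ G) ⊕ con s ⊗ (con s ⊗ (A ⊗ (p x ⊗ p y) ⊗ G)))
        ≡⟨ trans (top-⊕ _ _) (cong₂ _+_ (trans (top-⊕ _ _) (cong (λ z → top (A ⊗ G) + z) (trans (top-con s _) (cong (s *_) (top-⊕ _ _)))))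
             (trans (top-con s _) (cong (s *_) (top-con s _)))) ⟩
      top (A ⊗ G) + s * (top (A ⊗ (r x ⊗ c y) ⊗ G) + top (A ⊗ (r y ⊗ c x) ⊗ G)) + s * (s * top (A ⊗ (p x ⊗ p y) ⊗ G)) ∎
      where
      open ≡-Reasoning
      open Sol using (_:*_; _:+_; _:=_) renaming (con to con′)

    -- Modulo `s` every edge factor is 1.
    order₁ : ∀ es A → s ∣ top (A ⊗ Π ef es) - top A
    order₁ [] A = ∣-resp (sym (trans (cong (_- top A) (top-cong (ES.*-identityʳ A))) (ℤ.+-inverseʳ (top A)))) (divides 0ℤ refl)
    order₁ ((x , y) ∷ es) A = ∣-resp (trans (rearrange (top (A ⊗ Π ef es)) (top A) s _ _) (cong (_- top A) (sym (top-ef A x y (Π ef es)))))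
      (∣m∣n⇒∣m+n (order₁ es A) (∣m⇒∣m*n ((top (A ⊗ (r x ⊗ c y) ⊗ Π ef es) + top (A ⊗ (r y ⊗ c x) ⊗ Π ef es)) + s * top (A ⊗ (p x ⊗ p y) ⊗ Π ef es)) ∣-refl))
      where
      rearrange : ∀ t a s u v → t - a + s * (u + s * v) ≡ t + s * u + s * (s * v) - a
      rearrange = solve-∀

    order₁-0 : ∀ es A → top A ≡ 0ℤ → s ∣ top (A ⊗ Π ef es)
    order₁-0 es A eq = ∣-resp (trans (cong (λ z → top (A ⊗ Π ef es) - z) eq) (ℤ.+-identityʳ _)) (order₁ es A)

    -- Modulo `s * s` at most one edge can contribute, and only through one of its two arcs; the
    -- assumptions make these contributions vanish.
    order₂ : ∀ es A → top A ≡ 0ℤ → (∀ {i j} → (i , j) ∈ es → top (A ⊗ (r i ⊗ c j)) ≡ 0ℤ × top (A ⊗ (r j ⊗ c i)) ≡ 0ℤ) →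
      s * s ∣ top (A ⊗ Π ef es)
    order₂ [] A eq eqs = ∣-resp (sym (trans (top-cong (ES.*-identityʳ A)) eq)) (divides 0ℤ refl)
    order₂ ((x , y) ∷ es) A eq eqs = ∣-resp (sym (top-ef A x y (Π ef es)))
      (∣m∣n⇒∣m+n (∣m∣n⇒∣m+n (order₂ es A eq (eqs ∘ there))
        (*-monoʳ-∣ s (∣m∣n⇒∣m+n (order₁-0 es (A ⊗ (r x ⊗ c y)) (proj₁ (eqs (here refl)))) (order₁-0 es (A ⊗ (r y ⊗ c x)) (proj₂ (eqs (here refl)))))))
        (∣-resp (ℤ.*-assoc s s _) (∣m⇒∣m*n (top (A ⊗ (p x ⊗ p y) ⊗ Π ef es)) ∣-refl)))

    W : Expr (n ℕ.+ n)
    W = Π vf (allFin n)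

    private
      absorb-r : ∀ x → vf x ⊗ r x ≈ᴱ r x
      absorb-r x = ES.trans (Sol.solve 3 (λ d r c → (con′ 1 :+ d :* (r :* c)) :* r := r :+ (r :* r) :* (d :* c)) ES.refl (con (D x)) (r x) (c x))
        (ES.trans (ES.+-congˡ (ES.trans (ES.*-congʳ (gen² (x ↑ˡ n))) (ES.zeroˡ _))) (ES.+-identityʳ _))
        where open Sol using (_:*_; _:+_; _:=_) renaming (con to con′)
      absorb-c : ∀ x → vf x ⊗ c x ≈ᴱ c x
      absorb-c x = ES.trans (Sol.solve 3 (λ d r c → (con′ 1 :+ d :* (r :* c)) :* c := c :+ (c :* c) :* (d :* r)) ES.refl (con (D x)) (r x) (c x))
        (ES.trans (ES.+-congˡ (ES.trans (ES.*-congʳ (gen² (n ↑ʳ x))) (ES.zeroˡ _))) (ES.+-identityʳ _))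
        where open Sol using (_:*_; _:+_; _:=_) renaming (con to con′)

      isolate : ∀ x → Σ[ ys ∈ List (Fin n) ] W ≈ᴱ vf x ⊗ Π vf ys × x ∉ ys
      isolate x with pick (∈-allFin x) (Unique.allFin⁺ n)
      ... | ys , perm , x∉ , _ = ys , Π-↭ vf perm , x∉

    -- The arc takes the row of `x`, so `x` is no fixed point; with no `c x` in `B` its column
    -- remains uncovered.
    arc-vanishʳ : ∀ {x y} B → x ≢ y → Free (n ↑ʳ x) B → top (W ⊗ (r x ⊗ c y ⊗ B)) ≡ 0ℤ
    arc-vanishʳ {x} {y} B x≢y fB with isolate x
    ... | ys , W≈ , x∉ = trans (top-cong (ES.trans (ES.*-congʳ W≈) (ES.trans
        (Sol.solve 5 (λ v w r c b → v :* w :* (r :* c :* b) := (v :* r) :* (c :* (b :* w))) ES.refl (vf x) (Π vf ys) (r x) (c y) B)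
        (ES.*-congʳ (absorb-r x)))))
      (top-free (gen (r≢c {n} ∘ sym) ⊗ (gen (c≢c x≢y) ⊗ (fB ⊗ proj₂ (avoids-Πvf x∉)))))
      where open Sol using (_:*_; _:=_)

    arc-vanishˡ : ∀ {x y} B → x ≢ y → Free (y ↑ˡ n) B → top (W ⊗ (r x ⊗ c y ⊗ B)) ≡ 0ℤ
    arc-vanishˡ {x} {y} B x≢y fB with isolate y
    ... | ys , W≈ , y∉ = trans (top-cong (ES.trans (ES.*-congʳ W≈) (ES.trans
        (Sol.solve 5 (λ v w r c b → v :* w :* (r :* c :* b) := (v :* c) :* (r :* (b :* w))) ES.refl (vf y) (Π vf ys) (r x) (c y) B)
        (ES.*-congʳ (absorb-c y)))))
      (top-free (gen (r≢c {n}) ⊗ (gen (r≢r (x≢y ∘ sym)) ⊗ (fB ⊗ proj₁ (avoids-Πvf y∉)))))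
      where open Sol using (_:*_; _:=_)

    -- An arc has to be completed to a directed cycle. A single further arc could only be its
    -- reverse, which `es` does not offer; so at least two more arcs are needed.
    arc-order₂ : ∀ {x y} es → x ≢ y → (x , y) ∉ es → (y , x) ∉ es → s * s ∣ top (W ⊗ (r x ⊗ c y) ⊗ Π ef es)
    arc-order₂ {x} {y} es x≢y p q = order₂ es (W ⊗ (r x ⊗ c y))
      (trans (top-cong (ES.*-congˡ (ES.sym (ES.*-identityʳ _)))) (arc-vanishʳ 1ᴱ x≢y (con 1ℤ)))
      (λ {i} {j} e∈ → two i j (λ { refl → q e∈ }) , two j i (λ { refl → p e∈ }))
      where
      two : ∀ i j → (i , j) ≢ (y , x) → top (W ⊗ (r x ⊗ c y) ⊗ (r i ⊗ c j)) ≡ 0ℤ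
      two i j ≢ with j Fin.≟ x
      ... | no j≢x = trans (top-cong (ES.*-assoc _ _ _)) (arc-vanishʳ (r i ⊗ c j) x≢y (gen (r≢c {n} ∘ sym) ⊗ gen (c≢c (j≢x ∘ sym))))
      ... | yes refl = trans (top-cong (ES.*-assoc _ _ _)) (arc-vanishˡ (r i ⊗ c j) x≢y (gen (r≢r λ { refl → ≢ refl }) ⊗ gen (r≢c {n})))

    -- Directed cycles of length 3 or more cost at least `s³`, and so do two disjoint
    -- transpositions. What remains is the identity permutation and one transposition for each edge,
    -- whose fixed points weigh 1 modulo `s`.
    second-order : (∀ w → s ∣ D w - 1ℤ) → ∀ {es} → Simple es →
      s * (s * s) ∣ top (W ⊗ Π ef es) - (weightProduct (allFin n) + s * s * + length es)
    second-order D≡1 {[]} [] = divides 0ℤ (trans (cong₂ (λ a b → a - (weightProduct (allFin n) + b))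
        (trans (top-vertices (allFin n) [] (Unique.allFin⁺ n) (λ _ ()) (Perm.++-identityʳ _)) refl) (ℤ.*-zeroʳ (s * s)))
        (cancel (weightProduct (allFin n))))
      where
      cancel : ∀ a → a - (a + 0ℤ) ≡ 0ℤ
      cancel = solve-∀
    second-order D≡1 {(x , y) ∷ es} (cons x≢y xy∉ yx∉ S) =
      ∣-resp (trans (rearrange s (top (W ⊗ Π ef es)) (weightProduct (allFin n)) (+ length es) (top (W ⊗ (r x ⊗ c y) ⊗ Π ef es)) (top (W ⊗ (r y ⊗ c x)
        ⊗ Π ef es)) (top (W ⊗ (p x ⊗ p y) ⊗ Π ef es))) (cong (λ z → z - (weightProduct (allFin n) + s * s * (1ℤ +
        + length es))) (sym (top-ef W x y (Π ef es)))))
        (∣m∣n⇒∣m+n (∣m∣n⇒∣m+n (second-order D≡1 S)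
          (*-monoʳ-∣ s (∣m∣n⇒∣m+n (arc-order₂ es x≢y xy∉ yx∉) (arc-order₂ es (x≢y ∘ sym) yx∉ xy∉))))
          (*-monoʳ-∣ s (*-monoʳ-∣ s pair)))
      where
      rearrange : ∀ s t w m a b q → t - (w + s * s * m) + s * (a + b) + s * (s * (q - 1ℤ)) ≡
        t + s * (a + b) + s * (s * q) - (w + s * s * (1ℤ + m))
      rearrange = solve-∀
      product≡1 : ∀ ws → s ∣ weightProduct ws - 1ℤ
      product≡1 []       = divides 0ℤ refl
      product≡1 (w ∷ ws) = ∣-resp (combine (D w) (weightProduct ws)) (∣m∣n⇒∣m+n (∣m⇒∣m*n (weightProduct ws) (D≡1 w)) (product≡1 ws))
        where
        combine : ∀ d t → (d - 1ℤ) * t + (t - 1ℤ) ≡ d * t - 1ℤ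
        combine = solve-∀
      split : Σ[ ys ∈ List (Fin n) ] allFin n ↭ x ∷ y ∷ ys × x ∉ y ∷ ys × y ∉ ys × Unique ys
      split with pick (∈-allFin x) (Unique.allFin⁺ n)
      ... | zs , perm , x∉ , u , rest with pick (rest (∈-allFin y) (x≢y ∘ sym)) u
      ...   | ys , perm′ , y∉ , u′ , _ = ys , ↭-trans perm (prep x perm′) , (λ x∈ → x∉ (Perm.∈-resp-↭ (↭-sym perm′) x∈)) , y∉ , u′
      ys = proj₁ split
      pair-exact : top (W ⊗ (p x ⊗ p y)) ≡ weightProduct ys
      pair-exact = trans (top-cong (ES.trans (ES.*-congʳ (Π-↭ vf (proj₁ (proj₂ split))))
          (ES.trans (Sol.solve 7 (λ v w t rx cx ry cy → v :* (w :* t) :* (rx :* cx :* (ry :* cy)) := t :* (((v :* rx) :* cx) :* (((w :* ry) :* cy) :* con′ 1)))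
              ES.refl (vf x) (vf y) (Π vf ys) (r x) (c x) (r y) (c y))
            (ES.*-congˡ (ES.*-cong (ES.*-congʳ (absorb-r x)) (ES.*-congʳ (ES.*-congʳ (absorb-r y))))))))
        (top-vertices ys (x ∷ y ∷ []) (proj₂ (proj₂ (proj₂ (proj₂ split))))
          (λ { w∈ (here refl) → proj₁ (proj₂ (proj₂ split)) (there w∈) ; w∈ (there (here refl)) → proj₁ (proj₂ (proj₂ (proj₂ split))) w∈ })
          (↭-trans (Perm.++-comm ys (x ∷ y ∷ [])) (↭-sym (proj₁ (proj₂ split)))))
        where open Sol using (_:*_; _:=_) renaming (con to con′)
      pair : s ∣ top (W ⊗ (p x ⊗ p y) ⊗ Π ef es) - 1ℤ
      pair = ∣-resp (combine (top (W ⊗ (p x ⊗ p y) ⊗ Π ef es)) (top (W ⊗ (p x ⊗ p y)))) (∣m∣n⇒∣m+n (order₁ es (W ⊗ (p x ⊗ p y))) (∣-resp (cong (_-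
        1ℤ) (sym pair-exact)) (product≡1 ys)))
        where
        combine : ∀ t a → t - a + (a - 1ℤ) ≡ t - 1ℤ
        combine = solve-∀

-- Determination of the degree sequence.

module Degrees where

  open Permanent
  open NilpotentAlgebra
  open ArcProducts
  open EdgeLists
  open Presentations
  open SecondOrderTerms
  open Parities
  open Comparison using (total)
  open import Data.Integer.Base using (_+_; _*_; _-_; -_; _^_)

  -- Two evaluations, at an `s` above 2S + 2S′ and at one above 2B + 2B′. The factors `+ 2` only
  -- adapt the differences to `bounded`.
  coefficients-unique : ∀ {S S′ B B′} →
    (∀ s → s * (s * s) ∣ (1ℤ + s * + S + s * s * + B) - (1ℤ + s * + S′ + s * s * + B′)) → S ≡ S′ × B ≡ B′
  coefficients-unique {S} {S′} {B} {B′} d = S≡S′ , B≡B′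
    where
    module P = Parity S S′
    module Q = Parity B B′
    S≡S′ : S ≡ S′
    S≡S′ = P.bounded (∣-resp (split s (+ S) (+ S′) (+ B) (+ B′)) (∣n⇒∣m*n (+ 2) (∣m∣n⇒∣m-n
        (∣-trans (∣m⇒∣m*n s ∣-refl) (*-cancelˡ-∣ s {{P.s-nonZero}} (∣-resp (factor s (+ S) (+ S′) (+ B) (+ B′)) (d s))))
        (∣m⇒∣m*n (+ B - + B′) ∣-refl))))
      where
      s = P.s
      factor : ∀ s a a′ b b′ → (1ℤ + s * a + s * s * b) - (1ℤ + s * a′ + s * s * b′) ≡ s * ((a - a′) + s * (b - b′))
      factor = solve-∀
      split : ∀ s a a′ b b′ → + 2 * ((a - a′) + s * (b - b′) - s * (b - b′)) ≡ + 2 * a - + 2 * a′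
      split = solve-∀
    B≡B′ : B ≡ B′
    B≡B′ = Q.bounded (∣-resp (distrib (+ B) (+ B′)) (∣n⇒∣m*n (+ 2)
        (*-cancelˡ-∣ s {{Q.s-nonZero}} (*-cancelˡ-∣ s {{Q.s-nonZero}}
          (∣-resp (trans (cong (λ a → (1ℤ + s * + S + s * s * + B) - (1ℤ + s * + a + s * s * + B′)) (sym S≡S′))
            (factor s (+ S) (+ B) (+ B′))) (d s))))))
      where
      s = Q.s
      factor : ∀ s a b b′ → (1ℤ + s * a + s * s * b) - (1ℤ + s * a + s * s * b′) ≡ s * (s * (b - b′))
      factor = solve-∀
      distrib : ∀ b b′ → + 2 * (b - b′) ≡ + 2 * b - + 2 * b′
      distrib = solve-∀

  -- `pairSum` is the second elementary symmetric function, the coefficient of `s²` in the product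
  -- of the factors `1 + s d`.
  pairSum squareSum excessSum : List ℕ → ℕ
  pairSum []       = 0
  pairSum (d ∷ ds) = d ℕ.* total ds ℕ.+ pairSum ds
  squareSum []       = 0
  squareSum (d ∷ ds) = d ℕ.* d ℕ.+ squareSum ds

  -- (d − 2)(d − 3), which is not negative although its factors may be.
  excess : ℕ → ℕ
  excess 0                   = 6
  excess 1                   = 2
  excess 2                   = 0
  excess (suc (suc (suc e))) = suc e ℕ.* e

  excessSum []       = 0
  excessSum (d ∷ ds) = excess d ℕ.+ excessSum ds

  square-total : ∀ ds → squareSum ds ℕ.+ 2 ℕ.* pairSum ds ≡ total ds ℕ.* total ds
  square-total []       = refl
  square-total (d ∷ ds) = trans (expand d (total ds) (squareSum ds) (pairSum ds)) (trans (cong (d ℕ.* d ℕ.+ 2 ℕ.* (d ℕ.* total ds) ℕ.+_)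
    (square-total ds)) (square d (total ds)))
    where
    expand : ∀ d t q e → d ℕ.* d ℕ.+ q ℕ.+ 2 ℕ.* (d ℕ.* t ℕ.+ e) ≡ d ℕ.* d ℕ.+ 2 ℕ.* (d ℕ.* t) ℕ.+ (q ℕ.+ 2 ℕ.* e)
    expand = ℕR.solve-∀
    square : ∀ d t → d ℕ.* d ℕ.+ 2 ℕ.* (d ℕ.* t) ℕ.+ t ℕ.* t ≡ (d ℕ.+ t) ℕ.* (d ℕ.+ t)
    square = ℕR.solve-∀

  -- The expansion of `(d − 2)(d − 3)`, arranged without subtraction.
  excess-square : ∀ d → excess d ℕ.+ 5 ℕ.* d ≡ d ℕ.* d ℕ.+ 6
  excess-square 0                   = refl
  excess-square 1                   = refl
  excess-square 2                   = refl
  excess-square (suc (suc (suc e))) = expand e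
    where
    expand : ∀ e → suc e ℕ.* e ℕ.+ 5 ℕ.* (3 ℕ.+ e) ≡ (3 ℕ.+ e) ℕ.* (3 ℕ.+ e) ℕ.+ 6
    expand = ℕR.solve-∀

  excessSum-squareSum : ∀ ds → excessSum ds ℕ.+ 5 ℕ.* total ds ≡ squareSum ds ℕ.+ 6 ℕ.* length ds
  excessSum-squareSum []       = refl
  excessSum-squareSum (d ∷ ds) = trans (left (excess d) (excessSum ds) d (total ds))
    (trans (cong₂ ℕ._+_ (excess-square d) (excessSum-squareSum ds)) (right (d ℕ.* d) (squareSum ds) (length ds)))
    where
    left : ∀ x y d t → x ℕ.+ y ℕ.+ 5 ℕ.* (d ℕ.+ t) ≡ (x ℕ.+ 5 ℕ.* d) ℕ.+ (y ℕ.+ 5 ℕ.* t)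
    left = ℕR.solve-∀
    right : ∀ a q l → (a ℕ.+ 6) ℕ.+ (q ℕ.+ 6 ℕ.* l) ≡ a ℕ.+ q ℕ.+ 6 ℕ.* suc l
    right = ℕR.solve-∀

  excess-0 : ∀ d → excess d ≡ 0 → d ≡ 2 ⊎ d ≡ 3
  excess-0 2 _ = inj₁ refl
  excess-0 3 _ = inj₂ refl
  excess-0 (suc (suc (suc (suc e)))) ()

  total-↭ : ∀ {xs ys} → xs ↭ ys → total xs ≡ total ys
  total-↭ Perm.refl = refl
  total-↭ (Perm.prep x p) = cong (x ℕ.+_) (total-↭ p)
  total-↭ (Perm.swap x y p) = trans (exchange x y _) (cong (λ t → y ℕ.+ (x ℕ.+ t)) (total-↭ p))
    where
    exchange : ∀ x y t → x ℕ.+ (y ℕ.+ t) ≡ y ℕ.+ (x ℕ.+ t)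
    exchange = ℕR.solve-∀
  total-↭ (Perm.trans p q) = trans (total-↭ p) (total-↭ q)

  excessSum-total : ∀ ds → excessSum ds ≡ total (map excess ds)
  excessSum-total []       = refl
  excessSum-total (d ∷ ds) = cong (excess d ℕ.+_) (excessSum-total ds)

  total-+ : ∀ {A : Set} (f g : A → ℕ) xs → total (map (λ x → f x ℕ.+ g x) xs) ≡ total (map f xs) ℕ.+ total (map g xs)
  total-+ f g []       = refl
  total-+ f g (x ∷ xs) = trans (cong (f x ℕ.+ g x ℕ.+_) (total-+ f g xs)) (exchange (f x) (g x) _ _)
    where
    exchange : ∀ a b c d → a ℕ.+ b ℕ.+ (c ℕ.+ d) ≡ a ℕ.+ c ℕ.+ (b ℕ.+ d)
    exchange = ℕR.solve-∀

  +-total : ∀ {A : Set} (f : A → ℕ) xs → + total (map f xs) ≡ sumOver (λ x → + f x) xs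
  +-total f []       = refl
  +-total f (x ∷ xs) = cong (λ z → + f x + z) (+-total f xs)

  module _ {n : ℕ} where

    hits : ∀ (x : Fin n) → total (map (λ w → hit w x) (allFin n)) ≡ 1
    hits x = ℤ.+-injective (trans (+-total (λ w → hit w x) (allFin n)) (trans (sumOver-tabulate (λ w → + hit w x) id)
      (trans (∑ℤ-point (λ w → + hit w x) x (λ k k≢x → cong +_ (hit-≢ k≢x))) (cong +_ (hit-self x)))))

    handshake : ∀ (es : List (Edge n)) → total (map (λ w → occ w es) (allFin n)) ≡ 2 ℕ.* length es
    handshake []       = zeros (allFin n)
      where
      zeros : ∀ (xs : List (Fin n)) → total (map (λ _ → 0) xs) ≡ 0
      zeros []       = refl
      zeros (x ∷ xs) = zeros xs
    handshake (e ∷ es) = begin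
      total (map (λ w → ends w e ℕ.+ occ w es) (allFin n))
        ≡⟨ total-+ (λ w → ends w e) (λ w → occ w es) (allFin n) ⟩
      total (map (λ w → ends w e) (allFin n)) ℕ.+ total (map (λ w → occ w es) (allFin n))
        ≡⟨ cong₂ ℕ._+_ (trans (total-+ (λ w → hit w (src e)) (λ w → hit w (tgt e)) (allFin n)) (cong₂ ℕ._+_ (hits (src e)) (hits (tgt e)))) (handshake es) ⟩
      2 ℕ.+ 2 ℕ.* length es
        ≡⟨ ℕ.*-suc 2 (length es) ⟨
      2 ℕ.* suc (length es) ∎
      where open ≡-Reasoning

  length-allFin : ∀ n → length (allFin n) ≡ n
  length-allFin n = List.length-tabulate {n = n} id

  degrees : ∀ {n} → Graph n → List ℕ
  degrees {n} G = map (Graph.degree G) (allFin n)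

  degree-total : ∀ {n} {G : Graph n} {es} → Presents G es → total (degrees G) ≡ 2 ℕ.* length es
  degree-total {n} {G} {es} P = trans (cong total (List.map-cong (degree-occ P) (allFin n)))
    (trans (handshake (map toEdge es)) (cong (2 ℕ.*_) (List.length-map toEdge es)))

  module _ {n} {G : Graph n} {es} (P : Presents G es) where

    private
      module _ (s : ℤ) where
        open SecondOrder (vertexWeight G 1ℤ s) s

        weights : ∀ ws → s * (s * s) ∣ weightProduct ws - (1ℤ + s * + total (map (Graph.degree G) ws) + s * s * + pairSum (map (Graph.degree G) ws))
        weights [] = divides 0ℤ (zero-case s)
          where
          zero-case : ∀ s → 1ℤ - (1ℤ + s * 0ℤ + s * s * 0ℤ) ≡ 0ℤ * (s * (s * s))
          zero-case = solve-∀
        weights (w ∷ ws) = ∣-resp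
          (trans (expand s (+ d) (+ T) (+ E) (weightProduct ws)) (cong (λ z → (1ℤ + s * + d) * weightProduct ws - (1ℤ + s * (+ d + + T) + s * s
            * (z + + E))) (sym (ℤ.pos-* d T))))
          (∣m∣n⇒∣m+n (∣n⇒∣m*n (1ℤ + s * + d) (weights ws)) (∣m⇒∣m*n (+ d * + E) ∣-refl))
          where
          d = Graph.degree G w
          T = total (map (Graph.degree G) ws)
          E = pairSum (map (Graph.degree G) ws)
          expand : ∀ s d T E W → (1ℤ + s * d) * (W - (1ℤ + s * T + s * s * E)) + s * (s * s) * (d * E) ≡
            (1ℤ + s * d) * W - (1ℤ + s * (d + T) + s * s * (d * T + E))
          expand = solve-∀

    per-second-order : ∀ s → s * (s * s) ∣ perℤ (shiftedLaplacian G 1ℤ s) -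
      (1ℤ + s * + total (degrees G) + s * s * + (pairSum (degrees G) ℕ.+ length es))
    per-second-order s = ∣-resp
      (trans (combine s (top (W ⊗ Π ef es)) (weightProduct (allFin n)) (+ total (degrees G)) (+ pairSum (degrees G)) (+ length es))
        (cong (_- (1ℤ + s * + total (degrees G) + s * s * + (pairSum (degrees G) ℕ.+ length es))) (sym (per-shiftedLaplacian G es (Presents.adjacency
          P) 1ℤ s))))
      (∣m∣n⇒∣m+n (second-order (λ w → divides (+ Graph.degree G w) (cancel s (+ Graph.degree G w))) (Presents.isSimple P)) (weights s (allFin n)))
      where
      open SecondOrder (vertexWeight G 1ℤ s) s
      cancel : ∀ s d → 1ℤ + s * d - 1ℤ ≡ d * s
      cancel = solve-∀
      combine : ∀ s t w a b m → t - (w + s * s * m) + (w - (1ℤ + s * a + s * s * b)) ≡ t - (1ℤ + s * a + s * s * (b + m))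
      combine = solve-∀

  record Bicubic {n} (G : Graph n) : Set where
    field
      u v    : Fin n
      others : List (Fin n)
      all    : u ∷ v ∷ others ↭ allFin n
      deg-u  : Graph.degree G u ≡ 3
      deg-v  : Graph.degree G v ≡ 3
      deg-2  : All (λ w → Graph.degree G w ≡ 2) others

    totals : total (degrees G) ≡ 2 ℕ.+ 2 ℕ.* n
    totals = begin
      total (degrees G) ≡⟨ total-↭ (Perm.map⁺ (Graph.degree G) all) ⟨
      Graph.degree G u ℕ.+ (Graph.degree G v ℕ.+ total (map (Graph.degree G) others))
        ≡⟨ cong₂ ℕ._+_ deg-u (cong₂ ℕ._+_ deg-v (twos others deg-2)) ⟩
      6 ℕ.+ 2 ℕ.* length others ≡⟨ shape (length others) ⟩
      2 ℕ.+ 2 ℕ.* (2 ℕ.+ length others) ≡⟨ cong (λ k → 2 ℕ.+ 2 ℕ.* k) {x = 2 ℕ.+ length others} {y = n} (trans (Perm.↭-length all) (length-allFin n)) ⟩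
      2 ℕ.+ 2 ℕ.* n ∎
      where
      open ≡-Reasoning
      shape : ∀ l → 6 ℕ.+ 2 ℕ.* l ≡ 2 ℕ.+ 2 ℕ.* (2 ℕ.+ l)
      shape = ℕR.solve-∀
      twos : ∀ ws → All (λ w → Graph.degree G w ≡ 2) ws → total (map (Graph.degree G) ws) ≡ 2 ℕ.* length ws
      twos []       []       = refl
      twos (w ∷ ws) (q ∷ qs) = trans (cong₂ ℕ._+_ q (twos ws qs)) (sym (ℕ.*-suc 2 (length ws)))

    no-excess : excessSum (degrees G) ≡ 0
    no-excess = trans (excessSum-total (degrees G)) (trans (sym (total-↭ (Perm.map⁺ excess (Perm.map⁺ (Graph.degree G) all))))
      (cong₂ ℕ._+_ (cong excess deg-u) (cong₂ ℕ._+_ (cong excess deg-v) (zeros others deg-2))))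
      where
      zeros : ∀ ws → All (λ w → Graph.degree G w ≡ 2) ws → total (map excess (map (Graph.degree G) ws)) ≡ 0
      zeros []       []       = refl
      zeros (w ∷ ws) (q ∷ qs) = cong₂ ℕ._+_ (cong excess q) (zeros ws qs)

  -- Only degrees 2 and 3 have excess 0, and the amount by which the degree sum exceeds twice the
  -- number of vertices counts the 3s.
  separate : ∀ {A : Set} (d : A → ℕ) xs → excessSum (map d xs) ≡ 0 →
    Σ[ threes ∈ List A ] Σ[ twos ∈ List A ] threes ++ twos ↭ xs × All (λ x → d x ≡ 3) threes × All (λ x → d x ≡ 2) twos ×
    total (map d xs) ≡ length threes ℕ.+ 2 ℕ.* length xs
  separate d [] _ = [] , [] , ↭-refl , [] , [] , refl
  separate d (x ∷ xs) eq with excess-0 (d x) (ℕ.m+n≡0⇒m≡0 (excess (d x)) eq) | separate d xs (ℕ.m+n≡0⇒n≡0 (excess (d x)) eq)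
  ... | inj₁ dx | threes , twos , perm , q₃ , q₂ , sum = threes , x ∷ twos , ↭-trans (Perm.shift x threes twos) (prep x perm) , q₃ , dx ∷ q₂ ,
    trans (cong₂ ℕ._+_ dx sum) (shape (length threes) (length xs))
    where
    shape : ∀ a b → 2 ℕ.+ (a ℕ.+ 2 ℕ.* b) ≡ a ℕ.+ 2 ℕ.* suc b
    shape = ℕR.solve-∀
  ... | inj₂ dx | threes , twos , perm , q₃ , q₂ , sum = x ∷ threes , twos , prep x perm , dx ∷ q₃ , q₂ ,
    trans (cong₂ ℕ._+_ dx sum) (shape (length threes) (length xs))
    where
    shape : ∀ a b → 3 ℕ.+ (a ℕ.+ 2 ℕ.* b) ≡ suc a ℕ.+ 2 ℕ.* suc b
    shape = ℕR.solve-∀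

  module _ {n} {G H : Graph n} {es fs} (P : Presents G es) (Q : Presents H fs)
           (same : ∀ s → perℤ (shiftedLaplacian G 1ℤ s) ≡ perℤ (shiftedLaplacian H 1ℤ s)) where

    private
      coefficients : total (degrees G) ≡ total (degrees H) × pairSum (degrees G) ℕ.+ length es ≡ pairSum (degrees H) ℕ.+ length fs
      coefficients = coefficients-unique λ s → ∣-resp (difference (same s)) (∣m∣n⇒∣m-n (per-second-order Q s) (per-second-order P s))
        where
        cancel : ∀ t a b → t - b - (t - a) ≡ a - b
        cancel = solve-∀
        difference : ∀ {t t′ a b} → t ≡ t′ → t′ - b - (t - a) ≡ a - b
        difference {t} {a = a} {b} refl = cancel t a b

    edges-equal : length es ≡ length fs
    edges-equal = ℕ.*-cancelˡ-≡ (length es) (length fs) 2 (trans (sym (degree-total P)) (trans (proj₁ coefficients) (degree-total Q)))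

    private
      -- The transpositions contribute the number of edges to the second coefficient; known from the
      -- first coefficient, it can be subtracted.
      pairs-equal : pairSum (degrees G) ≡ pairSum (degrees H)
      pairs-equal = ℕ.+-cancelʳ-≡ (length es) _ _ (trans (proj₂ coefficients) (cong (pairSum (degrees H) ℕ.+_) (sym edges-equal)))

      squares-equal : squareSum (degrees G) ≡ squareSum (degrees H)
      squares-equal = ℕ.+-cancelʳ-≡ (2 ℕ.* pairSum (degrees G)) _ _ (trans (square-total (degrees G))
        (trans (cong (λ t → t ℕ.* t) (proj₁ coefficients)) (trans (sym (square-total (degrees H))) (cong (λ t
          → squareSum (degrees H) ℕ.+ 2 ℕ.* t) (sym pairs-equal)))))

      excess-equal : excessSum (degrees G) ≡ excessSum (degrees H)
      excess-equal = ℕ.+-cancelʳ-≡ (5 ℕ.* total (degrees G)) _ _ (trans (excessSum-squareSum (degrees G))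
        (trans (cong₂ (λ a b → a ℕ.+ 6 ℕ.* b) squares-equal (trans (List.length-map _ (allFin n)) (sym (List.length-map _ (allFin n)))))
          (trans (sym (excessSum-squareSum (degrees H))) (cong (λ t → excessSum (degrees H) ℕ.+ 5 ℕ.* t) (sym (proj₁ coefficients))))))

    bicubic : Bicubic H → Bicubic G
    bicubic B = build (separate (Graph.degree G) (allFin n) (trans excess-equal (Bicubic.no-excess B)))
      where
      two : ∀ k → total (degrees G) ≡ k ℕ.+ 2 ℕ.* length (allFin n) → k ≡ 2
      two k sum = ℕ.+-cancelʳ-≡ (2 ℕ.* n) k 2 (trans (cong (λ m → k ℕ.+ 2 ℕ.* m) (sym (length-allFin n)))
        (trans (sym sum) (trans (proj₁ coefficients) (Bicubic.totals B))))
      pair : ∀ threes twos → length threes ≡ 2 → threes ++ twos ↭ allFin n →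
        All (λ x → Graph.degree G x ≡ 3) threes → All (λ x → Graph.degree G x ≡ 2) twos → Bicubic G
      pair (u ∷ v ∷ []) twos _ perm (du ∷ dv ∷ []) d₂ = record { u = u ; v = v ; others = twos ; all = perm ; deg-u = du ; deg-v = dv ; deg-2 = d₂ }
      build : _ → Bicubic G
      build (threes , twos , perm , d₃ , d₂ , sum) = pair threes twos (two (length threes) sum) perm d₃ d₂

-- Shapes of graphs with two cubic vertices, and the theta graphs themselves.

module ThetaGraphs where

  open Permanent
  open NilpotentAlgebra
  open ArcProducts
  open Merging
  open LoopsAndTerminals
  open EdgeLists
  open CoreValues
  open Presentations
  open Degrees
  open Comparison using (total)

  Unique-↭ : ∀ {A : Set} {xs ys : List A} → xs ↭ ys → Unique xs → Unique ys
  Unique-↭ Perm.refl u = u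
  Unique-↭ (Perm.prep x p) (x∉ ∷ u) = Perm.All-resp-↭ p x∉ ∷ Unique-↭ p u
  Unique-↭ (Perm.swap x y p) ((x≢y ∷ x∉) ∷ y∉ ∷ u) = ((x≢y ∘ sym) ∷ Perm.All-resp-↭ p y∉) ∷ Perm.All-resp-↭ p x∉ ∷ Unique-↭ p u
  Unique-↭ (Perm.trans p q) u = Unique-↭ q (Unique-↭ p u)

  sort₃ : ∀ {A : Set} (f : A → ℕ) x y z → Σ[ a ∈ A ] Σ[ b ∈ A ] Σ[ c ∈ A ] x ∷ y ∷ z ∷ [] ↭ a ∷ b ∷ c ∷ [] × f a ≤ f b × f b ≤ f c
  sort₃ f x y z with ℕ.≤-total (f x) (f y) | ℕ.≤-total (f y) (f z) | ℕ.≤-total (f x) (f z)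
  ... | inj₁ xy | inj₁ yz | _       = x , y , z , ↭-refl , xy , yz
  ... | inj₁ xy | inj₂ zy | inj₁ xz = x , z , y , prep x (swap y z ↭-refl) , xz , zy
  ... | inj₁ xy | inj₂ zy | inj₂ zx = z , x , y , Perm.++-comm (x ∷ y ∷ []) [ z ] , zx , xy
  ... | inj₂ yx | inj₁ yz | inj₁ xz = y , x , z , swap x y ↭-refl , yx , xz
  ... | inj₂ yx | inj₁ yz | inj₂ zx = y , z , x , Perm.++-comm [ x ] (y ∷ z ∷ []) , yz , zx
  ... | inj₂ yx | inj₂ zy | _       = z , y , x , ↭-sym (Perm.↭-reverse (x ∷ y ∷ z ∷ [])) , zy , yx

  Step-toEdge : ∀ {n} (es : List (Fin n × Fin n)) i j → ((i , j) ∈ es ⊎ (j , i) ∈ es) ⇔ Step (map toEdge es) i j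
  Step-toEdge es i j = mk⇔ [ to inj₁ , to inj₂ ]′ from
    where
    to : ∀ {e fs} → (∀ {g} → e ∈ [ g ] → StepIn (toEdge g) i j) → e ∈ fs → Step (map toEdge fs) i j
    to f (here refl) = here (f (here refl))
    to f (there e∈)  = there (to f e∈)
    from : ∀ {fs} → Step (map toEdge fs) i j → (i , j) ∈ fs ⊎ (j , i) ∈ fs
    from {e ∷ fs} (here (inj₁ (here refl))) = inj₁ (here refl)
    from {e ∷ fs} (here (inj₂ (here refl))) = inj₂ (here refl)
    from {e ∷ fs} (there a) = Sum.map there there (from a)

  inners-toEdge : ∀ {n} (es : List (Fin n × Fin n)) → inners (map toEdge es) ≡ []
  inners-toEdge []       = refl
  inners-toEdge (e ∷ es) = inners-toEdge es

  -- Every edge carries a factor 1 + s², one of which is lost with every eliminated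
  -- vertex; m is the number of edges and k the number of eliminated vertices.
  record Factors {n} (G : Graph n) (m k : ℕ) (ks : List ℕ) (value : ℤ → ℤ) : Set where
    field
      equation : ∀ s → (1ℤ ℤ.+ s ℤ.* s) ℤ.^ m ℤ.* perℤ (shiftedLaplacian G (1ℤ ℤ.- + 2 ℤ.* s ℤ.- s ℤ.* s) s) ≡
        (1ℤ ℤ.+ s ℤ.* s) ℤ.^ k ℤ.* (cyclesValue s ks ℤ.* value s)

  threePaths : ∀ {n} → Fin n → Fin n → List (Fin n) → List (Fin n) → List (Fin n) → List (Edge n)
  threePaths u v A B C = edge u A v ∷ edge u B v ∷ edge u C v ∷ []

  Realises : ∀ {n} → Graph n → Fin n → Fin n → List (Fin n) → List (Fin n) → List (Fin n) → Set
  Realises {n} G u v A B C = u ∷ v ∷ A ++ B ++ C ↭ allFin n × (∀ i j → Graph.Adj G i j ⇔ Step (threePaths u v A B C) i j)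

  -- The comparison wants the paths sorted by length, the isomorphism wants them in the order of
  -- `p`, `q`, `r`. Hence the realisation is provided for every rearrangement.
  data Shape {n} (G : Graph n) (m k : ℕ) (u v : Fin n) : Set where
    theta : ∀ A B C ks → length A ≤ length B → length B ≤ length C → All (2 ≤_) ks →
      m ≡ total ks ℕ.+ (suc (length A) ℕ.+ suc (length B) ℕ.+ suc (length C)) →
      Factors G m k ks (λ s → thetaValue s (suc (length A)) (suc (length B)) (suc (length C))) →
      (ks ≡ [] → ∀ {X Y Z} → A ∷ B ∷ C ∷ [] ↭ X ∷ Y ∷ Z ∷ [] → Realises G u v X Y Z) → Shape G m k u v
    dumbbell : ∀ a b c ks → 1 ≤ a → 2 ≤ b → 2 ≤ c → All (2 ≤_) ks → m ≡ total ks ℕ.+ (a ℕ.+ b ℕ.+ c) →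
      Factors G m k ks (λ s → dumbbellValue s a b c) → Shape G m k u v

  -- The weights are those of s (Q − x I) at x = 2 + s − 1/s, where a vertex of degree 2 has
  -- weight 1 − s².
  module Start {n} {G : Graph n} {es} (P : Presents G es) (B : Bicubic G) where
    open Bicubic B

    weights : ℤ → Fin n → ℤ
    weights s = vertexWeight G (1ℤ ℤ.- + 2 ℤ.* s ℤ.- s ℤ.* s) s

    private
      unique-all : Unique (u ∷ v ∷ others)
      unique-all = Unique-↭ (↭-sym all) (Unique.allFin⁺ n)

    u≢v : u ≢ v
    u≢v with unique-all
    ... | (u≢v ∷ _) ∷ _ = u≢v

    weight-3 : ∀ w → Graph.degree G w ≡ 3 → ∀ s → weights s w ≡ 1ℤ ℤ.+ s ℤ.- s ℤ.* s
    weight-3 w eq s = trans (cong (λ d → 1ℤ ℤ.- + 2 ℤ.* s ℤ.- s ℤ.* s ℤ.+ s ℤ.* + d) eq) (simplify s)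
      where
      simplify : ∀ s → 1ℤ ℤ.- + 2 ℤ.* s ℤ.- s ℤ.* s ℤ.+ s ℤ.* + 3 ≡ 1ℤ ℤ.+ s ℤ.- s ℤ.* s
      simplify = solve-∀

    weight-2 : ∀ w → Graph.degree G w ≡ 2 → ∀ s → weights s w ≡ 1ℤ ℤ.- s ℤ.* s
    weight-2 w eq s = trans (cong (λ d → 1ℤ ℤ.- + 2 ℤ.* s ℤ.- s ℤ.* s ℤ.+ s ℤ.* + d) eq) (simplify s)
      where
      simplify : ∀ s → 1ℤ ℤ.- + 2 ℤ.* s ℤ.- s ℤ.* s ℤ.+ s ℤ.* + 2 ≡ 1ℤ ℤ.- s ℤ.* s
      simplify = solve-∀

    open Elimination weights u v
    open Core u≢v (weight-3 u deg-u) (weight-3 v deg-v)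

    -- At length 1 the signed power is `- (s * s)`: the coefficient of the one-sided terms vanishes,
    -- and the others are divisible by `1ℤ + s * s`.
    segment-1 : ∀ s (e : Fin n × Fin n) → segmentOf s (toEdge e) ≈ᴱ con (1ℤ ℤ.+ s ℤ.* s) ⊗ edgeFactor s e
    segment-1 s (x , y) = begin
      segmentOf s (toEdge (x , y))
        ≈⟨ ES.reflexive (cong₂ (λ A B → con A ⊕ con B ⊗ (p x ⊕ p y) ⊕ con (s ℤ.* s ℤ.* (s ℤ.* s) ℤ.- α) ⊗ (p x ⊗ p y) ⊕ con ((1ℤ ℤ.+ s ℤ.* s)
          ℤ.* (s ℤ.* 1ℤ)) ⊗ arcs₂) (idA s) (idB s)) ⟩
      con (1ℤ ℤ.+ s ℤ.* s) ⊕ con 0ℤ ⊗ (p x ⊕ p y) ⊕ con (s ℤ.* s ℤ.* (s ℤ.* s) ℤ.- α) ⊗ (p x ⊗ p y) ⊕ con ((1ℤ ℤ.+ s ℤ.* s) ℤ.* (s ℤ.* 1ℤ)) ⊗ arcs₂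
        ≈⟨ ES.+-cong (ES.+-cong (ES.trans (ES.+-congˡ (ES.zeroˡ _)) (ES.+-identityʳ _))
             (ES.*-congʳ (ES.trans (ES.reflexive (cong con (idC s))) (ES.trans (con-* q (s ℤ.* s)) (ES.*-congˡ (con-* s s))))))
             (ES.*-congʳ (ES.trans (ES.reflexive (cong con (idE s))) (con-* q s))) ⟩
      con q ⊕ con q ⊗ (con s ⊗ con s) ⊗ (p x ⊗ p y) ⊕ con q ⊗ con s ⊗ arcs₂
        ≈⟨ Sol.solve 4 (λ q s pp a → q :+ q :* (s :* s) :* pp :+ q :* s :* a := q :* (con′ 1 :+ s :* a :+ s :* s :* pp)) ES.refl (con q) (con s) (p x
          ⊗ p y) arcs₂ ⟩
      con q ⊗ edgeFactor s (x , y) ∎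
      where
      open ER
      open Sol using (_:*_; _:+_; _:=_) renaming (con to con′)
      q = 1ℤ ℤ.+ s ℤ.* s
      α = (ℤ.- (s ℤ.* s)) ℤ.* 1ℤ
      arcs₂ = r x ⊗ c y ⊕ r y ⊗ c x
      idA : ∀ s → 1ℤ ℤ.- (ℤ.- (s ℤ.* s)) ℤ.* 1ℤ ≡ 1ℤ ℤ.+ s ℤ.* s
      idA = solve-∀
      idB : ∀ s → s ℤ.* s ℤ.+ (ℤ.- (s ℤ.* s)) ℤ.* 1ℤ ≡ 0ℤ
      idB = solve-∀
      idC : ∀ s → s ℤ.* s ℤ.* (s ℤ.* s) ℤ.- (ℤ.- (s ℤ.* s)) ℤ.* 1ℤ ≡ (1ℤ ℤ.+ s ℤ.* s) ℤ.* (s ℤ.* s)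
      idC = solve-∀
      idE : ∀ s → (1ℤ ℤ.+ s ℤ.* s) ℤ.* (s ℤ.* 1ℤ) ≡ (1ℤ ℤ.+ s ℤ.* s) ℤ.* s
      idE = solve-∀

    segments : ∀ s fs → Π (segmentOf s) (map toEdge fs) ≈ᴱ con ((1ℤ ℤ.+ s ℤ.* s) ℤ.^ length fs) ⊗ Π (edgeFactor s) fs
    segments s []       = ES.sym (ES.*-identityˡ 1ᴱ)
    segments s (e ∷ fs) = ES.trans (ES.*-cong (segment-1 s e) (segments s fs)) (ES.trans
      (Sol.solve 4 (λ q e Q E → q :* e :* (Q :* E) := (q :* Q) :* (e :* E)) ES.refl (con q) (edgeFactor s e) (con (q ℤ.^ length fs)) (Π (edgeFactor s) fs))
      (ES.*-congʳ (ES.sym (con-* q (q ℤ.^ length fs)))))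
      where
      open Sol using (_:*_; _:=_)
      q = 1ℤ ℤ.+ s ℤ.* s

    val-start : ∀ s → val s [] others (map toEdge es) ≡
      (1ℤ ℤ.+ s ℤ.* s) ℤ.^ length es ℤ.* perℤ (shiftedLaplacian G (1ℤ ℤ.- + 2 ℤ.* s ℤ.- s ℤ.* s) s)
    val-start s = begin
      val s [] others (map toEdge es)
        ≡⟨ top-cong (ES.*-congˡ (segments s es)) ⟩
      top (1ᴱ ⊗ (vertexFactor (weights s) u ⊗ (vertexFactor (weights s) v ⊗ 1ᴱ)) ⊗ Π (vertexFactor (weights s)) others ⊗ (con Q ⊗ Π (edgeFactor s) es))
        ≡⟨ top-cong (Sol.solve 5 (λ a b o Q E → con′ 1 :* (a :* (b :* con′ 1)) :* o :* (Q :* E) := Q :* ((a :* (b :* o)) :* E)) ES.refl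
             (vertexFactor (weights s) u) (vertexFactor (weights s) v) (Π (vertexFactor (weights s)) others) (con Q) (Π (edgeFactor s) es)) ⟩
      top (con Q ⊗ (Π (vertexFactor (weights s)) (u ∷ v ∷ others) ⊗ Π (edgeFactor s) es))
        ≡⟨ top-con Q _ ⟩
      Q ℤ.* top (Π (vertexFactor (weights s)) (u ∷ v ∷ others) ⊗ Π (edgeFactor s) es)
        ≡⟨ cong (Q ℤ.*_) (trans (top-cong (ES.*-congʳ (Π-↭ (vertexFactor (weights s)) all)))
             (sym (per-shiftedLaplacian G es (Presents.adjacency P) (1ℤ ℤ.- + 2 ℤ.* s ℤ.- s ℤ.* s) s))) ⟩
      Q ℤ.* perℤ (shiftedLaplacian G (1ℤ ℤ.- + 2 ℤ.* s ℤ.- s ℤ.* s) s) ∎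
      where
      open ≡-Reasoning
      open Sol using (_:*_; _:=_) renaming (con to con′)
      Q = (1ℤ ℤ.+ s ℤ.* s) ℤ.^ length es

    invariant : Invariant [] others (map toEdge es)
    invariant = record
      { occ-u = trans (sym (degree-occ P u)) deg-u
      ; occ-v = trans (sym (degree-occ P v)) deg-v
      ; occ-ws = λ w∈ → trans (sym (degree-occ P _)) (All.lookup deg-2 w∈)
      ; occ-else = λ {z} z≢u z≢v z∉ → ⊥-elim (nowhere z≢u z≢v z∉ (Perm.∈-resp-↭ (↭-sym all) (∈-allFin z)))
      ; unique = drop₂ unique-all
      ; fresh = λ w∈ → fresh unique-all w∈
      ; weight = λ {w} w∈ → weight-2 w (All.lookup deg-2 w∈)
      ; proper = proper es (Presents.isSimple P) }
      where
      nowhere : ∀ {z} → z ≢ u → z ≢ v → z ∉ others → z ∉ u ∷ v ∷ others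
      nowhere z≢u z≢v z∉ (here eq) = z≢u eq
      nowhere z≢u z≢v z∉ (there (here eq)) = z≢v eq
      nowhere z≢u z≢v z∉ (there (there z∈)) = z∉ z∈
      drop₂ : Unique (u ∷ v ∷ others) → Unique others
      drop₂ (_ ∷ _ ∷ q) = q
      fresh : Unique (u ∷ v ∷ others) → ∀ {w} → w ∈ others → w ≢ u × w ≢ v × w ∉ []
      fresh ((_ ∷ u∉) ∷ v∉ ∷ _) w∈ = (λ { refl → All.lookup u∉ w∈ refl }) , (λ { refl → All.lookup v∉ w∈ refl }) , λ ()
      proper : ∀ fs → Simple fs → All Proper (map toEdge fs)
      proper [] [] = []
      proper ((x , y) ∷ fs) (cons x≢y _ _ S) = (λ eq → ⊥-elim (x≢y eq)) ∷ proper fs S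

    totalLen-toEdge : ∀ (fs : List (Fin n × Fin n)) → totalLen (map toEdge fs) ≡ length fs
    totalLen-toEdge []       = refl
    totalLen-toEdge (e ∷ fs) = cong suc (totalLen-toEdge fs)

    final-vertices : ∀ {dn} → dn ↭ others ++ [] → u ∷ v ∷ dn ↭ allFin n × u ∉ dn × v ∉ dn
    final-vertices {dn} perm = ↭-trans (prep u (prep v perm′)) all , (λ u∈ → u∉ (Perm.∈-resp-↭ perm′ u∈)) , (λ v∈ → v∉ (Perm.∈-resp-↭ perm′ v∈))
      where
      perm′ = ↭-trans perm (↭-reflexive (List.++-identityʳ others))
      u∉ : u ∉ others
      u∉ u∈ with unique-all
      ... | (_ ∷ q) ∷ _ = All.lookup q u∈ refl
      v∉ : v ∉ others
      v∉ v∈ with unique-all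
      ... | _ ∷ q ∷ _ = All.lookup q v∈ refl

    total₃ : ∀ {fs : List (Edge n)} {e f g} → fs ≃ e ∷ f ∷ g ∷ [] → totalLen fs ≡ len e ℕ.+ len f ℕ.+ len g
    total₃ {e = e} {f} {g} perm = trans (totalLen-≃ perm) (sum₃ (len e) (len f) (len g))
      where
      sum₃ : ∀ a b c → a ℕ.+ (b ℕ.+ (c ℕ.+ 0)) ≡ a ℕ.+ b ℕ.+ c
      sum₃ = ℕR.solve-∀

    module Reduced {dn fs ks} (R : Reduces [] others (map toEdge es) dn fs ks) where

      edge-total : ∀ {e f g} → fs ≃ e ∷ f ∷ g ∷ [] → length es ≡ total ks ℕ.+ (len e ℕ.+ len f ℕ.+ len g)
      edge-total perm = trans (sym (totalLen-toEdge es)) (trans (Reduces.total R) (cong (total ks ℕ.+_) (total₃ perm)))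

      factors : ∀ {gs} (V : ℤ → ℤ) → fs ≃ gs → (∀ s → val s dn [] gs ≡ V s) → Factors G (length es) (length others) ks V
      factors {gs} V perm val≡ = record { equation = λ s → begin
        (1ℤ ℤ.+ s ℤ.* s) ℤ.^ length es ℤ.* perℤ (shiftedLaplacian G (1ℤ ℤ.- + 2 ℤ.* s ℤ.- s ℤ.* s) s)
          ≡⟨ val-start s ⟨
        val s [] others (map toEdge es)
          ≡⟨ Reduces.value R s ⟩
        (1ℤ ℤ.+ s ℤ.* s) ℤ.^ length others ℤ.* cyclesValue s ks ℤ.* val s dn [] fs
          ≡⟨ ℤ.*-assoc ((1ℤ ℤ.+ s ℤ.* s) ℤ.^ length others) (cyclesValue s ks) _ ⟩
        (1ℤ ℤ.+ s ℤ.* s) ℤ.^ length others ℤ.* (cyclesValue s ks ℤ.* val s dn [] fs)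
          ≡⟨ cong (λ w → (1ℤ ℤ.+ s ℤ.* s) ℤ.^ length others ℤ.* (cyclesValue s ks ℤ.* w)) (trans (val-≃ s dn [] perm) (val≡ s)) ⟩
        (1ℤ ℤ.+ s ℤ.* s) ℤ.^ length others ℤ.* (cyclesValue s ks ℤ.* V s) ∎ }
        where open ≡-Reasoning

      theta-factors : ∀ A B C → fs ≃ threePaths u v A B C →
        Factors G (length es) (length others) ks (λ s → thetaValue s (suc (length A)) (suc (length B)) (suc (length C)))
      theta-factors A B C perm = factors _ perm λ s → val-theta s A B C (proj₁ final) (proj₁ (proj₂ final)) (proj₂ (proj₂ final))
        where final = final-vertices (Reduces.eliminated R)

      dumbbell-factors : ∀ P Q L → fs ≃ edge u P v ∷ edge u Q u ∷ edge v L v ∷ [] →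
        Factors G (length es) (length others) ks (λ s → dumbbellValue s (suc (length P)) (suc (length Q)) (suc (length L)))
      dumbbell-factors P Q L perm = factors _ perm λ s → val-dumbbell s P Q L (proj₁ final) (proj₁ (proj₂ final)) (proj₂ (proj₂ final))
        where final = final-vertices (Reduces.eliminated R)

      realises : ks ≡ [] → ∀ A B C → fs ≃ threePaths u v A B C → Realises G u v A B C
      realises ks≡[] A B C perm = vertices↭ , λ i j → mk⇔
        (Equivalence.to (Step-≃ perm i j) ∘ Equivalence.to (proj₁ unreduced i j) ∘ Equivalence.to (Step-toEdge es i j) ∘ Equivalence.to
          (Presents.adjacent P i j))
        (Equivalence.from (Presents.adjacent P i j) ∘ Equivalence.from (Step-toEdge es i j) ∘ Equivalence.from (proj₁ unreduced i j) ∘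
          Equivalence.from (Step-≃ perm i j))
        where
        unreduced : map toEdge es ⇔ˢ fs × inners fs ↭ others ++ inners (map toEdge es)
        unreduced = Reduces.same R ks≡[]
        vertices↭ : u ∷ v ∷ A ++ B ++ C ↭ allFin n
        vertices↭ = ↭-trans (prep u (prep v (↭-trans (↭-reflexive (cong (λ l → A ++ B ++ l) (sym (List.++-identityʳ C))))
          (↭-trans (↭-sym (inners-≃ perm)) (↭-trans (proj₂ unreduced) (↭-reflexive (trans (cong (others ++_) (inners-toEdge es)) (List.++-identityʳ
            others)))))))) all

    arrange : ∀ {A B C X Y Z} → A ∷ B ∷ C ∷ [] ↭ X ∷ Y ∷ Z ∷ [] → threePaths u v A B C ≃ threePaths u v X Y Z
    arrange perm = ↭⇒≃ (Perm.map⁺ (λ L → edge u L v) perm)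

    shape : Shape G (length es) (length others) u v
    shape = let (dn , fs , ks , J , R) = reduce others invariant in shapeOf R J (coreShape J)
      where
      shapeOf : ∀ {dn fs ks} → Reduces [] others (map toEdge es) dn fs ks → Invariant dn [] fs → CoreShape fs → Shape G (length es) (length others) u v
      shapeOf R J (dumbbell P Q L perm) = dumbbell (suc (length P)) (suc (length Q)) (suc (length L)) _ (s≤s z≤n) (loop₁ proper) (loop₂ proper) (Reduces.long R)
          (Reduced.edge-total R perm) (Reduced.dumbbell-factors R P Q L perm)
        where
        proper = Proper-≃ perm (Invariant.proper J)
        loop₁ : ∀ {e} → All Proper (e ∷ edge u Q u ∷ edge v L v ∷ []) → 2 ≤ suc (length Q)
        loop₁ (_ ∷ pr ∷ _) = pr refl
        loop₂ : ∀ {e f} → All Proper (e ∷ f ∷ edge v L v ∷ []) → 2 ≤ suc (length L)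
        loop₂ (_ ∷ _ ∷ pr ∷ _) = pr refl
      shapeOf {dn} {fs} {ks} R J (theta P Q L perm) = sorted (sort₃ length P Q L)
        where
        sorted : Σ[ A ∈ _ ] Σ[ B ∈ _ ] Σ[ C ∈ _ ] P ∷ Q ∷ L ∷ [] ↭ A ∷ B ∷ C ∷ [] × length A ≤ length B × length B ≤ length C
          → Shape G (length es) (length others) u v
        sorted (A , B , C , perm′ , A≤B , B≤C) = theta A B C ks A≤B B≤C (Reduces.long R) (Reduced.edge-total R arranged) (Reduced.theta-factors R A B
          C arranged)
          (λ ks≡[] {X} {Y} {Z} perm″ → Reduced.realises R ks≡[] X Y Z (≃-trans arranged (arrange perm″)))
          where
          arranged : fs ≃ threePaths u v A B C
          arranged = ≃-trans perm (arrange perm′)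

    stepsOf : List (Fin n) → List (Edge n)
    stepsOf L = map toEdge (steps (u ∷ L ++ [ v ]))

    -- The order R, Q, P arises because each collapsed path is put in front of the earlier ones.
    path-factors : ∀ P Q R → others ≡ P ++ Q ++ R ++ [] → map toEdge es ≡ stepsOf P ++ stepsOf Q ++ stepsOf R ++ [] →
      ∀ {A B C} → R ∷ Q ∷ P ∷ [] ↭ A ∷ B ∷ C ∷ [] →
      length es ≡ suc (length A) ℕ.+ suc (length B) ℕ.+ suc (length C) ×
      Factors G (length es) (length others) [] (λ s → thetaValue s (suc (length A)) (suc (length B)) (suc (length C)))
    path-factors P Q R others≡ edges≡ {A} {B} {C} perm =
      Reduced.edge-total reduced (arrange perm) , Reduced.theta-factors reduced A B C (arrange perm)
      where
      collapsed = collapseTheta P Q R (subst (Invariant [] (P ++ Q ++ R ++ [])) edges≡ (subst (λ ws → Invariant [] ws (map toEdge es)) others≡ invariant))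
      reduced : Reduces [] others (map toEdge es) (proj₁ collapsed) (threePaths u v R Q P) []
      reduced = subst (λ ws → Reduces [] ws (map toEdge es) (proj₁ collapsed) (threePaths u v R Q P) []) (sym others≡)
        (subst (λ fs → Reduces [] (P ++ Q ++ R ++ []) fs (proj₁ collapsed) (threePaths u v R Q P) []) (sym edges≡) (proj₂ collapsed))


  module _ {A : Set} where

    steps-src : ∀ l {b : A} {x y} → (x , y) ∈ steps (l ++ [ b ]) → x ∈ l
    steps-src (a ∷ [])     (here refl) = here refl
    steps-src (a ∷ a′ ∷ l) (here refl) = here refl
    steps-src (a ∷ a′ ∷ l) (there st)  = there (steps-src (a′ ∷ l) st)

    steps-tgt : ∀ {a : A} l {x y} → (x , y) ∈ steps (a ∷ l) → y ∈ l
    steps-tgt (b ∷ l) (here refl) = here refl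
    steps-tgt (b ∷ l) (there st)  = there (steps-tgt l st)

    steps-mem : ∀ (l : List A) {x y} → (x , y) ∈ steps l → x ∈ l
    steps-mem (a ∷ b ∷ l) (here refl) = here refl
    steps-mem (a ∷ b ∷ l) (there st)  = there (steps-mem (b ∷ l) st)

    steps-unique : ∀ {l : List A} → Unique l → Unique (steps l)
    steps-unique {[]}        u = []
    steps-unique {a ∷ []}    u = []
    steps-unique {a ∷ b ∷ l} (a∉ ∷ u) = All.tabulate (λ { st refl → All.lookup a∉ (steps-mem (b ∷ l) st) refl }) ∷ steps-unique u

    steps-asym : ∀ {l : List A} {x y} → Unique l → (x , y) ∈ steps l → (y , x) ∉ steps l
    steps-asym {a ∷ b ∷ l} (a∉ ∷ u) (here refl) (here refl) = All.lookup a∉ (here refl) refl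
    steps-asym {a ∷ b ∷ l} (a∉ ∷ u) (here refl) (there st)  = All.lookup a∉ (there (steps-tgt l st)) refl
    steps-asym {a ∷ b ∷ l} (a∉ ∷ u) (there st) (here refl)  = All.lookup a∉ (there (steps-tgt l st)) refl
    steps-asym {a ∷ b ∷ l} (a∉ ∷ u) (there st) (there st′)  = steps-asym u st st′

    unique-++ : ∀ {xs ys : List A} {z} → Unique (xs ++ ys) → z ∈ xs → z ∉ ys
    unique-++ {x ∷ xs} (x∉ ∷ u) (here refl) z∈ = All.lookup (All.++⁻ʳ xs x∉) z∈ refl
    unique-++ {x ∷ xs} (x∉ ∷ u) (there z∈)     = unique-++ u z∈

    unique-++ˡ : ∀ (xs : List A) {ys} → Unique (xs ++ ys) → Unique xs
    unique-++ˡ []       u = []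
    unique-++ˡ (x ∷ xs) (x∉ ∷ u) = All.++⁻ˡ xs x∉ ∷ unique-++ˡ xs u

    unique-++ʳ : ∀ (xs : List A) {ys} → Unique (xs ++ ys) → Unique ys
    unique-++ʳ []       u = u
    unique-++ʳ (x ∷ xs) (x∉ ∷ u) = unique-++ʳ xs u

    module _ {u v : A} (u≢v : u ≢ v) where

      Interior : List A → Set
      Interior P = Unique P × u ∉ P × v ∉ P

      private
        path-unique′ : ∀ {P} → Interior P → Unique (u ∷ P ++ [ v ])
        path-unique′ {P} (uP , u∉ , v∉) =
          All.++⁺ (All.tabulate λ x∈ → λ { refl → u∉ x∈ }) (u≢v ∷ []) ∷ Unique.++⁺ uP ([] ∷ []) (λ { (x∈ , here refl) → v∉ x∈ })

        direct : ∀ {P} → Interior P → (u , v) ∈ steps (u ∷ P ++ [ v ]) → P ≡ []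
        direct {[]} _ _ = refl
        direct {z ∷ zs} (_ , u∉ , v∉) (here refl) = ⊥-elim (v∉ (here refl))
        direct {z ∷ zs} (_ , u∉ , v∉) (there st)  = ⊥-elim (u∉ (steps-src (z ∷ zs) st))

      module _ {P Q : List A} (IP : Interior P) (IQ : Interior Q) (disjoint : ∀ {x} → x ∈ P → x ∉ Q) where

        -- Disjoint interiors force a common step to run from `u` to `v`, and then both paths are
        -- that single edge.
        steps-disjoint : ¬ (P ≡ [] × Q ≡ []) → ∀ {e} → e ∈ steps (u ∷ P ++ [ v ]) → e ∉ steps (u ∷ Q ++ [ v ])
        steps-disjoint nonempty {x , y} st st′ with steps-src (u ∷ P) st | steps-src (u ∷ Q) st′ | ∈-++⁻ P (steps-tgt (P ++ [ v ]) st) | ∈-++⁻ Q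
          (steps-tgt (Q ++ [ v ]) st′)
        ... | there x∈ | there x∈′ | _ | _ = disjoint x∈ x∈′
        ... | there x∈ | here refl | _ | _ = proj₁ (proj₂ IP) x∈
        ... | here refl | there x∈ | _ | _ = proj₁ (proj₂ IQ) x∈
        ... | here refl | here refl | inj₁ y∈ | inj₁ y∈′ = disjoint y∈ y∈′
        ... | here refl | here refl | inj₁ y∈ | inj₂ (here refl) = proj₂ (proj₂ IP) y∈
        ... | here refl | here refl | inj₂ (here refl) | inj₁ y∈ = proj₂ (proj₂ IQ) y∈
        ... | here refl | here refl | inj₂ (here refl) | inj₂ _ = nonempty (direct IP st , direct IQ st′)

        steps-opposite : ∀ {x y} → (x , y) ∈ steps (u ∷ P ++ [ v ]) → (y , x) ∉ steps (u ∷ Q ++ [ v ])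
        steps-opposite st st′ with steps-src (u ∷ P) st | ∈-++⁻ Q (steps-tgt (Q ++ [ v ]) st′)
        ... | here refl | inj₁ x∈ = proj₁ (proj₂ IQ) x∈
        ... | here refl | inj₂ (here eq) = u≢v eq
        ... | there x∈ | inj₁ x∈′ = disjoint x∈ x∈′
        ... | there x∈ | inj₂ (here refl) = proj₂ (proj₂ IP) x∈

      steps-own : ∀ {P x y} → Interior P → (x , y) ∈ steps (u ∷ P ++ [ v ]) → (y , x) ∉ steps (u ∷ P ++ [ v ])
      steps-own IP = steps-asym (path-unique′ IP)

      steps-interior-unique : ∀ {P} → Interior P → Unique (steps (u ∷ P ++ [ v ]))
      steps-interior-unique IP = steps-unique (path-unique′ IP)

  occ-++ : ∀ {n} (w : Fin n) es fs → occ w (es ++ fs) ≡ occ w es ℕ.+ occ w fs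
  occ-++ w []       fs = refl
  occ-++ w (e ∷ es) fs = trans (cong (ends w e ℕ.+_) (occ-++ w es fs)) (sym (ℕ.+-assoc (ends w e) _ _))

  hitCount : ∀ {n} → Fin n → List (Fin n) → ℕ
  hitCount w l = total (map (hit w) l)

  occ-path : ∀ {n} (w x : Fin n) P y → occ w (map toEdge (steps (x ∷ P ++ [ y ]))) ≡ hit w x ℕ.+ hit w y ℕ.+ 2 ℕ.* hitCount w P
  occ-path w x []      y = refl
  occ-path w x (z ∷ P) y = trans (cong (hit w x ℕ.+ hit w z ℕ.+_) (occ-path w z P y)) (rearrange (hit w x) (hit w z) (hit w y) (hitCount w P))
    where
    rearrange : ∀ a b c d → a ℕ.+ b ℕ.+ (b ℕ.+ c ℕ.+ 2 ℕ.* d) ≡ a ℕ.+ c ℕ.+ 2 ℕ.* (b ℕ.+ d)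
    rearrange = ℕR.solve-∀

  hit-sym : ∀ {n} (w x : Fin n) → hit w x ≡ hit x w
  hit-sym w x with w Fin.≟ x
  ... | yes refl = sym (hit-self w)
  ... | no w≢x = sym (hit-≢ (w≢x ∘ sym))

  hitCount-++ : ∀ {n} (w : Fin n) xs ys → hitCount w (xs ++ ys) ≡ hitCount w xs ℕ.+ hitCount w ys
  hitCount-++ w []       ys = refl
  hitCount-++ w (x ∷ xs) ys = trans (cong (hit w x ℕ.+_) (hitCount-++ w xs ys)) (sym (ℕ.+-assoc (hit w x) _ _))

  tabulate-+ : ∀ {A : Set} m {n} (f : Fin (m ℕ.+ n) → A) → List.tabulate f ≡ List.tabulate (λ i → f (i ↑ˡ n)) ++ List.tabulate (λ i → f (m ↑ʳ i))
  tabulate-+ zero    f = refl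
  tabulate-+ (suc m) f = cong (f zero ∷_) (tabulate-+ m (f ∘ suc))

  module Theta (p q r : ℕ) (pq : ¬ (p ≡ 0 × q ≡ 0)) (pr : ¬ (p ≡ 0 × r ≡ 0)) (qr : ¬ (q ≡ 0 × r ≡ 0)) where

    N : ℕ
    N = 2 ℕ.+ (p ℕ.+ q ℕ.+ r)

    listP listQ listR : List (Fin N)
    listP = List.tabulate (inP p q r)
    listQ = List.tabulate (inQ p q r)
    listR = List.tabulate (inR p q r)

    vertexList : allFin N ≡ 0F ∷ 1F ∷ listP ++ listQ ++ listR
    vertexList = cong (λ l → 0F ∷ 1F ∷ l) (trans (tabulate-+ (p ℕ.+ q) (2 ↑ʳ_)) (trans (cong (_++ listR) (tabulate-+ p (λ i
      → 2 ↑ʳ (i ↑ˡ r)))) (List.++-assoc listP listQ listR)))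

    private
      unique : Unique (0F ∷ 1F ∷ listP ++ listQ ++ listR)
      unique = subst Unique vertexList (Unique.allFin⁺ N)

      0≢1 : ∀ {k} → _≢_ {A = Fin (2 ℕ.+ k)} 0F 1F
      0≢1 ()

      uPQR : Unique (listP ++ listQ ++ listR)
      uPQR with unique
      ... | _ ∷ _ ∷ u = u
      u∉ : 0F ∉ listP ++ listQ ++ listR
      u∉ x∈ with unique
      ... | (_ ∷ q) ∷ _ = All.lookup q x∈ refl
      v∉ : 1F ∉ listP ++ listQ ++ listR
      v∉ x∈ with unique
      ... | _ ∷ q ∷ _ = All.lookup q x∈ refl

      interiorP : Interior 0≢1 listP
      interiorP = unique-++ˡ listP uPQR , u∉ ∘ ∈-++⁺ˡ , v∉ ∘ ∈-++⁺ˡ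
      interiorQ : Interior 0≢1 listQ
      interiorQ = unique-++ˡ listQ (unique-++ʳ listP uPQR) , u∉ ∘ ∈-++⁺ʳ listP ∘ ∈-++⁺ˡ , v∉ ∘ ∈-++⁺ʳ listP ∘ ∈-++⁺ˡ
      interiorR : Interior 0≢1 listR
      interiorR = unique-++ʳ listQ (unique-++ʳ listP uPQR) , u∉ ∘ ∈-++⁺ʳ listP ∘ ∈-++⁺ʳ listQ , v∉ ∘ ∈-++⁺ʳ listP ∘ ∈-++⁺ʳ listQ

      P∩Q : ∀ {x} → x ∈ listP → x ∉ listQ
      P∩Q x∈ = unique-++ uPQR x∈ ∘ ∈-++⁺ˡ
      P∩R : ∀ {x} → x ∈ listP → x ∉ listR
      P∩R x∈ = unique-++ uPQR x∈ ∘ ∈-++⁺ʳ listQ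
      Q∩R : ∀ {x} → x ∈ listQ → x ∉ listR
      Q∩R = unique-++ (unique-++ʳ listP uPQR)

      empty : ∀ {k} (f : Fin k → Fin N) → List.tabulate f ≡ [] → k ≡ 0
      empty {zero} f _ = refl

      pathSteps : List (Fin N) → List (Fin N × Fin N)
      pathSteps L = steps (0F ∷ L ++ [ 1F ])

    -- The conditions on `p`, `q`, `r` keep the edge between the two given vertices from being
    -- listed twice.
    presents : Presents (θ p q r) (θ-edges p q r)
    presents = record
      { isSimple = simple
          (Unique.++⁺ (steps-interior-unique 0≢1 interiorP) (Unique.++⁺ (steps-interior-unique 0≢1 interiorQ) (steps-interior-unique 0≢1 interiorR)
              (λ (a , b) → steps-disjoint 0≢1 interiorQ interiorR Q∩R (λ (e , f) → qr (empty (inQ p q r) e , empty (inR p q r) f)) a b))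
            (λ (a , b) → Sum.[ steps-disjoint 0≢1 interiorP interiorQ P∩Q (λ (e , f) → pq (empty (inP p q r) e , empty (inQ p q r) f)) a
                             , steps-disjoint 0≢1 interiorP interiorR P∩R (λ (e , f) → pr (empty (inP p q r) e , empty (inR p q r) f)) a ] (∈-++⁻
                               (pathSteps listQ) b)))
          asym
      ; adjacent = λ i j → mk⇔ id id }
      where
      data Path : Set where P Q R : Path
      list : Path → List (Fin N)
      list P = listP
      list Q = listQ
      list R = listR
      locate : ∀ {e} → e ∈ θ-edges p q r → Σ[ k ∈ Path ] e ∈ pathSteps (list k)
      locate e∈ with ∈-++⁻ (pathSteps listP) e∈
      ... | inj₁ s = P , s
      ... | inj₂ e∈′ with ∈-++⁻ (pathSteps listQ) e∈′
      ...   | inj₁ s = Q , s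
      ...   | inj₂ s = R , s
      asym : ∀ {x y} → (x , y) ∈ θ-edges p q r → (y , x) ∉ θ-edges p q r
      asym a b with locate a | locate b
      ... | P , s | P , t = steps-own 0≢1 interiorP s t
      ... | P , s | Q , t = steps-opposite 0≢1 interiorP interiorQ P∩Q s t
      ... | P , s | R , t = steps-opposite 0≢1 interiorP interiorR P∩R s t
      ... | Q , s | P , t = steps-opposite 0≢1 interiorP interiorQ P∩Q t s
      ... | Q , s | Q , t = steps-own 0≢1 interiorQ s t
      ... | Q , s | R , t = steps-opposite 0≢1 interiorQ interiorR Q∩R s t
      ... | R , s | P , t = steps-opposite 0≢1 interiorP interiorR P∩R t s
      ... | R , s | Q , t = steps-opposite 0≢1 interiorQ interiorR Q∩R t s
      ... | R , s | R , t = steps-own 0≢1 interiorR s t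

    private
      degree-count : ∀ w → Graph.degree (θ p q r) w ≡ 3 ℕ.* (hit w 0F ℕ.+ hit w 1F) ℕ.+ 2 ℕ.* hitCount w (listP ++ listQ ++ listR)
      degree-count w = begin
        Graph.degree (θ p q r) w
          ≡⟨ degree-occ presents w ⟩
        occ w (map toEdge (pathSteps listP ++ pathSteps listQ ++ pathSteps listR))
          ≡⟨ cong (occ w) (trans (List.map-++ toEdge (pathSteps listP) _) (cong (map toEdge (pathSteps listP) ++_) (List.map-++ toEdge (pathSteps listQ) _))) ⟩
        occ w (map toEdge (pathSteps listP) ++ map toEdge (pathSteps listQ) ++ map toEdge (pathSteps listR))
          ≡⟨ trans (occ-++ w (map toEdge (pathSteps listP)) _) (cong₂ ℕ._+_ (occ-path w 0F listP 1F)
               (trans (occ-++ w (map toEdge (pathSteps listQ)) _) (cong₂ ℕ._+_ (occ-path w 0F listQ 1F) (occ-path w 0F listR 1F)))) ⟩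
        (a ℕ.+ b ℕ.+ 2 ℕ.* hitCount w listP) ℕ.+ ((a ℕ.+ b ℕ.+ 2 ℕ.* hitCount w listQ) ℕ.+ (a ℕ.+ b ℕ.+ 2 ℕ.* hitCount w listR))
          ≡⟨ collect a b (hitCount w listP) (hitCount w listQ) (hitCount w listR) ⟩
        3 ℕ.* (a ℕ.+ b) ℕ.+ 2 ℕ.* (hitCount w listP ℕ.+ (hitCount w listQ ℕ.+ hitCount w listR))
          ≡⟨ cong (λ t → 3 ℕ.* (a ℕ.+ b) ℕ.+ 2 ℕ.* t) (trans (hitCount-++ w listP _) (cong (hitCount w listP ℕ.+_) (hitCount-++ w listQ listR))) ⟨
        3 ℕ.* (a ℕ.+ b) ℕ.+ 2 ℕ.* hitCount w (listP ++ listQ ++ listR) ∎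
        where
        open ≡-Reasoning
        a = hit w 0F
        b = hit w 1F
        collect : ∀ a b x y z → (a ℕ.+ b ℕ.+ 2 ℕ.* x) ℕ.+ ((a ℕ.+ b ℕ.+ 2 ℕ.* y) ℕ.+ (a ℕ.+ b ℕ.+ 2 ℕ.* z)) ≡ 3 ℕ.* (a ℕ.+ b) ℕ.+ 2 ℕ.* (x ℕ.+ (y ℕ.+ z))
        collect = ℕR.solve-∀

      once : ∀ w → hit w 0F ℕ.+ (hit w 1F ℕ.+ hitCount w (listP ++ listQ ++ listR)) ≡ 1
      once w = trans (cong (hitCount w) (sym vertexList)) (trans (cong total (List.map-cong (hit-sym w) (allFin N))) (hits w))

      degree-interior : ∀ {w} → w ≢ 0F → w ≢ 1F → Graph.degree (θ p q r) w ≡ 2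
      degree-interior {w} w≢u w≢v = trans (degree-count w) (trans (cong₂ (λ a b
        → 3 ℕ.* (a ℕ.+ b) ℕ.+ 2 ℕ.* hitCount w (listP ++ listQ ++ listR)) (hit-≢ w≢u) (hit-≢ w≢v))
        (cong (2 ℕ.*_) (trans (sym (cong₂ (λ a b → a ℕ.+ (b ℕ.+ hitCount w (listP ++ listQ ++ listR))) (hit-≢ w≢u) (hit-≢ w≢v))) (once w))))

    theta-bicubic : Bicubic (θ p q r)
    theta-bicubic = record
      -- The trailing `[]` matches the form in which `collapseTheta` consumes the paths.
      { u = 0F ; v = 1F ; others = listP ++ listQ ++ listR ++ []
      ; all = ↭-reflexive (trans (cong (λ l → 0F ∷ 1F ∷ listP ++ listQ ++ l) (List.++-identityʳ listR)) (sym vertexList))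
      ; deg-u = trans (degree-count 0F) (cong (λ t → 3 ℕ.+ 2 ℕ.* t) (ℕ.suc-injective (once 0F)))
      ; deg-v = trans (degree-count 1F) (cong (λ t → 3 ℕ.+ 2 ℕ.* t) (ℕ.suc-injective (once 1F)))
      ; deg-2 = subst (λ l → All (λ w → Graph.degree (θ p q r) w ≡ 2) (listP ++ listQ ++ l)) (sym (List.++-identityʳ listR))
          (All.tabulate λ w∈ → degree-interior (λ { refl → u∉ w∈ }) (λ { refl → v∉ w∈ })) }

    private
      edges≡ : map toEdge (θ-edges p q r) ≡ map toEdge (pathSteps listP) ++ map toEdge (pathSteps listQ) ++ map toEdge (pathSteps listR) ++ []
      edges≡ = trans (List.map-++ toEdge (pathSteps listP) _) (cong (map toEdge (pathSteps listP) ++_)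
        (trans (List.map-++ toEdge (pathSteps listQ) _) (cong (map toEdge (pathSteps listQ) ++_) (sym (List.++-identityʳ _)))))

    theta-factors : ∀ {A B C} → listR ∷ listQ ∷ listP ∷ [] ↭ A ∷ B ∷ C ∷ [] →
      length (θ-edges p q r) ≡ suc (length A) ℕ.+ suc (length B) ℕ.+ suc (length C) ×
      Factors (θ p q r) (length (θ-edges p q r)) (length (Bicubic.others theta-bicubic)) [] (λ s
        → thetaValue s (suc (length A)) (suc (length B)) (suc (length C)))
    theta-factors = Start.path-factors presents theta-bicubic listP listQ listR refl edges≡

-- The isomorphism with the theta graph, and the conclusion.

open Permanent
open ArcProducts using (shiftedLaplacian)
open EdgeLists
open CoreValues
open Homogenisation
open Presentations
open Degrees
open ThetaGraphs
open LoopsAndTerminals using (cyclesValue; cyclesValue-[])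
open Comparison

tabulate-injective : ∀ {A : Set} {k} {f : Fin k → A} → Unique (List.tabulate f) → ∀ i j → f i ≡ f j → i ≡ j
tabulate-injective u zero zero _ = refl
tabulate-injective {f = f} (x∉ ∷ u) zero (suc j) eq = ⊥-elim (All.lookup x∉ (∈-tabulate⁺ {f = f ∘ suc} j) eq)
tabulate-injective {f = f} (x∉ ∷ u) (suc i) zero eq = ⊥-elim (All.lookup x∉ (∈-tabulate⁺ {f = f ∘ suc} i) (sym eq))
tabulate-injective (x∉ ∷ u) (suc i) (suc j) eq = cong suc (tabulate-injective u i j eq)

steps-map : ∀ {A B : Set} (f : A → B) l → steps (map f l) ≡ map (Product.map f f) (steps l)
steps-map f []          = refl
steps-map f (a ∷ [])    = refl
steps-map f (a ∷ b ∷ l) = cong ((f a , f b) ∷_) (steps-map f (b ∷ l))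

module Isomorphism {n} (H : Graph n) (u v : Fin n) (A B C : List (Fin n)) (all : u ∷ v ∷ A ++ B ++ C ↭ allFin n)
  (adj : ∀ i j → Graph.Adj H i j ⇔ Step (edge u A v ∷ edge u B v ∷ edge u C v ∷ []) i j) where

  private
    p = length A
    q = length B
    r = length C
    N = 2 ℕ.+ (p ℕ.+ q ℕ.+ r)

    -- Follows the numbering of the vertices of `θ`, so that its values are listed as
    -- `u ∷ v ∷ A ++ B ++ C`; the inverse is then read off from the enumeration `all`.
    ψ : Fin N → Fin n
    ψ zero          = u
    ψ (suc zero)    = v
    ψ (suc (suc i)) = [ [ List.lookup A , List.lookup B ]′ ∘ splitAt p , List.lookup C ]′ (splitAt (p ℕ.+ q) i)

    ψ-P : List.tabulate (ψ ∘ inP p q r) ≡ A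
    ψ-P = trans (List.tabulate-cong λ i → trans (cong [ [ List.lookup A , List.lookup B ]′ ∘ splitAt p , List.lookup C ]′ (Fin.splitAt-↑ˡ (p ℕ.+ q) (i ↑ˡ q) r))
      (cong [ List.lookup A , List.lookup B ]′ (Fin.splitAt-↑ˡ p i q))) (List.tabulate-lookup A)

    ψ-Q : List.tabulate (ψ ∘ inQ p q r) ≡ B
    ψ-Q = trans (List.tabulate-cong λ i → trans (cong [ [ List.lookup A , List.lookup B ]′ ∘ splitAt p , List.lookup C ]′ (Fin.splitAt-↑ˡ (p ℕ.+ q) (p ↑ʳ i) r))
      (cong [ List.lookup A , List.lookup B ]′ (Fin.splitAt-↑ʳ p q i))) (List.tabulate-lookup B)

    ψ-R : List.tabulate (ψ ∘ inR p q r) ≡ C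
    ψ-R = trans (List.tabulate-cong λ i → cong [ [ List.lookup A , List.lookup B ]′ ∘ splitAt p , List.lookup C ]′ (Fin.splitAt-↑ʳ (p ℕ.+ q) r i))
      (List.tabulate-lookup C)

    ψ-all : List.tabulate ψ ≡ u ∷ v ∷ A ++ B ++ C
    ψ-all = cong (λ l → u ∷ v ∷ l) (begin
      List.tabulate (λ i → ψ (suc (suc i)))
        ≡⟨ tabulate-+ (p ℕ.+ q) (λ i → ψ (suc (suc i))) ⟩
      List.tabulate (λ i → ψ (suc (suc (i ↑ˡ r)))) ++ List.tabulate (ψ ∘ inR p q r)
        ≡⟨ cong (_++ List.tabulate (ψ ∘ inR p q r)) (tabulate-+ p (λ i → ψ (suc (suc (i ↑ˡ r))))) ⟩
      (List.tabulate (ψ ∘ inP p q r) ++ List.tabulate (ψ ∘ inQ p q r)) ++ List.tabulate (ψ ∘ inR p q r)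
        ≡⟨ cong₂ _++_ (cong₂ _++_ ψ-P ψ-Q) ψ-R ⟩
      (A ++ B) ++ C ≡⟨ List.++-assoc A B C ⟩
      A ++ B ++ C ∎)
      where open ≡-Reasoning

    ψ-injective : ∀ i j → ψ i ≡ ψ j → i ≡ j
    ψ-injective = tabulate-injective (subst Unique (sym ψ-all) (Unique-↭ (↭-sym all) (Unique.allFin⁺ n)))

    preimage : ∀ x → Σ[ i ∈ Fin N ] x ≡ ψ i
    preimage x = ∈-tabulate⁻ (subst (x ∈_) (sym ψ-all) (Perm.∈-resp-↭ (↭-sym all) (∈-allFin x)))

    φ : Fin n → Fin N
    φ = proj₁ ∘ preimage

    ψ-φ : ∀ x → ψ (φ x) ≡ x
    ψ-φ x = sym (proj₂ (preimage x))

    ψ-steps : ∀ {k} (f : Fin k → Fin N) {L} → List.tabulate (ψ ∘ f) ≡ L → map (Product.map ψ ψ) (steps (path p q r f)) ≡ steps (u ∷ L ++ [ v ])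
    ψ-steps f eq = trans (sym (steps-map ψ (path p q r f))) (cong (λ l → steps (u ∷ l))
      (trans (List.map-++ ψ (List.tabulate f) [ 1F ]) (cong (_++ [ v ]) (trans (List.map-tabulate f ψ) eq))))

    Hsteps : List (Fin n × Fin n)
    Hsteps = steps (u ∷ A ++ [ v ]) ++ steps (u ∷ B ++ [ v ]) ++ steps (u ∷ C ++ [ v ])

    ψ-edges : map (Product.map ψ ψ) (θ-edges p q r) ≡ Hsteps
    ψ-edges = trans (List.map-++ (Product.map ψ ψ) (steps (path p q r (inP p q r))) _) (cong₂ _++_ (ψ-steps (inP p q r) ψ-P)
      (trans (List.map-++ (Product.map ψ ψ) (steps (path p q r (inQ p q r))) _) (cong₂ _++_ (ψ-steps (inQ p q r) ψ-Q) (ψ-steps (inR p q r) ψ-R))))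

    Step⇒ : ∀ {i j} → Step (edge u A v ∷ edge u B v ∷ edge u C v ∷ []) i j → (i , j) ∈ Hsteps ⊎ (j , i) ∈ Hsteps
    Step⇒ (here s) = Sum.map ∈-++⁺ˡ ∈-++⁺ˡ s
    Step⇒ (there (here s)) = Sum.map (∈-++⁺ʳ (steps (u ∷ A ++ [ v ])) ∘ ∈-++⁺ˡ) (∈-++⁺ʳ (steps (u ∷ A ++ [ v ])) ∘ ∈-++⁺ˡ) s
    Step⇒ (there (there (here s))) = Sum.map (∈-++⁺ʳ (steps (u ∷ A ++ [ v ])) ∘ ∈-++⁺ʳ (steps (u ∷ B ++ [ v ]))) (∈-++⁺ʳ (steps (u ∷ A ++ [ v ])) ∘
      ∈-++⁺ʳ (steps (u ∷ B ++ [ v ]))) s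

    locate : ∀ {e} → e ∈ Hsteps → e ∈ steps (u ∷ A ++ [ v ]) ⊎ e ∈ steps (u ∷ B ++ [ v ]) ⊎ e ∈ steps (u ∷ C ++ [ v ])
    locate e∈ with ∈-++⁻ (steps (u ∷ A ++ [ v ])) e∈
    ... | inj₁ s = inj₁ s
    ... | inj₂ t = inj₂ (∈-++⁻ (steps (u ∷ B ++ [ v ])) t)

    ⇒Step : ∀ {i j} → (i , j) ∈ Hsteps ⊎ (j , i) ∈ Hsteps → Step (edge u A v ∷ edge u B v ∷ edge u C v ∷ []) i j
    ⇒Step (inj₁ e∈) = [ here ∘ inj₁ , [ there ∘ here ∘ inj₁ , there ∘ there ∘ here ∘ inj₁ ]′ ]′ (locate e∈)
    ⇒Step (inj₂ e∈) = [ here ∘ inj₂ , [ there ∘ here ∘ inj₂ , there ∘ there ∘ here ∘ inj₂ ]′ ]′ (locate e∈)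

    forth : ∀ {a b} → (a , b) ∈ θ-edges p q r → (ψ a , ψ b) ∈ Hsteps
    forth {a} {b} e∈ = subst ((ψ a , ψ b) ∈_) ψ-edges (∈-map⁺ (Product.map ψ ψ) e∈)

    back : ∀ {a b} → (ψ a , ψ b) ∈ Hsteps → (a , b) ∈ θ-edges p q r
    back {a} {b} e∈ with ∈-map⁻ (Product.map ψ ψ) (subst ((ψ a , ψ b) ∈_) (sym ψ-edges) e∈)
    ... | (a′ , b′) , e∈′ , eq with ψ-injective a a′ (cong proj₁ eq) | ψ-injective b b′ (cong proj₂ eq)
    ...   | refl | refl = e∈′

    moved : ∀ {i j} {X : Fin n × Fin n → Set} → X (i , j) → X (ψ (φ i) , ψ (φ j))
    moved {i} {j} {X} = subst X (cong₂ _,_ (sym (ψ-φ i)) (sym (ψ-φ j)))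

  isomorphism : H ≅ θ p q r
  isomorphism = FinPerm.permutation φ ψ (λ i → ψ-injective _ _ (ψ-φ (ψ i))) ψ-φ , λ i j → mk⇔
    (λ a → Sum.map (back ∘ moved {X = _∈ Hsteps}) (back ∘ moved {X = _∈ Hsteps}) (Step⇒ (Equivalence.to (adj i j) a)))
    (λ e → Equivalence.from (adj i j) (⇒Step (Sum.map (unmoved ∘ forth) (unmoved ∘ forth) e)))
    where
    unmoved : ∀ {i j} → (ψ (φ i) , ψ (φ j)) ∈ Hsteps → (i , j) ∈ Hsteps
    unmoved {i} {j} = subst (_∈ Hsteps) (cong₂ _,_ (ψ-φ i) (ψ-φ j))

-- The number of zeros among the three lengths is invariant under sorting, and so carries the
-- pairwise conditions over to the sorted triple.
isZero : ℕ → ℕ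
isZero zero    = 1
isZero (suc _) = 0

one-zero : ∀ p q r → ¬ (p ≡ 0 × q ≡ 0) → ¬ (p ≡ 0 × r ≡ 0) → ¬ (q ≡ 0 × r ≡ 0) → isZero r ℕ.+ (isZero q ℕ.+ (isZero p ℕ.+ 0)) ≤ 1
one-zero zero    zero    r       pq pr qr = ⊥-elim (pq (refl , refl))
one-zero zero    (suc q) zero    pq pr qr = ⊥-elim (pr (refl , refl))
one-zero zero    (suc q) (suc r) pq pr qr = s≤s z≤n
one-zero (suc p) zero    zero    pq pr qr = ⊥-elim (qr (refl , refl))
one-zero (suc p) zero    (suc r) pq pr qr = s≤s z≤n
one-zero (suc p) (suc q) zero    pq pr qr = s≤s z≤n
one-zero (suc p) (suc q) (suc r) pq pr qr = z≤n

-- If the middle one of the sorted numbers were 0, the smallest would be 0 too.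
few-zeros : ∀ {x y z} → x ≤ y → isZero x ℕ.+ (isZero y ℕ.+ z) ≤ 1 → 2 ≤ suc y
few-zeros {zero}  {zero}  _ (s≤s ())
few-zeros {x}     {suc y} _ _ = s≤s (s≤s z≤n)

1+s²-cancel : ∀ s k {a b} → (1ℤ ℤ.+ s ℤ.* s) ℤ.^ k ℤ.* a ≡ (1ℤ ℤ.+ s ℤ.* s) ℤ.^ k ℤ.* b → a ≡ b
1+s²-cancel s k {a} {b} = ℤ.*-cancelˡ-≡ ((1ℤ ℤ.+ s ℤ.* s) ℤ.^ k) a b {{ℤ.≢-nonZero (λ eq → nonzero s (ℤ.i^n≡0⇒i≡0 _ k eq))}}
  where
  nonzero : ∀ s → 1ℤ ℤ.+ s ℤ.* s ≢ 0ℤ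
  nonzero (+ n) eq with trans (cong (λ z → 1ℤ ℤ.+ z) (ℤ.pos-* n n)) eq
  ... | ()
  nonzero -[1+ n ] ()

module _ {n} {G : Graph n} {es} (P : Presents G es) where

  -- At `s = 0` the estimate `per-second-order` asserts divisibility by 0, that is equality.
  leading-coefficient : coeff (permanentalPolynomial (signlessLaplacian G)) n ≡ 1ℤ
  leading-coefficient = begin
    coeff (permanentalPolynomial (signlessLaplacian G)) n
      ≡⟨ hom-1-0 n _ ⟨
    hom 1ℤ 0ℤ n (coeff (permanentalPolynomial (signlessLaplacian G)))
      ≡⟨ hom-permanentalPolynomial (signlessLaplacian G) 1ℤ 0ℤ ⟩
    perℤ (shiftedLaplacian G 1ℤ 0ℤ)
      ≡⟨ ℤ.i-j≡0⇒i≡j _ _ (0∣⇒≡0 (per-second-order P 0ℤ)) ⟩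
    1ℤ ∎
    where open ≡-Reasoning

-- Trailing zeros hide the degree of a coefficient list. The order is recovered because the
-- polynomial of a graph on n vertices has coefficient 1 at n and 0 beyond.
same-order : ∀ {m n} {G : Graph m} {H : Graph n} {es fs} → Presents G es → Presents H fs →
  permanentalPolynomial (signlessLaplacian G) ≈ᴾ permanentalPolynomial (signlessLaplacian H) → m ≡ n
same-order {m} {n} {G} {H} P Q eq with ℕ.<-cmp m n
... | tri≈ _ m≡n _ = m≡n
... | tri< m<n _ _ = ⊥-elim (1≢0 (trans (sym (leading-coefficient Q)) (trans (sym (eq n)) (permanentalPolynomial-bounded (signlessLaplacian G) n m<n))))
  where
  1≢0 : 1ℤ ≢ 0ℤ
  1≢0 ()
... | tri> _ _ n<m = ⊥-elim (1≢0 (trans (sym (leading-coefficient P)) (trans (eq m) (permanentalPolynomial-bounded (signlessLaplacian H) m n<m))))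
  where
  1≢0 : 1ℤ ≢ 0ℤ
  1≢0 ()

≅-resp : ∀ {n} {H : Graph n} {p q r p′ q′ r′} → p ≡ p′ → q ≡ q′ → r ≡ r′ → H ≅ θ p′ q′ r′ → H ≅ θ p q r
≅-resp refl refl refl iso = iso

module Determined (p q r : ℕ) (pq : ¬ (p ≡ 0 × q ≡ 0)) (pr : ¬ (p ≡ 0 × r ≡ 0)) (qr : ¬ (q ≡ 0 × r ≡ 0))
  (H : Graph (2 ℕ.+ (p ℕ.+ q ℕ.+ r)))
  (eq : permanentalPolynomial (signlessLaplacian H) ≈ᴾ permanentalPolynomial (signlessLaplacian (θ p q r))) where

  private
    size = 2 ℕ.+ (p ℕ.+ q ℕ.+ r)
    listP = Theta.listP p q r pq pr qr
    listQ = Theta.listQ p q r pq pr qr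
    listR = Theta.listR p q r pq pr qr
    θ-presents = Theta.presents p q r pq pr qr
    θ-bicubic = Theta.theta-bicubic p q r pq pr qr

    same-per : ∀ X s → perℤ (shiftedLaplacian H X s) ≡ perℤ (shiftedLaplacian (θ p q r) X s)
    same-per X s = trans (sym (hom-permanentalPolynomial (signlessLaplacian H) X s))
      (trans (hom-cong X (ℤ.- s) size eq) (hom-permanentalPolynomial (signlessLaplacian (θ p q r)) X s))

    same-size : length (edgeList H) ≡ length (θ-edges p q r)
    same-size = edges-equal (edgeList-presents H) θ-presents (same-per 1ℤ)

    H-bicubic : Bicubic H
    H-bicubic = bicubic (edgeList-presents H) θ-presents (same-per 1ℤ) θ-bicubic

    open Bicubic H-bicubic

    others-length : length others ≡ length (Bicubic.others θ-bicubic)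
    others-length = ℕ.suc-injective (ℕ.suc-injective (trans (Perm.↭-length all) (sym (Perm.↭-length (Bicubic.all θ-bicubic)))))

    module _ {A B C : List (Fin size)} (θ-perm : listR ∷ listQ ∷ listP ∷ [] ↭ A ∷ B ∷ C ∷ []) (A≤B : length A ≤ length B) (B≤C : length B ≤ length C) where

      a b c : ℕ
      a = suc (length A)
      b = suc (length B)
      c = suc (length C)

      2≤b : 2 ≤ b
      2≤b = few-zeros A≤B (subst (_≤ 1) (sym zeros) (one-zero p q r pq pr qr))
        where
        zeros : total (map (isZero ∘ length) (A ∷ B ∷ C ∷ [])) ≡ isZero r ℕ.+ (isZero q ℕ.+ (isZero p ℕ.+ 0))
        zeros = trans (sym (total-↭ (Perm.map⁺ (isZero ∘ length) θ-perm)))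
          (cong₂ (λ x y → isZero x ℕ.+ y) (List.length-tabulate (inR p q r)) (cong₂ (λ x y
            → isZero x ℕ.+ (isZero y ℕ.+ 0)) (List.length-tabulate (inQ p q r)) (List.length-tabulate (inP p q r))))

      θ-factors = Theta.theta-factors p q r pq pr qr θ-perm

      -- Both graphs have the same numbers of edges and of eliminated vertices, so the powers of
      -- `1 + s²` agree; over ℤ this factor is never 0 and cancels.
      compare : ∀ {ks V} → Factors H (length (edgeList H)) (length others) ks V → ∀ s → thetaValue s a b c ≡ cyclesValue s ks ℤ.* V s
      compare {ks} {V} F s = 1+s²-cancel s (length others) (begin
        Q ℤ.^ length others ℤ.* thetaValue s a b c
          ≡⟨ cong₂ (λ k w → Q ℤ.^ k ℤ.* w) others-length (sym (trans (cong (ℤ._* thetaValue s a b c) (cyclesValue-[] s)) (ℤ.*-identityˡ _))) ⟩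
        Q ℤ.^ length (Bicubic.others θ-bicubic) ℤ.* (cyclesValue s [] ℤ.* thetaValue s a b c)
          ≡⟨ Factors.equation (proj₂ θ-factors) s ⟨
        Q ℤ.^ length (θ-edges p q r) ℤ.* perℤ (shiftedLaplacian (θ p q r) x₀ s)
          ≡⟨ cong₂ (λ k w → Q ℤ.^ k ℤ.* w) same-size (same-per x₀ s) ⟨
        Q ℤ.^ length (edgeList H) ℤ.* perℤ (shiftedLaplacian H x₀ s)
          ≡⟨ Factors.equation F s ⟩
        Q ℤ.^ length others ℤ.* (cyclesValue s ks ℤ.* V s) ∎)
        where
        open ≡-Reasoning
        Q  = 1ℤ ℤ.+ s ℤ.* s
        x₀ = 1ℤ ℤ.- + 2 ℤ.* s ℤ.- s ℤ.* s

      total-equal : ∀ {t} → length (edgeList H) ≡ t → a ℕ.+ b ℕ.+ c ≡ t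
      total-equal m≡t = trans (sym (proj₁ θ-factors)) (trans (sym same-size) m≡t)

      -- Only the sorted lengths are known to agree. Undoing the sorting on the level of lengths and
      -- lifting it to the paths gives an order in which the paths have lengths exactly `p`, `q`,
      -- `r`.
      match : ∀ {A′ B′ C′} → (∀ {X Y Z} → A′ ∷ B′ ∷ C′ ∷ [] ↭ X ∷ Y ∷ Z ∷ [] → Realises H u v X Y Z) →
        a ≡ suc (length A′) → b ≡ suc (length B′) → c ≡ suc (length C′) → H ≅ θ p q r
      match {A′} {B′} {C′} realises a≡ b≡ c≡ = arrange (Perm.↭-map-inv length {xs = A′ ∷ B′ ∷ C′ ∷ []} lengths↭)
        where
        lengths↭ : map length (A′ ∷ B′ ∷ C′ ∷ []) ↭ p ∷ q ∷ r ∷ []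
        lengths↭ = ↭-trans (↭-reflexive (sym (cong₂ _∷_ (ℕ.suc-injective a≡) (cong₂ _∷_ (ℕ.suc-injective b≡) (cong (_∷ []) (ℕ.suc-injective c≡))))))
          (↭-trans (↭-sym (Perm.map⁺ length θ-perm)) (↭-trans
            (↭-reflexive (cong₂ _∷_ (List.length-tabulate (inR p q r)) (cong₂ _∷_ (List.length-tabulate (inQ p q r)) (cong (_∷ [])
              (List.length-tabulate (inP p q r))))))
            (Perm.↭-reverse (p ∷ q ∷ r ∷ []))))
        first second third : List ℕ → ℕ
        first (x ∷ _) = x
        first []      = 0
        second (_ ∷ xs) = first xs
        second []       = 0
        third (_ ∷ xs) = second xs
        third []       = 0
        arrange : (∃ λ Ls → p ∷ q ∷ r ∷ [] ≡ map length Ls × A′ ∷ B′ ∷ C′ ∷ [] ↭ Ls) → H ≅ θ p q r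
        arrange (X ∷ Y ∷ Z ∷ [] , lengths≡ , perm) = ≅-resp {H = H} {p} {q} {r} {length X} {length Y} {length Z} (cong first lengths≡) (cong second
          lengths≡) (cong third lengths≡)
          (Isomorphism.isomorphism H u v X Y Z (proj₁ (realises {X} {Y} {Z} perm)) (proj₂ (realises {X} {Y} {Z} perm)))

      conclude : Shape H (length (edgeList H)) (length others) u v → H ≅ θ p q r
      conclude (dumbbell a′ b′ c′ ks 1≤a′ 2≤b′ 2≤c′ ks≥2 m≡ F) = ⊥-elim
        (Uniqueness.not-dumbbell (s≤s z≤n) (s≤s A≤B) (s≤s B≤C) 2≤b 1≤a′ 2≤b′ 2≤c′ ks≥2 (total-equal m≡) (compare F))
      conclude (theta A′ B′ C′ ks A′≤B′ B′≤C′ ks≥2 m≡ F realises) = pure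
          (Uniqueness.unique-theta (s≤s z≤n) (s≤s A≤B) (s≤s B≤C) 2≤b (s≤s z≤n) (s≤s A′≤B′) (s≤s B′≤C′) ks≥2 (total-equal m≡) (compare F))
        where
        pure : ks ≡ [] × a ≡ suc (length A′) × b ≡ suc (length B′) × c ≡ suc (length C′) → H ≅ θ p q r
        pure (ks≡[] , a≡ , b≡ , c≡) = match (λ {X} {Y} {Z} perm → realises ks≡[] {X} {Y} {Z} perm) a≡ b≡ c≡

  determined : H ≅ θ p q r
  determined = let (_ , _ , _ , perm , A≤B , B≤C) = sort₃ length listR listQ listP in
    conclude perm A≤B B≤C (Start.shape (edgeList-presents H) H-bicubic)

theorem1p4 : (p q r : ℕ) →
    ¬ (p ≡ 0 × q ≡ 0) → ¬ (p ≡ 0 × r ≡ 0) → ¬ (q ≡ 0 × r ≡ 0) →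
    ∀ {n} (H : Graph n) →
    permanentalPolynomial (signlessLaplacian H) ≈ᴾ permanentalPolynomial (signlessLaplacian (θ p q r)) →
    H ≅ θ p q r
theorem1p4 p q r pq pr qr {n} H eq = at-order n (same-order (edgeList-presents H) (Theta.presents p q r pq pr qr) eq) H eq
  where
  -- The order of `H` is kept variable here, so that its equation can be matched with `refl`.
  at-order : ∀ n → n ≡ 2 ℕ.+ (p ℕ.+ q ℕ.+ r) → (H : Graph n) →
    permanentalPolynomial (signlessLaplacian H) ≈ᴾ permanentalPolynomial (signlessLaplacian (θ p q r)) → H ≅ θ p q r
  at-order _ refl H eq = Determined.determined p q r pq pr qr H eq
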